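{- Let $B$ be a nonzero sixth-power-free integer and let $E_B$ be the elliptic curve $y^2=x^3+B$ over $\mathbb{Q}$. Let $P$ be a non-torsion integral point on $E_B$. Then there is at most one integer $n\geq 29$ such that $[n]P$ is integral.
   Context: A point of $E_B(\mathbb{Q})$ is integral if it is not the point at infinity and both of its affine coordinates are integers. $[n]P$ denotes the $n$-fold multiple of $P$ in $E_B(\mathbb{Q})$. -}

module Defs where

open import Data.Nat as ℕ using (ℕ; zero; suc)
open import Data.Nat.Divisibility as ℕD using ()
open import Data.Integer as ℤ using (ℤ)
open import Data.Rational as ℚ using (ℚ; 0ℚ; 1ℚ; _+_; _-_; _*_; -_; _÷_; ≢-nonZero)
open import Data.Rational.Properties using (_≟_)
open import Data.Unit using (⊤)
open import Data.Product using (Σ; ∃; _×_; _,_)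
open import Relation.Nullary using (yes; no; ¬_)
open import Relation.Binary.PropositionalEquality using (_≡_; _≢_)

data Point : Set where
  O  : Point
  pt : ℚ → ℚ → Point

OnCurve : ℤ → Point → Set
OnCurve B O = ⊤
OnCurve B (pt x y) = y * y ≡ x * x * x + (B ℚ./ 1)

2ℚ 3ℚ : ℚ
2ℚ = 1ℚ + 1ℚ
3ℚ = 2ℚ + 1ℚ

-- Chord-and-tangent group law on y^2 = x^3 + B (a = 0, independent of B).
-- (Only its values on points of the curve matter.)
_⊕_ : Point → Point → Point
O ⊕ Q = Q
P ⊕ O = P
pt x₁ y₁ ⊕ pt x₂ y₂ with (x₂ - x₁) ≟ 0ℚ
... | no x₂-x₁≢0 = pt x₃ (λ' * (x₁ - x₃) - y₁)
  where
    instance _ = ≢-nonZero x₂-x₁≢0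
    λ' = (y₂ - y₁) ÷ (x₂ - x₁)
    x₃ = λ' * λ' - x₁ - x₂
... | yes _ with y₁ ≟ (- y₂)
...   | yes _ = O
...   | no _ with (2ℚ * y₁) ≟ 0ℚ
...     | yes _ = O
...     | no 2y₁≢0 = pt x₃ (λ' * (x₁ - x₃) - y₁)
  where
    instance _ = ≢-nonZero 2y₁≢0
    λ' = (3ℚ * x₁ * x₁) ÷ (2ℚ * y₁)
    x₃ = λ' * λ' - x₁ - x₁

[_]_ : ℕ → Point → Point
[ zero ] P = O
[ suc n ] P = P ⊕ ([ n ] P)

NonTorsion : Point → Set
NonTorsion P = ∀ (m : ℕ) → [ suc m ] P ≢ O

Integral : Point → Set
Integral P = Σ ℤ λ a → Σ ℤ λ b → P ≡ pt (a ℚ./ 1) (b ℚ./ 1)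

SixthPowerFree : ℤ → Set
SixthPowerFree B = ∀ (d : ℕ) → (d ℕ.^ 6) ℕD.∣ ℤ.∣ B ∣ → d ≡ 1

{-# OPTIONS --safe #-}
-- Scale the division polynomials of P = (x , y) as W n = v n · aᵗ dᶠ Gᵉ with a = 2 y and d = ψ₃(P), so that
-- the v n are integers satisfying the doubling recursions with coefficients T, b, c of disjoint prime support.
-- As B is sixth-power free, a prime-by-prime analysis shows that v n = ± 1 whenever n P is integral.
-- Integrality passes from n to n / 2 and n / 3 (rational root theorem).  If 2 q P with q > 1 prime to 6 were
-- integral, units on both sides would give y(qP)² = y(P)²; for 3 q they give ψ₃(qP) = ψ₃(P), the sign being
-- decided modulo 3; both force x(qP) = x(P).  So only n prime to 6 and n ≤ 18 remain.
-- Two such n are excluded 2-adically.  For s = 6 or s = 4 the point s P is 2-adically close to torsion, so that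
-- U n = x(nP) / x(sP) has small differences of all orders along n ≡ 1 mod s, and W (n + s) W (n - s) / W n ² is
-- proportional to 1 - U n.  Hence a high 2-power of F n = W n ¹² / G ^ (n² - 1) is nearly quadratic in n, and the
-- value 1 at n = 1 and at two further places contradicts the values of F at 1 - s and 1 + s.
module Submission where

open import Data.Empty using (⊥; ⊥-elim)
open import Data.Integer as ℤ using (ℤ; 0ℤ; 1ℤ)
open import Data.Integer using () renaming (_*_ to _·_; _+_ to _∔_)
import Data.Integer.Divisibility.Signed as ℤD
import Data.Integer.Properties as ℤₚ
import Data.Integer.Tactic.RingSolver as ℤ-Ring
open import Data.Nat as ℕ using (ℕ; zero; suc; _≤_)
import Data.Nat.Divisibility as ℕD
import Data.Nat.Properties as ℕₚ
open import Data.Nat.Tactic.RingSolver using () renaming (solve-∀ to ℕ-solve)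
open import Data.Product.Base using (Σ; _×_; _,_; proj₁; proj₂)
open import Data.Rational as ℚ using (ℚ; 0ℚ; 1ℚ)
import Data.Rational.Properties as ℚₚ
open import Data.Sum.Base using (_⊎_; inj₁; inj₂)
open import Relation.Nullary using (Dec; yes; no; ¬_)
import Tactic.RingSolver.Core.Expression as Expr
open import Relation.Binary.PropositionalEquality hiding ([_]; J)
open import Tactic.RingSolver.NonReflective ℤ-Ring.ring using () renaming (solve to ℤ-solve)
open import Defs

open Expr using (Expr; Κ)

-- The prime 2 is available because it is always bad: if 3x³/(2y)² is N/s in lowest terms, one of N,
-- s and s - N is even, so 2 divides `T` or `b`, and the parities of the v n follow a fixed pattern.
-- This decides between s = 6 and s = 4 for the step of the progression. Three values 1 of a nearly
-- quadratic function should make it nearly constant. The obstacle is uniformity: the positions κ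
-- and l of the two unknown multiples may be 2-adically close to 0 and to each other, and
-- interpolation loses the factor κ l (κ - l). The loss is repaired by replacing F with its power
-- 2^K, K adapted to κ and l. As F is odd, each squaring adds one binary digit of smallness to the
-- higher differences and exactly one to the valuation of the value to be contradicted, whereas the
-- error of linearising products is of order 2^(2K). So K can be taken large, and congruences
-- between integers replace the 2-adic logarithm. The twelfth power in F removes signs and the
-- fractional powers of G in `a` and `d`, which have weights 3 and 8 when G has weight 12.

infixl 6 _:+_ _:-_
infixl 7 _:*_
infix 8 :-_

_:+_ _:-_ _:*_ : ∀ {A : Set} {n} → Expr A n → Expr A n → Expr A n
x :+ y = x Expr.⊕ y
x :- y = x Expr.⊕ (Expr.⊝ y)
x :* y = x Expr.⊗ y

:-_ : ∀ {A : Set} {n} → Expr A n → Expr A n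
:- x = Expr.⊝ x

-- Chord-and-tangent formulas for the multiples of a point of infinite order

module GroupLaw where

 open import Data.Rational using (_+_; _-_; _*_; -_; _÷_; ≢-nonZero; 1/_)
 open import Data.Maybe.Base using (just; nothing)
 open import Level using (0ℓ)
 import Tactic.RingSolver.Core.AlmostCommutativeRing as ACR

 ℚ-ring : ACR.AlmostCommutativeRing 0ℓ 0ℓ
 ℚ-ring = ACR.fromCommutativeRing ℚₚ.+-*-commutativeRing isZero
   where
   isZero : ∀ q → _
   isZero q with 0ℚ ℚₚ.≟ q
   ... | yes 0≡q = just 0≡q
   ... | no  _   = nothing

 open import Tactic.RingSolver.NonReflective ℚ-ring public using () renaming (solve to ℚ-solve)

 4ℚ 8ℚ : ℚ
 4ℚ = 2ℚ * 2ℚ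
 8ℚ = 2ℚ * 4ℚ

 infix 9 _²

 _² : ℚ → ℚ
 q ² = q * q

 -≡0⇒≡ : ∀ {p q} → p - q ≡ 0ℚ → p ≡ q
 -≡0⇒≡ {p} {q} e = trans (lem p q) (trans (cong (_+ q) e) (ℚₚ.+-identityˡ q))
   where
   lem : ∀ p q → p ≡ (p - q) + q
   lem = ℚ-solve 2 (λ p q → p , (p :- q) :+ q) refl

 *-cancelʳ : ∀ {p q} r → r ≢ 0ℚ → p * r ≡ q * r → p ≡ q
 *-cancelʳ {p} {q} r r≢0 e = begin
   p               ≡⟨ sym (ℚₚ.*-identityʳ p) ⟩
   p * 1ℚ          ≡⟨ cong (p *_) (sym inv) ⟩
   p * (r * 1/ r)  ≡⟨ sym (ℚₚ.*-assoc p r _) ⟩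
   p * r * 1/ r    ≡⟨ cong (_* 1/ r) e ⟩
   q * r * 1/ r    ≡⟨ ℚₚ.*-assoc q r _ ⟩
   q * (r * 1/ r)  ≡⟨ cong (q *_) inv ⟩
   q * 1ℚ          ≡⟨ ℚₚ.*-identityʳ q ⟩
   q               ∎
   where
   open ≡-Reasoning
   instance _ = ≢-nonZero r≢0
   inv : r * 1/ r ≡ 1ℚ
   inv = ℚₚ.*-inverseʳ r

 *-≢0 : ∀ {p q} → p ≢ 0ℚ → q ≢ 0ℚ → p * q ≢ 0ℚ
 *-≢0 {p} {q} p≢0 q≢0 e = p≢0 (*-cancelʳ q q≢0 (trans e (sym (ℚₚ.*-zeroˡ q))))

 -- A relational view of `_⊕_`, so that its nested case distinction is made only once. Slopes are
 -- characterised by products instead of quotients. `infinity` carries no condition, because it is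
 -- always refuted by non-torsion.
 data Sum (x₁ y₁ x₂ y₂ : ℚ) : Point → Set where
   chord    : ∀ l → x₂ - x₁ ≢ 0ℚ → l * (x₂ - x₁) ≡ y₂ - y₁ →
              Sum x₁ y₁ x₂ y₂ (pt (l * l - x₁ - x₂) (l * (x₁ - (l * l - x₁ - x₂)) - y₁))
   tangent  : ∀ l → x₂ - x₁ ≡ 0ℚ → y₁ ≢ - y₂ → l * (2ℚ * y₁) ≡ 3ℚ * x₁ * x₁ →
              Sum x₁ y₁ x₂ y₂ (pt (l * l - x₁ - x₁) (l * (x₁ - (l * l - x₁ - x₁)) - y₁))
   infinity : Sum x₁ y₁ x₂ y₂ O

 ÷-* : ∀ p q (q≢0 : q ≢ 0ℚ) → (p ÷ q) {{≢-nonZero q≢0}} * q ≡ p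
 ÷-* p q q≢0 = trans (ℚₚ.*-assoc p _ q) (trans (cong (p *_) (ℚₚ.*-inverseˡ q)) (ℚₚ.*-identityʳ p))
   where instance _ = ≢-nonZero q≢0

 ⊕-sum : ∀ x₁ y₁ x₂ y₂ → Sum x₁ y₁ x₂ y₂ (pt x₁ y₁ ⊕ pt x₂ y₂)
 ⊕-sum x₁ y₁ x₂ y₂ with (x₂ - x₁) ℚₚ.≟ 0ℚ
 ... | no d≢0 = chord (((y₂ - y₁) ÷ (x₂ - x₁)) {{≢-nonZero d≢0}}) d≢0 (÷-* (y₂ - y₁) (x₂ - x₁) d≢0)
 ... | yes d≡0 with y₁ ℚₚ.≟ (- y₂)
 ...   | yes _ = infinity
 ...   | no y₁≢ with (2ℚ * y₁) ℚₚ.≟ 0ℚ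
 ...     | yes _ = infinity
 ...     | no 2y≢0 = tangent (((3ℚ * x₁ * x₁) ÷ (2ℚ * y₁)) {{≢-nonZero 2y≢0}}) d≡0 y₁≢ (÷-* (3ℚ * x₁ * x₁) (2ℚ * y₁) 2y≢0)

 -- Affine coordinates X n, Y n of the multiples n P (n ≥ 1) of a point P = (x , y) of infinite order.
 record Multiples (B x y : ℚ) : Set where
   field
     X Y     : ℕ → ℚ
     X₁      : X 1 ≡ x
     Y₁      : Y 1 ≡ y
     y≢0     : y ≢ 0ℚ
     curve   : ∀ n → Y (suc n) ² ≡ X (suc n) * X (suc n) * X (suc n) + B
     slope   : ℕ → ℚ
     X-step  : ∀ n → X (2 ℕ.+ n) ≡ slope n * slope n - x - X (suc n)
     Y-step  : ∀ n → Y (2 ℕ.+ n) ≡ slope n * (x - X (2 ℕ.+ n)) - y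
     chord-slope   : ∀ n → slope n * (X (suc n) - x) ≡ Y (suc n) - y
     tangent-slope : slope 0 * (2ℚ * y) ≡ 3ℚ * x * x
     X≢x     : ∀ n → X (2 ℕ.+ n) ≢ x

 xOf yOf : Point → ℚ
 xOf O        = 0ℚ
 xOf (pt x _) = x
 yOf O        = 0ℚ
 yOf (pt _ y) = y

 pt-η : ∀ {Q} → Q ≢ O → Q ≡ pt (xOf Q) (yOf Q)
 pt-η {O} h = ⊥-elim (h refl)
 pt-η {pt x y} h = refl

 -- After multiplication by `x₂ - x`, the defect of the third point in the curve equation is an
 -- explicit linear combination of the defects of the two given points on the line.
 chord-curve : ∀ B x y l x₂ → x₂ - x ≢ 0ℚ → y ² ≡ x * x * x + B →
               (y + l * (x₂ - x)) ² ≡ x₂ * x₂ * x₂ + B →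
               (l * (x - (l * l - x - x₂)) - y) ² ≡
               (l * l - x - x₂) * (l * l - x - x₂) * (l * l - x - x₂) + B
 chord-curve B x y l x₂ d≢0 e₁ e₂ = -≡0⇒≡ (*-cancelʳ (x₂ - x) d≢0 (begin
   (Y3 ² - (X3 * X3 * X3 + B)) * d
     ≡⟨ alg B x y l x₂ ⟩
   (y ² - (x * x * x + B)) * (d - (X3 - x)) + ((y + l * d) ² - (x₂ * x₂ * x₂ + B)) * (X3 - x)
     ≡⟨ cong₂ (λ u v → u * (d - (X3 - x)) + v * (X3 - x)) (≡⇒0 e₁) (≡⇒0 e₂) ⟩
   0ℚ * (d - (X3 - x)) + 0ℚ * (X3 - x)
     ≡⟨ zero-lem (d - (X3 - x)) (X3 - x) d ⟩
   0ℚ * d ∎))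
   where
   open ≡-Reasoning
   d = x₂ - x
   X3 = l * l - x - x₂
   Y3 = l * (x - X3) - y
   ≡⇒0 : ∀ {p q} → p ≡ q → p - q ≡ 0ℚ
   ≡⇒0 {p} refl = ℚₚ.+-inverseʳ p
   zero-lem : ∀ u v w → 0ℚ * u + 0ℚ * v ≡ 0ℚ * w
   zero-lem = ℚ-solve 3 (λ u v w → Κ 0ℚ :* u :+ Κ 0ℚ :* v , Κ 0ℚ :* w) refl
   alg : ∀ B x y l x₂ →
     ((l * (x - (l * l - x - x₂)) - y) * (l * (x - (l * l - x - x₂)) - y)
       - ((l * l - x - x₂) * (l * l - x - x₂) * (l * l - x - x₂) + B)) * (x₂ - x) ≡
     (y * y - (x * x * x + B)) * ((x₂ - x) - ((l * l - x - x₂) - x))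
       + ((y + l * (x₂ - x)) * (y + l * (x₂ - x)) - (x₂ * x₂ * x₂ + B)) * ((l * l - x - x₂) - x)
   alg = ℚ-solve 5 (λ B x y l x₂ → ((l :* (x :- (l :* l :- x :- x₂)) :- y) :* (l :* (x :- (l :* l :- x :- x₂)) :- y) :- ((l :* l :- x :- x₂) :* (l :* l :- x :- x₂) :* (l :* l :- x :- x₂) :+ B)) :* (x₂ :- x) , (y :* y :- (x :* x :* x :+ B)) :* ((x₂ :- x) :- ((l :* l :- x :- x₂) :- x)) :+ ((y :+ l :* (x₂ :- x)) :* (y :+ l :* (x₂ :- x)) :- (x₂ :* x₂ :* x₂ :+ B)) :* ((l :* l :- x :- x₂) :- x)) refl

 tangent-curve : ∀ B x y l → y ² ≡ x * x * x + B → l * (2ℚ * y) ≡ 3ℚ * x * x →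
                 (l * (x - (l * l - x - x)) - y) ² ≡
                 (l * l - x - x) * (l * l - x - x) * (l * l - x - x) + B
 tangent-curve B x y l e₁ e₂ = -≡0⇒≡ (begin
   Y3 ² - (X3 * X3 * X3 + B)
     ≡⟨ alg B x y l ⟩
   (y ² - (x * x * x + B)) + (l * (2ℚ * y) - 3ℚ * x * x) * (X3 - x)
     ≡⟨ cong₂ (λ u v → u + v * (X3 - x)) (≡⇒0 e₁) (≡⇒0 e₂) ⟩
   0ℚ + 0ℚ * (X3 - x) ≡⟨ zero-lem (X3 - x) ⟩
   0ℚ ∎)
   where
   open ≡-Reasoning
   X3 = l * l - x - x
   Y3 = l * (x - X3) - y
   ≡⇒0 : ∀ {p q} → p ≡ q → p - q ≡ 0ℚ
   ≡⇒0 {p} refl = ℚₚ.+-inverseʳ p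
   zero-lem : ∀ u → 0ℚ + 0ℚ * u ≡ 0ℚ
   zero-lem = ℚ-solve 1 (λ u → Κ 0ℚ :+ Κ 0ℚ :* u , Κ 0ℚ) refl
   alg : ∀ B x y l →
     (l * (x - (l * l - x - x)) - y) * (l * (x - (l * l - x - x)) - y)
       - ((l * l - x - x) * (l * l - x - x) * (l * l - x - x) + B) ≡
     (y * y - (x * x * x + B)) + (l * ((1ℚ + 1ℚ) * y) - (1ℚ + 1ℚ + 1ℚ) * x * x) * ((l * l - x - x) - x)
   alg = ℚ-solve 4 (λ B x y l → (l :* (x :- (l :* l :- x :- x)) :- y) :* (l :* (x :- (l :* l :- x :- x)) :- y) :- ((l :* l :- x :- x) :* (l :* l :- x :- x) :* (l :* l :- x :- x) :+ B) , (y :* y :- (x :* x :* x :+ B)) :+ (l :* ((Κ 1ℚ :+ Κ 1ℚ) :* y) :- (Κ 1ℚ :+ Κ 1ℚ :+ Κ 1ℚ) :* x :* x) :* ((l :* l :- x :- x) :- x)) refl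

 ≡⇒-≡0 : ∀ {p q} → p ≡ q → p - q ≡ 0ℚ
 ≡⇒-≡0 {p} refl = ℚₚ.+-inverseʳ p

 multiples : ∀ {B x y} → OnCurve B (pt x y) → NonTorsion (pt x y) →
             Σ (Multiples (B ℚ./ 1) x y) λ M →
               ∀ n → [ suc n ] (pt x y) ≡ pt (Multiples.X M (suc n)) (Multiples.Y M (suc n))
 multiples {B} {x} {y} onE nt = M , eq
   where
   P = pt x y
   X Y : ℕ → ℚ
   X n = xOf ([ n ] P)
   Y n = yOf ([ n ] P)
   eq : ∀ n → [ suc n ] P ≡ pt (X (suc n)) (Y (suc n))
   eq n = pt-η (nt n)

   y≢0 : y ≢ 0ℚ
   y≢0 y≡0 = double-O _ (⊕-sum x y x y) (nt 1)
     where
     double-O : ∀ Q → Sum x y x y Q → Q ≢ O → ⊥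
     double-O _ (chord l d≢0 _) _ = d≢0 (ℚₚ.+-inverseʳ x)
     double-O _ (tangent l _ y≢ _) _ = y≢ (trans y≡0 (cong -_ (sym y≡0)))
     double-O _ infinity h = h refl

   record Step (n : ℕ) : Set where
     field
       l  : ℚ
       eX : X (2 ℕ.+ n) ≡ l * l - x - X (suc n)
       eY : Y (2 ℕ.+ n) ≡ l * (x - X (2 ℕ.+ n)) - y
       eC : l * (X (suc n) - x) ≡ Y (suc n) - y
       eT : X (suc n) ≡ x → l * (2ℚ * y) ≡ 3ℚ * x * x
       nz : n ≢ 0 → X (suc n) ≢ x
   open Step

   prev-y : ∀ n → Step n → X (2 ℕ.+ n) ≡ x → Y (2 ℕ.+ n) ≡ - y
   prev-y n s e = trans (eY s) (trans (cong (λ u → l s * u - y) (≡⇒-≡0 (sym e))) (lem (l s) y))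
     where
     lem : ∀ l y → l * 0ℚ - y ≡ - y
     lem = ℚ-solve 2 (λ l y → l :* Κ 0ℚ :- y , :- y) refl

   neg-neg : ∀ p → - (- p) ≡ p
   neg-neg = ℚ-solve 1 (λ p → :- (:- p) , p) refl

   mutual
     step′ : ∀ n Q → Sum x y (X (suc n)) (Y (suc n)) Q → Q ≡ [ 2 ℕ.+ n ] P → Step n
     step′ n _ (chord l d≢0 e) Q≡ = record
       { l = l
       ; eX = sym (cong xOf Q≡)
       ; eY = trans (sym (cong yOf Q≡)) (cong (λ u → l * (x - u) - y) (cong xOf Q≡))
       ; eC = e
       ; eT = λ h → ⊥-elim (d≢0 (≡⇒-≡0 h))
       ; nz = λ _ h → d≢0 (≡⇒-≡0 h) }
     step′ zero _ (tangent l d≡0 y≢ e) Q≡ = record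
       { l = l
       ; eX = sym (cong xOf Q≡)
       ; eY = trans (sym (cong yOf Q≡)) (cong (λ u → l * (x - u) - y) (cong xOf Q≡))
       ; eC = trans (cong (l *_) (ℚₚ.+-inverseʳ x)) (trans (ℚₚ.*-zeroʳ l) (sym (ℚₚ.+-inverseʳ y)))
       ; eT = λ _ → e
       ; nz = λ h → ⊥-elim (h refl) }
     -- Only the first addition can be a tangent: if a later multiple had abscissa `x`, the step
     -- leading to it would give it the ordinate `- y`, contrary to `y≢`.
     step′ (suc n) _ (tangent l d≡0 y≢ e) Q≡ =
       ⊥-elim (y≢ (sym (trans (cong -_ (prev-y n (step n) (-≡0⇒≡ d≡0))) (neg-neg y))))
     step′ n _ infinity Q≡ = ⊥-elim (nt (suc n) (sym Q≡))

     step : ∀ n → Step n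
     step n = step′ n _ (⊕-sum x y (X (suc n)) (Y (suc n))) (cong (P ⊕_) (sym (eq n)))

   curve : ∀ n → Y (suc n) ² ≡ X (suc n) * X (suc n) * X (suc n) + B ℚ./ 1
   curve zero = onE
   curve (suc n) with X (suc n) ℚₚ.≟ x
   ... | no h = subst₂ (λ u v → v ² ≡ u * u * u + B ℚ./ 1) (sym (eX s)) (sym eY′)
                  (chord-curve (B ℚ./ 1) x y (l s) (X (suc n)) (λ d → h (-≡0⇒≡ d)) onE
                    (trans (cong _² (trans (cong (λ u → y + u) (eC s)) (cancel y (Y (suc n))))) (curve n)))
     where
     s = step n
     eY′ = trans (eY s) (cong (λ u → l s * (x - u) - y) (eX s))
     cancel : ∀ y z → y + (z - y) ≡ z
     cancel = ℚ-solve 2 (λ y z → y :+ (z :- y) , z) refl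
   ... | yes h = subst₂ (λ u v → v ² ≡ u * u * u + B ℚ./ 1) (sym eX′) (sym eY′)
                   (tangent-curve (B ℚ./ 1) x y (l s) onE (eT s h))
     where
     s = step n
     eX′ = trans (eX s) (cong (λ u → l s * l s - x - u) h)
     eY′ = trans (eY s) (cong (λ u → l s * (x - u) - y) eX′)

   M : Multiples (B ℚ./ 1) x y
   M = record
     { X = X ; Y = Y ; X₁ = refl ; Y₁ = refl ; y≢0 = y≢0 ; curve = curve
     ; slope = λ n → l (step n)
     ; X-step = λ n → eX (step n) ; Y-step = λ n → eY (step n)
     ; chord-slope = λ n → eC (step n)
     ; tangent-slope = eT (step 0) refl
     ; X≢x = λ n → nz (step (suc n)) (λ ()) }

-- Index arithmetic and exponents of the scaling monomials

module Indices where

 open import Data.Nat.Induction using (<-rec)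
 open import Data.Integer using (+_; _^_)

 -- dbl m d = 2 m + d
 dbl : ℕ → ℕ → ℕ
 dbl zero    d = d
 dbl (suc m) d = suc (suc (dbl m d))

 dbl-shift : ∀ m d → dbl m (2 ℕ.+ d) ≡ 2 ℕ.+ dbl m d
 dbl-shift zero    d = refl
 dbl-shift (suc m) d = cong (2 ℕ.+_) (dbl-shift m d)

 even⊎odd : ∀ n → (Σ ℕ λ k → n ≡ dbl k 0) ⊎ (Σ ℕ λ k → n ≡ dbl k 1)
 even⊎odd zero = inj₁ (0 , refl)
 even⊎odd (suc zero) = inj₂ (0 , refl)
 even⊎odd (suc (suc n)) with even⊎odd n
 ... | inj₁ (k , e) = inj₁ (suc k , cong (2 ℕ.+_) e)
 ... | inj₂ (k , e) = inj₂ (suc k , cong (2 ℕ.+_) e)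

 -- Induction along the doubling formulas of elliptic divisibility sequences.
 eds-induction : (P : ℕ → Set) → P 1 → P 2 → P 3 → P 4 →
   (∀ k → P (1 ℕ.+ k) → P (2 ℕ.+ k) → P (3 ℕ.+ k) → P (4 ℕ.+ k) → P (suc (dbl k 4))) →
   (∀ k → P (1 ℕ.+ k) → P (2 ℕ.+ k) → P (3 ℕ.+ k) → P (4 ℕ.+ k) → P (5 ℕ.+ k) → P (suc (dbl k 5))) →
   ∀ n → P (suc n)
 eds-induction P P₁ P₂ P₃ P₄ odd even = <-rec (λ n → P (suc n)) body
   where
   4+dbl : ∀ k d → dbl k (4 ℕ.+ d) ≡ 4 ℕ.+ dbl k d
   4+dbl k d = trans (dbl-shift k (2 ℕ.+ d)) (cong (2 ℕ.+_) (dbl-shift k d))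
   bound : ∀ k d → d ℕ.+ k ℕ.< dbl k (suc d)
   bound zero d = subst (ℕ._< suc d) (sym (ℕₚ.+-identityʳ d)) ℕₚ.≤-refl
   bound (suc k) d = subst (ℕ._< dbl (suc k) (suc d)) (sym (ℕₚ.+-suc d k)) (ℕ.s≤s (ℕₚ.m≤n⇒m≤1+n (bound k d)))
   below : ∀ k d {i} → i ℕ.≤ d → i ℕ.+ k ℕ.< dbl k (suc d)
   below k d i≤d = ℕₚ.≤-<-trans (ℕₚ.+-monoˡ-≤ k i≤d) (bound k d)
   body : ∀ n → (∀ {m} → m ℕ.< n → P (suc m)) → P (suc n)
   body 0 rec = P₁
   body 1 rec = P₂
   body 2 rec = P₃
   body 3 rec = P₄
   body (suc (suc (suc (suc n)))) rec with even⊎odd n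
   ... | inj₁ (k , refl) rewrite sym (4+dbl k 0) =
     odd k (rec (below k 3 ℕ.z≤n)) (rec (below k 3 (ℕ.s≤s ℕ.z≤n))) (rec (below k 3 (ℕ.s≤s (ℕ.s≤s ℕ.z≤n)))) (rec (below k 3 ℕₚ.≤-refl))
   ... | inj₂ (k , refl) rewrite sym (4+dbl k 1) =
     even k (rec (below k 4 ℕ.z≤n)) (rec (below k 4 (ℕ.s≤s ℕ.z≤n))) (rec (below k 4 (ℕ.s≤s (ℕ.s≤s ℕ.z≤n))))
            (rec (below k 4 (ℕ.s≤s (ℕ.s≤s (ℕ.s≤s ℕ.z≤n))))) (rec (below k 4 ℕₚ.≤-refl))

 -- τ n = [2 ∣ n], δ n = [3 ∣ n] and 12 e n + 3 τ n + 8 δ n + 1 = n² for n ≥ 1.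
 τ δ e : ℕ → ℕ
 τ 0 = 1
 τ 1 = 0
 τ (suc (suc n)) = τ n
 δ 0 = 1
 δ 1 = 0
 δ 2 = 0
 δ (suc (suc (suc n))) = δ n
 e 0 = 0
 e 1 = 0
 e 2 = 0
 e 3 = 0
 e 4 = 1
 e 5 = 2
 e 6 = 2
 e (suc (suc (suc (suc (suc (suc (suc n))))))) = e (suc n) ℕ.+ suc n ℕ.+ 3

 -- A shift by 6 fixes `τ` and `δ` and changes `e` by a term linear in the index, so identities
 -- among them reduce to six evaluations.
 by-six : (P : ℕ → Set) → P 0 → P 1 → P 2 → P 3 → P 4 → P 5 → (∀ n → P n → P (6 ℕ.+ n)) → ∀ n → P n
 by-six P p₀ p₁ p₂ p₃ p₄ p₅ s 0 = p₀
 by-six P p₀ p₁ p₂ p₃ p₄ p₅ s 1 = p₁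
 by-six P p₀ p₁ p₂ p₃ p₄ p₅ s 2 = p₂
 by-six P p₀ p₁ p₂ p₃ p₄ p₅ s 3 = p₃
 by-six P p₀ p₁ p₂ p₃ p₄ p₅ s 4 = p₄
 by-six P p₀ p₁ p₂ p₃ p₄ p₅ s 5 = p₅
 by-six P p₀ p₁ p₂ p₃ p₄ p₅ s (suc (suc (suc (suc (suc (suc n)))))) = s n (by-six P p₀ p₁ p₂ p₃ p₄ p₅ s n)

 dbl≡ : ∀ k d → dbl k d ≡ k ℕ.+ k ℕ.+ d
 dbl≡ zero d = refl
 dbl≡ (suc k) d = cong suc (trans (cong suc (dbl≡ k d)) (cong (ℕ._+ d) (sym (ℕₚ.+-suc k k))))

 -- Counts the exponent of `G` in σ(m + 2) σ(m)³ for m = k + 2: every a⁴ supplies one `G` and every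
 -- d³ two. Both products of the odd recursion reach the exponent of the target index, which is why
 -- the quotients by `σ` again satisfy an integral recursion.
 e-odd₁ : ∀ k → τ (2 ℕ.+ k) ℕ.+ 2 ℕ.* δ (2 ℕ.+ k) ℕ.+ e (4 ℕ.+ k) ℕ.+ 3 ℕ.* e (2 ℕ.+ k) ≡ e (suc (dbl k 4))
 e-odd₁ = by-six _ refl refl refl refl refl refl λ k h →
   trans (lem₁ (τ (2 ℕ.+ k)) (δ (2 ℕ.+ k)) (e (4 ℕ.+ k)) (e (2 ℕ.+ k)) k)
     (trans (cong (ℕ._+ (4 ℕ.* k ℕ.+ 22)) h) (trans (lem₂ (e (suc (dbl k 4))) k)
       (cong (λ d → e (suc (dbl k 4)) ℕ.+ suc d ℕ.+ 3 ℕ.+ suc (6 ℕ.+ d) ℕ.+ 3) (sym (dbl≡ k 4)))))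
   where
   lem₁ : ∀ t d e₁ e₂ k → t ℕ.+ 2 ℕ.* d ℕ.+ (e₁ ℕ.+ suc (3 ℕ.+ k) ℕ.+ 3) ℕ.+ 3 ℕ.* (e₂ ℕ.+ suc (1 ℕ.+ k) ℕ.+ 3) ≡
          (t ℕ.+ 2 ℕ.* d ℕ.+ e₁ ℕ.+ 3 ℕ.* e₂) ℕ.+ (4 ℕ.* k ℕ.+ 22)
   lem₁ = ℕ-solve
   lem₂ : ∀ e k → e ℕ.+ (4 ℕ.* k ℕ.+ 22) ≡ e ℕ.+ suc (k ℕ.+ k ℕ.+ 4) ℕ.+ 3 ℕ.+ suc (6 ℕ.+ (k ℕ.+ k ℕ.+ 4)) ℕ.+ 3
   lem₂ = ℕ-solve

 e-odd₂ : ∀ k → τ (3 ℕ.+ k) ℕ.+ 2 ℕ.* δ (3 ℕ.+ k) ℕ.+ e (1 ℕ.+ k) ℕ.+ 3 ℕ.* e (3 ℕ.+ k) ≡ e (suc (dbl k 4))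
 e-odd₂ = by-six _ refl refl refl refl refl refl λ k h →
   trans (lem₁ (τ (3 ℕ.+ k)) (δ (3 ℕ.+ k)) (e (1 ℕ.+ k)) (e (3 ℕ.+ k)) k)
     (trans (cong (ℕ._+ (4 ℕ.* k ℕ.+ 22)) h) (trans (lem₂ (e (suc (dbl k 4))) k)
       (cong (λ d → e (suc (dbl k 4)) ℕ.+ suc d ℕ.+ 3 ℕ.+ suc (6 ℕ.+ d) ℕ.+ 3) (sym (dbl≡ k 4)))))
   where
   lem₁ : ∀ t d e₁ e₂ k → t ℕ.+ 2 ℕ.* d ℕ.+ (e₁ ℕ.+ suc (0 ℕ.+ k) ℕ.+ 3) ℕ.+ 3 ℕ.* (e₂ ℕ.+ suc (2 ℕ.+ k) ℕ.+ 3) ≡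
          (t ℕ.+ 2 ℕ.* d ℕ.+ e₁ ℕ.+ 3 ℕ.* e₂) ℕ.+ (4 ℕ.* k ℕ.+ 22)
   lem₁ = ℕ-solve
   lem₂ : ∀ e k → e ℕ.+ (4 ℕ.* k ℕ.+ 22) ≡ e ℕ.+ suc (k ℕ.+ k ℕ.+ 4) ℕ.+ 3 ℕ.+ suc (6 ℕ.+ (k ℕ.+ k ℕ.+ 4)) ℕ.+ 3
   lem₂ = ℕ-solve

 e-even₁ : ∀ k → 2 ℕ.* δ (5 ℕ.+ k) ℕ.+ e (3 ℕ.+ k) ℕ.+ e (5 ℕ.+ k) ℕ.+ 2 ℕ.* e (2 ℕ.+ k) ≡ e (suc (dbl k 5))
 e-even₁ = by-six _ refl refl refl refl refl refl λ k h →
   trans (lem₁ (δ (5 ℕ.+ k)) (e (3 ℕ.+ k)) (e (5 ℕ.+ k)) (e (2 ℕ.+ k)) k)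
     (trans (cong (ℕ._+ (4 ℕ.* k ℕ.+ 24)) h) (trans (lem₂ (e (suc (dbl k 5))) k)
       (cong (λ d → e (suc (dbl k 5)) ℕ.+ suc d ℕ.+ 3 ℕ.+ suc (6 ℕ.+ d) ℕ.+ 3) (sym (dbl≡ k 5)))))
   where
   lem₁ : ∀ d e₁ e₂ e₃ k → 2 ℕ.* d ℕ.+ (e₁ ℕ.+ suc (2 ℕ.+ k) ℕ.+ 3) ℕ.+ (e₂ ℕ.+ suc (4 ℕ.+ k) ℕ.+ 3) ℕ.+ 2 ℕ.* (e₃ ℕ.+ suc (1 ℕ.+ k) ℕ.+ 3) ≡
          (2 ℕ.* d ℕ.+ e₁ ℕ.+ e₂ ℕ.+ 2 ℕ.* e₃) ℕ.+ (4 ℕ.* k ℕ.+ 24)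
   lem₁ = ℕ-solve
   lem₂ : ∀ e k → e ℕ.+ (4 ℕ.* k ℕ.+ 24) ≡ e ℕ.+ suc (k ℕ.+ k ℕ.+ 5) ℕ.+ 3 ℕ.+ suc (6 ℕ.+ (k ℕ.+ k ℕ.+ 5)) ℕ.+ 3
   lem₂ = ℕ-solve

 e-even₂ : ∀ k → 2 ℕ.* δ (4 ℕ.+ k) ℕ.+ e (3 ℕ.+ k) ℕ.+ e (1 ℕ.+ k) ℕ.+ 2 ℕ.* e (4 ℕ.+ k) ≡ e (suc (dbl k 5))
 e-even₂ = by-six _ refl refl refl refl refl refl λ k h →
   trans (lem₁ (δ (4 ℕ.+ k)) (e (3 ℕ.+ k)) (e (1 ℕ.+ k)) (e (4 ℕ.+ k)) k)
     (trans (cong (ℕ._+ (4 ℕ.* k ℕ.+ 24)) h) (trans (lem₂ (e (suc (dbl k 5))) k)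
       (cong (λ d → e (suc (dbl k 5)) ℕ.+ suc d ℕ.+ 3 ℕ.+ suc (6 ℕ.+ d) ℕ.+ 3) (sym (dbl≡ k 5)))))
   where
   lem₁ : ∀ d e₁ e₂ e₃ k → 2 ℕ.* d ℕ.+ (e₁ ℕ.+ suc (2 ℕ.+ k) ℕ.+ 3) ℕ.+ (e₂ ℕ.+ suc (0 ℕ.+ k) ℕ.+ 3) ℕ.+ 2 ℕ.* (e₃ ℕ.+ suc (3 ℕ.+ k) ℕ.+ 3) ≡
          (2 ℕ.* d ℕ.+ e₁ ℕ.+ e₂ ℕ.+ 2 ℕ.* e₃) ℕ.+ (4 ℕ.* k ℕ.+ 24)
   lem₁ = ℕ-solve
   lem₂ : ∀ e k → e ℕ.+ (4 ℕ.* k ℕ.+ 24) ≡ e ℕ.+ suc (k ℕ.+ k ℕ.+ 5) ℕ.+ 3 ℕ.+ suc (6 ℕ.+ (k ℕ.+ k ℕ.+ 5)) ℕ.+ 3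
   lem₂ = ℕ-solve

 τ-odd : ∀ k → τ (suc (dbl k 4)) ≡ 0
 τ-odd zero = refl
 τ-odd (suc k) = τ-odd k

 τ-even : ∀ k → τ (suc (dbl k 5)) ≡ 1
 τ-even zero = refl
 τ-even (suc k) = τ-even k

 δ-odd : ∀ k → δ (suc (dbl k 4)) ≡ δ (1 ℕ.+ k)
 δ-odd = by-six _ refl refl refl refl refl refl λ k h → h

 δ-even : ∀ k → δ (suc (dbl k 5)) ≡ δ (3 ℕ.+ k)
 δ-even = by-six _ refl refl refl refl refl refl λ k h → h

 τ-suc : ∀ k → τ k ℕ.+ τ (suc k) ≡ 1
 τ-suc 0 = refl
 τ-suc 1 = refl
 τ-suc (suc (suc k)) = τ-suc k

 -- Sizes of an elliptic divisibility sequence with W₂ = a, W₃ = d, a⁴ = T G and d³ = b G².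
 module Scale (a d T b G : ℤ) (a⁴ : a · a · (a · a) ≡ T · G) (d³ : d · d · d ≡ b · (G · G)) where

   -- The monomial of weight n² - 1, the weight of the n-th division polynomial, when `a`, `d` and
   -- `G` have weights 3, 8 and 12 (and `T`, `b` weight 0). The factors `a` and `d` reflect that ψ₂
   -- divides ψ at even indices and ψ₃ at multiples of 3.
   σ : ℕ → ℤ
   σ n = a ^ τ n · d ^ δ n · G ^ e n

   cube sq : ℤ → ℤ
   cube z = z · z · z
   sq z = z · z

   pow₄ : ∀ t → a ^ t · cube (a ^ t) ≡ T ^ t · G ^ t
   pow₄ zero = refl
   pow₄ (suc t) = trans (lem₁ a (a ^ t)) (trans (cong₂ _·_ a⁴ (pow₄ t)) (lem₂ T G (T ^ t) (G ^ t)))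
     where
     lem₁ : ∀ a p → a · p · (a · p · (a · p) · (a · p)) ≡ a · a · (a · a) · (p · (p · p · p))
     lem₁ = ℤ-solve 2 (λ a p → a :* p :* (a :* p :* (a :* p) :* (a :* p)) , a :* a :* (a :* a) :* (p :* (p :* p :* p))) refl
     lem₂ : ∀ T G p q → T · G · (p · q) ≡ T · p · (G · q)
     lem₂ = ℤ-solve 4 (λ T G p q → T :* G :* (p :* q) , T :* p :* (G :* q)) refl

   pow₃ : ∀ t → cube (d ^ t) ≡ b ^ t · G ^ (2 ℕ.* t)
   pow₃ zero = refl
   pow₃ (suc t) = trans (lem₁ d (d ^ t)) (trans (cong₂ _·_ d³ (pow₃ t))
       (trans (lem₂ b G (b ^ t) (G ^ (2 ℕ.* t))) (cong (λ u → b ^ suc t · u) (sym (cong (G ^_) (ℕₚ.*-suc 2 t))))))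
     where
     lem₁ : ∀ d p → d · p · (d · p) · (d · p) ≡ d · d · d · (p · p · p)
     lem₁ = ℤ-solve 2 (λ d p → d :* p :* (d :* p) :* (d :* p) , d :* d :* d :* (p :* p :* p)) refl
     lem₂ : ∀ b G p q → b · (G · G) · (p · q) ≡ b · p · (G · (G · q))
     lem₂ = ℤ-solve 4 (λ b G p q → b :* (G :* G) :* (p :* q) , b :* p :* (G :* (G :* q))) refl

   pow-sum₄ : ∀ i j k l → G ^ i · G ^ j · G ^ k · G ^ l ≡ G ^ (i ℕ.+ j ℕ.+ k ℕ.+ l)
   pow-sum₄ i j k l = sym (trans (ℤₚ.^-distribˡ-+-* G (i ℕ.+ j ℕ.+ k) l) (cong (_· G ^ l)
     (trans (ℤₚ.^-distribˡ-+-* G (i ℕ.+ j) k) (cong (_· G ^ k) (ℤₚ.^-distribˡ-+-* G i j)))))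

   cube^ : ∀ i → cube (G ^ i) ≡ G ^ (3 ℕ.* i)
   cube^ i = sym (trans (cong (G ^_) (lem i)) (trans (ℤₚ.^-distribˡ-+-* G (i ℕ.+ i) i) (cong (_· G ^ i) (ℤₚ.^-distribˡ-+-* G i i))))
     where
     lem : ∀ i → 3 ℕ.* i ≡ i ℕ.+ i ℕ.+ i
     lem = ℕ-solve

   sq^ : ∀ i → sq (G ^ i) ≡ G ^ (2 ℕ.* i)
   sq^ i = sym (trans (cong (λ u → G ^ (i ℕ.+ u)) (ℕₚ.+-identityʳ i)) (ℤₚ.^-distribˡ-+-* G i i))

   σ-odd : ∀ t p q d₁ d₂ e₁ e₂ {m} → τ m ≡ 0 → δ m ≡ d₁ → t ≡ p → t ≡ q →
     t ℕ.+ 2 ℕ.* d₂ ℕ.+ e₁ ℕ.+ 3 ℕ.* e₂ ≡ e m →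
     (a ^ p · d ^ d₁ · G ^ e₁) · cube (a ^ q · d ^ d₂ · G ^ e₂) ≡ T ^ t · b ^ d₂ · σ m
   σ-odd t _ _ d₁ d₂ e₁ e₂ {m} τ≡ δ≡ refl refl e≡ = begin
     (a ^ t · d ^ d₁ · G ^ e₁) · cube (a ^ t · d ^ d₂ · G ^ e₂) ≡⟨ lem₁ (a ^ t) (d ^ d₁) (G ^ e₁) (d ^ d₂) (G ^ e₂) ⟩
     (a ^ t · cube (a ^ t)) · cube (d ^ d₂) · d ^ d₁ · (G ^ e₁ · cube (G ^ e₂))
       ≡⟨ cong₂ (λ u v → u · v · d ^ d₁ · (G ^ e₁ · cube (G ^ e₂))) (pow₄ t) (pow₃ d₂) ⟩
     (T ^ t · G ^ t) · (b ^ d₂ · G ^ (2 ℕ.* d₂)) · d ^ d₁ · (G ^ e₁ · cube (G ^ e₂))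
       ≡⟨ cong (λ u → (T ^ t · G ^ t) · (b ^ d₂ · G ^ (2 ℕ.* d₂)) · d ^ d₁ · (G ^ e₁ · u)) (cube^ e₂) ⟩
     (T ^ t · G ^ t) · (b ^ d₂ · G ^ (2 ℕ.* d₂)) · d ^ d₁ · (G ^ e₁ · G ^ (3 ℕ.* e₂))
       ≡⟨ lem₂ (T ^ t) (G ^ t) (b ^ d₂) (G ^ (2 ℕ.* d₂)) (d ^ d₁) (G ^ e₁) (G ^ (3 ℕ.* e₂)) ⟩
     T ^ t · b ^ d₂ · (1ℤ · d ^ d₁ · (G ^ t · G ^ (2 ℕ.* d₂) · G ^ e₁ · G ^ (3 ℕ.* e₂)))
       ≡⟨ cong (λ u → T ^ t · b ^ d₂ · (1ℤ · d ^ d₁ · u)) (trans (pow-sum₄ t (2 ℕ.* d₂) e₁ (3 ℕ.* e₂)) (cong (G ^_) e≡)) ⟩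
     T ^ t · b ^ d₂ · (a ^ 0 · d ^ d₁ · G ^ e m)
       ≡⟨ cong₂ (λ u v → T ^ t · b ^ d₂ · (a ^ u · d ^ v · G ^ e m)) (sym τ≡) (sym δ≡) ⟩
     T ^ t · b ^ d₂ · σ m ∎
     where
     open ≡-Reasoning
     lem₁ : ∀ p q r s t → (p · q · r) · ((p · s · t) · (p · s · t) · (p · s · t)) ≡
       (p · (p · p · p)) · (s · s · s) · q · (r · (t · t · t))
     lem₁ = ℤ-solve 5 (λ p q r s t → (p :* q :* r) :* ((p :* s :* t) :* (p :* s :* t) :* (p :* s :* t)) , (p :* (p :* p :* p)) :* (s :* s :* s) :* q :* (r :* (t :* t :* t))) refl
     lem₂ : ∀ p q r s t u v → (p · q) · (r · s) · t · (u · v) ≡ p · r · (1ℤ · t · (q · s · u · v))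
     lem₂ = ℤ-solve 7 (λ p q r s t u v → (p :* q) :* (r :* s) :* t :* (u :* v) , p :* r :* (Κ 1ℤ :* t :* (q :* s :* u :* v))) refl

   -- The exponents t₁, t₁, t₂, t₂ of a add up to 2.
   σ-even : ∀ t₁ t₂ p q d₁ d₂ e₁ e₂ e₃ {m d₃ d₄} → τ m ≡ 1 → δ m ≡ d₁ → t₁ ℕ.+ t₂ ≡ 1 → t₁ ≡ p → t₂ ≡ q → d₂ ≡ d₃ → d₂ ≡ d₄ →
     2 ℕ.* d₂ ℕ.+ e₁ ℕ.+ e₂ ℕ.+ 2 ℕ.* e₃ ≡ e m →
     (a ^ t₁ · d ^ d₁ · G ^ e₁) · (a ^ p · d ^ d₃ · G ^ e₂) · sq (a ^ q · d ^ d₄ · G ^ e₃) ≡ b ^ d₂ · (σ m · a)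
   σ-even t₁ t₂ _ _ d₁ d₂ e₁ e₂ e₃ {m} τ≡ δ≡ t≡ refl refl refl refl e≡ = begin
     _ ≡⟨ lem₁ (a ^ t₁) (d ^ d₁) (G ^ e₁) (d ^ d₂) (G ^ e₂) (a ^ t₂) (G ^ e₃) ⟩
     sq (a ^ t₁ · a ^ t₂) · cube (d ^ d₂) · d ^ d₁ · (G ^ e₁ · G ^ e₂ · sq (G ^ e₃))
       ≡⟨ cong₂ (λ u v → sq u · v · d ^ d₁ · (G ^ e₁ · G ^ e₂ · sq (G ^ e₃)))
            (trans (sym (ℤₚ.^-distribˡ-+-* a t₁ t₂)) (trans (cong (a ^_) t≡) (ℤₚ.^-identityʳ a))) (pow₃ d₂) ⟩
     sq a · (b ^ d₂ · G ^ (2 ℕ.* d₂)) · d ^ d₁ · (G ^ e₁ · G ^ e₂ · sq (G ^ e₃))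
       ≡⟨ cong (λ u → sq a · (b ^ d₂ · G ^ (2 ℕ.* d₂)) · d ^ d₁ · (G ^ e₁ · G ^ e₂ · u)) (sq^ e₃) ⟩
     sq a · (b ^ d₂ · G ^ (2 ℕ.* d₂)) · d ^ d₁ · (G ^ e₁ · G ^ e₂ · G ^ (2 ℕ.* e₃))
       ≡⟨ lem₂ a (b ^ d₂) (G ^ (2 ℕ.* d₂)) (d ^ d₁) (G ^ e₁) (G ^ e₂) (G ^ (2 ℕ.* e₃)) ⟩
     b ^ d₂ · (a · 1ℤ · d ^ d₁ · (G ^ (2 ℕ.* d₂) · G ^ e₁ · G ^ e₂ · G ^ (2 ℕ.* e₃)) · a)
       ≡⟨ cong (λ u → b ^ d₂ · (a · 1ℤ · d ^ d₁ · u · a)) (trans (pow-sum₄ (2 ℕ.* d₂) e₁ e₂ (2 ℕ.* e₃)) (cong (G ^_) e≡)) ⟩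
     b ^ d₂ · (a ^ 1 · d ^ d₁ · G ^ e m · a)
       ≡⟨ cong₂ (λ u v → b ^ d₂ · (a ^ u · d ^ v · G ^ e m · a)) (sym τ≡) (sym δ≡) ⟩
     b ^ d₂ · (σ m · a) ∎
     where
     open ≡-Reasoning
     lem₁ : ∀ p q r s t u v → (p · q · r) · (p · s · t) · ((u · s · v) · (u · s · v)) ≡
       (p · u) · (p · u) · (s · s · s) · q · (r · t · (v · v))
     lem₁ = ℤ-solve 7 (λ p q r s t u v → (p :* q :* r) :* (p :* s :* t) :* ((u :* s :* v) :* (u :* s :* v)) , (p :* u) :* (p :* u) :* (s :* s :* s) :* q :* (r :* t :* (v :* v))) refl
     lem₂ : ∀ a p q r s t u → a · a · (p · q) · r · (s · t · u) ≡ p · (a · 1ℤ · r · (q · s · t · u) · a)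
     lem₂ = ℤ-solve 7 (λ a p q r s t u → a :* a :* (p :* q) :* r :* (s :* t :* u) , p :* (a :* Κ 1ℤ :* r :* (q :* s :* t :* u) :* a)) refl

   σ-odd₁ : ∀ k → σ (4 ℕ.+ k) · cube (σ (2 ℕ.+ k)) ≡ T ^ τ (2 ℕ.+ k) · b ^ δ (2 ℕ.+ k) · σ (suc (dbl k 4))
   σ-odd₁ k = σ-odd (τ (2 ℕ.+ k)) (τ (4 ℕ.+ k)) (τ (2 ℕ.+ k)) (δ (4 ℕ.+ k)) (δ (2 ℕ.+ k)) (e (4 ℕ.+ k)) (e (2 ℕ.+ k))
     {suc (dbl k 4)} (τ-odd k) (δ-odd k) refl refl (e-odd₁ k)

   σ-odd₂ : ∀ k → σ (1 ℕ.+ k) · cube (σ (3 ℕ.+ k)) ≡ T ^ τ (3 ℕ.+ k) · b ^ δ (3 ℕ.+ k) · σ (suc (dbl k 4))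
   σ-odd₂ k = σ-odd (τ (3 ℕ.+ k)) (τ (1 ℕ.+ k)) (τ (3 ℕ.+ k)) (δ (1 ℕ.+ k)) (δ (3 ℕ.+ k)) (e (1 ℕ.+ k)) (e (3 ℕ.+ k))
     {suc (dbl k 4)} (τ-odd k) (δ-odd k) refl refl (e-odd₂ k)

   σ-even₁ : ∀ k → σ (3 ℕ.+ k) · σ (5 ℕ.+ k) · sq (σ (2 ℕ.+ k)) ≡ b ^ δ (5 ℕ.+ k) · (σ (suc (dbl k 5)) · a)
   σ-even₁ k = σ-even (τ (3 ℕ.+ k)) (τ (2 ℕ.+ k)) (τ (5 ℕ.+ k)) (τ (2 ℕ.+ k)) (δ (3 ℕ.+ k)) (δ (5 ℕ.+ k))
     (e (3 ℕ.+ k)) (e (5 ℕ.+ k)) (e (2 ℕ.+ k)) {suc (dbl k 5)} {δ (5 ℕ.+ k)} {δ (2 ℕ.+ k)} (τ-even k) (δ-even k)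
     (trans (ℕₚ.+-comm (τ (1 ℕ.+ k)) (τ k)) (τ-suc k)) refl refl refl refl (e-even₁ k)

   σ-even₂ : ∀ k → σ (3 ℕ.+ k) · σ (1 ℕ.+ k) · sq (σ (4 ℕ.+ k)) ≡ b ^ δ (4 ℕ.+ k) · (σ (suc (dbl k 5)) · a)
   σ-even₂ k = σ-even (τ (3 ℕ.+ k)) (τ (4 ℕ.+ k)) (τ (1 ℕ.+ k)) (τ (4 ℕ.+ k)) (δ (3 ℕ.+ k)) (δ (4 ℕ.+ k))
     (e (3 ℕ.+ k)) (e (1 ℕ.+ k)) (e (4 ℕ.+ k)) {suc (dbl k 5)} {δ (1 ℕ.+ k)} {δ (4 ℕ.+ k)} (τ-even k) (δ-even k)
     (trans (ℕₚ.+-comm (τ (1 ℕ.+ k)) (τ k)) (τ-suc k)) refl refl refl refl (e-even₂ k)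

open GroupLaw

-- Integers inside the rationals

module Embedding where

 import Data.Nat.Coprimality as Coprime
 open import Data.Rational using (_+_; _-_; _*_; -_; mkℚ)
 import Data.Rational.Unnormalised as ℚᵘ
 import Data.Rational.Unnormalised.Properties as ℚᵘₚ

 ι : ℤ → ℚ
 ι i = i ℚ./ 1

 ι-mk : ∀ i → ι i ≡ mkℚ i 0 (Coprime.sym (Coprime.1-coprimeTo ℤ.∣ i ∣))
 ι-mk i = ℚₚ.↥p/↧p≡p (mkℚ i 0 _)

 ι-injective : ∀ {i j} → ι i ≡ ι j → i ≡ j
 ι-injective {i} {j} e = cong ℚ.↥_ (trans (sym (ι-mk i)) (trans e (ι-mk j)))

 toℚᵘ-ι : ∀ i → ℚ.toℚᵘ (ι i) ≡ ℚᵘ.mkℚᵘ i 0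
 toℚᵘ-ι i = cong ℚ.toℚᵘ (ι-mk i)

 ι-+ : ∀ i j → ι (i ∔ j) ≡ ι i + ι j
 ι-+ i j = ℚₚ.toℚᵘ-injective (ℚᵘₚ.≃-trans (ℚᵘₚ.≃-reflexive (toℚᵘ-ι (i ∔ j)))
   (ℚᵘₚ.≃-trans (ℚᵘ.*≡* (lem i j))
   (ℚᵘₚ.≃-trans (ℚᵘₚ.≃-reflexive (cong₂ ℚᵘ._+_ (sym (toℚᵘ-ι i)) (sym (toℚᵘ-ι j))))
   (ℚᵘₚ.≃-sym (ℚₚ.toℚᵘ-homo-+ (ι i) (ι j))))))
   where
   lem : ∀ i j → (i ∔ j) · 1ℤ ≡ (i · 1ℤ ∔ j · 1ℤ) · 1ℤ
   lem = ℤ-solve 2 (λ i j → (i :+ j) :* Κ 1ℤ , (i :* Κ 1ℤ :+ j :* Κ 1ℤ) :* Κ 1ℤ) refl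

 ι-* : ∀ i j → ι (i · j) ≡ ι i * ι j
 ι-* i j = ℚₚ.toℚᵘ-injective (ℚᵘₚ.≃-trans (ℚᵘₚ.≃-reflexive (toℚᵘ-ι (i · j)))
   (ℚᵘₚ.≃-trans (ℚᵘₚ.≃-reflexive (cong₂ ℚᵘ._*_ (sym (toℚᵘ-ι i)) (sym (toℚᵘ-ι j))))
   (ℚᵘₚ.≃-sym (ℚₚ.toℚᵘ-homo-* (ι i) (ι j)))))

 ι-neg : ∀ i → ι (ℤ.- i) ≡ - ι i
 ι-neg i = -≡0⇒≡ (trans (cong (λ u → ι (ℤ.- i) + u) (neg-neg (ι i))) (trans (sym (ι-+ (ℤ.- i) i)) (cong ι (ℤₚ.+-inverseˡ i))))
   where
   neg-neg : ∀ p → - (- p) ≡ p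
   neg-neg = ℚ-solve 1 (λ p → :- (:- p) , p) refl

 ι-- : ∀ i j → ι (i ℤ.- j) ≡ ι i - ι j
 ι-- i j = trans (ι-+ i (ℤ.- j)) (cong (ι i +_) (ι-neg j))

 ι-≢0 : ∀ {i} → i ≢ 0ℤ → ι i ≢ 0ℚ
 ι-≢0 i≢0 e = i≢0 (ι-injective e)

open Embedding
module Denominators where

 open import Data.Integer using (+_)
 open import Data.Rational using (_+_; _*_)

 clear-den : ∀ q → q * ι (ℚ.↧ q) ≡ ι (ℚ.↥ q)
 clear-den q@(ℚ.mkℚ _ _ _) = trans (cong (_* ι (ℚ.↧ q)) (sym (ℚₚ.↥p/↧p≡p q))) (ℚₚ.toℚᵘ-injective (ℚᵘₚ.≃-trans (ℚₚ.toℚᵘ-homo-* (ℚ.↥ q ℚ./ ℚ.↧ₙ q) (ι (ℚ.↧ q)))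
     (ℚᵘₚ.≃-trans (ℚᵘₚ.≃-reflexive (cong₂ ℚᵘ._*_ (cong ℚ.toℚᵘ (ℚₚ.↥p/↧p≡p q)) (toℚᵘ-ι (ℚ.↧ q))))
     (ℚᵘₚ.≃-trans (ℚᵘ.*≡* {q = ℚᵘ.mkℚᵘ (ℚ.↥ q) 0} (lem (ℚ.↥ q) (ℚ.↧ q))) (ℚᵘₚ.≃-reflexive (sym (toℚᵘ-ι (ℚ.↥ q))))))))
   where
   import Data.Rational.Unnormalised as ℚᵘ
   import Data.Rational.Unnormalised.Properties as ℚᵘₚ
   lem : ∀ n d → n · d · 1ℤ ≡ n · (d · 1ℤ)
   lem = ℤ-solve 2 (λ n d → n :* d :* Κ 1ℤ , n :* (d :* Κ 1ℤ)) refl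

-- Values of the division polynomials and their recursions

module DivisionPolynomials where
 open Indices
 open import Data.Integer using (+_; _^_)

 ℤ-cancelʳ : ∀ {i j} k → k ≢ 0ℤ → i · k ≡ j · k → i ≡ j
 ℤ-cancelʳ k k≢0 e = ℤₚ.*-cancelʳ-≡ _ _ k {{ℤ.≢-nonZero k≢0}} e

 ℤ-*-≢0 : ∀ {i j} → i ≢ 0ℤ → j ≢ 0ℤ → i · j ≢ 0ℤ
 ℤ-*-≢0 {i} i≢0 j≢0 e with ℤₚ.i*j≡0⇒i≡0∨j≡0 i e
 ... | inj₁ h = i≢0 h
 ... | inj₂ h = j≢0 h

 ℤ-^-≢0 : ∀ {i} n → i ≢ 0ℤ → i ^ n ≢ 0ℤ
 ℤ-^-≢0 n i≢0 e = i≢0 (ℤₚ.i^n≡0⇒i≡0 _ n e)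

 infix 9 _²ℤ _³ℤ

 _²ℤ _³ℤ : ℤ → ℤ
 i ²ℤ = i · i
 i ³ℤ = i · i · i

 ψ₃ ψ₄ : ℤ → ℤ → ℤ
 ψ₃ x y = + 3 · x · (+ 4 · y ²ℤ ℤ.- + 3 · x ³ℤ)
 ψ₄ x y = + 4 · y · (+ 36 · x ³ℤ · y ²ℤ ℤ.- + 27 · x ³ℤ · x ³ℤ ℤ.- + 8 · y ²ℤ · y ²ℤ)

 -- `G` collects what ψ₂⁴ and ψ₃³ have in common, `T` and `b` are the remaining factors. `c` is the
 -- fourth term of the sequence in this normalisation, and `h` is x normalised likewise, as needed
 -- for the numerators of x(4P) and x(6P).
 record Params (x y : ℤ) : Set where
   field
     T b c G h : ℤ
     a⁴    : (+ 2 · y) · (+ 2 · y) · ((+ 2 · y) · (+ 2 · y)) ≡ T · G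
     d³    : ψ₃ x y · ψ₃ x y · ψ₃ x y ≡ b · (G · G)
     ψ₄≡   : ψ₄ x y ≡ (+ 2 · y) · c · G
     xa²d² : x · (+ 2 · y) ²ℤ · ψ₃ x y ²ℤ ≡ h · G ²ℤ
   a d : ℤ
   a = + 2 · y
   d = ψ₃ x y

module EllipticDivisibility {B x y : ℚ} (M : Multiples B x y) where
 open Indices using (dbl; dbl-shift)
 open import Data.Rational using (_+_; _-_; _*_; -_; _÷_; ≢-nonZero)

 open Multiples M public

 x-X≢0 : ∀ n → x - X (2 ℕ.+ n) ≢ 0ℚ
 x-X≢0 n e = X≢x n (sym (-≡0⇒≡ e))

 2y≢0 : 2ℚ * y ≢ 0ℚ
 2y≢0 = *-≢0 {2ℚ} {y} (λ ()) y≢0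

 -- The relation ψ(n+1) ψ(n-1) = ψ(n)² (x - x(nP)) serves as the definition. It divides by the older
 -- of two consecutive terms, so a pair is carried together with its nonvanishing; the new term is
 -- nonzero because x(nP) ≠ x for n ≥ 2.
 W-pair : ℕ → Σ ℚ λ w → Σ ℚ λ w′ → w ≢ 0ℚ × w′ ≢ 0ℚ
 W-pair zero = 1ℚ , 2ℚ * y , (λ ()) , 2y≢0
 W-pair (suc n) with W-pair n
 ... | w , w′ , w≢0 , w′≢0 = w′ , next , w′≢0 , λ e → *-≢0 (*-≢0 w′≢0 w′≢0) (x-X≢0 n)
         (trans (sym (÷-* (w′ ² * (x - X (2 ℕ.+ n))) w w≢0))
                (trans (cong (_* w) e) (ℚₚ.*-zeroˡ w)))
   where next = (w′ ² * (x - X (2 ℕ.+ n)) ÷ w) {{≢-nonZero w≢0}}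

 W : ℕ → ℚ
 W zero    = 0ℚ
 W (suc n) = proj₁ (W-pair n)

 W≢0 : ∀ n → W (suc n) ≢ 0ℚ
 W≢0 n = proj₁ (proj₂ (proj₂ (W-pair n)))

 -- The pair (`w n` : `Φ n`) is a projective form of x(nP). The values 0 and 1 at n = 0 encode the
 -- pole at the point at infinity and let the neighbour formulas start at n = 1.
 w Φ : ℕ → ℚ
 w n = W n ²
 Φ zero    = 1ℚ
 Φ (suc n) = w (suc n) * X (suc n)

 W-rec : ∀ n → W (3 ℕ.+ n) * W (1 ℕ.+ n) ≡ w (2 ℕ.+ n) * (x - X (2 ℕ.+ n))
 W-rec n = ÷-* (w (2 ℕ.+ n) * (x - X (2 ℕ.+ n))) (W (1 ℕ.+ n)) (W≢0 n)

 y²≡ : y ² ≡ x * x * x + B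
 y²≡ = subst₂ (λ u v → v ² ≡ u * u * u + B) X₁ Y₁ (curve 0)

 W-step : ∀ n → W (2 ℕ.+ n) * W n ≡ x * w (1 ℕ.+ n) - Φ (1 ℕ.+ n)
 W-step zero = trans (ℚₚ.*-zeroʳ (2ℚ * y)) (sym (trans (cong (λ u → x * 1ℚ ² - 1ℚ ² * u) X₁) (lem x)))
   where
   lem : ∀ x → x * (1ℚ * 1ℚ) - (1ℚ * 1ℚ) * x ≡ 0ℚ
   lem = ℚ-solve 1 (λ x → x :* (Κ 1ℚ :* Κ 1ℚ) :- (Κ 1ℚ :* Κ 1ℚ) :* x , Κ 0ℚ) refl
 W-step (suc n) = trans (W-rec n) (lem (w (2 ℕ.+ n)) x (X (2 ℕ.+ n)))
   where
   lem : ∀ w x X → w * (x - X) ≡ x * w - w * X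
   lem = ℚ-solve 3 (λ w x X → w :* (x :- X) , x :* w :- w :* X) refl

 -- `X⁺` and `X⁻` come from the slopes (Y⁰ - y)/D and (Y⁰ + y)/D. Their sum and product depend on
 -- ordinates only through squares, so they are rational in the abscissas; their difference retains
 -- the sign of `Y⁰`, which `W-double` exploits.
 module Neighbours (n : ℕ) where
   D X⁻ X⁰ X⁺ Y⁰ : ℚ
   X⁻ = X (1 ℕ.+ n)
   X⁰ = X (2 ℕ.+ n)
   X⁺ = X (3 ℕ.+ n)
   Y⁰ = Y (2 ℕ.+ n)
   D = X⁰ - x

   D≢0 : D ≢ 0ℚ
   D≢0 e = X≢x n (-≡0⇒≡ e)

   up : D ² * X⁺ ≡ (Y⁰ - y) ² - (x + X⁰) * D ²
   up = trans (cong (D ² *_) (X-step (suc n)))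
          (trans (lem (slope (suc n)) D x X⁰) (cong (λ u → u ² - (x + X⁰) * D ²) (chord-slope (suc n))))
     where
     lem : ∀ l D x X → D * D * (l * l - x - X) ≡ (l * D) * (l * D) - (x + X) * (D * D)
     lem = ℚ-solve 4 (λ l D x X → D :* D :* (l :* l :- x :- X) , (l :* D) :* (l :* D) :- (x :+ X) :* (D :* D)) refl

   down : D ² * X⁻ ≡ (Y⁰ + y) ² - (x + X⁰) * D ²
   down = begin
     D ² * X⁻                       ≡⟨ lem₁ (slope n) D x X⁰ X⁻ ⟩
     (l * D) ² - (x + (l * l - x - X⁻)) * D ²
       ≡⟨ cong (λ u → (l * D) ² - (x + u) * D ²) (sym (X-step n)) ⟩
     (l * D) ² - (x + X⁰) * D ²     ≡⟨ cong (λ u → u - (x + X⁰) * D ²) (lem₂ l x X⁰ y) ⟩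
     (l * (x - X⁰) - y + y) ² - (x + X⁰) * D ²
       ≡⟨ cong (λ u → (u + y) ² - (x + X⁰) * D ²) (sym (Y-step n)) ⟩
     (Y⁰ + y) ² - (x + X⁰) * D ² ∎
     where
     open ≡-Reasoning
     l = slope n
     lem₁ : ∀ l D x X X⁻ → D * D * X⁻ ≡ (l * D) * (l * D) - (x + (l * l - x - X⁻)) * (D * D)
     lem₁ = ℚ-solve 5 (λ l D x X X⁻ → D :* D :* X⁻ , (l :* D) :* (l :* D) :- (x :+ (l :* l :- x :- X⁻)) :* (D :* D)) refl
     lem₂ : ∀ l x X y → (l * (X - x)) * (l * (X - x)) ≡ (l * (x - X) - y + y) * (l * (x - X) - y + y)
     lem₂ = ℚ-solve 4 (λ l x X y → (l :* (X :- x)) :* (l :* (X :- x)) , (l :* (x :- X) :- y :+ y) :* (l :* (x :- X) :- y :+ y)) refl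

   sum : D ² * (X⁺ + X⁻) ≡ 2ℚ * (x * X⁰ * (x + X⁰) + 2ℚ * B)
   sum = begin
     D ² * (X⁺ + X⁻) ≡⟨ ℚₚ.*-distribˡ-+ (D ²) X⁺ X⁻ ⟩
     D ² * X⁺ + D ² * X⁻ ≡⟨ cong₂ _+_ up down ⟩
     ((Y⁰ - y) ² - (x + X⁰) * D ²) + ((Y⁰ + y) ² - (x + X⁰) * D ²) ≡⟨ lem₁ x y X⁰ Y⁰ ⟩
     2ℚ * (Y⁰ ² + y ² - (x + X⁰) * D ²)
       ≡⟨ cong₂ (λ u v → 2ℚ * (u + v - (x + X⁰) * D ²)) (curve (suc n)) y²≡ ⟩
     2ℚ * (X⁰ * X⁰ * X⁰ + B + (x * x * x + B) - (x + X⁰) * D ²) ≡⟨ lem₂ x X⁰ B ⟩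
     2ℚ * (x * X⁰ * (x + X⁰) + 2ℚ * B) ∎
     where
     open ≡-Reasoning
     lem₁ : ∀ x y X Y → ((Y - y) * (Y - y) - (x + X) * ((X - x) * (X - x))) + ((Y + y) * (Y + y) - (x + X) * ((X - x) * (X - x)))
       ≡ (1ℚ + 1ℚ) * (Y * Y + y * y - (x + X) * ((X - x) * (X - x)))
     lem₁ = ℚ-solve 4 (λ x y X Y → ((Y :- y) :* (Y :- y) :- (x :+ X) :* ((X :- x) :* (X :- x))) :+ ((Y :+ y) :* (Y :+ y) :- (x :+ X) :* ((X :- x) :* (X :- x))) , (Κ 1ℚ :+ Κ 1ℚ) :* (Y :* Y :+ y :* y :- (x :+ X) :* ((X :- x) :* (X :- x)))) refl
     lem₂ : ∀ x X B → (1ℚ + 1ℚ) * (X * X * X + B + (x * x * x + B) - (x + X) * ((X - x) * (X - x)))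
       ≡ (1ℚ + 1ℚ) * (x * X * (x + X) + (1ℚ + 1ℚ) * B)
     lem₂ = ℚ-solve 3 (λ x X B → (Κ 1ℚ :+ Κ 1ℚ) :* (X :* X :* X :+ B :+ (x :* x :* x :+ B) :- (x :+ X) :* ((X :- x) :* (X :- x))) , (Κ 1ℚ :+ Κ 1ℚ) :* (x :* X :* (x :+ X) :+ (Κ 1ℚ :+ Κ 1ℚ) :* B)) refl

   difference : D ² * (X⁻ - X⁺) ≡ 4ℚ * (y * Y⁰)
   difference = trans (lem₁ (D ²) X⁻ X⁺) (trans (cong₂ _-_ down up) (lem₂ Y⁰ y ((x + X⁰) * D ²)))
     where
     lem₁ : ∀ D a b → D * (a - b) ≡ D * a - D * b
     lem₁ = ℚ-solve 3 (λ D a b → D :* (a :- b) , D :* a :- D :* b) refl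
     lem₂ : ∀ Y y z → ((Y + y) * (Y + y) - z) - ((Y - y) * (Y - y) - z) ≡ 4ℚ * (y * Y)
     lem₂ = ℚ-solve 3 (λ Y y z → ((Y :+ y) :* (Y :+ y) :- z) :- ((Y :- y) :* (Y :- y) :- z) , Κ 4ℚ :* (y :* Y)) refl

   prod : D ² * (X⁺ * X⁻) ≡ (x * X⁰) ² - 4ℚ * B * (x + X⁰)
   prod = *-cancelʳ (D ²) (*-≢0 D≢0 D≢0) (begin
     D ² * (X⁺ * X⁻) * D ² ≡⟨ lem₁ (D ²) X⁺ X⁻ ⟩
     (D ² * X⁺) * (D ² * X⁻) ≡⟨ cong₂ _*_ up down ⟩
     ((Y⁰ - y) ² - s * D ²) * ((Y⁰ + y) ² - s * D ²) ≡⟨ lem₂ s (D ²) y Y⁰ ⟩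
     (Y⁰ ² - y ²) ² - s * D ² * (2ℚ * (Y⁰ ² + y ²)) + s ² * D ² ²
       ≡⟨ cong₂ (λ u v → (u - v) ² - s * D ² * (2ℚ * (u + v)) + s ² * D ² ²) (curve (suc n)) y²≡ ⟩
     _ ≡⟨ lem₃ x X⁰ B ⟩
     ((x * X⁰) ² - 4ℚ * B * (x + X⁰)) * D ² ∎)
     where
     open ≡-Reasoning
     s = x + X⁰
     lem₁ : ∀ D a b → D * (a * b) * D ≡ (D * a) * (D * b)
     lem₁ = ℚ-solve 3 (λ D a b → D :* (a :* b) :* D , (D :* a) :* (D :* b)) refl
     lem₂ : ∀ s D y Y → ((Y - y) * (Y - y) - s * D) * ((Y + y) * (Y + y) - s * D)
       ≡ (Y * Y - y * y) * (Y * Y - y * y) - s * D * ((1ℚ + 1ℚ) * (Y * Y + y * y)) + s * s * (D * D)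
     lem₂ = ℚ-solve 4 (λ s D y Y → ((Y :- y) :* (Y :- y) :- s :* D) :* ((Y :+ y) :* (Y :+ y) :- s :* D) , (Y :* Y :- y :* y) :* (Y :* Y :- y :* y) :- s :* D :* ((Κ 1ℚ :+ Κ 1ℚ) :* (Y :* Y :+ y :* y)) :+ s :* s :* (D :* D)) refl
     lem₃ : ∀ x X B → let D = (X - x) * (X - x); u = X * X * X + B; v = x * x * x + B; s = x + X in
       (u - v) * (u - v) - s * D * (2ℚ * (u + v)) + s * s * (D * D)
       ≡ ((x * X) * (x * X) - 4ℚ * B * (x + X)) * D
     lem₃ = ℚ-solve 3 (λ x X B →
                      let D = (X :- x) :* (X :- x); u = X :* X :* X :+ B; v = x :* x :* x :+ B; s = x :+ X in
       (u :- v) :* (u :- v) :- s :* D :* (Κ 2ℚ :* (u :+ v)) :+ s :* s :* (D :* D)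
       , ((x :* X) :* (x :* X) :- Κ 4ℚ :* B :* (x :+ X)) :* D) refl

 -- The coefficients of the biquadratic form whose roots in the first pair (u : v) are x(nP ± P), for (u : v) = (w n : Φ n).
 α β γ : ℚ → ℚ → ℚ
 α u v = (x * u - v) ²
 β u v = 2ℚ * (x * v * (x * u + v) + 2ℚ * B * u * u)
 γ u v = x * x * v * v - 4ℚ * B * u * (x * u + v)

 neighbours-α : ∀ n → w (2 ℕ.+ n) * w n ≡ α (w (1 ℕ.+ n)) (Φ (1 ℕ.+ n))
 neighbours-α n = trans (lem (W (2 ℕ.+ n)) (W n)) (cong _² (W-step n))
   where
   lem : ∀ a b → a * a * (b * b) ≡ (a * b) * (a * b)
   lem = ℚ-solve 2 (λ a b → a :* a :* (b :* b) , (a :* b) :* (a :* b)) refl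

 X₂-double : 4ℚ * y ² * X 2 ≡ x * (x * x * x - 8ℚ * B)
 X₂-double = begin
   4ℚ * y ² * X 2 ≡⟨ cong (4ℚ * y ² *_) (trans (X-step 0) (cong (λ u → slope 0 * slope 0 - x - u) X₁)) ⟩
   4ℚ * y ² * (slope 0 * slope 0 - x - x) ≡⟨ lem₁ (slope 0) y x ⟩
   (slope 0 * (2ℚ * y)) ² - 8ℚ * x * y ² ≡⟨ cong₂ (λ u v → u ² - 8ℚ * x * v) tangent-slope y²≡ ⟩
   (3ℚ * x * x) ² - 8ℚ * x * (x * x * x + B) ≡⟨ lem₂ x B ⟩
   x * (x * x * x - 8ℚ * B) ∎
   where
   open ≡-Reasoning
   lem₁ : ∀ l y x → 4ℚ * (y * y) * (l * l - x - x) ≡ (l * (2ℚ * y)) * (l * (2ℚ * y)) - 8ℚ * x * (y * y)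
   lem₁ = ℚ-solve 3 (λ l y x → Κ 4ℚ :* (y :* y) :* (l :* l :- x :- x) , (l :* (Κ 2ℚ :* y)) :* (l :* (Κ 2ℚ :* y)) :- Κ 8ℚ :* x :* (y :* y)) refl
   lem₂ : ∀ x B → (3ℚ * x * x) * (3ℚ * x * x) - 8ℚ * x * (x * x * x + B) ≡ x * (x * x * x - 8ℚ * B)
   lem₂ = ℚ-solve 2 (λ x B → (Κ 3ℚ :* x :* x) :* (Κ 3ℚ :* x :* x) :- Κ 8ℚ :* x :* (x :* x :* x :+ B) , x :* (x :* x :* x :- Κ 8ℚ :* B)) refl

 neighbours-β : ∀ n → Φ (2 ℕ.+ n) * w n + Φ n * w (2 ℕ.+ n) ≡ β (w (1 ℕ.+ n)) (Φ (1 ℕ.+ n))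
 neighbours-β zero = trans (lem₁ (Φ 2) y) (trans (cong (4ℚ *_) y²≡)
     (trans (lem₂ x B) (cong (λ u → β (w 1) (1ℚ ² * u)) (sym X₁))))
   where
   lem₁ : ∀ Φ y → Φ * (0ℚ * 0ℚ) + 1ℚ * ((2ℚ * y) * (2ℚ * y)) ≡ 4ℚ * (y * y)
   lem₁ = ℚ-solve 2 (λ Φ y → Φ :* (Κ 0ℚ :* Κ 0ℚ) :+ Κ 1ℚ :* ((Κ 2ℚ :* y) :* (Κ 2ℚ :* y)) , Κ 4ℚ :* (y :* y)) refl
   lem₂ : ∀ x B → 4ℚ * (x * x * x + B) ≡ 2ℚ * (x * (1ℚ * 1ℚ * x) * (x * (1ℚ * 1ℚ) + 1ℚ * 1ℚ * x) + 2ℚ * B * (1ℚ * 1ℚ) * (1ℚ * 1ℚ))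
   lem₂ = ℚ-solve 2 (λ x B → Κ 4ℚ :* (x :* x :* x :+ B) , Κ 2ℚ :* (x :* (Κ 1ℚ :* Κ 1ℚ :* x) :* (x :* (Κ 1ℚ :* Κ 1ℚ) :+ Κ 1ℚ :* Κ 1ℚ :* x) :+ Κ 2ℚ :* B :* (Κ 1ℚ :* Κ 1ℚ) :* (Κ 1ℚ :* Κ 1ℚ))) refl
 neighbours-β (suc n) = begin
   w (3 ℕ.+ n) * X⁺ * w (1 ℕ.+ n) + w (1 ℕ.+ n) * X⁻ * w (3 ℕ.+ n) ≡⟨ lem₁ (W (3 ℕ.+ n)) (W (1 ℕ.+ n)) X⁺ X⁻ ⟩
   (W (3 ℕ.+ n) * W (1 ℕ.+ n)) ² * (X⁺ + X⁻) ≡⟨ cong (λ u → u ² * (X⁺ + X⁻)) (W-rec n) ⟩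
   (w (2 ℕ.+ n) * (x - X⁰)) ² * (X⁺ + X⁻) ≡⟨ lem₂ (w (2 ℕ.+ n)) x X⁰ (X⁺ + X⁻) ⟩
   w (2 ℕ.+ n) ² * (D ² * (X⁺ + X⁻)) ≡⟨ cong (w (2 ℕ.+ n) ² *_) sum ⟩
   w (2 ℕ.+ n) ² * (2ℚ * (x * X⁰ * (x + X⁰) + 2ℚ * B)) ≡⟨ lem₃ (w (2 ℕ.+ n)) x X⁰ B ⟩
   β (w (2 ℕ.+ n)) (Φ (2 ℕ.+ n)) ∎
   where
   open ≡-Reasoning
   open Neighbours n
   lem₁ : ∀ p q a b → p * p * a * (q * q) + q * q * b * (p * p) ≡ (p * q) * (p * q) * (a + b)
   lem₁ = ℚ-solve 4 (λ p q a b → p :* p :* a :* (q :* q) :+ q :* q :* b :* (p :* p) , (p :* q) :* (p :* q) :* (a :+ b)) refl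
   lem₂ : ∀ w x X s → (w * (x - X)) * (w * (x - X)) * s ≡ w * w * ((X - x) * (X - x) * s)
   lem₂ = ℚ-solve 4 (λ w x X s → (w :* (x :- X)) :* (w :* (x :- X)) :* s , w :* w :* ((X :- x) :* (X :- x) :* s)) refl
   lem₃ : ∀ w x X B → w * w * (2ℚ * (x * X * (x + X) + 2ℚ * B)) ≡ 2ℚ * (x * (w * X) * (x * w + w * X) + 2ℚ * B * w * w)
   lem₃ = ℚ-solve 4 (λ w x X B → w :* w :* (Κ 2ℚ :* (x :* X :* (x :+ X) :+ Κ 2ℚ :* B)) , Κ 2ℚ :* (x :* (w :* X) :* (x :* w :+ w :* X) :+ Κ 2ℚ :* B :* w :* w)) refl

 neighbours-γ : ∀ n → Φ (2 ℕ.+ n) * Φ n ≡ γ (w (1 ℕ.+ n)) (Φ (1 ℕ.+ n))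
 neighbours-γ zero = trans (lem₁ y (X 2)) (trans X₂-double (trans (lem₂ x B) (cong (λ u → γ (w 1) (1ℚ ² * u)) (sym X₁))))
   where
   lem₁ : ∀ y X → ((2ℚ * y) * (2ℚ * y)) * X * 1ℚ ≡ 4ℚ * (y * y) * X
   lem₁ = ℚ-solve 2 (λ y X → ((Κ 2ℚ :* y) :* (Κ 2ℚ :* y)) :* X :* Κ 1ℚ , Κ 4ℚ :* (y :* y) :* X) refl
   lem₂ : ∀ x B → x * (x * x * x - 8ℚ * B) ≡ x * x * (1ℚ * 1ℚ * x) * (1ℚ * 1ℚ * x) - 4ℚ * B * (1ℚ * 1ℚ) * (x * (1ℚ * 1ℚ) + 1ℚ * 1ℚ * x)
   lem₂ = ℚ-solve 2 (λ x B → x :* (x :* x :* x :- Κ 8ℚ :* B) , x :* x :* (Κ 1ℚ :* Κ 1ℚ :* x) :* (Κ 1ℚ :* Κ 1ℚ :* x) :- Κ 4ℚ :* B :* (Κ 1ℚ :* Κ 1ℚ) :* (x :* (Κ 1ℚ :* Κ 1ℚ) :+ Κ 1ℚ :* Κ 1ℚ :* x)) refl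
 neighbours-γ (suc n) = begin
   w (3 ℕ.+ n) * X⁺ * (w (1 ℕ.+ n) * X⁻) ≡⟨ lem₁ (W (3 ℕ.+ n)) (W (1 ℕ.+ n)) X⁺ X⁻ ⟩
   (W (3 ℕ.+ n) * W (1 ℕ.+ n)) ² * (X⁺ * X⁻) ≡⟨ cong (λ u → u ² * (X⁺ * X⁻)) (W-rec n) ⟩
   (w (2 ℕ.+ n) * (x - X⁰)) ² * (X⁺ * X⁻) ≡⟨ lem₂ (w (2 ℕ.+ n)) x X⁰ (X⁺ * X⁻) ⟩
   w (2 ℕ.+ n) ² * (D ² * (X⁺ * X⁻)) ≡⟨ cong (w (2 ℕ.+ n) ² *_) prod ⟩
   w (2 ℕ.+ n) ² * ((x * X⁰) ² - 4ℚ * B * (x + X⁰)) ≡⟨ lem₃ (w (2 ℕ.+ n)) x X⁰ B ⟩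
   γ (w (2 ℕ.+ n)) (Φ (2 ℕ.+ n)) ∎
   where
   open ≡-Reasoning
   open Neighbours n
   lem₁ : ∀ p q a b → p * p * a * (q * q * b) ≡ (p * q) * (p * q) * (a * b)
   lem₁ = ℚ-solve 4 (λ p q a b → p :* p :* a :* (q :* q :* b) , (p :* q) :* (p :* q) :* (a :* b)) refl
   lem₂ : ∀ w x X s → (w * (x - X)) * (w * (x - X)) * s ≡ w * w * ((X - x) * (X - x) * s)
   lem₂ = ℚ-solve 4 (λ w x X s → (w :* (x :- X)) :* (w :* (x :- X)) :* s , w :* w :* ((X :- x) :* (X :- x) :* s)) refl
   lem₃ : ∀ w x X B → w * w * ((x * X) * (x * X) - 4ℚ * B * (x + X)) ≡ x * x * (w * X) * (w * X) - 4ℚ * B * w * (x * w + w * X)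
   lem₃ = ℚ-solve 4 (λ w x X B → w :* w :* ((x :* X) :* (x :* X) :- Κ 4ℚ :* B :* (x :+ X)) , x :* x :* (w :* X) :* (w :* X) :- Κ 4ℚ :* B :* w :* (x :* w :+ w :* X)) refl

 form : ℚ → ℚ → ℚ → ℚ → ℚ
 form u v u′ v′ = γ u v * u′ ² - β u v * (u′ * v′) + α u v * v′ ²

 -- Geometrically, R = ± Q ± P is a symmetric condition on the abscissas of Q and R. This symmetry
 -- drives the induction in `W-W`.
 form-sym : ∀ u v u′ v′ → form u v u′ v′ ≡ form u′ v′ u v
 form-sym = lem x B
   where
   lem : ∀ x B u v u′ v′ →
     (x * x * v * v - 4ℚ * B * u * (x * u + v)) * (u′ * u′) - (2ℚ * (x * v * (x * u + v) + 2ℚ * B * u * u)) * (u′ * v′)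
       + (x * u - v) * (x * u - v) * (v′ * v′) ≡
     (x * x * v′ * v′ - 4ℚ * B * u′ * (x * u′ + v′)) * (u * u) - (2ℚ * (x * v′ * (x * u′ + v′) + 2ℚ * B * u′ * u′)) * (u * v)
       + (x * u′ - v′) * (x * u′ - v′) * (v * v)
   lem = ℚ-solve 6 (λ x B u v u′ v′ → (x :* x :* v :* v :- Κ 4ℚ :* B :* u :* (x :* u :+ v)) :* (u′ :* u′) :- (Κ 2ℚ :* (x :* v :* (x :* u :+ v) :+ Κ 2ℚ :* B :* u :* u)) :* (u′ :* v′) :+ (x :* u :- v) :* (x :* u :- v) :* (v′ :* v′) , (x :* x :* v′ :* v′ :- Κ 4ℚ :* B :* u′ :* (x :* u′ :+ v′)) :* (u :* u) :- (Κ 2ℚ :* (x :* v′ :* (x :* u′ :+ v′) :+ Κ 2ℚ :* B :* u′ :* u′)) :* (u :* v) :+ (x :* u′ :- v′) :* (x :* u′ :- v′) :* (v :* v)) refl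

 form-neighbours : ∀ n u v → (Φ n * u - w n * v) * (Φ (2 ℕ.+ n) * u - w (2 ℕ.+ n) * v) ≡ form (w (1 ℕ.+ n)) (Φ (1 ℕ.+ n)) u v
 form-neighbours n u v = trans (lem (Φ n) (w n) (Φ (2 ℕ.+ n)) (w (2 ℕ.+ n)) u v)
   (trans (cong₂ (λ a b → a * u ² - b * (u * v) + w (2 ℕ.+ n) * w n * v ²) (neighbours-γ n) (neighbours-β n))
          (cong (λ c → γ (w (1 ℕ.+ n)) (Φ (1 ℕ.+ n)) * u ² - β (w (1 ℕ.+ n)) (Φ (1 ℕ.+ n)) * (u * v) + c * v ²) (neighbours-α n)))
   where
   lem : ∀ p q p′ q′ u v → (p * u - q * v) * (p′ * u - q′ * v) ≡ (p′ * p) * (u * u) - (p′ * q + p * q′) * (u * v) + (q′ * q) * (v * v)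
   lem = ℚ-solve 6 (λ p q p′ q′ u v → (p :* u :- q :* v) :* (p′ :* u :- q′ :* v) , (p′ :* p) :* (u :* u) :- (p′ :* q :+ p :* q′) :* (u :* v) :+ (q′ :* q) :* (v :* v)) refl

 cross : ℕ → ℕ → ℚ
 cross m h = Φ m * w h - w m * Φ h

 shift : ∀ m d → m ℕ.+ (2 ℕ.+ d) ≡ 2 ℕ.+ (m ℕ.+ d)
 shift m d = trans (ℕₚ.+-suc m (suc d)) (cong suc (ℕₚ.+-suc m d))

 -- After multiplication by the nonzero `C * D`, the left side is `form` at h and suc m, expanded
 -- over the neighbours of h, and the right side is `form` at suc m and h, expanded over the
 -- neighbours m and m + 2. They agree by `form-sym`.
 W-W-step : ∀ m d → W (dbl (suc m) (2 ℕ.+ d)) * W (2 ℕ.+ d) ≡ cross (suc m) (suc m ℕ.+ (2 ℕ.+ d)) →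
            W (dbl (suc m) d) * W d ≡ cross (suc m) (suc m ℕ.+ d) →
            W (dbl m (2 ℕ.+ d)) * W (2 ℕ.+ d) ≡ cross m (m ℕ.+ (2 ℕ.+ d)) →
            W (dbl (2 ℕ.+ m) d) * W d ≡ cross (2 ℕ.+ m) (2 ℕ.+ m ℕ.+ d)
 W-W-step m d K₁ K₂ K₃ = *-cancelʳ (C * D) (*-≢0 {C} {D} (W≢0 (suc (dbl m d))) (W≢0 (suc d))) (begin
   A * F * (C * D)                     ≡⟨ lem A F C D ⟩
   (A * D) * (C * F)                   ≡⟨ cong₂ _*_ AD K₂ ⟩
   cross (suc m) (suc h) * cross (suc m) h⁻ ≡⟨ neg² (Φ (suc m)) (w (suc m)) (w (suc h)) (Φ (suc h)) (w h⁻) (Φ h⁻) ⟩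
   (Φ h⁻ * w (suc m) - w h⁻ * Φ (suc m)) * (Φ (suc h) * w (suc m) - w (suc h) * Φ (suc m))
     ≡⟨ form-neighbours h⁻ (w (suc m)) (Φ (suc m)) ⟩
   form (w h) (Φ h) (w (suc m)) (Φ (suc m)) ≡⟨ form-sym _ _ _ _ ⟩
   form (w (suc m)) (Φ (suc m)) (w h) (Φ h) ≡⟨ sym (form-neighbours m (w h) (Φ h)) ⟩
   cross m h * cross (2 ℕ.+ m) h       ≡⟨ cong (_* cross (2 ℕ.+ m) h) (sym CD) ⟩
   C * D * cross (2 ℕ.+ m) h           ≡⟨ ℚₚ.*-comm (C * D) _ ⟩
   cross (2 ℕ.+ m) h * (C * D) ∎)
   where
   open ≡-Reasoning
   h⁻ = suc m ℕ.+ d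
   h = suc h⁻
   A = W (dbl (suc (suc m)) d)
   F = W d
   C = W (dbl (suc m) d)
   D = W (2 ℕ.+ d)
   AD : A * D ≡ cross (suc m) (suc h)
   AD = subst₂ (λ u v → W u * D ≡ cross (suc m) v) (dbl-shift (suc m) d) (shift (suc m) d) K₁
   CD : C * D ≡ cross m h
   CD = subst₂ (λ u v → W u * D ≡ cross m v) (dbl-shift m d) (shift m d) K₃
   lem : ∀ A F C D → A * F * (C * D) ≡ (A * D) * (C * F)
   lem = ℚ-solve 4 (λ A F C D → A :* F :* (C :* D) , (A :* D) :* (C :* F)) refl
   neg² : ∀ p q a b c d → (p * a - q * b) * (p * c - q * d) ≡ (d * q - c * p) * (b * q - a * p)
   neg² = ℚ-solve 6 (λ p q a b c d → (p :* a :- q :* b) :* (p :* c :- q :* d) , (d :* q :- c :* p) :* (b :* q :- a :* p)) refl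

 -- The addition formula ψ(h+m) ψ(h-m) = ψ(h)² ψ(m)² (x(mP) - x(hP)) with h = m + d; parametrising
 -- by the difference d keeps all indices natural.
 W-W : ∀ m d → W (dbl m d) * W d ≡ cross m (m ℕ.+ d)
 W-W zero d = lem (W d) (Φ d)
   where
   lem : ∀ W Φ → W * W ≡ 1ℚ * (W * W) - (0ℚ * 0ℚ) * Φ
   lem = ℚ-solve 2 (λ W Φ → W :* W , Κ 1ℚ :* (W :* W) :- (Κ 0ℚ :* Κ 0ℚ) :* Φ) refl
 W-W (suc zero) d = trans (W-step d) (trans (lem x (w (1 ℕ.+ d)) (Φ (1 ℕ.+ d))) (cong (λ u → 1ℚ ² * u * w (1 ℕ.+ d) - 1ℚ ² * Φ (1 ℕ.+ d)) (sym X₁)))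
   where
   lem : ∀ x w Φ → x * w - Φ ≡ 1ℚ * 1ℚ * x * w - (1ℚ * 1ℚ) * Φ
   lem = ℚ-solve 3 (λ x w Φ → x :* w :- Φ , Κ 1ℚ :* Κ 1ℚ :* x :* w :- (Κ 1ℚ :* Κ 1ℚ) :* Φ) refl
 W-W (suc (suc m)) d = W-W-step m d (W-W (suc m) (2 ℕ.+ d)) (W-W (suc m) d) (W-W m (2 ℕ.+ d))

 W-W′ : ∀ {p q m h} → p ≡ h ℕ.+ m → m ℕ.+ q ≡ h → W p * W q ≡ cross m h
 W-W′ {q = q} {m} refl refl = subst (λ u → W u * W q ≡ cross m (m ℕ.+ q)) (dbl-sum m q) (W-W m q)
   where
   dbl-sum : ∀ m d → dbl m d ≡ (m ℕ.+ d) ℕ.+ m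
   dbl-sum zero d = sym (ℕₚ.+-identityʳ d)
   dbl-sum (suc m) d = cong suc (trans (cong suc (dbl-sum m d)) (sym (ℕₚ.+-suc (m ℕ.+ d) m)))

 Φ≡ : ∀ n → Φ (suc n) ≡ x * w (suc n) - W (2 ℕ.+ n) * W n
 Φ≡ n = trans (lem (Φ (suc n)) (x * w (suc n))) (cong (λ u → x * w (suc n) - u) (sym (W-step n)))
   where
   lem : ∀ Φ z → Φ ≡ z - (z - Φ)
   lem = ℚ-solve 2 (λ Φ z → Φ , z :- (z :- Φ)) refl

 -- The case h - m = 1 of the addition formula: once each `Φ` is expressed by `Φ≡`, the terms with x
 -- cancel. `W-even` is the case h - m = 2.
 W-odd : ∀ k → W (suc (suc k ℕ.+ suc k)) ≡ W (3 ℕ.+ k) * W (suc k) * w (suc k) - W k * W (2 ℕ.+ k) * w (2 ℕ.+ k)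
 W-odd k = begin
   W (suc (suc k ℕ.+ suc k)) ≡⟨ sym (ℚₚ.*-identityʳ _) ⟩
   W (suc (suc k ℕ.+ suc k)) * W 1 ≡⟨ W-W′ {q = 1} {m = suc k} {h = 2 ℕ.+ k} refl (ℕₚ.+-comm (suc k) 1) ⟩
   cross (suc k) (2 ℕ.+ k) ≡⟨ cong₂ (λ u v → u * w (2 ℕ.+ k) - w (suc k) * v) (Φ≡ k) (Φ≡ (suc k)) ⟩
   _ ≡⟨ lem x (W k) (W (1 ℕ.+ k)) (W (2 ℕ.+ k)) (W (3 ℕ.+ k)) ⟩
   _ ∎
   where
   open ≡-Reasoning
   lem : ∀ x a b c d → (x * (b * b) - c * a) * (c * c) - (b * b) * (x * (c * c) - d * b) ≡ d * b * (b * b) - a * c * (c * c)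
   lem = ℚ-solve 5 (λ x a b c d → (x :* (b :* b) :- c :* a) :* (c :* c) :- (b :* b) :* (x :* (c :* c) :- d :* b) , d :* b :* (b :* b) :- a :* c :* (c :* c)) refl

 W-even : ∀ k → W (2 ℕ.+ k ℕ.+ (2 ℕ.+ k)) * W 2 ≡ W (2 ℕ.+ k) * (W (4 ℕ.+ k) * w (1 ℕ.+ k) - W k * w (3 ℕ.+ k))
 W-even k = begin
   W (2 ℕ.+ k ℕ.+ (2 ℕ.+ k)) * W 2 ≡⟨ W-W′ {q = 2} {m = 1 ℕ.+ k} {h = 3 ℕ.+ k} (cong (2 ℕ.+_) (ℕₚ.+-suc k (suc k))) (ℕₚ.+-comm (suc k) 2) ⟩
   cross (1 ℕ.+ k) (3 ℕ.+ k) ≡⟨ cong₂ (λ u v → u * w (3 ℕ.+ k) - w (1 ℕ.+ k) * v) (Φ≡ k) (Φ≡ (2 ℕ.+ k)) ⟩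
   _ ≡⟨ lem x (W k) (W (1 ℕ.+ k)) (W (2 ℕ.+ k)) (W (3 ℕ.+ k)) (W (4 ℕ.+ k)) ⟩
   _ ∎
   where
   open ≡-Reasoning
   lem : ∀ x a b c d e → (x * (b * b) - c * a) * (d * d) - (b * b) * (x * (d * d) - e * c) ≡ c * (e * (b * b) - a * (d * d))
   lem = ℚ-solve 6 (λ x a b c d e → (x :* (b :* b) :- c :* a) :* (d :* d) :- (b :* b) :* (x :* (d :* d) :- e :* c) , c :* (e :* (b :* b) :- a :* (d :* d))) refl

 w-curve : ∀ n → Y (suc n) ² * w (suc n) * w (suc n) * w (suc n) ≡ Φ (suc n) * Φ (suc n) * Φ (suc n) + B * w (suc n) * w (suc n) * w (suc n)
 w-curve n = trans (cong (λ u → u * w (suc n) * w (suc n) * w (suc n)) (curve n)) (lem (X (suc n)) B (w (suc n)))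
   where
   lem : ∀ X B w → (X * X * X + B) * w * w * w ≡ (w * X) * (w * X) * (w * X) + B * w * w * w
   lem = ℚ-solve 3 (λ X B w → (X :* X :* X :+ B) :* w :* w :* w , (w :* X) :* (w :* X) :* (w :* X) :+ B :* w :* w :* w) refl

 -- Multiplied by W 2, the left side is a difference of the abscissas of nP - P and nP + P, and that
 -- difference is proportional to y(nP). Comparing 2q with 2 rests on this formula.
 W-double : ∀ n → W (suc n ℕ.+ suc n) ≡ 2ℚ * Y (suc n) * w (suc n) ²
 W-double zero = trans (cong (2ℚ *_) (sym Y₁)) (lem (Y 1))
   where
   lem : ∀ Y → 2ℚ * Y ≡ 2ℚ * Y * (1ℚ * 1ℚ * (1ℚ * 1ℚ))
   lem = ℚ-solve 1 (λ Y → Κ 2ℚ :* Y , Κ 2ℚ :* Y :* (Κ 1ℚ :* Κ 1ℚ :* (Κ 1ℚ :* Κ 1ℚ))) refl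
 W-double (suc n) = *-cancelʳ (W 2) 2y≢0 (begin
   W (2 ℕ.+ n ℕ.+ (2 ℕ.+ n)) * W 2
     ≡⟨ W-W′ {q = 2} {m = 1 ℕ.+ n} {h = 3 ℕ.+ n} (cong (2 ℕ.+_) (ℕₚ.+-suc n (suc n))) (ℕₚ.+-comm (suc n) 2) ⟩
   w (1 ℕ.+ n) * X⁻ * w (3 ℕ.+ n) - w (1 ℕ.+ n) * (w (3 ℕ.+ n) * X⁺)
     ≡⟨ lem₁ (W (1 ℕ.+ n)) (W (3 ℕ.+ n)) X⁻ X⁺ ⟩
   (W (3 ℕ.+ n) * W (1 ℕ.+ n)) ² * (X⁻ - X⁺) ≡⟨ cong (λ u → u ² * (X⁻ - X⁺)) (W-rec n) ⟩
   (w (2 ℕ.+ n) * (x - X⁰)) ² * (X⁻ - X⁺) ≡⟨ lem₂ (w (2 ℕ.+ n)) x X⁰ (X⁻ - X⁺) ⟩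
   w (2 ℕ.+ n) ² * (D ² * (X⁻ - X⁺)) ≡⟨ cong (w (2 ℕ.+ n) ² *_) difference ⟩
   w (2 ℕ.+ n) ² * (4ℚ * (y * Y⁰)) ≡⟨ lem₃ (w (2 ℕ.+ n)) y Y⁰ ⟩
   2ℚ * Y⁰ * w (2 ℕ.+ n) ² * W 2 ∎)
   where
   open ≡-Reasoning
   open Neighbours n
   lem₁ : ∀ q p a b → q * q * a * (p * p) - q * q * (p * p * b) ≡ (p * q) * (p * q) * (a - b)
   lem₁ = ℚ-solve 4 (λ q p a b → q :* q :* a :* (p :* p) :- q :* q :* (p :* p :* b) , (p :* q) :* (p :* q) :* (a :- b)) refl
   lem₂ : ∀ w x X s → (w * (x - X)) * (w * (x - X)) * s ≡ w * w * ((X - x) * (X - x) * s)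
   lem₂ = ℚ-solve 4 (λ w x X s → (w :* (x :- X)) :* (w :* (x :- X)) :* s , w :* w :* ((X :- x) :* (X :- x) :* s)) refl
   lem₃ : ∀ w y Y → w * w * (4ℚ * (y * Y)) ≡ 2ℚ * Y * (w * w) * (2ℚ * y)
   lem₃ = ℚ-solve 3 (λ w y Y → w :* w :* (Κ 4ℚ :* (y :* Y)) , Κ 2ℚ :* Y :* (w :* w) :* (Κ 2ℚ :* y)) refl

 module _ (n : ℕ) where
   private
     v = w (suc n)
     Ψ = Φ (suc n)

   w-double : w (suc n ℕ.+ suc n) ≡ 4ℚ * (Ψ * Ψ * Ψ * v + B * v * v * v * v)
   w-double = begin
     w (suc n ℕ.+ suc n) ≡⟨ cong _² (W-double n) ⟩
     (2ℚ * Y (suc n) * v ²) ² ≡⟨ lem₁ (Y (suc n)) v ⟩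
     4ℚ * v * (Y (suc n) ² * v * v * v) ≡⟨ cong (4ℚ * v *_) (w-curve n) ⟩
     4ℚ * v * (Ψ * Ψ * Ψ + B * v * v * v) ≡⟨ lem₂ v Ψ B ⟩
     _ ∎
     where
     open ≡-Reasoning
     lem₁ : ∀ Y v → (2ℚ * Y * (v * v)) * (2ℚ * Y * (v * v)) ≡ 4ℚ * v * (Y * Y * v * v * v)
     lem₁ = ℚ-solve 2 (λ Y v → (Κ 2ℚ :* Y :* (v :* v)) :* (Κ 2ℚ :* Y :* (v :* v)) , Κ 4ℚ :* v :* (Y :* Y :* v :* v :* v)) refl
     lem₂ : ∀ v Ψ B → 4ℚ * v * (Ψ * Ψ * Ψ + B * v * v * v) ≡ 4ℚ * (Ψ * Ψ * Ψ * v + B * v * v * v * v)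
     lem₂ = ℚ-solve 3 (λ v Ψ B → Κ 4ℚ :* v :* (Ψ :* Ψ :* Ψ :+ B :* v :* v :* v) , Κ 4ℚ :* (Ψ :* Ψ :* Ψ :* v :+ B :* v :* v :* v :* v)) refl

   -- The product of the two neighbours of W(2n) is minus `form` on the diagonal, by `W-W` at
   -- differences 1; `Φ≡` recovers Φ(2n) from it.
   Φ-double : Φ (suc n ℕ.+ suc n) ≡ Ψ * (Ψ * Ψ * Ψ - 8ℚ * B * v * v * v)
   Φ-double = begin
     Φ (suc n ℕ.+ suc n) ≡⟨ Φ≡ (n ℕ.+ suc n) ⟩
     x * w (suc n ℕ.+ suc n) - W (suc (suc n ℕ.+ suc n)) * W (n ℕ.+ suc n)
       ≡⟨ cong (λ u → x * w (suc n ℕ.+ suc n) - u) product ⟩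
     x * w (suc n ℕ.+ suc n) - - form v Ψ v Ψ
       ≡⟨ cong (λ u → x * u - - form v Ψ v Ψ) w-double ⟩
     x * (4ℚ * (Ψ * Ψ * Ψ * v + B * v * v * v * v)) - - form v Ψ v Ψ ≡⟨ lem x B v Ψ ⟩
     _ ∎
     where
     open ≡-Reasoning
     mul-one : ∀ a → a ≡ a * 1ℚ
     mul-one = ℚ-solve 1 (λ a → a , a :* Κ 1ℚ) refl
     above : W (suc (suc n ℕ.+ suc n)) ≡ Ψ * w (2 ℕ.+ n) - v * Φ (2 ℕ.+ n)
     above = trans (mul-one _) (W-W′ {q = 1} {m = suc n} {h = 2 ℕ.+ n} refl (ℕₚ.+-comm (suc n) 1))
     below : W (n ℕ.+ suc n) ≡ Φ n * v - w n * Ψ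
     below = trans (mul-one _) (W-W′ {q = 1} {m = n} {h = suc n} (ℕₚ.+-comm n (suc n)) (ℕₚ.+-comm n 1))
     rearrange : ∀ a b c d e f → (a * b - c * d) * (e * c - f * a) ≡ - ((e * c - f * a) * (d * c - b * a))
     rearrange = ℚ-solve 6 (λ a b c d e f → (a :* b :- c :* d) :* (e :* c :- f :* a) , :- ((e :* c :- f :* a) :* (d :* c :- b :* a))) refl
     product : W (suc (suc n ℕ.+ suc n)) * W (n ℕ.+ suc n) ≡ - form v Ψ v Ψ
     product = trans (cong₂ _*_ above below)
       (trans (rearrange Ψ (w (2 ℕ.+ n)) v (Φ (2 ℕ.+ n)) (Φ n) (w n)) (cong -_ (form-neighbours n v Ψ)))
     lem : ∀ x B v Ψ → x * (4ℚ * (Ψ * Ψ * Ψ * v + B * v * v * v * v))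
       - - ((x * x * Ψ * Ψ - 4ℚ * B * v * (x * v + Ψ)) * (v * v) - (2ℚ * (x * Ψ * (x * v + Ψ) + 2ℚ * B * v * v)) * (v * Ψ)
       + (x * v - Ψ) * (x * v - Ψ) * (Ψ * Ψ)) ≡ Ψ * (Ψ * Ψ * Ψ - 8ℚ * B * v * v * v)
     lem = ℚ-solve 4 (λ x B v Ψ → x :* (Κ 4ℚ :* (Ψ :* Ψ :* Ψ :* v :+ B :* v :* v :* v :* v)) :- :- ((x :* x :* Ψ :* Ψ :- Κ 4ℚ :* B :* v :* (x :* v :+ Ψ)) :* (v :* v) :- (Κ 2ℚ :* (x :* Ψ :* (x :* v :+ Ψ) :+ Κ 2ℚ :* B :* v :* v)) :* (v :* Ψ) :+ (x :* v :- Ψ) :* (x :* v :- Ψ) :* (Ψ :* Ψ)) , Ψ :* (Ψ :* Ψ :* Ψ :- Κ 8ℚ :* B :* v :* v :* v)) refl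

 -- The binary quadratic form with roots x(nP + mP) and x(nP - mP) is fixed by its leading
 -- coefficient and its values at x and at x(nP). Each of the three is a product of W's, and `lem₁`
 -- solves for the middle coefficient.
 Φ-sum : ∀ {q′ m′ n′} → suc m′ ℕ.+ suc q′ ≡ 2 ℕ.+ n′ →
         let q = suc q′; m = suc m′; n = 2 ℕ.+ n′; p = n ℕ.+ m in
         w p * Φ q + w q * Φ p ≡ 2ℚ * (Φ n * Φ m * (Φ n * w m + Φ m * w n) + 2ℚ * B * w n * w n * w m * w m)
 Φ-sum {q′} {m′} {n′} m+q≡n = *-cancelʳ (w n * (x * w n - Φ n)) unit (begin
   (w p * Φ q + w q * Φ p) * (w n * (x * w n - Φ n))
     ≡⟨ lem₁ x (w p) (w q) (Φ p) (Φ q) (w n) (Φ n) ⟩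
   w p * w q * (x * x * w n * w n - Φ n * Φ n) - w n * w n * ((x * w p - Φ p) * (x * w q - Φ q))
     + (Φ n * w p - w n * Φ p) * (Φ n * w q - w n * Φ q)
     ≡⟨ cong₂ _+_ (cong₂ (λ u v → u * (x * x * w n * w n - Φ n * Φ n) - w n * w n * v) pq at-x) at-n ⟩
   cross m n ² * (x * x * w n * w n - Φ n * Φ n) - w n * w n * form (w n) (Φ n) (w m) (Φ m)
     + - (cross m (n ℕ.+ n) * w m)
     ≡⟨ cong₂ (λ u v → cross m n ² * (x * x * w n * w n - Φ n * Φ n) - w n * w n * form (w n) (Φ n) (w m) (Φ m)
                + - ((Φ m * u - w m * v) * w m)) (w-double (suc n′)) (Φ-double (suc n′)) ⟩
   _ ≡⟨ lem₂ x B (w n) (Φ n) (w m) (Φ m) ⟩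
   2ℚ * (Φ n * Φ m * (Φ n * w m + Φ m * w n) + 2ℚ * B * w n * w n * w m * w m) * (w n * (x * w n - Φ n)) ∎)
   where
   open ≡-Reasoning
   q = suc q′
   m = suc m′
   n = 2 ℕ.+ n′
   p = n ℕ.+ m
   sq : ∀ a b → (a * a) * (b * b) ≡ (a * b) * (a * b)
   sq = ℚ-solve 2 (λ a b → (a :* a) :* (b :* b) , (a :* b) :* (a :* b)) refl
   w≢0 : w n ≢ 0ℚ
   w≢0 = *-≢0 {W n} {W n} (W≢0 (suc n′)) (W≢0 (suc n′))
   unit : w n * (x * w n - Φ n) ≢ 0ℚ
   unit = *-≢0 w≢0 λ e → *-≢0 {W (3 ℕ.+ n′)} {W (1 ℕ.+ n′)} (W≢0 (2 ℕ.+ n′)) (W≢0 n′) (trans (W-step (suc n′)) e)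
   pq : w p * w q ≡ cross m n ²
   pq = trans (sq (W p) (W q)) (cong _² (W-W′ {p} {q} {m} {n} refl m+q≡n))
   at-x : (x * w p - Φ p) * (x * w q - Φ q) ≡ form (w n) (Φ n) (w m) (Φ m)
   at-x = begin
     (x * w p - Φ p) * (x * w q - Φ q) ≡⟨ cong₂ _*_ (sym (W-step (suc n′ ℕ.+ m))) (sym (W-step q′)) ⟩
     W (suc n ℕ.+ m) * W (suc n′ ℕ.+ m) * (W (suc q) * W q′)
       ≡⟨ swap (W (suc n ℕ.+ m)) (W (suc n′ ℕ.+ m)) (W (suc q)) (W q′) ⟩
     W (suc n′ ℕ.+ m) * W q′ * (W (suc n ℕ.+ m) * W (suc q))
       ≡⟨ cong₂ _*_ (W-W′ {_} {q′} {m} {suc n′} refl (ℕₚ.suc-injective (trans (sym (ℕₚ.+-suc m q′)) m+q≡n)))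
                    (W-W′ {_} {suc q} {m} {suc n} refl (trans (ℕₚ.+-suc m q) (cong suc m+q≡n))) ⟩
     cross m (suc n′) * cross m (suc n) ≡⟨ neg² (Φ m) (w m) (w (suc n′)) (Φ (suc n′)) (w (suc n)) (Φ (suc n)) ⟩
     _ ≡⟨ form-neighbours (suc n′) (w m) (Φ m) ⟩
     form (w n) (Φ n) (w m) (Φ m) ∎
     where
     swap : ∀ a b c d → a * b * (c * d) ≡ b * d * (a * c)
     swap = ℚ-solve 4 (λ a b c d → a :* b :* (c :* d) , b :* d :* (a :* c)) refl
     neg² : ∀ p q a b c d → (p * a - q * b) * (p * c - q * d) ≡ (b * q - a * p) * (d * q - c * p)
     neg² = ℚ-solve 6 (λ p q a b c d → (p :* a :- q :* b) :* (p :* c :- q :* d) , (b :* q :- a :* p) :* (d :* q :- c :* p)) refl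
   at-n : (Φ n * w p - w n * Φ p) * (Φ n * w q - w n * Φ q) ≡ - (cross m (n ℕ.+ n) * w m)
   at-n = begin
     cross n p * (Φ n * w q - w n * Φ q) ≡⟨ flip (cross n p) (Φ n) (w q) (w n) (Φ q) ⟩
     - (cross n p * cross q n)
       ≡⟨ cong₂ (λ u v → - (u * v)) (sym (W-W′ {_} {m} {n} {p} refl refl)) (sym (W-W′ {_} {m} {q} {n} refl (trans (ℕₚ.+-comm q m) m+q≡n))) ⟩
     - (W (p ℕ.+ n) * W m * (W (n ℕ.+ q) * W m)) ≡⟨ regroup (W (p ℕ.+ n)) (W m) (W (n ℕ.+ q)) ⟩
     - (W (p ℕ.+ n) * W (n ℕ.+ q) * w m)
       ≡⟨ cong (λ u → - (u * w m)) (W-W′ {p ℕ.+ n} {n ℕ.+ q} {m} {n ℕ.+ n} p+n m+n+q) ⟩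
     - (cross m (n ℕ.+ n) * w m) ∎
     where
     flip : ∀ c a b d e → c * (a * b - d * e) ≡ - (c * (e * d - b * a))
     flip = ℚ-solve 5 (λ c a b d e → c :* (a :* b :- d :* e) , :- (c :* (e :* d :- b :* a))) refl
     regroup : ∀ a b c → - (a * b * (c * b)) ≡ - (a * c * (b * b))
     regroup = ℚ-solve 3 (λ a b c → :- (a :* b :* (c :* b)) , :- (a :* c :* (b :* b))) refl
     p+n : p ℕ.+ n ≡ n ℕ.+ n ℕ.+ m
     p+n = trans (ℕₚ.+-assoc n m n) (trans (cong (n ℕ.+_) (ℕₚ.+-comm m n)) (sym (ℕₚ.+-assoc n n m)))
     m+n+q : m ℕ.+ (n ℕ.+ q) ≡ n ℕ.+ n
     m+n+q = trans (sym (ℕₚ.+-assoc m n q)) (trans (cong (ℕ._+ q) (ℕₚ.+-comm m n)) (trans (ℕₚ.+-assoc n m q) (cong (n ℕ.+_) m+q≡n)))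
   lem₁ : ∀ x P Q f g w Φ → (P * g + Q * f) * (w * (x * w - Φ)) ≡
     P * Q * (x * x * w * w - Φ * Φ) - w * w * ((x * P - f) * (x * Q - g)) + (Φ * P - w * f) * (Φ * Q - w * g)
   lem₁ = ℚ-solve 7 (λ x P Q f g w Φ → (P :* g :+ Q :* f) :* (w :* (x :* w :- Φ)) , P :* Q :* (x :* x :* w :* w :- Φ :* Φ) :- w :* w :* ((x :* P :- f) :* (x :* Q :- g)) :+ (Φ :* P :- w :* f) :* (Φ :* Q :- w :* g)) refl
   lem₂ : ∀ x B w Φ u v → (v * w - u * Φ) * (v * w - u * Φ) * (x * x * w * w - Φ * Φ)
     - w * w * ((x * x * Φ * Φ - 4ℚ * B * w * (x * w + Φ)) * (u * u) - (2ℚ * (x * Φ * (x * w + Φ) + 2ℚ * B * w * w)) * (u * v)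
       + (x * w - Φ) * (x * w - Φ) * (v * v))
     + - ((v * (4ℚ * (Φ * Φ * Φ * w + B * w * w * w * w)) - u * (Φ * (Φ * Φ * Φ - 8ℚ * B * w * w * w))) * u)
     ≡ 2ℚ * (Φ * v * (Φ * u + v * w) + 2ℚ * B * w * w * u * u) * (w * (x * w - Φ))
   lem₂ = ℚ-solve 6 (λ x B w Φ u v → (v :* w :- u :* Φ) :* (v :* w :- u :* Φ) :* (x :* x :* w :* w :- Φ :* Φ) :- w :* w :* ((x :* x :* Φ :* Φ :- Κ 4ℚ :* B :* w :* (x :* w :+ Φ)) :* (u :* u) :- (Κ 2ℚ :* (x :* Φ :* (x :* w :+ Φ) :+ Κ 2ℚ :* B :* w :* w)) :* (u :* v) :+ (x :* w :- Φ) :* (x :* w :- Φ) :* (v :* v)) :+ :- ((v :* (Κ 4ℚ :* (Φ :* Φ :* Φ :* w :+ B :* w :* w :* w :* w)) :- u :* (Φ :* (Φ :* Φ :* Φ :- Κ 8ℚ :* B :* w :* w :* w))) :* u) , Κ 2ℚ :* (Φ :* v :* (Φ :* u :+ v :* w) :+ Κ 2ℚ :* B :* w :* w :* u :* u) :* (w :* (x :* w :- Φ))) refl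

 w≢0 : ∀ n → w (suc n) ≢ 0ℚ
 w≢0 n = *-≢0 (W≢0 n) (W≢0 n)

 W-W-X : ∀ {p q m n} → p ≡ suc n ℕ.+ suc m → suc m ℕ.+ q ≡ suc n →
         W p * W q ≡ w (suc n) * w (suc m) * (X (suc m) - X (suc n))
 W-W-X {m = m} {n} e₁ e₂ = trans (W-W′ e₁ e₂) (lem (w (suc m)) (X (suc m)) (w (suc n)) (X (suc n)))
   where
   lem : ∀ a b c d → a * b * c - a * (c * d) ≡ c * a * (b - d)
   lem = ℚ-solve 4 (λ a b c d → a :* b :* c :- a :* (c :* d) , c :* a :* (b :- d)) refl

 X-sum : ∀ {q m n} → suc m ℕ.+ suc q ≡ 2 ℕ.+ n →
         (X (2 ℕ.+ n) - X (suc m)) ² * (X (2 ℕ.+ n ℕ.+ suc m) + X (suc q)) ≡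
         2ℚ * (X (2 ℕ.+ n) * X (suc m) * (X (2 ℕ.+ n) + X (suc m)) + 2ℚ * B)
 X-sum {q} {m} {n} e = *-cancelʳ (wn * wm * (wn * wm)) (*-≢0 nz nz) (begin
   (Xn - Xm) ² * (Xp + Xq) * (wn * wm * (wn * wm)) ≡⟨ lem₁ Xn Xm Xp Xq wn wm ⟩
   (wn * wm * (Xm - Xn)) ² * (Xp + Xq)           ≡⟨ cong (λ u → u ² * (Xp + Xq)) (sym (W-W-X {q = suc q} {m} {suc n} refl e)) ⟩
   (W p * W (suc q)) ² * (Xp + Xq)               ≡⟨ lem₂ (W p) (W (suc q)) Xp Xq ⟩
   w p * Φ (suc q) + w (suc q) * Φ p             ≡⟨ Φ-sum e ⟩
   _                                             ≡⟨ lem₃ Xn Xm wn wm B ⟩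
   2ℚ * (Xn * Xm * (Xn + Xm) + 2ℚ * B) * (wn * wm * (wn * wm)) ∎)
   where
   open ≡-Reasoning
   p = 2 ℕ.+ n ℕ.+ suc m
   wn = w (2 ℕ.+ n)
   wm = w (suc m)
   Xn = X (2 ℕ.+ n)
   Xm = X (suc m)
   Xp = X p
   Xq = X (suc q)
   nz = *-≢0 (w≢0 (suc n)) (w≢0 m)
   lem₁ : ∀ a b c d u v → (a - b) * (a - b) * (c + d) * (u * v * (u * v)) ≡ (u * v * (b - a)) * (u * v * (b - a)) * (c + d)
   lem₁ = ℚ-solve 6 (λ a b c d u v → (a :- b) :* (a :- b) :* (c :+ d) :* (u :* v :* (u :* v)) , (u :* v :* (b :- a)) :* (u :* v :* (b :- a)) :* (c :+ d)) refl
   lem₂ : ∀ a b c d → (a * b) * (a * b) * (c + d) ≡ a * a * (b * b * d) + b * b * (a * a * c)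
   lem₂ = ℚ-solve 4 (λ a b c d → (a :* b) :* (a :* b) :* (c :+ d) , a :* a :* (b :* b :* d) :+ b :* b :* (a :* a :* c)) refl
   lem₃ : ∀ a b u v B → 2ℚ * (u * a * (v * b) * (u * a * v + v * b * u) + 2ℚ * B * u * u * v * v)
     ≡ 2ℚ * (a * b * (a + b) + 2ℚ * B) * (u * v * (u * v))
   lem₃ = ℚ-solve 5 (λ a b u v B → Κ 2ℚ :* (u :* a :* (v :* b) :* (u :* a :* v :+ v :* b :* u) :+ Κ 2ℚ :* B :* u :* u :* v :* v) , Κ 2ℚ :* (a :* b :* (a :+ b) :+ Κ 2ℚ :* B) :* (u :* v :* (u :* v))) refl

 X-double : ∀ n → 4ℚ * (X (suc n) * X (suc n) * X (suc n) + B) * X (suc n ℕ.+ suc n) ≡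
                  X (suc n) * (X (suc n) * X (suc n) * X (suc n) - 8ℚ * B)
 X-double n = *-cancelʳ (w (suc n) ² ²) (*-≢0 (*-≢0 nz nz) (*-≢0 nz nz)) (begin
   4ℚ * (X¹ * X¹ * X¹ + B) * X² * v ² ²                       ≡⟨ lem₁ X¹ B X² v ⟩
   4ℚ * (v * X¹ * (v * X¹) * (v * X¹) * v + B * v * v * v * v) * X² ≡⟨ cong (_* X²) (sym (w-double n)) ⟩
   Φ (suc n ℕ.+ suc n)                                        ≡⟨ Φ-double n ⟩
   _                                                          ≡⟨ lem₂ X¹ B v ⟩
   X¹ * (X¹ * X¹ * X¹ - 8ℚ * B) * v ² ² ∎)
   where
   open ≡-Reasoning
   v = w (suc n)
   nz = w≢0 n
   X¹ = X (suc n)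
   X² = X (suc n ℕ.+ suc n)
   lem₁ : ∀ X B X² v → 4ℚ * (X * X * X + B) * X² * (v * v * (v * v)) ≡ 4ℚ * (v * X * (v * X) * (v * X) * v + B * v * v * v * v) * X²
   lem₁ = ℚ-solve 4 (λ X B X² v → Κ 4ℚ :* (X :* X :* X :+ B) :* X² :* (v :* v :* (v :* v)) , Κ 4ℚ :* (v :* X :* (v :* X) :* (v :* X) :* v :+ B :* v :* v :* v :* v) :* X²) refl
   lem₂ : ∀ X B v → v * X * (v * X * (v * X) * (v * X) - 8ℚ * B * v * v * v) ≡ X * (X * X * X - 8ℚ * B) * (v * v * (v * v))
   lem₂ = ℚ-solve 3 (λ X B v → v :* X :* (v :* X :* (v :* X) :* (v :* X) :- Κ 8ℚ :* B :* v :* v :* v) , X :* (X :* X :* X :- Κ 8ℚ :* B) :* (v :* v :* (v :* v))) refl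

 -- The addition formula for 2n and n, with the doubling formulas inserted. The first factor is ψ₃
 -- evaluated at nP, the second is ψ(n)⁹.
 W-triple : ∀ n → W (suc n ℕ.+ suc n ℕ.+ suc n) ≡
                  3ℚ * X (suc n) * (X (suc n) * X (suc n) * X (suc n) + 4ℚ * B) * (W (suc n) * w (suc n) ² ²)
 W-triple n = *-cancelʳ (W (suc n)) (W≢0 n) (begin
   W (suc n ℕ.+ suc n ℕ.+ suc n) * W (suc n) ≡⟨ W-W′ {_} {suc n} {suc n} {suc n ℕ.+ suc n} refl refl ⟩
   v * X¹ * w (suc n ℕ.+ suc n) - v * Φ (suc n ℕ.+ suc n)
     ≡⟨ cong₂ (λ a b → v * X¹ * a - v * b) (w-double n) (Φ-double n) ⟩
   _ ≡⟨ lem X¹ B (W (suc n)) ⟩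
   3ℚ * X¹ * (X¹ * X¹ * X¹ + 4ℚ * B) * (W (suc n) * v ² ²) * W (suc n) ∎)
   where
   open ≡-Reasoning
   v = w (suc n)
   X¹ = X (suc n)
   lem : ∀ X B W → let v = W * W in
     v * X * (4ℚ * (v * X * (v * X) * (v * X) * v + B * v * v * v * v)) - v * (v * X * (v * X * (v * X) * (v * X) - 8ℚ * B * v * v * v))
     ≡ 3ℚ * X * (X * X * X + 4ℚ * B) * (W * (v * v * (v * v))) * W
   lem = ℚ-solve 3 (λ X B W →
                   let v = W :* W in
     v :* X :* (Κ 4ℚ :* (v :* X :* (v :* X) :* (v :* X) :* v :+ B :* v :* v :* v :* v)) :- v :* (v :* X :* (v :* X :* (v :* X) :* (v :* X) :- Κ 8ℚ :* B :* v :* v :* v))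
     , Κ 3ℚ :* X :* (X :* X :* X :+ Κ 4ℚ :* B) :* (W :* (v :* v :* (v :* v))) :* W) refl

open DivisionPolynomials

-- Divisibility by powers of a prime

module PrimeDivisors where

 open import Data.Nat.Primality using (Prime; euclidsLemma; prime⇒nonZero; ¬prime[1])
 open import Data.Nat.Primality.Factorisation using (factorise)
 open import Data.List.Base using ([]; _∷_)
 open import Data.Nat.ListAction using (product)
 open import Data.List.Relation.Unary.All using ([]; _∷_)
 open import Data.Integer using (+_; _^_)
 open import Data.Integer.Divisibility.Signed using (_∣_; divides; ∣⇒∣ᵤ; ∣ᵤ⇒∣)

 infix 4 _∤_
 _∤_ : ℤ → ℤ → Set
 i ∤ j = ¬ (i ∣ j)

 module _ {p : ℕ} (pp : Prime p) where
   private π = + p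

   π≢0 : π ≢ 0ℤ
   π≢0 e = ℕ.≢-nonZero⁻¹ p {{prime⇒nonZero pp}} (ℤₚ.+-injective e)

   ∣-* : ∀ i {j} → π ∣ i · j → π ∣ i ⊎ π ∣ j
   ∣-* i {j} h with euclidsLemma ℤ.∣ i ∣ ℤ.∣ j ∣ pp (subst (p ℕD.∣_) (ℤₚ.abs-* i j) (∣⇒∣ᵤ h))
   ... | inj₁ q = inj₁ (∣ᵤ⇒∣ q)
   ... | inj₂ q = inj₂ (∣ᵤ⇒∣ q)

   ∤-* : ∀ {i j} → π ∤ i → π ∤ j → π ∤ i · j
   ∤-* {i} hi hj h with ∣-* i h
   ... | inj₁ q = hi q
   ... | inj₂ q = hj q

   ∤-1 : π ∤ 1ℤ
   ∤-1 h = ¬prime[1] (subst Prime (ℕD.∣1⇒≡1 (∣⇒∣ᵤ h)) pp)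

   ∤-^ : ∀ {i} n → π ∤ i → π ∤ i ^ n
   ∤-^ zero    hi = ∤-1
   ∤-^ (suc n) hi = ∤-* hi (∤-^ n hi)

   ∣-cancel : ∀ k {i u} → π ∤ u → π ^ k ∣ i · u → π ^ k ∣ i
   ∣-cancel zero {i} hu _ = divides i (sym (ℤₚ.*-identityʳ i))
   ∣-cancel (suc k) {i} {u} hu h with ∣-* i (ℤD.∣-trans (ℤD.∣m⇒∣m*n (π ^ k) ℤD.∣-refl) h)
   ... | inj₂ q = ⊥-elim (hu q)
   ... | inj₁ (divides j refl) = subst (π ^ suc k ∣_) (ℤₚ.*-comm π j)
           (ℤD.*-monoʳ-∣ π (∣-cancel k hu (ℤD.*-cancelˡ-∣ π {{ℤ.≢-nonZero π≢0}} (subst (π ^ suc k ∣_) (lem j π u) h))))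
     where
     lem : ∀ j π u → j · π · u ≡ π · (j · u)
     lem = ℤ-solve 3 (λ j π u → j :* π :* u , π :* (j :* u)) refl

   -- 2k + 1, and `triple-suc k` is 3k + 1: the least exponents of p in a square or a cube that
   -- force p^(k+1) into the root.
   double-suc : ℕ → ℕ
   double-suc zero    = 1
   double-suc (suc k) = 2 ℕ.+ double-suc k

   triple-suc : ℕ → ℕ
   triple-suc zero    = 1
   triple-suc (suc k) = 3 ℕ.+ triple-suc k

   ∣-√ : ∀ k {i} → π ^ double-suc k ∣ i · i → π ^ suc k ∣ i
   ∣-√ zero {i} h with ∣-* i (subst (_∣ i · i) (ℤₚ.*-identityʳ π) h)
   ... | inj₁ q = subst (_∣ i) (sym (ℤₚ.*-identityʳ π)) q
   ... | inj₂ q = subst (_∣ i) (sym (ℤₚ.*-identityʳ π)) q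
   ∣-√ (suc k) {i} h with ∣-√ zero {i} (ℤD.∣-trans (subst (_∣ π ^ double-suc (suc k)) (sym (ℤₚ.*-identityʳ π)) (ℤD.∣m⇒∣m*n _ ℤD.∣-refl)) h)
   ... | divides j refl = subst (π ^ suc (suc k) ∣_) (lem₁ π j)
           (ℤD.*-monoʳ-∣ π (∣-√ k (ℤD.*-cancelˡ-∣ π {{nz}} (ℤD.*-cancelˡ-∣ π {{nz}} (subst (π ^ double-suc (suc k) ∣_) (lem₂ π j) h)))))
     where
     nz = ℤ.≢-nonZero π≢0
     lem₁ : ∀ π j → π · j ≡ j · (π · 1ℤ)
     lem₁ = ℤ-solve 2 (λ π j → π :* j , j :* (π :* Κ 1ℤ)) refl
     lem₂ : ∀ π j → j · (π · 1ℤ) · (j · (π · 1ℤ)) ≡ π · (π · (j · j))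
     lem₂ = ℤ-solve 2 (λ π j → j :* (π :* Κ 1ℤ) :* (j :* (π :* Κ 1ℤ)) , π :* (π :* (j :* j))) refl

   ∣-∛ : ∀ k {i} → π ^ triple-suc k ∣ i ³ℤ → π ^ suc k ∣ i
   ∣-∛ zero {i} h with ∣-* (i · i) (subst (_∣ i ³ℤ) (ℤₚ.*-identityʳ π) h)
   ... | inj₂ q = subst (_∣ i) (sym (ℤₚ.*-identityʳ π)) q
   ... | inj₁ q with ∣-* i q
   ...   | inj₁ q′ = subst (_∣ i) (sym (ℤₚ.*-identityʳ π)) q′
   ...   | inj₂ q′ = subst (_∣ i) (sym (ℤₚ.*-identityʳ π)) q′
   ∣-∛ (suc k) {i} h with ∣-∛ zero {i} (ℤD.∣-trans (subst (_∣ π ^ triple-suc (suc k)) (sym (ℤₚ.*-identityʳ π)) (ℤD.∣m⇒∣m*n _ ℤD.∣-refl)) h)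
   ... | divides j refl = subst (π ^ suc (suc k) ∣_) (lem₁ π j)
           (ℤD.*-monoʳ-∣ π (∣-∛ k (ℤD.*-cancelˡ-∣ π {{nz}} (ℤD.*-cancelˡ-∣ π {{nz}} (ℤD.*-cancelˡ-∣ π {{nz}} (subst (π ^ triple-suc (suc k) ∣_) (lem₂ π j) h))))))
     where
     nz = ℤ.≢-nonZero π≢0
     lem₁ : ∀ π j → π · j ≡ j · (π · 1ℤ)
     lem₁ = ℤ-solve 2 (λ π j → π :* j , j :* (π :* Κ 1ℤ)) refl
     lem₂ : ∀ π j → (j · (π · 1ℤ)) · (j · (π · 1ℤ)) · (j · (π · 1ℤ)) ≡ π · (π · (π · (j · j · j)))
     lem₂ = ℤ-solve 2 (λ π j → (j :* (π :* Κ 1ℤ)) :* (j :* (π :* Κ 1ℤ)) :* (j :* (π :* Κ 1ℤ)) , π :* (π :* (π :* (j :* j :* j)))) refl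

   ∣-sub : ∀ {i j} → π ∣ i → π ∤ j → π ∤ i ℤ.- j
   ∣-sub {i} {j} hi hj h = hj (subst (π ∣_) (lem i j) (ℤD.∣m∣n⇒∣m-n hi h))
     where
     lem : ∀ i j → i ℤ.- (i ℤ.- j) ≡ j
     lem = ℤ-solve 2 (λ i j → i :- (i :- j) , j) refl

   sub-∣ : ∀ {i j} → π ∤ i → π ∣ j → π ∤ i ℤ.- j
   sub-∣ {i} {j} hi hj h = hi (subst (π ∣_) (lem i j) (ℤD.∣m∣n⇒∣m+n h hj))
     where
     lem : ∀ i j → i ℤ.- j ∔ j ≡ i
     lem = ℤ-solve 2 (λ i j → i :- j :+ j , i) refl

 ∣-^-mono : ∀ {i j} n → i ∣ j → i ^ n ∣ j ^ n
 ∣-^-mono zero    h = ℤD.∣-refl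
 ∣-^-mono {i} {j} (suc n) h = ℤD.∣-trans (ℤD.*-monoʳ-∣ i (∣-^-mono n h)) (ℤD.*-monoˡ-∣ (j ^ n) h)

 *-mono-∣ : ∀ {i j k l} → i ∣ j → k ∣ l → i · k ∣ j · l
 *-mono-∣ {i} {j} {k} {l} h h′ = ℤD.∣-trans (ℤD.*-monoʳ-∣ i h′) (ℤD.*-monoˡ-∣ l h)

 no-prime⇒unit : ∀ {i} → i ≢ 0ℤ → (∀ {p} → Prime p → + p ∤ i) → ℤ.∣ i ∣ ≡ 1
 no-prime⇒unit {i} i≢0 h with factorise ℤ.∣ i ∣ {{ℤ.≢-nonZero i≢0}}
 ... | record { factors = [] ; isFactorisation = e } = e
 ... | record { factors = p ∷ ps ; isFactorisation = e ; factorsPrime = pp ∷ _ } =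
   ⊥-elim (h pp (∣ᵤ⇒∣ (ℕD.divides (product ps) (trans e (ℕₚ.*-comm p (product ps))))))

 abs-^ : ∀ i n → ℤ.∣ i ^ n ∣ ≡ ℤ.∣ i ∣ ℕ.^ n
 abs-^ i zero    = refl
 abs-^ i (suc n) = trans (ℤₚ.abs-* i (i ^ n)) (cong (ℤ.∣ i ∣ ℕ.*_) (abs-^ i n))

 -- Sixth-power freeness acts through these fields. `b-bad` and `T-bad` deny the divisibilities that
 -- a prime p of v n would cause in the cubed integrality relation: p⁶ comes from v(n)⁶, the further
 -- p² of the exponent 8 from b², and T² is a factor of the left side there.
 record LocalParams {x y : ℤ} (Pm : Params x y) : Set where
   open Params Pm
   field
     T∤b   : ∀ {p} → Prime p → + p ∣ T → + p ∤ b
     b∤c   : ∀ {p} → Prime p → + p ∣ b → + p ∤ T → + p ∤ c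
     Tb∤G  : ∀ {p} → Prime p → + p ∤ T → + p ∤ b → + p ∤ G
     b-bad : ∀ {p} → Prime p → + p ∣ b → + p ∤ T → ∀ {u} → + p ∤ u → (+ p) ^ 8 ∤ a ²ℤ · u
     T-bad : ∀ {p} → Prime p → + p ∣ T → ∀ {u} → + p ∤ u → (+ p) ^ 6 · T ²ℤ ∤ a ²ℤ · u

-- The integral sequence v and its recursions

module Normalised {B x y : ℤ} (B≡ : B ≡ y ²ℤ ℤ.- x ³ℤ) (M : Multiples (ι B) (ι x) (ι y)) (Pm : Params x y) where
 open Indices
 open import Data.Integer using (+_; _^_)

 open import Data.Rational using (_+_; _-_; _*_; -_)

 open EllipticDivisibility M public
 open Params Pm public
 open Scale a d T b G a⁴ d³ public

 ι-³ : ∀ i j → ι (i · j ³ℤ) ≡ ι i * ι j * (ι j * ι j)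
 ι-³ i j = trans (ι-* i (j ³ℤ)) (trans (cong (ι i *_) (trans (ι-* (j · j) j) (cong (_* ι j) (ι-* j j)))) (lem (ι i) (ι j)))
   where
   lem : ∀ i j → i * (j * j * j) ≡ i * j * (j * j)
   lem = ℚ-solve 2 (λ i j → i :* (j :* j :* j) , i :* j :* (j :* j)) refl

 ι-² : ∀ i j k → ι (i · j · k ²ℤ) ≡ ι i * (ι j * (ι k * ι k))
 ι-² i j k = trans (ι-* (i · j) (k ²ℤ)) (trans (cong₂ _*_ (ι-* i j) (ι-* k k)) (ℚₚ.*-assoc (ι i) (ι j) (ι k * ι k)))

 W₂≡ : W 2 ≡ ι a
 W₂≡ = sym (ι-* (+ 2) y)

 a≢0 : a ≢ 0ℤ
 a≢0 e = 2y≢0 (trans W₂≡ (cong ι e))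

 w₂≡ : w 2 ≡ ι (+ 4 · y ²ℤ)
 w₂≡ = trans (cong₂ _*_ W₂≡ W₂≡) (trans (sym (ι-* a a)) (cong ι (lem y)))
   where
   lem : ∀ y → (+ 2 · y) · (+ 2 · y) ≡ + 4 · (y · y)
   lem = ℤ-solve 1 (λ y → (Κ (+ 2) :* y) :* (Κ (+ 2) :* y) , Κ (+ 4) :* (y :* y)) refl

 Φ₂≡ : Φ 2 ≡ ι (x · (x ³ℤ ℤ.- + 8 · B))
 Φ₂≡ = trans (lem (ι y) (X 2)) (trans X₂-double (sym (trans (ι-* x (x ³ℤ ℤ.- + 8 · B)) (cong (ι x *_)
         (trans (ι-- (x ³ℤ) (+ 8 · B)) (cong₂ _-_ (trans (ι-* (x · x) x) (cong (_* ι x) (ι-* x x))) (ι-* (+ 8) B)))))))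
   where
   lem : ∀ y X → (2ℚ * y) * (2ℚ * y) * X ≡ 4ℚ * (y * y) * X
   lem = ℚ-solve 2 (λ y X → (Κ 2ℚ :* y) :* (Κ 2ℚ :* y) :* X , Κ 4ℚ :* (y :* y) :* X) refl

 W₃≡ : W 3 ≡ ι d
 W₃≡ = trans (mul-one (W 3)) (trans (W-step 1) (trans (cong₂ (λ u v → ι x * u - v) w₂≡ Φ₂≡)
         (trans (cong (_- ι (x · (x ³ℤ ℤ.- + 8 · B))) (sym (ι-* x (+ 4 · y ²ℤ))))
         (trans (sym (ι-- (x · (+ 4 · y ²ℤ)) (x · (x ³ℤ ℤ.- + 8 · B))))
                (cong ι (trans (cong (λ B → x · (+ 4 · y ²ℤ) ℤ.- x · (x ³ℤ ℤ.- + 8 · B)) B≡) (lem x y)))))))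
   where
   mul-one : ∀ u → u ≡ u * 1ℚ
   mul-one = ℚ-solve 1 (λ u → u , u :* Κ 1ℚ) refl
   lem : ∀ x y → x · (+ 4 · (y · y)) ℤ.- x · (x · x · x ℤ.- + 8 · (y · y ℤ.- x · x · x)) ≡
         + 3 · x · (+ 4 · (y · y) ℤ.- + 3 · (x · x · x))
   lem = ℤ-solve 2 (λ x y → x :* (Κ (+ 4) :* (y :* y)) :- x :* (x :* x :* x :- Κ (+ 8) :* (y :* y :- x :* x :* x)) , Κ (+ 3) :* x :* (Κ (+ 4) :* (y :* y) :- Κ (+ 3) :* (x :* x :* x))) refl

 d≢0 : d ≢ 0ℤ
 d≢0 e = W≢0 2 (trans W₃≡ (cong ι e))

 module Fourth where
   X₂ Q A₁ A₂ bt : ℤ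
   X₂ = x · (x ³ℤ ℤ.- + 8 · B)
   Q = + 4 · y ²ℤ
   A₁ = x · X₂ · (x · Q ∔ X₂)
   A₂ = + 2 · B · Q · Q
   bt = + 2 · (A₁ ∔ A₂)
   A₁≡ : ι A₁ ≡ ι x * ι X₂ * (ι x * ι Q + ι X₂)
   A₁≡ = trans (ι-* (x · X₂) (x · Q ∔ X₂)) (cong₂ _*_ (ι-* x X₂) (trans (ι-+ (x · Q) X₂) (cong (_+ ι X₂) (ι-* x Q))))
   A₂≡ : ι A₂ ≡ 2ℚ * ι B * ι Q * ι Q
   A₂≡ = trans (ι-* (+ 2 · B · Q) Q) (cong (_* ι Q) (trans (ι-* (+ 2 · B) Q) (cong (_* ι Q) (ι-* (+ 2) B))))
   β₂≡ : β (w 2) (Φ 2) ≡ ι bt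
   β₂≡ = trans (cong₂ β w₂≡ Φ₂≡) (sym (trans (ι-* (+ 2) (A₁ ∔ A₂)) (cong (2ℚ *_) (trans (ι-+ A₁ A₂) (cong₂ _+_ A₁≡ A₂≡)))))
   -- `neighbours-β` at the index 2 yields Φ 3, since w 1 and Φ 1 are known; the computation thus
   -- stays with the coordinates of 2P.
   W₄W₂ : W 4 * W 2 ≡ ι (ψ₄ x y) * ι a
   W₄W₂ = begin
     W 4 * W 2 ≡⟨ W-step 2 ⟩
     ι x * w 3 - Φ 3 ≡⟨ lem₁ (ι x * w 3) (Φ 3) ⟩
     ι x * w 3 + ι x * w 3 - (Φ 3 * 1ℚ ² + ι x * w 3)
       ≡⟨ cong (λ u → ι x * w 3 + ι x * w 3 - (Φ 3 * 1ℚ ² + u * w 3)) (trans (one (ι x)) (cong (1ℚ ² *_) (sym X₁))) ⟩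
     ι x * w 3 + ι x * w 3 - (Φ 3 * w 1 + Φ 1 * w 3) ≡⟨ cong (λ u → ι x * w 3 + ι x * w 3 - u) (trans (neighbours-β 1) β₂≡) ⟩
     ι x * w 3 + ι x * w 3 - ι bt ≡⟨ cong (λ u → ι x * u + ι x * u - ι bt) (trans (cong₂ _*_ W₃≡ W₃≡) (sym (ι-* d d))) ⟩
     ι x * ι (d · d) + ι x * ι (d · d) - ι bt ≡⟨ cong (λ u → u + u - ι bt) (sym (ι-* x (d · d))) ⟩
     ι (x · (d · d)) + ι (x · (d · d)) - ι bt
       ≡⟨ trans (cong (_- ι bt) (sym (ι-+ (x · (d · d)) (x · (d · d))))) (sym (ι-- (x · (d · d) ∔ x · (d · d)) bt)) ⟩
     ι (x · (d · d) ∔ x · (d · d) ℤ.- bt) ≡⟨ cong ι (trans (cong body B≡) (lem₂ x y)) ⟩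
     ι (ψ₄ x y · a) ≡⟨ ι-* (ψ₄ x y) a ⟩
     ι (ψ₄ x y) * ι a ∎
     where
     open ≡-Reasoning
     one : ∀ u → u ≡ 1ℚ * 1ℚ * u
     one = ℚ-solve 1 (λ u → u , Κ 1ℚ :* Κ 1ℚ :* u) refl
     lem₁ : ∀ p q → p - q ≡ p + p - (q * (1ℚ * 1ℚ) + p)
     lem₁ = ℚ-solve 2 (λ p q → p :- q , p :+ p :- (q :* (Κ 1ℚ :* Κ 1ℚ) :+ p)) refl
     body : ℤ → ℤ
     body B = let X₂ = x · (x ³ℤ ℤ.- + 8 · B) in x · (d · d) ∔ x · (d · d) ℤ.-
       + 2 · (x · X₂ · (x · (+ 4 · y ²ℤ) ∔ X₂) ∔ + 2 · B · (+ 4 · y ²ℤ) · (+ 4 · y ²ℤ))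
     lem₂ : ∀ x y →
       let B = y · y ℤ.- x · x · x
           X₂ = x · (x · x · x ℤ.- + 8 · B)
           d = + 3 · x · (+ 4 · (y · y) ℤ.- + 3 · (x · x · x)) in
       x · (d · d) ∔ x · (d · d) ℤ.-
       + 2 · (x · X₂ · (x · (+ 4 · (y · y)) ∔ X₂) ∔ + 2 · B · (+ 4 · (y · y)) · (+ 4 · (y · y)))
       ≡ + 4 · y · (+ 36 · (x · x · x) · (y · y) ℤ.- + 27 · (x · x · x) · (x · x · x) ℤ.- + 8 · (y · y) · (y · y)) · (+ 2 · y)
     lem₂ = ℤ-solve 2 (λ x y →
       let B = y :* y :- x :* x :* x
           X₂ = x :* (x :* x :* x :- Κ (+ 8) :* B)
           d = Κ (+ 3) :* x :* (Κ (+ 4) :* (y :* y) :- Κ (+ 3) :* (x :* x :* x)) in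
       x :* (d :* d) :+ x :* (d :* d) :-
       Κ (+ 2) :* (x :* X₂ :* (x :* (Κ (+ 4) :* (y :* y)) :+ X₂) :+ Κ (+ 2) :* B :* (Κ (+ 4) :* (y :* y)) :* (Κ (+ 4) :* (y :* y)))
       , Κ (+ 4) :* y :* (Κ (+ 36) :* (x :* x :* x) :* (y :* y) :- Κ (+ 27) :* (x :* x :* x) :* (x :* x :* x) :- Κ (+ 8) :* (y :* y) :* (y :* y)) :* (Κ (+ 2) :* y)) refl

 W₄≡ : W 4 ≡ ι (a · c · G)
 W₄≡ = trans (*-cancelʳ (W 2) 2y≢0 (trans Fourth.W₄W₂ (cong (ι (ψ₄ x y) *_) (sym W₂≡)))) (cong ι ψ₄≡)

 G≢0 : G ≢ 0ℤ
 G≢0 e = ℤ-*-≢0 (ℤ-*-≢0 a≢0 a≢0) (ℤ-*-≢0 a≢0 a≢0) (trans a⁴ (trans (cong (T ·_) e) (ℤₚ.*-zeroʳ T)))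

 T≢0 : T ≢ 0ℤ
 T≢0 e = ℤ-*-≢0 (ℤ-*-≢0 a≢0 a≢0) (ℤ-*-≢0 a≢0 a≢0) (trans a⁴ (trans (cong (_· G) e) (ℤₚ.*-zeroˡ G)))

 b≢0 : b ≢ 0ℤ
 b≢0 e = ℤ-*-≢0 (ℤ-*-≢0 d≢0 d≢0) d≢0 (trans d³ (trans (cong (_· (G · G)) e) (ℤₚ.*-zeroˡ (G · G))))

 σ≢0 : ∀ n → σ n ≢ 0ℤ
 σ≢0 n = ℤ-*-≢0 (ℤ-*-≢0 (ℤ-^-≢0 (τ n) a≢0) (ℤ-^-≢0 (δ n) d≢0)) (ℤ-^-≢0 (e n) G≢0)

 -- `W-odd` divided by `σ`, and `evenPart` is `W-even` divided by `σ`. Only nonnegative powers of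
 -- `T` and `b` remain, hence v stays integral. Each parity or residue class mod 3 of the index
 -- decides which product carries `T` or `b`.
 oddPart : ℕ → ℤ → ℤ → ℤ → ℤ → ℤ
 oddPart k v₁ v₂ v₃ v₄ = T ^ τ (2 ℕ.+ k) · b ^ δ (2 ℕ.+ k) · (v₄ · v₂ ³ℤ)
                   ℤ.- T ^ τ (3 ℕ.+ k) · b ^ δ (3 ℕ.+ k) · (v₁ · v₃ ³ℤ)

 evenPart : ℕ → ℤ → ℤ → ℤ → ℤ → ℤ → ℤ
 evenPart k v₁ v₂ v₃ v₄ v₅ = b ^ δ (5 ℕ.+ k) · (v₃ · v₅ · v₂ ²ℤ)
                       ℤ.- b ^ δ (4 ℕ.+ k) · (v₃ · v₁ · v₄ ²ℤ)

 Scaled : ℕ → ℤ → Set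
 Scaled n v = W n ≡ ι (v · σ n)

 scaled-odd : ∀ k v₁ v₂ v₃ v₄ → Scaled (1 ℕ.+ k) v₁ → Scaled (2 ℕ.+ k) v₂ → Scaled (3 ℕ.+ k) v₃ → Scaled (4 ℕ.+ k) v₄ →
              Scaled (suc (dbl k 4)) (oddPart k v₁ v₂ v₃ v₄)
 scaled-odd k v₁ v₂ v₃ v₄ h₁ h₂ h₃ h₄ = begin
   W (suc (dbl k 4)) ≡⟨ cong (λ n → W (suc n)) idx ⟩
   W (suc (2 ℕ.+ k ℕ.+ (2 ℕ.+ k))) ≡⟨ W-odd (suc k) ⟩
   W (4 ℕ.+ k) * W (2 ℕ.+ k) * w (2 ℕ.+ k) - W (1 ℕ.+ k) * W (3 ℕ.+ k) * w (3 ℕ.+ k)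
     ≡⟨ cong₂ _-_ (cong₂ (λ p q → p * q * (q * q)) h₄ h₂) (cong₂ (λ p q → p * q * (q * q)) h₁ h₃) ⟩
   _ ≡⟨ sym (trans (ι-- (v₄ · s₄ · (v₂ · s₂) ³ℤ) (v₁ · s₁ · (v₃ · s₃) ³ℤ)) (cong₂ _-_ (ι-³ (v₄ · s₄) (v₂ · s₂)) (ι-³ (v₁ · s₁) (v₃ · s₃)))) ⟩
   ι (v₄ · s₄ · (v₂ · s₂) ³ℤ ℤ.- v₁ · s₁ · (v₃ · s₃) ³ℤ) ≡⟨ cong ι (lem₁ v₁ v₂ v₃ v₄ s₁ s₂ s₃ s₄) ⟩
   ι (v₄ · v₂ ³ℤ · (s₄ · s₂ ³ℤ) ℤ.- v₁ · v₃ ³ℤ · (s₁ · s₃ ³ℤ))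
     ≡⟨ cong ι (cong₂ (λ p q → v₄ · v₂ ³ℤ · p ℤ.- v₁ · v₃ ³ℤ · q) (σ-odd₁ k) (σ-odd₂ k)) ⟩
   _ ≡⟨ cong ι (lem₂ (v₄ · v₂ ³ℤ) (T ^ τ (2 ℕ.+ k) · b ^ δ (2 ℕ.+ k)) (v₁ · v₃ ³ℤ) (T ^ τ (3 ℕ.+ k) · b ^ δ (3 ℕ.+ k)) (σ (suc (dbl k 4)))) ⟩
   ι (oddPart k v₁ v₂ v₃ v₄ · σ (suc (dbl k 4))) ∎
   where
   open ≡-Reasoning
   s₁ = σ (1 ℕ.+ k)
   s₂ = σ (2 ℕ.+ k)
   s₃ = σ (3 ℕ.+ k)
   s₄ = σ (4 ℕ.+ k)
   idx : dbl k 4 ≡ 2 ℕ.+ k ℕ.+ (2 ℕ.+ k)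
   idx = trans (dbl≡ k 4) (trans (ℕₚ.+-comm (k ℕ.+ k) 4) (cong (2 ℕ.+_) (sym (trans (ℕₚ.+-suc k (suc k)) (cong suc (ℕₚ.+-suc k k))))))
   lem₁ : ∀ v₁ v₂ v₃ v₄ s₁ s₂ s₃ s₄ → v₄ · s₄ · (v₂ · s₂ · (v₂ · s₂) · (v₂ · s₂)) ℤ.- v₁ · s₁ · (v₃ · s₃ · (v₃ · s₃) · (v₃ · s₃))
     ≡ v₄ · (v₂ · v₂ · v₂) · (s₄ · (s₂ · s₂ · s₂)) ℤ.- v₁ · (v₃ · v₃ · v₃) · (s₁ · (s₃ · s₃ · s₃))
   lem₁ = ℤ-solve 8 (λ v₁ v₂ v₃ v₄ s₁ s₂ s₃ s₄ → v₄ :* s₄ :* (v₂ :* s₂ :* (v₂ :* s₂) :* (v₂ :* s₂)) :- v₁ :* s₁ :* (v₃ :* s₃ :* (v₃ :* s₃) :* (v₃ :* s₃)) , v₄ :* (v₂ :* v₂ :* v₂) :* (s₄ :* (s₂ :* s₂ :* s₂)) :- v₁ :* (v₃ :* v₃ :* v₃) :* (s₁ :* (s₃ :* s₃ :* s₃))) refl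
   lem₂ : ∀ p q r s t → p · (q · t) ℤ.- r · (s · t) ≡ (q · p ℤ.- s · r) · t
   lem₂ = ℤ-solve 5 (λ p q r s t → p :* (q :* t) :- r :* (s :* t) , (q :* p :- s :* r) :* t) refl

 scaled-even : ∀ k v₁ v₂ v₃ v₄ v₅ → Scaled (1 ℕ.+ k) v₁ → Scaled (2 ℕ.+ k) v₂ → Scaled (3 ℕ.+ k) v₃ → Scaled (4 ℕ.+ k) v₄ →
               Scaled (5 ℕ.+ k) v₅ → Scaled (suc (dbl k 5)) (evenPart k v₁ v₂ v₃ v₄ v₅)
 scaled-even k v₁ v₂ v₃ v₄ v₅ h₁ h₂ h₃ h₄ h₅ = *-cancelʳ (W 2) 2y≢0 (begin
   W (suc (dbl k 5)) * W 2 ≡⟨ cong (λ n → W (suc n) * W 2) idx ⟩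
   W (3 ℕ.+ k ℕ.+ (3 ℕ.+ k)) * W 2 ≡⟨ W-even (suc k) ⟩
   W (3 ℕ.+ k) * (W (5 ℕ.+ k) * w (2 ℕ.+ k) - W (1 ℕ.+ k) * w (4 ℕ.+ k))
     ≡⟨ trans (lem₀ (W (3 ℕ.+ k)) (W (5 ℕ.+ k)) (w (2 ℕ.+ k)) (W (1 ℕ.+ k)) (w (4 ℕ.+ k)))
          (cong₂ _-_ (cong₂ _*_ h₃ (cong₂ _*_ h₅ (cong₂ _*_ h₂ h₂))) (cong₂ _*_ h₃ (cong₂ _*_ h₁ (cong₂ _*_ h₄ h₄)))) ⟩
   _ ≡⟨ sym (trans (ι-- (v₃ · s₃ · (v₅ · s₅) · (v₂ · s₂) ²ℤ) (v₃ · s₃ · (v₁ · s₁) · (v₄ · s₄) ²ℤ)) (cong₂ _-_ (ι-² (v₃ · s₃) (v₅ · s₅) (v₂ · s₂)) (ι-² (v₃ · s₃) (v₁ · s₁) (v₄ · s₄)))) ⟩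
   ι (v₃ · s₃ · (v₅ · s₅) · (v₂ · s₂) ²ℤ ℤ.- v₃ · s₃ · (v₁ · s₁) · (v₄ · s₄) ²ℤ)
     ≡⟨ cong ι (lem₁ v₁ v₂ v₃ v₄ v₅ s₁ s₂ s₃ s₄ s₅) ⟩
   ι (v₃ · v₅ · v₂ ²ℤ · (s₃ · s₅ · s₂ ²ℤ) ℤ.- v₃ · v₁ · v₄ ²ℤ · (s₃ · s₁ · s₄ ²ℤ))
     ≡⟨ cong ι (cong₂ (λ p q → v₃ · v₅ · v₂ ²ℤ · p ℤ.- v₃ · v₁ · v₄ ²ℤ · q) (σ-even₁ k) (σ-even₂ k)) ⟩
   _ ≡⟨ cong ι (lem₂ (v₃ · v₅ · v₂ ²ℤ) (b ^ δ (5 ℕ.+ k)) (v₃ · v₁ · v₄ ²ℤ) (b ^ δ (4 ℕ.+ k)) (σ (suc (dbl k 5))) a) ⟩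
   ι (evenPart k v₁ v₂ v₃ v₄ v₅ · σ (suc (dbl k 5)) · a) ≡⟨ trans (ι-* (evenPart k v₁ v₂ v₃ v₄ v₅ · σ (suc (dbl k 5))) a) (cong (ι (evenPart k v₁ v₂ v₃ v₄ v₅ · σ (suc (dbl k 5))) *_) (sym W₂≡)) ⟩
   ι (evenPart k v₁ v₂ v₃ v₄ v₅ · σ (suc (dbl k 5))) * W 2 ∎)
   where
   open ≡-Reasoning
   s₁ = σ (1 ℕ.+ k)
   s₂ = σ (2 ℕ.+ k)
   s₃ = σ (3 ℕ.+ k)
   s₄ = σ (4 ℕ.+ k)
   s₅ = σ (5 ℕ.+ k)
   idx : dbl k 5 ≡ 2 ℕ.+ k ℕ.+ (3 ℕ.+ k)
   idx = trans (dbl≡ k 5) (trans (ℕₚ.+-comm (k ℕ.+ k) 5) (cong (2 ℕ.+_) (sym (trans (ℕₚ.+-suc k (2 ℕ.+ k)) (cong suc (trans (ℕₚ.+-suc k (suc k)) (cong suc (ℕₚ.+-suc k k))))))))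
   lem₀ : ∀ p q r s t → p * (q * r - s * t) ≡ p * (q * r) - p * (s * t)
   lem₀ = ℚ-solve 5 (λ p q r s t → p :* (q :* r :- s :* t) , p :* (q :* r) :- p :* (s :* t)) refl
   lem₁ : ∀ v₁ v₂ v₃ v₄ v₅ s₁ s₂ s₃ s₄ s₅ → v₃ · s₃ · (v₅ · s₅) · (v₂ · s₂ · (v₂ · s₂)) ℤ.- v₃ · s₃ · (v₁ · s₁) · (v₄ · s₄ · (v₄ · s₄))
     ≡ v₃ · v₅ · (v₂ · v₂) · (s₃ · s₅ · (s₂ · s₂)) ℤ.- v₃ · v₁ · (v₄ · v₄) · (s₃ · s₁ · (s₄ · s₄))
   lem₁ = ℤ-solve 10 (λ v₁ v₂ v₃ v₄ v₅ s₁ s₂ s₃ s₄ s₅ → v₃ :* s₃ :* (v₅ :* s₅) :* (v₂ :* s₂ :* (v₂ :* s₂)) :- v₃ :* s₃ :* (v₁ :* s₁) :* (v₄ :* s₄ :* (v₄ :* s₄)) , v₃ :* v₅ :* (v₂ :* v₂) :* (s₃ :* s₅ :* (s₂ :* s₂)) :- v₃ :* v₁ :* (v₄ :* v₄) :* (s₃ :* s₁ :* (s₄ :* s₄))) refl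
   lem₂ : ∀ p q r s t a → p · (q · (t · a)) ℤ.- r · (s · (t · a)) ≡ (q · p ℤ.- s · r) · t · a
   lem₂ = ℤ-solve 6 (λ p q r s t a → p :* (q :* (t :* a)) :- r :* (s :* (t :* a)) , (q :* p :- s :* r) :* t :* a) refl

 scaled₁ : Scaled 1 1ℤ
 scaled₁ = refl
 scaled₂ : Scaled 2 1ℤ
 scaled₂ = trans W₂≡ (cong ι (lem a))
   where
   lem : ∀ a → a ≡ 1ℤ · (a · 1ℤ · 1ℤ · 1ℤ)
   lem = ℤ-solve 1 (λ a → a , Κ 1ℤ :* (a :* Κ 1ℤ :* Κ 1ℤ :* Κ 1ℤ)) refl
 scaled₃ : Scaled 3 1ℤ
 scaled₃ = trans W₃≡ (cong ι (lem d))
   where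
   lem : ∀ d → d ≡ 1ℤ · (1ℤ · (d · 1ℤ) · 1ℤ)
   lem = ℤ-solve 1 (λ d → d , Κ 1ℤ :* (Κ 1ℤ :* (d :* Κ 1ℤ) :* Κ 1ℤ)) refl
 scaled₄ : Scaled 4 c
 scaled₄ = trans W₄≡ (cong ι (lem a c G))
   where
   lem : ∀ a c G → a · c · G ≡ c · (a · 1ℤ · 1ℤ · (G · 1ℤ))
   lem = ℤ-solve 3 (λ a c G → a :* c :* G , c :* (a :* Κ 1ℤ :* Κ 1ℤ :* (G :* Κ 1ℤ))) refl

 scaled : ∀ n → Σ ℤ (Scaled (suc n))
 scaled = eds-induction (λ n → Σ ℤ (Scaled n)) (1ℤ , scaled₁) (1ℤ , scaled₂) (1ℤ , scaled₃) (c , scaled₄)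
   (λ k p₁ p₂ p₃ p₄ → oddPart k (proj₁ p₁) (proj₁ p₂) (proj₁ p₃) (proj₁ p₄) , scaled-odd k (proj₁ p₁) (proj₁ p₂) (proj₁ p₃) (proj₁ p₄) (proj₂ p₁) (proj₂ p₂) (proj₂ p₃) (proj₂ p₄))
   (λ k p₁ p₂ p₃ p₄ p₅ → evenPart k (proj₁ p₁) (proj₁ p₂) (proj₁ p₃) (proj₁ p₄) (proj₁ p₅) , scaled-even k (proj₁ p₁) (proj₁ p₂) (proj₁ p₃) (proj₁ p₄) (proj₁ p₅) (proj₂ p₁) (proj₂ p₂) (proj₂ p₃) (proj₂ p₄) (proj₂ p₅))

 abstract
   v : ℕ → ℤ
   v zero    = 0ℤ
   v (suc n) = proj₁ (scaled n)

   v-zero : v 0 ≡ 0ℤ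
   v-zero = refl

   W≡vσ : ∀ n → W (suc n) ≡ ι (v (suc n) · σ (suc n))
   W≡vσ n = proj₂ (scaled n)

 -- As `σ` does not vanish, a scaled value is determined by W; every scaled identity for W therefore
 -- becomes an identity for v.
 v-unique : ∀ n {i} → Scaled (suc n) i → v (suc n) ≡ i
 v-unique n h = ℤ-cancelʳ (σ (suc n)) (σ≢0 (suc n)) (ι-injective (trans (sym (W≡vσ n)) h))

 v₁ : v 1 ≡ 1ℤ
 v₁ = v-unique 0 scaled₁
 v₂ : v 2 ≡ 1ℤ
 v₂ = v-unique 1 scaled₂
 v₃ : v 3 ≡ 1ℤ
 v₃ = v-unique 2 scaled₃
 v₄ : v 4 ≡ c
 v₄ = v-unique 3 scaled₄

 v-odd : ∀ k → v (suc (dbl k 4)) ≡ oddPart k (v (1 ℕ.+ k)) (v (2 ℕ.+ k)) (v (3 ℕ.+ k)) (v (4 ℕ.+ k))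
 v-odd k = v-unique (dbl k 4) (scaled-odd k (v (1 ℕ.+ k)) (v (2 ℕ.+ k)) (v (3 ℕ.+ k)) (v (4 ℕ.+ k)) (W≡vσ k) (W≡vσ (1 ℕ.+ k)) (W≡vσ (2 ℕ.+ k)) (W≡vσ (3 ℕ.+ k)))

 v-even : ∀ k → v (suc (dbl k 5)) ≡ evenPart k (v (1 ℕ.+ k)) (v (2 ℕ.+ k)) (v (3 ℕ.+ k)) (v (4 ℕ.+ k)) (v (5 ℕ.+ k))
 v-even k = v-unique (dbl k 5) (scaled-even k (v (1 ℕ.+ k)) (v (2 ℕ.+ k)) (v (3 ℕ.+ k)) (v (4 ℕ.+ k)) (v (5 ℕ.+ k))
   (W≡vσ k) (W≡vσ (1 ℕ.+ k)) (W≡vσ (2 ℕ.+ k)) (W≡vσ (3 ℕ.+ k)) (W≡vσ (4 ℕ.+ k)))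

 v≢0 : ∀ n → v (suc n) ≢ 0ℤ
 v≢0 n e = W≢0 n (trans (W≡vσ n) (cong ι (trans (cong (_· σ (suc n)) e) (ℤₚ.*-zeroˡ (σ (suc n))))))

open PrimeDivisors

-- Prime divisors of v n at an integral multiple

module LocalAnalysis {B x y : ℤ} (B≡ : B ≡ y ²ℤ ℤ.- x ³ℤ) (M : Multiples (ι B) (ι x) (ι y)) (Pm : Params x y) (Lp : LocalParams Pm) where
 open Indices
 open import Data.Integer using (+_; _^_)

 open import Data.Nat.Primality using (Prime)
 open import Data.Integer.Divisibility.Signed using (_∣_)
 open import Data.Rational using (_+_; _-_; _*_; -_)

 open Normalised B≡ M Pm public
 open LocalParams Lp public

 τ-cases : ∀ k → (τ k ≡ 0 × τ (suc k) ≡ 1) ⊎ (τ k ≡ 1 × τ (suc k) ≡ 0)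
 τ-cases 0 = inj₂ (refl , refl)
 τ-cases 1 = inj₁ (refl , refl)
 τ-cases (suc (suc k)) = τ-cases k

 data δ-Cases (k : ℕ) : Set where
   δ₀ : δ k ≡ 1 → δ (1 ℕ.+ k) ≡ 0 → δ (2 ℕ.+ k) ≡ 0 → δ-Cases k
   δ₁ : δ k ≡ 0 → δ (1 ℕ.+ k) ≡ 1 → δ (2 ℕ.+ k) ≡ 0 → δ-Cases k
   δ₂ : δ k ≡ 0 → δ (1 ℕ.+ k) ≡ 0 → δ (2 ℕ.+ k) ≡ 1 → δ-Cases k

 δ-cases : ∀ k → δ-Cases k
 δ-cases 0 = δ₀ refl refl refl
 δ-cases 1 = δ₂ refl refl refl
 δ-cases 2 = δ₁ refl refl refl
 δ-cases (suc (suc (suc k))) with δ-cases k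
 ... | δ₀ p q r = δ₀ p q r
 ... | δ₁ p q r = δ₁ p q r
 ... | δ₂ p q r = δ₂ p q r

 contra : ∀ {n : ℕ} {A : Set} → n ≡ 0 → n ≡ 1 → A
 contra refl ()

 ^1-∣ : ∀ {i z n} → i ∣ z → n ≡ 1 → i ∣ z ^ n
 ^1-∣ h refl = ℤD.∣m⇒∣m*n 1ℤ h

 module _ {p : ℕ} (pp : Prime p) where
   private π = + p

   ^0-∤ : ∀ z {n} → n ≡ 0 → π ∤ z ^ n
   ^0-∤ z refl = ∤-1 pp

   ∤-³ : ∀ i → π ∤ i → π ∤ i ³ℤ
   ∤-³ i h = ∤-* pp {i · i} {i} (∤-* pp {i} {i} h h) h

   ∤-² : ∀ i → π ∤ i → π ∤ i ²ℤ
   ∤-² i h = ∤-* pp {i} {i} h h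

   ∤-*₃ : ∀ r s t → π ∤ r → π ∤ s → π ∤ t → π ∤ r · s · t
   ∤-*₃ r s t hr hs ht = ∤-* pp {r · s} {t} (∤-* pp {r} {s} hr hs) ht

   ∣-*₃ : ∀ r s t → π ∣ r ⊎ π ∣ s → π ∣ r · s · t
   ∣-*₃ r s t (inj₁ h) = ℤD.∣m⇒∣m*n t (ℤD.∣m⇒∣m*n s h)
   ∣-*₃ r s t (inj₂ h) = ℤD.∣m⇒∣m*n t (ℤD.∣n⇒∣m*n r h)

   -- Of two consecutive indices exactly one is even, so modulo p exactly one product of the odd
   -- recursion survives. It involves v only at odd indices, besides a power of `b`, which is prime
   -- to p.
   T∣⇒∤v-odd : π ∣ T → ∀ n → τ (suc n) ≡ 0 → π ∤ v (suc n)
   T∣⇒∤v-odd p∣T = eds-induction (λ n → τ n ≡ 0 → π ∤ v n)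
     (λ _ → subst (π ∤_) (sym v₁) (∤-1 pp)) (λ ()) (λ _ → subst (π ∤_) (sym v₃) (∤-1 pp)) (λ ())
     odd (λ k _ _ _ _ _ h → contra h (τ-even k))
     where
     p∤b = T∤b pp p∣T
     odd : ∀ k → (τ (1 ℕ.+ k) ≡ 0 → π ∤ v (1 ℕ.+ k)) → (τ (2 ℕ.+ k) ≡ 0 → π ∤ v (2 ℕ.+ k)) →
           (τ (3 ℕ.+ k) ≡ 0 → π ∤ v (3 ℕ.+ k)) → (τ (4 ℕ.+ k) ≡ 0 → π ∤ v (4 ℕ.+ k)) →
           τ (suc (dbl k 4)) ≡ 0 → π ∤ v (suc (dbl k 4))
     odd k h₁ h₂ h₃ h₄ _ = subst (π ∤_) (sym (v-odd k)) (by (τ-cases k))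
       where
       T₁ = T ^ τ (2 ℕ.+ k)
       b₁ = b ^ δ (2 ℕ.+ k)
       r₁ = v (4 ℕ.+ k) · v (2 ℕ.+ k) ³ℤ
       T₂ = T ^ τ (3 ℕ.+ k)
       b₂ = b ^ δ (3 ℕ.+ k)
       r₂ = v (1 ℕ.+ k) · v (3 ℕ.+ k) ³ℤ
       by : _ → π ∤ T₁ · b₁ · r₁ ℤ.- T₂ · b₂ · r₂
       by (inj₁ (e₀ , e₁)) = sub-∣ pp {T₁ · b₁ · r₁} {T₂ · b₂ · r₂}
           (∤-*₃ T₁ b₁ r₁ (^0-∤ T e₀) (∤-^ pp (δ (2 ℕ.+ k)) p∤b) (∤-* pp {v (4 ℕ.+ k)} {v (2 ℕ.+ k) ³ℤ} (h₄ e₀) (∤-³ (v (2 ℕ.+ k)) (h₂ e₀))))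
           (∣-*₃ T₂ b₂ r₂ (inj₁ (^1-∣ p∣T e₁)))
       by (inj₂ (e₀ , e₁)) = ∣-sub pp {T₁ · b₁ · r₁} {T₂ · b₂ · r₂}
           (∣-*₃ T₁ b₁ r₁ (inj₁ (^1-∣ p∣T e₀)))
           (∤-*₃ T₂ b₂ r₂ (^0-∤ T e₁) (∤-^ pp (δ (3 ℕ.+ k)) p∤b) (∤-* pp {v (1 ℕ.+ k)} {v (3 ℕ.+ k) ³ℤ} (h₁ e₁) (∤-³ (v (3 ℕ.+ k)) (h₃ e₁))))

   -- When the target index is prime to 3, exactly one of the two products carries the factor `b`;
   -- the other consists of v at indices prime to 3 and a power of `T`.
   b∣⇒∤v : π ∣ b → π ∤ T → ∀ n → δ (suc n) ≡ 0 → π ∤ v (suc n)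
   b∣⇒∤v p∣b p∤T = eds-induction (λ n → δ n ≡ 0 → π ∤ v n)
     (λ _ → subst (π ∤_) (sym v₁) (∤-1 pp)) (λ _ → subst (π ∤_) (sym v₂) (∤-1 pp)) (λ ())
     (λ _ → subst (π ∤_) (sym v₄) (b∤c pp p∣b p∤T)) odd even
     where
     odd : ∀ k → (δ (1 ℕ.+ k) ≡ 0 → π ∤ v (1 ℕ.+ k)) → (δ (2 ℕ.+ k) ≡ 0 → π ∤ v (2 ℕ.+ k)) →
           (δ (3 ℕ.+ k) ≡ 0 → π ∤ v (3 ℕ.+ k)) → (δ (4 ℕ.+ k) ≡ 0 → π ∤ v (4 ℕ.+ k)) →
           δ (suc (dbl k 4)) ≡ 0 → π ∤ v (suc (dbl k 4))
     odd k h₁ h₂ h₃ h₄ δ≡0 = subst (π ∤_) (sym (v-odd k)) (by (δ-cases k))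
       where
       T₁ = T ^ τ (2 ℕ.+ k)
       b₁ = b ^ δ (2 ℕ.+ k)
       r₁ = v (4 ℕ.+ k) · v (2 ℕ.+ k) ³ℤ
       T₂ = T ^ τ (3 ℕ.+ k)
       b₂ = b ^ δ (3 ℕ.+ k)
       r₂ = v (1 ℕ.+ k) · v (3 ℕ.+ k) ³ℤ
       by : δ-Cases k → π ∤ T₁ · b₁ · r₁ ℤ.- T₂ · b₂ · r₂
       by (δ₁ _ e₁ _) = contra (trans (sym (δ-odd k)) δ≡0) e₁
       by (δ₀ e₀ e₁ e₂) = sub-∣ pp {T₁ · b₁ · r₁} {T₂ · b₂ · r₂}
           (∤-*₃ T₁ b₁ r₁ (∤-^ pp (τ (2 ℕ.+ k)) p∤T) (^0-∤ b e₂) (∤-* pp {v (4 ℕ.+ k)} {v (2 ℕ.+ k) ³ℤ} (h₄ e₁) (∤-³ (v (2 ℕ.+ k)) (h₂ e₂))))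
           (∣-*₃ T₂ b₂ r₂ (inj₂ (^1-∣ p∣b e₀)))
       by (δ₂ e₀ e₁ e₂) = ∣-sub pp {T₁ · b₁ · r₁} {T₂ · b₂ · r₂}
           (∣-*₃ T₁ b₁ r₁ (inj₂ (^1-∣ p∣b e₂)))
           (∤-*₃ T₂ b₂ r₂ (∤-^ pp (τ (3 ℕ.+ k)) p∤T) (^0-∤ b e₀) (∤-* pp {v (1 ℕ.+ k)} {v (3 ℕ.+ k) ³ℤ} (h₁ e₁) (∤-³ (v (3 ℕ.+ k)) (h₃ e₀))))
     even : ∀ k → (δ (1 ℕ.+ k) ≡ 0 → π ∤ v (1 ℕ.+ k)) → (δ (2 ℕ.+ k) ≡ 0 → π ∤ v (2 ℕ.+ k)) →
            (δ (3 ℕ.+ k) ≡ 0 → π ∤ v (3 ℕ.+ k)) → (δ (4 ℕ.+ k) ≡ 0 → π ∤ v (4 ℕ.+ k)) →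
            (δ (5 ℕ.+ k) ≡ 0 → π ∤ v (5 ℕ.+ k)) →
            δ (suc (dbl k 5)) ≡ 0 → π ∤ v (suc (dbl k 5))
     even k h₁ h₂ h₃ h₄ h₅ δ≡0 = subst (π ∤_) (sym (v-even k)) (by (δ-cases k))
       where
       b₁ = b ^ δ (5 ℕ.+ k)
       b₂ = b ^ δ (4 ℕ.+ k)
       u₁ = v (1 ℕ.+ k)
       u₂ = v (2 ℕ.+ k)
       u₃ = v (3 ℕ.+ k)
       u₄ = v (4 ℕ.+ k)
       u₅ = v (5 ℕ.+ k)
       r₁ = u₃ · u₅ · u₂ ²ℤ
       r₂ = u₃ · u₁ · u₄ ²ℤ
       by : δ-Cases k → π ∤ b₁ · r₁ ℤ.- b₂ · r₂
       by (δ₀ e₀ e₁ e₂) = contra (trans (sym (δ-even k)) δ≡0) e₀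
       by (δ₁ e₀ e₁ e₂) = sub-∣ pp {b₁ · r₁} {b₂ · r₂}
           (∤-* pp {b₁} {r₁} (^0-∤ b e₂) (∤-*₃ u₃ u₅ (u₂ ²ℤ) (h₃ e₀) (h₅ e₂) (∤-² u₂ (h₂ e₂))))
           (ℤD.∣m⇒∣m*n r₂ (^1-∣ p∣b e₁))
       by (δ₂ e₀ e₁ e₂) = ∣-sub pp {b₁ · r₁} {b₂ · r₂}
           (ℤD.∣m⇒∣m*n r₁ (^1-∣ p∣b e₂))
           (∤-* pp {b₂} {r₂} (^0-∤ b e₁) (∤-*₃ u₃ u₁ (u₄ ²ℤ) (h₃ e₀) (h₁ e₁) (∤-² u₄ (h₄ e₁))))

 W-int : ℕ → ℤ
 W-int n = v n · σ n

 W≡W-int : ∀ n → W n ≡ ι (W-int n)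
 W≡W-int zero = sym (trans (cong (λ u → ι (u · σ 0)) v-zero) (cong ι (ℤₚ.*-zeroˡ (σ 0))))
 W≡W-int (suc n) = W≡vσ n

 IntegralAt : ℕ → ℤ → Set
 IntegralAt n z = X n ≡ ι z

 integral-relation : ∀ {n z} → IntegralAt (1 ℕ.+ n) z →
                     W-int (2 ℕ.+ n) · W-int n ≡ W-int (1 ℕ.+ n) ²ℤ · (x ℤ.- z)
 integral-relation {n} {z} h = ι-injective (begin
   ι (W-int (2 ℕ.+ n) · W-int n) ≡⟨ trans (ι-* (W-int (2 ℕ.+ n)) (W-int n)) (sym (cong₂ _*_ (W≡W-int (2 ℕ.+ n)) (W≡W-int n))) ⟩
   W (2 ℕ.+ n) * W n ≡⟨ W-step n ⟩
   ι x * w (1 ℕ.+ n) - w (1 ℕ.+ n) * X (1 ℕ.+ n) ≡⟨ cong (λ u → ι x * w (1 ℕ.+ n) - w (1 ℕ.+ n) * u) h ⟩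
   ι x * w (1 ℕ.+ n) - w (1 ℕ.+ n) * ι z ≡⟨ lem (ι x) (W (1 ℕ.+ n)) (ι z) ⟩
   W (1 ℕ.+ n) * W (1 ℕ.+ n) * (ι x - ι z)
     ≡⟨ cong₂ _*_ (trans (cong₂ _*_ (W≡W-int (1 ℕ.+ n)) (W≡W-int (1 ℕ.+ n))) (sym (ι-* (W-int (1 ℕ.+ n)) (W-int (1 ℕ.+ n))))) (sym (ι-- x z)) ⟩
   ι (W-int (1 ℕ.+ n) ²ℤ) * ι (x ℤ.- z) ≡⟨ sym (ι-* (W-int (1 ℕ.+ n) ²ℤ) (x ℤ.- z)) ⟩
   ι (W-int (1 ℕ.+ n) ²ℤ · (x ℤ.- z)) ∎)
   where
   open ≡-Reasoning
   lem : ∀ x w z → x * (w * w) - w * w * z ≡ w * w * (x - z)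
   lem = ℚ-solve 3 (λ x w z → x :* (w :* w) :- w :* w :* z , w :* w :* (x :- z)) refl

 -- The addition formula for the pair 2 and n + 2, with coefficients ψ₂² and ψ₃. Unlike the doubling
 -- recursions it links neighbouring terms, as the descent in `no-consecutive` requires.
 somos : ∀ n → W-int (4 ℕ.+ n) · W-int n ≡ a ²ℤ · (W-int (3 ℕ.+ n) · W-int (1 ℕ.+ n)) ℤ.- d · W-int (2 ℕ.+ n) ²ℤ
 somos n = ι-injective (begin
   ι (W-int (4 ℕ.+ n) · W-int n) ≡⟨ trans (ι-* (W-int (4 ℕ.+ n)) (W-int n)) (sym (cong₂ _*_ (W≡W-int (4 ℕ.+ n)) (W≡W-int n))) ⟩
   W (4 ℕ.+ n) * W n ≡⟨ W-W 2 n ⟩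
   Φ 2 * w (2 ℕ.+ n) - w 2 * Φ (2 ℕ.+ n) ≡⟨ cong (λ u → Φ 2 * w (2 ℕ.+ n) - w 2 * u) (Φ≡ (1 ℕ.+ n)) ⟩
   Φ 2 * w (2 ℕ.+ n) - w 2 * (ι x * w (2 ℕ.+ n) - W (3 ℕ.+ n) * W (1 ℕ.+ n)) ≡⟨ lem (Φ 2) (w (2 ℕ.+ n)) (W 2) (ι x) (W (3 ℕ.+ n)) (W (1 ℕ.+ n)) ⟩
   w 2 * (W (3 ℕ.+ n) * W (1 ℕ.+ n)) - (ι x * w 2 - Φ 2) * w (2 ℕ.+ n) ≡⟨ cong (λ u → w 2 * (W (3 ℕ.+ n) * W (1 ℕ.+ n)) - u * w (2 ℕ.+ n)) (trans (sym (W-step 1)) (ℚₚ.*-identityʳ (W 3))) ⟩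
   w 2 * (W (3 ℕ.+ n) * W (1 ℕ.+ n)) - W 3 * w (2 ℕ.+ n)
     ≡⟨ cong₂ _-_ (cong₂ _*_ (trans (cong₂ _*_ W₂≡ W₂≡) (sym (ι-* a a))) (trans (cong₂ _*_ (W≡W-int (3 ℕ.+ n)) (W≡W-int (1 ℕ.+ n))) (sym (ι-* (W-int (3 ℕ.+ n)) (W-int (1 ℕ.+ n))))))
                  (cong₂ _*_ W₃≡ (trans (cong₂ _*_ (W≡W-int (2 ℕ.+ n)) (W≡W-int (2 ℕ.+ n))) (sym (ι-* (W-int (2 ℕ.+ n)) (W-int (2 ℕ.+ n)))))) ⟩
   ι (a ²ℤ) * ι (W-int (3 ℕ.+ n) · W-int (1 ℕ.+ n)) - ι d * ι (W-int (2 ℕ.+ n) ²ℤ)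
     ≡⟨ sym (trans (ι-- (a ²ℤ · (W-int (3 ℕ.+ n) · W-int (1 ℕ.+ n))) (d · W-int (2 ℕ.+ n) ²ℤ))
          (cong₂ _-_ (ι-* (a ²ℤ) (W-int (3 ℕ.+ n) · W-int (1 ℕ.+ n))) (ι-* d (W-int (2 ℕ.+ n) ²ℤ)))) ⟩
   ι (a ²ℤ · (W-int (3 ℕ.+ n) · W-int (1 ℕ.+ n)) ℤ.- d · W-int (2 ℕ.+ n) ²ℤ) ∎)
   where
   open ≡-Reasoning
   lem : ∀ P w W₂ x p q → P * w - W₂ * W₂ * (x * w - p * q) ≡ W₂ * W₂ * (p * q) - (x * (W₂ * W₂) - P) * w
   lem = ℚ-solve 6 (λ P w W₂ x p q → P :* w :- W₂ :* W₂ :* (x :* w :- p :* q) , W₂ :* W₂ :* (p :* q) :- (x :* (W₂ :* W₂) :- P) :* w) refl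

 e-step : ∀ k → 1 ℕ.+ e (3 ℕ.+ k) ℕ.+ e (1 ℕ.+ k) ≡ e (2 ℕ.+ k) ℕ.+ e (2 ℕ.+ k) ℕ.+ τ (2 ℕ.+ k) ℕ.+ 2 ℕ.* δ (2 ℕ.+ k)
 e-step = by-six _ refl refl refl refl refl refl λ k h →
   trans (lem₁ (e (3 ℕ.+ k)) (e (1 ℕ.+ k)) k) (trans (cong (ℕ._+ (2 ℕ.* k ℕ.+ 10)) h) (lem₂ (e (2 ℕ.+ k)) (τ (2 ℕ.+ k)) (δ (2 ℕ.+ k)) k))
   where
   lem₁ : ∀ p q k → 1 ℕ.+ (p ℕ.+ suc (2 ℕ.+ k) ℕ.+ 3) ℕ.+ (q ℕ.+ suc k ℕ.+ 3) ≡ (1 ℕ.+ p ℕ.+ q) ℕ.+ (2 ℕ.* k ℕ.+ 10)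
   lem₁ = ℕ-solve
   lem₂ : ∀ p t d k → (p ℕ.+ p ℕ.+ t ℕ.+ 2 ℕ.* d) ℕ.+ (2 ℕ.* k ℕ.+ 10) ≡ (p ℕ.+ suc (1 ℕ.+ k) ℕ.+ 3) ℕ.+ (p ℕ.+ suc (1 ℕ.+ k) ℕ.+ 3) ℕ.+ t ℕ.+ 2 ℕ.* d
   lem₂ = ℕ-solve

 σ-neighbours : ∀ k {t d₁ d₃} → τ (1 ℕ.+ k) ≡ t → δ (1 ℕ.+ k) ≡ d₁ → δ (3 ℕ.+ k) ≡ d₃ →
   G · (σ (3 ℕ.+ k) · σ (1 ℕ.+ k)) ≡
   (a ^ t) ²ℤ · (d ^ d₃ · d ^ d₁) · ((G ^ e (2 ℕ.+ k)) ²ℤ · (G ^ τ (2 ℕ.+ k) · G ^ (2 ℕ.* δ (2 ℕ.+ k))))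
 σ-neighbours k refl refl refl = begin
   _ ≡⟨ lem₁ G (a ^ τ (1 ℕ.+ k)) (d ^ δ (3 ℕ.+ k)) (G ^ e (3 ℕ.+ k)) (d ^ δ (1 ℕ.+ k)) (G ^ e (1 ℕ.+ k)) ⟩
   (a ^ τ (1 ℕ.+ k)) ²ℤ · (d ^ δ (3 ℕ.+ k) · d ^ δ (1 ℕ.+ k)) · (G · G ^ e (3 ℕ.+ k) · G ^ e (1 ℕ.+ k))
     ≡⟨ cong (λ u → (a ^ τ (1 ℕ.+ k)) ²ℤ · (d ^ δ (3 ℕ.+ k) · d ^ δ (1 ℕ.+ k)) · u)
        (trans (sym (ℤₚ.^-distribˡ-+-* G (1 ℕ.+ e (3 ℕ.+ k)) (e (1 ℕ.+ k)))) (trans (cong (G ^_) (e-step k))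
          (trans (sym (pow-sum₄ (e (2 ℕ.+ k)) (e (2 ℕ.+ k)) (τ (2 ℕ.+ k)) (2 ℕ.* δ (2 ℕ.+ k)))) (ℤₚ.*-assoc ((G ^ e (2 ℕ.+ k)) ²ℤ) (G ^ τ (2 ℕ.+ k)) (G ^ (2 ℕ.* δ (2 ℕ.+ k))))))) ⟩
   _ ∎
   where
   open ≡-Reasoning
   lem₁ : ∀ G a d₃ g₃ d₁ g₁ → G · (a · d₃ · g₃ · (a · d₁ · g₁)) ≡ a · a · (d₃ · d₁) · (G · g₃ · g₁)
   lem₁ = ℤ-solve 6 (λ G a d₃ g₃ d₁ g₁ → G :* (a :* d₃ :* g₃ :* (a :* d₁ :* g₁)) , a :* a :* (d₃ :* d₁) :* (G :* g₃ :* g₁)) refl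

 v⁶ : ℤ → ℤ
 v⁶ i = i ³ℤ · i ³ℤ

 ^6≡ : ∀ i → i ^ 6 ≡ v⁶ i
 ^6≡ = lem
   where
   lem : ∀ i → i · (i · (i · (i · (i · (i · 1ℤ))))) ≡ (i · i · i) · (i · i · i)
   lem = ℤ-solve 1 (λ i → i :* (i :* (i :* (i :* (i :* (i :* Κ 1ℤ))))) , (i :* i :* i) :* (i :* i :* i)) refl

 ^2≡ : ∀ i → i ^ 2 ≡ i ²ℤ
 ^2≡ = lem
   where
   lem : ∀ i → i · (i · 1ℤ) ≡ i · i
   lem = ℤ-solve 1 (λ i → i :* (i :* Κ 1ℤ) , i :* i) refl

 -- The integrality relation at 2 + k, for u = v (3 + k) v (1 + k) and q = x − x((2 + k)P), after cubing and clearing d and G.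
 module AtIndex (k : ℕ) (q : ℤ) (rel : W-int (3 ℕ.+ k) · W-int (1 ℕ.+ k) ≡ W-int (2 ℕ.+ k) ²ℤ · q) where
   u V g : ℤ
   u = v (3 ℕ.+ k) · v (1 ℕ.+ k)
   V = v (2 ℕ.+ k)
   g = G ^ e (2 ℕ.+ k)

   g≢0 : g ≢ 0ℤ
   g≢0 = ℤ-^-≢0 (e (2 ℕ.+ k)) G≢0

   rel′ : ∀ {t d₁ d₃ t₂ d₂} → τ (1 ℕ.+ k) ≡ t → δ (1 ℕ.+ k) ≡ d₁ → δ (3 ℕ.+ k) ≡ d₃ → τ (2 ℕ.+ k) ≡ t₂ → δ (2 ℕ.+ k) ≡ d₂ →
          u · ((a ^ t) ²ℤ · (d ^ d₃ · d ^ d₁) · (g ²ℤ · (G ^ t₂ · G ^ (2 ℕ.* d₂)))) ≡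
          G · ((V · (a ^ t₂ · d ^ d₂ · g)) ²ℤ · q)
   rel′ e₁ e₂ e₃ refl refl = trans (cong (u ·_) (sym (σ-neighbours k e₁ e₂ e₃)))
     (trans (lem (v (3 ℕ.+ k)) (v (1 ℕ.+ k)) G (σ (3 ℕ.+ k)) (σ (1 ℕ.+ k))) (cong (G ·_) rel))
     where
     lem : ∀ v₃ v₁ G s₃ s₁ → v₃ · v₁ · (G · (s₃ · s₁)) ≡ G · (v₃ · s₃ · (v₁ · s₁))
     lem = ℤ-solve 5 (λ v₃ v₁ G s₃ s₁ → v₃ :* v₁ :* (G :* (s₃ :* s₁)) , G :* (v₃ :* s₃ :* (v₁ :* s₁))) refl

   even-rel : ∀ {d₁ d₃} → τ (1 ℕ.+ k) ≡ 0 → δ (1 ℕ.+ k) ≡ d₁ → δ (3 ℕ.+ k) ≡ d₃ → d₃ ℕ.+ d₁ ≡ 1 → τ (2 ℕ.+ k) ≡ 1 → δ (2 ℕ.+ k) ≡ 0 →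
              v⁶ V · T ²ℤ · q ³ℤ ≡ a ²ℤ · (u ³ℤ · b)
   even-rel {d₁} {d₃} e₁ e₂ e₃ d≡1 e₄ e₅ = ℤ-cancelʳ (a ³ℤ · a ³ℤ) (ℤ-*-≢0 a³≢0 a³≢0) (begin
     v⁶ V · T ²ℤ · q ³ℤ · (a ³ℤ · a ³ℤ) ≡⟨ lem₁ V T q a ⟩
     T ²ℤ · (V ²ℤ · a ²ℤ · q) ³ℤ ≡⟨ cong (λ z → T ²ℤ · z ³ℤ) (sym ud) ⟩
     T ²ℤ · (u · d) ³ℤ ≡⟨ lem₂ T u d ⟩
     T ²ℤ · u ³ℤ · (d · d · d) ≡⟨ cong (T ²ℤ · u ³ℤ ·_) d³ ⟩
     T ²ℤ · u ³ℤ · (b · (G · G)) ≡⟨ lem₃ T u b G ⟩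
     u ³ℤ · b · (T · G) ²ℤ ≡⟨ cong (λ z → u ³ℤ · b · z ²ℤ) (sym a⁴) ⟩
     u ³ℤ · b · (a · a · (a · a)) ²ℤ ≡⟨ lem₄ u b a ⟩
     a ²ℤ · (u ³ℤ · b) · (a ³ℤ · a ³ℤ) ∎)
     where
     open ≡-Reasoning
     a³≢0 = ℤ-*-≢0 (ℤ-*-≢0 a≢0 a≢0) a≢0
     ud : u · d ≡ V ²ℤ · a ²ℤ · q
     ud = ℤ-cancelʳ (g ²ℤ · G) (ℤ-*-≢0 (ℤ-*-≢0 g≢0 g≢0) G≢0) (begin
       u · d · (g ²ℤ · G) ≡⟨ cong (λ z → u · z · (g ²ℤ · G)) (trans (sym (ℤₚ.^-identityʳ d)) (trans (cong (d ^_) (sym d≡1)) (ℤₚ.^-distribˡ-+-* d d₃ d₁))) ⟩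
       u · (d ^ d₃ · d ^ d₁) · (g ²ℤ · G) ≡⟨ lem₅ u (d ^ d₃ · d ^ d₁) g G ⟩
       _ ≡⟨ rel′ e₁ e₂ e₃ e₄ e₅ ⟩
       _ ≡⟨ lem₆ G V a g q ⟩
       V ²ℤ · a ²ℤ · q · (g ²ℤ · G) ∎)
       where
       lem₅ : ∀ u D g G → u · D · (g · g · G) ≡ u · (1ℤ · 1ℤ · D · (g · g · (G · 1ℤ · 1ℤ)))
       lem₅ = ℤ-solve 4 (λ u D g G → u :* D :* (g :* g :* G) , u :* (Κ 1ℤ :* Κ 1ℤ :* D :* (g :* g :* (G :* Κ 1ℤ :* Κ 1ℤ)))) refl
       lem₆ : ∀ G V a g q → G · ((V · (a · 1ℤ · 1ℤ · g)) · (V · (a · 1ℤ · 1ℤ · g)) · q) ≡ V · V · (a · a) · q · (g · g · G)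
       lem₆ = ℤ-solve 5 (λ G V a g q → G :* ((V :* (a :* Κ 1ℤ :* Κ 1ℤ :* g)) :* (V :* (a :* Κ 1ℤ :* Κ 1ℤ :* g)) :* q) , V :* V :* (a :* a) :* q :* (g :* g :* G)) refl
     lem₁ : ∀ V T q a → (V · V · V) · (V · V · V) · (T · T) · (q · q · q) · ((a · a · a) · (a · a · a)) ≡
       T · T · ((V · V · (a · a) · q) · (V · V · (a · a) · q) · (V · V · (a · a) · q))
     lem₁ = ℤ-solve 4 (λ V T q a → (V :* V :* V) :* (V :* V :* V) :* (T :* T) :* (q :* q :* q) :* ((a :* a :* a) :* (a :* a :* a)) , T :* T :* ((V :* V :* (a :* a) :* q) :* (V :* V :* (a :* a) :* q) :* (V :* V :* (a :* a) :* q))) refl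
     lem₂ : ∀ T u d → T · T · (u · d · (u · d) · (u · d)) ≡ T · T · (u · u · u) · (d · d · d)
     lem₂ = ℤ-solve 3 (λ T u d → T :* T :* (u :* d :* (u :* d) :* (u :* d)) , T :* T :* (u :* u :* u) :* (d :* d :* d)) refl
     lem₃ : ∀ T u b G → T · T · (u · u · u) · (b · (G · G)) ≡ u · u · u · b · (T · G · (T · G))
     lem₃ = ℤ-solve 4 (λ T u b G → T :* T :* (u :* u :* u) :* (b :* (G :* G)) , u :* u :* u :* b :* (T :* G :* (T :* G))) refl
     lem₄ : ∀ u b a → u · u · u · b · (a · a · (a · a) · (a · a · (a · a))) ≡ a · a · (u · u · u · b) · (a · a · a · (a · a · a))
     lem₄ = ℤ-solve 3 (λ u b a → u :* u :* u :* b :* (a :* a :* (a :* a) :* (a :* a :* (a :* a))) , a :* a :* (u :* u :* u :* b) :* (a :* a :* a :* (a :* a :* a))) refl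

   triple-rel : τ (1 ℕ.+ k) ≡ 1 → δ (1 ℕ.+ k) ≡ 0 → δ (3 ℕ.+ k) ≡ 0 → τ (2 ℕ.+ k) ≡ 0 → δ (2 ℕ.+ k) ≡ 1 →
                v⁶ V · b ²ℤ · q ³ℤ ≡ a ²ℤ · (u ³ℤ · T)
   triple-rel e₁ e₂ e₃ e₄ e₅ = ℤ-cancelʳ (T · G · G ³ℤ) (ℤ-*-≢0 (ℤ-*-≢0 T≢0 G≢0) (ℤ-*-≢0 (ℤ-*-≢0 G≢0 G≢0) G≢0)) (begin
     v⁶ V · b ²ℤ · q ³ℤ · (T · G · G ³ℤ) ≡⟨ lem₁ V T q b G ⟩
     T · (V ³ℤ · V ³ℤ · (b · (G · G)) ²ℤ · q ³ℤ) ≡⟨ cong (λ z → T · (V ³ℤ · V ³ℤ · z ²ℤ · q ³ℤ)) (sym d³) ⟩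
     T · (V ³ℤ · V ³ℤ · (d · d · d) ²ℤ · q ³ℤ) ≡⟨ lem₂ T V d q ⟩
     T · (V ²ℤ · d ²ℤ · q) ³ℤ ≡⟨ cong (λ z → T · z ³ℤ) (sym ua) ⟩
     T · (u · a ²ℤ · G) ³ℤ ≡⟨ lem₃ T u a G ⟩
     a ²ℤ · (u ³ℤ · T) · (a · a · (a · a) · G ³ℤ) ≡⟨ cong (λ z → a ²ℤ · (u ³ℤ · T) · (z · G ³ℤ)) a⁴ ⟩
     a ²ℤ · (u ³ℤ · T) · (T · G · G ³ℤ) ∎)
     where
     open ≡-Reasoning
     ua : u · a ²ℤ · G ≡ V ²ℤ · d ²ℤ · q
     ua = ℤ-cancelʳ (g ²ℤ · G) (ℤ-*-≢0 (ℤ-*-≢0 g≢0 g≢0) G≢0)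
       (trans (lem₅ u a g G) (trans (rel′ e₁ e₂ e₃ e₄ e₅) (lem₆ G V d g q)))
       where
       lem₅ : ∀ u a g G → u · (a · a) · G · (g · g · G) ≡ u · (a · 1ℤ · (a · 1ℤ) · (1ℤ · 1ℤ) · (g · g · (1ℤ · (G · (G · 1ℤ)))))
       lem₅ = ℤ-solve 4 (λ u a g G → u :* (a :* a) :* G :* (g :* g :* G) , u :* (a :* Κ 1ℤ :* (a :* Κ 1ℤ) :* (Κ 1ℤ :* Κ 1ℤ) :* (g :* g :* (Κ 1ℤ :* (G :* (G :* Κ 1ℤ)))))) refl
       lem₆ : ∀ G V d g q → G · ((V · (1ℤ · (d · 1ℤ) · g)) · (V · (1ℤ · (d · 1ℤ) · g)) · q) ≡ V · V · (d · d) · q · (g · g · G)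
       lem₆ = ℤ-solve 5 (λ G V d g q → G :* ((V :* (Κ 1ℤ :* (d :* Κ 1ℤ) :* g)) :* (V :* (Κ 1ℤ :* (d :* Κ 1ℤ) :* g)) :* q) , V :* V :* (d :* d) :* q :* (g :* g :* G)) refl
     lem₁ : ∀ V T q b G → (V · V · V) · (V · V · V) · (b · b) · (q · q · q) · (T · G · (G · G · G)) ≡
       T · ((V · V · V) · (V · V · V) · ((b · (G · G)) · (b · (G · G))) · (q · q · q))
     lem₁ = ℤ-solve 5 (λ V T q b G → (V :* V :* V) :* (V :* V :* V) :* (b :* b) :* (q :* q :* q) :* (T :* G :* (G :* G :* G)) , T :* ((V :* V :* V) :* (V :* V :* V) :* ((b :* (G :* G)) :* (b :* (G :* G))) :* (q :* q :* q))) refl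
     lem₂ : ∀ T V d q → T · ((V · V · V) · (V · V · V) · ((d · d · d) · (d · d · d)) · (q · q · q)) ≡
       T · ((V · V · (d · d) · q) · (V · V · (d · d) · q) · (V · V · (d · d) · q))
     lem₂ = ℤ-solve 4 (λ T V d q → T :* ((V :* V :* V) :* (V :* V :* V) :* ((d :* d :* d) :* (d :* d :* d)) :* (q :* q :* q)) , T :* ((V :* V :* (d :* d) :* q) :* (V :* V :* (d :* d) :* q) :* (V :* V :* (d :* d) :* q))) refl
     lem₃ : ∀ T u a G → T · ((u · (a · a) · G) · (u · (a · a) · G) · (u · (a · a) · G)) ≡
       a · a · (u · u · u · T) · (a · a · (a · a) · (G · G · G))
     lem₃ = ℤ-solve 4 (λ T u a G → T :* ((u :* (a :* a) :* G) :* (u :* (a :* a) :* G) :* (u :* (a :* a) :* G)) , a :* a :* (u :* u :* u :* T) :* (a :* a :* (a :* a) :* (G :* G :* G))) refl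

   sextuple-rel : τ (1 ℕ.+ k) ≡ 0 → δ (1 ℕ.+ k) ≡ 0 → δ (3 ℕ.+ k) ≡ 0 → τ (2 ℕ.+ k) ≡ 1 → δ (2 ℕ.+ k) ≡ 1 →
                  v⁶ V · b ²ℤ · T ²ℤ · q ³ℤ ≡ a ²ℤ · u ³ℤ
   sextuple-rel e₁ e₂ e₃ e₄ e₅ = ℤ-cancelʳ (a ³ℤ · a ³ℤ · (G ²ℤ · G ²ℤ)) (ℤ-*-≢0 (ℤ-*-≢0 a³≢0 a³≢0) (ℤ-*-≢0 G²≢0 G²≢0)) (begin
     v⁶ V · b ²ℤ · T ²ℤ · q ³ℤ · (a ³ℤ · a ³ℤ · (G ²ℤ · G ²ℤ)) ≡⟨ lem₁ V T q b G a ⟩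
     T ²ℤ · (V ³ℤ · V ³ℤ · (a ³ℤ · a ³ℤ) · (b · (G · G)) ²ℤ · q ³ℤ)
       ≡⟨ cong (λ z → T ²ℤ · (V ³ℤ · V ³ℤ · (a ³ℤ · a ³ℤ) · z ²ℤ · q ³ℤ)) (sym d³) ⟩
     T ²ℤ · (V ³ℤ · V ³ℤ · (a ³ℤ · a ³ℤ) · (d · d · d) ²ℤ · q ³ℤ) ≡⟨ lem₂ T V d q a ⟩
     T ²ℤ · (V ²ℤ · a ²ℤ · d ²ℤ · q) ³ℤ ≡⟨ cong (λ z → T ²ℤ · z ³ℤ) (sym uG) ⟩
     T ²ℤ · (u · G ²ℤ) ³ℤ ≡⟨ lem₃ T u G ⟩
     u ³ℤ · (T · G) ²ℤ · (G ²ℤ · G ²ℤ) ≡⟨ cong (λ z → u ³ℤ · z ²ℤ · (G ²ℤ · G ²ℤ)) (sym a⁴) ⟩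
     u ³ℤ · (a · a · (a · a)) ²ℤ · (G ²ℤ · G ²ℤ) ≡⟨ lem₄ u a G ⟩
     a ²ℤ · u ³ℤ · (a ³ℤ · a ³ℤ · (G ²ℤ · G ²ℤ)) ∎)
     where
     open ≡-Reasoning
     a³≢0 = ℤ-*-≢0 (ℤ-*-≢0 a≢0 a≢0) a≢0
     G²≢0 = ℤ-*-≢0 G≢0 G≢0
     uG : u · G ²ℤ ≡ V ²ℤ · a ²ℤ · d ²ℤ · q
     uG = ℤ-cancelʳ (g ²ℤ · G) (ℤ-*-≢0 (ℤ-*-≢0 g≢0 g≢0) G≢0)
       (trans (lem₅ u g G) (trans (rel′ e₁ e₂ e₃ e₄ e₅) (lem₆ G V a d g q)))
       where
       lem₅ : ∀ u g G → u · (G · G) · (g · g · G) ≡ u · (1ℤ · 1ℤ · (1ℤ · 1ℤ) · (g · g · (G · 1ℤ · (G · (G · 1ℤ)))))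
       lem₅ = ℤ-solve 3 (λ u g G → u :* (G :* G) :* (g :* g :* G) , u :* (Κ 1ℤ :* Κ 1ℤ :* (Κ 1ℤ :* Κ 1ℤ) :* (g :* g :* (G :* Κ 1ℤ :* (G :* (G :* Κ 1ℤ)))))) refl
       lem₆ : ∀ G V a d g q → G · ((V · (a · 1ℤ · (d · 1ℤ) · g)) · (V · (a · 1ℤ · (d · 1ℤ) · g)) · q) ≡ V · V · (a · a) · (d · d) · q · (g · g · G)
       lem₆ = ℤ-solve 6 (λ G V a d g q → G :* ((V :* (a :* Κ 1ℤ :* (d :* Κ 1ℤ) :* g)) :* (V :* (a :* Κ 1ℤ :* (d :* Κ 1ℤ) :* g)) :* q) , V :* V :* (a :* a) :* (d :* d) :* q :* (g :* g :* G)) refl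
     lem₁ : ∀ V T q b G a → (V · V · V) · (V · V · V) · (b · b) · (T · T) · (q · q · q) · ((a · a · a) · (a · a · a) · (G · G · (G · G))) ≡
       T · T · ((V · V · V) · (V · V · V) · ((a · a · a) · (a · a · a)) · ((b · (G · G)) · (b · (G · G))) · (q · q · q))
     lem₁ = ℤ-solve 6 (λ V T q b G a → (V :* V :* V) :* (V :* V :* V) :* (b :* b) :* (T :* T) :* (q :* q :* q) :* ((a :* a :* a) :* (a :* a :* a) :* (G :* G :* (G :* G))) , T :* T :* ((V :* V :* V) :* (V :* V :* V) :* ((a :* a :* a) :* (a :* a :* a)) :* ((b :* (G :* G)) :* (b :* (G :* G))) :* (q :* q :* q))) refl
     lem₂ : ∀ T V d q a → T · T · ((V · V · V) · (V · V · V) · ((a · a · a) · (a · a · a)) · ((d · d · d) · (d · d · d)) · (q · q · q)) ≡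
       T · T · ((V · V · (a · a) · (d · d) · q) · (V · V · (a · a) · (d · d) · q) · (V · V · (a · a) · (d · d) · q))
     lem₂ = ℤ-solve 5 (λ T V d q a → T :* T :* ((V :* V :* V) :* (V :* V :* V) :* ((a :* a :* a) :* (a :* a :* a)) :* ((d :* d :* d) :* (d :* d :* d)) :* (q :* q :* q)) , T :* T :* ((V :* V :* (a :* a) :* (d :* d) :* q) :* (V :* V :* (a :* a) :* (d :* d) :* q) :* (V :* V :* (a :* a) :* (d :* d) :* q))) refl
     lem₃ : ∀ T u G → T · T · ((u · (G · G)) · (u · (G · G)) · (u · (G · G))) ≡ (u · u · u) · (T · G · (T · G)) · (G · G · (G · G))
     lem₃ = ℤ-solve 3 (λ T u G → T :* T :* ((u :* (G :* G)) :* (u :* (G :* G)) :* (u :* (G :* G))) , (u :* u :* u) :* (T :* G :* (T :* G)) :* (G :* G :* (G :* G))) refl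
     lem₄ : ∀ u a G → (u · u · u) · (a · a · (a · a) · (a · a · (a · a))) · (G · G · (G · G)) ≡
       a · a · (u · u · u) · ((a · a · a) · (a · a · a) · (G · G · (G · G)))
     lem₄ = ℤ-solve 3 (λ u a G → (u :* u :* u) :* (a :* a :* (a :* a) :* (a :* a :* (a :* a))) :* (G :* G :* (G :* G)) , a :* a :* (u :* u :* u) :* ((a :* a :* a) :* (a :* a :* a) :* (G :* G :* (G :* G)))) refl

 module _ {p : ℕ} (pp : Prime p) where
   private π = + p

   ∣⁶ : ∀ {i} → π ∣ i → π ^ 6 ∣ v⁶ i
   ∣⁶ {i} h = subst (π ^ 6 ∣_) (^6≡ i) (∣-^-mono 6 h)

   ∣⁸ : ∀ {i j} → π ∣ i → π ∣ j → π ^ 8 ∣ v⁶ i · j ²ℤ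
   ∣⁸ {i} {j} h h′ = subst₂ _∣_ (sym (ℤₚ.^-distribˡ-+-* π 6 2)) (cong (v⁶ i ·_) (^2≡ j)) (*-mono-∣ (∣⁶ h) (∣-^-mono 2 h′))

   -- Away from `T` and `b` all `σ` are prime to p. If p divided two consecutive terms, `somos`
   -- would put it into d W² of the preceding term, and as p ∤ d the descent would end at v 1 or v
   -- 2.
   no-consecutive : π ∤ T → π ∤ b → ∀ n → π ∣ v (1 ℕ.+ n) → π ∤ v (2 ℕ.+ n)
   no-consecutive p∤T p∤b = go
     where
     p∤G : π ∤ G
     p∤G = Tb∤G pp p∤T p∤b
     p∤a : π ∤ a
     p∤a h = ∤-* pp {T} {G} p∤T p∤G (subst (π ∣_) a⁴ (ℤD.∣m⇒∣m*n (a · a) (ℤD.∣m⇒∣m*n a h)))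
     p∤d : π ∤ d
     p∤d h = ∤-* pp {b} {G · G} p∤b (∤-* pp {G} {G} p∤G p∤G) (subst (π ∣_) d³ (ℤD.∣n⇒∣m*n (d · d) h))
     p∤σ : ∀ n → π ∤ σ n
     p∤σ n = ∤-*₃ pp (a ^ τ n) (d ^ δ n) (G ^ e n) (∤-^ pp (τ n) p∤a) (∤-^ pp (δ n) p∤d) (∤-^ pp (e n) p∤G)
     go : ∀ n → π ∣ v (1 ℕ.+ n) → π ∤ v (2 ℕ.+ n)
     go zero h _ = ∤-1 pp (subst (π ∣_) v₁ h)
     go (suc zero) h _ = ∤-1 pp (subst (π ∣_) v₂ h)
     go (suc (suc n)) h h′ = ∤-* pp {d} {W-int (2 ℕ.+ n) ²ℤ} p∤d
         (∤-² pp (W-int (2 ℕ.+ n)) (∤-* pp {v (2 ℕ.+ n)} {σ (2 ℕ.+ n)} (λ q → go (suc n) q h) (p∤σ (2 ℕ.+ n))))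
         (subst (π ∣_) (lem (a ²ℤ · (W-int (3 ℕ.+ n) · W-int (1 ℕ.+ n))) (d · W-int (2 ℕ.+ n) ²ℤ))
           (ℤD.∣m∣n⇒∣m-n (ℤD.∣n⇒∣m*n (a ²ℤ) (ℤD.∣m⇒∣m*n (W-int (1 ℕ.+ n)) (ℤD.∣m⇒∣m*n (σ (3 ℕ.+ n)) h)))
             (subst (π ∣_) (somos n) (ℤD.∣m⇒∣m*n (W-int n) (ℤD.∣m⇒∣m*n (σ (4 ℕ.+ n)) h′)))))
       where
       lem : ∀ i j → i ℤ.- (i ℤ.- j) ≡ j
       lem = ℤ-solve 2 (λ i j → i :- (i :- j) , j) refl

   -- For p prime to `T` and `b`, integrality would push p into a neighbouring term. For p ∣ T the
   -- index must be even, for p ∣ b a multiple of 3; both neighbours are then prime to p, and the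
   -- cubed relation contradicts `T-bad` or `b-bad`.
   no-prime : ∀ {n z} → IntegralAt (2 ℕ.+ n) z → π ∤ v (2 ℕ.+ n)
   no-prime {n} {z} int p∣v = cases (π ℤD.∣? T) (π ℤD.∣? b) (τ-cases (1 ℕ.+ n)) (δ-cases (1 ℕ.+ n))
     where
     rel = integral-relation {1 ℕ.+ n} {z} int
     open AtIndex n (x ℤ.- z) rel
     u-unit : π ∤ v (3 ℕ.+ n) → π ∤ v (1 ℕ.+ n) → π ∤ u ³ℤ
     u-unit h h′ = ∤-³ pp u (∤-* pp {v (3 ℕ.+ n)} {v (1 ℕ.+ n)} h h′)
     cases : _ → _ → _ → _ → ⊥
     cases (no p∤T) (no p∤b) _ _ = neighbours (∣-* pp (W-int (3 ℕ.+ n)) (subst (π ∣_) (sym rel) (ℤD.∣m⇒∣m*n (x ℤ.- z) (ℤD.∣m⇒∣m*n (W-int (2 ℕ.+ n)) (ℤD.∣m⇒∣m*n (σ (2 ℕ.+ n)) p∣v)))))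
       where
       p∤G = Tb∤G pp p∤T p∤b
       p∤σ : ∀ n → π ∤ σ n
       p∤σ n = ∤-*₃ pp (a ^ τ n) (d ^ δ n) (G ^ e n)
         (∤-^ pp (τ n) λ h → ∤-* pp {T} {G} p∤T p∤G (subst (π ∣_) a⁴ (ℤD.∣m⇒∣m*n (a · a) (ℤD.∣m⇒∣m*n a h))))
         (∤-^ pp (δ n) λ h → ∤-* pp {b} {G · G} p∤b (∤-* pp {G} {G} p∤G p∤G) (subst (π ∣_) d³ (ℤD.∣n⇒∣m*n (d · d) h)))
         (∤-^ pp (e n) p∤G)
       neighbours : π ∣ W-int (3 ℕ.+ n) ⊎ π ∣ W-int (1 ℕ.+ n) → ⊥
       neighbours (inj₁ h) with ∣-* pp (v (3 ℕ.+ n)) h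
       ... | inj₁ h′ = no-consecutive p∤T p∤b (1 ℕ.+ n) p∣v h′
       ... | inj₂ h′ = p∤σ (3 ℕ.+ n) h′
       neighbours (inj₂ h) with ∣-* pp (v (1 ℕ.+ n)) h
       ... | inj₁ h′ = no-consecutive p∤T p∤b n h′ p∣v
       ... | inj₂ h′ = p∤σ (1 ℕ.+ n) h′
     cases (yes p∣T) _ (inj₂ (_ , τ₀)) _ = T∣⇒∤v-odd pp p∣T (1 ℕ.+ n) τ₀ p∣v
     cases (yes p∣T) _ (inj₁ (τ₀ , τ₁)) (δ₁ d₀ d₁ d₂) =
       T-bad pp p∣T (u-unit (T∣⇒∤v-odd pp p∣T (2 ℕ.+ n) τ₀) (T∣⇒∤v-odd pp p∣T n τ₀))
         (subst ((π ^ 6 · T ²ℤ) ∣_) (trans (lem (v⁶ V) (b ²ℤ) (T ²ℤ) ((x ℤ.- z) ³ℤ)) (sextuple-rel τ₀ d₀ d₂ τ₁ d₁))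
           (ℤD.∣m⇒∣m*n (b ²ℤ · (x ℤ.- z) ³ℤ) (*-mono-∣ (∣⁶ {V} p∣v) ℤD.∣-refl)))
       where
       lem : ∀ p q r s → p · r · (q · s) ≡ p · q · r · s
       lem = ℤ-solve 4 (λ p q r s → p :* r :* (q :* s) , p :* q :* r :* s) refl
     cases (yes p∣T) _ (inj₁ (τ₀ , τ₁)) (δ₀ d₀ d₁ d₂) =
       T-bad pp p∣T (∤-* pp {u ³ℤ} {b} (u-unit (T∣⇒∤v-odd pp p∣T (2 ℕ.+ n) τ₀) (T∣⇒∤v-odd pp p∣T n τ₀)) (T∤b pp p∣T))
         (subst ((π ^ 6 · T ²ℤ) ∣_) (even-rel τ₀ d₀ d₂ refl τ₁ d₁)
           (ℤD.∣m⇒∣m*n ((x ℤ.- z) ³ℤ) (*-mono-∣ (∣⁶ {V} p∣v) ℤD.∣-refl)))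
     cases (yes p∣T) _ (inj₁ (τ₀ , τ₁)) (δ₂ d₀ d₁ d₂) =
       T-bad pp p∣T (∤-* pp {u ³ℤ} {b} (u-unit (T∣⇒∤v-odd pp p∣T (2 ℕ.+ n) τ₀) (T∣⇒∤v-odd pp p∣T n τ₀)) (T∤b pp p∣T))
         (subst ((π ^ 6 · T ²ℤ) ∣_) (even-rel τ₀ d₀ d₂ refl τ₁ d₁)
           (ℤD.∣m⇒∣m*n ((x ℤ.- z) ³ℤ) (*-mono-∣ (∣⁶ {V} p∣v) ℤD.∣-refl)))
     cases (no p∤T) (yes p∣b) _ (δ₀ d₀ d₁ d₂) = b∣⇒∤v pp p∣b p∤T (1 ℕ.+ n) d₁ p∣v
     cases (no p∤T) (yes p∣b) _ (δ₂ d₀ d₁ d₂) = b∣⇒∤v pp p∣b p∤T (1 ℕ.+ n) d₁ p∣v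
     cases (no p∤T) (yes p∣b) (inj₁ (τ₀ , τ₁)) (δ₁ d₀ d₁ d₂) =
       b-bad pp p∣b p∤T (u-unit (b∣⇒∤v pp p∣b p∤T (2 ℕ.+ n) d₂) (b∣⇒∤v pp p∣b p∤T n d₀))
         (subst (π ^ 8 ∣_) (sextuple-rel τ₀ d₀ d₂ τ₁ d₁)
           (ℤD.∣m⇒∣m*n ((x ℤ.- z) ³ℤ) (ℤD.∣m⇒∣m*n (T ²ℤ) (∣⁸ {V} {b} p∣v p∣b))))
     cases (no p∤T) (yes p∣b) (inj₂ (τ₁ , τ₀)) (δ₁ d₀ d₁ d₂) =
       b-bad pp p∣b p∤T (∤-* pp {u ³ℤ} {T} (u-unit (b∣⇒∤v pp p∣b p∤T (2 ℕ.+ n) d₂) (b∣⇒∤v pp p∣b p∤T n d₀)) p∤T)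
         (subst (π ^ 8 ∣_) (triple-rel τ₁ d₀ d₂ τ₀ d₁)
           (ℤD.∣m⇒∣m*n ((x ℤ.- z) ³ℤ) (∣⁸ {V} {b} p∣v p∣b)))

 integral⇒v-unit : ∀ {n z} → IntegralAt (1 ℕ.+ n) z → ℤ.∣ v (1 ℕ.+ n) ∣ ≡ 1
 integral⇒v-unit {zero}      _   = cong ℤ.∣_∣ v₁
 integral⇒v-unit {suc n} {z} int = no-prime⇒unit (v≢0 (suc n)) λ pp → no-prime pp {n} {z} int

-- 2-adic estimates for sequences and their differences

module DyadicIntegers where

 open import Data.Nat.Primality using (prime[2])
 open import Data.Integer using (+_; _^_)
 open import Data.Integer.Divisibility.Signed using (_∣_; divides)
 open import Data.Rational using (_+_; _-_; _*_; -_)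

 Odd : ℤ → Set
 Odd i = + 2 ∤ i

 Odd-* : ∀ {i j} → Odd i → Odd j → Odd (i · j)
 Odd-* {i} {j} = ∤-* prime[2] {i} {j}

 Odd-≢0 : ∀ {i} → Odd i → i ≢ 0ℤ
 Odd-≢0 h refl = h (divides 0ℤ refl)

 infixl 8 2^_
 2^_ : ℕ → ℤ
 2^ k = (+ 2) ^ k

 -- q lies in 2ᵏ ℤ₍₂₎.
 record Div (k : ℕ) (q : ℚ) : Set where
   constructor div
   field
     num den : ℤ
     den-odd : Odd den
     eq      : q * ι den ≡ ι (2^ k · num)

 Div-+ : ∀ {k p q} → Div k p → Div k q → Div k (p + q)
 Div-+ {k} {p} {q} (div n d o e) (div n′ d′ o′ e′) = div (n · d′ ∔ n′ · d) (d · d′) (Odd-* {d} {d′} o o′) (begin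
   (p + q) * ι (d · d′) ≡⟨ cong ((p + q) *_) (ι-* d d′) ⟩
   (p + q) * (ι d * ι d′) ≡⟨ lem₁ p q (ι d) (ι d′) ⟩
   (p * ι d) * ι d′ + (q * ι d′) * ι d ≡⟨ cong₂ (λ a b → a * ι d′ + b * ι d) e e′ ⟩
   ι (2^ k · n) * ι d′ + ι (2^ k · n′) * ι d
     ≡⟨ sym (trans (ι-+ (2^ k · n · d′) (2^ k · n′ · d)) (cong₂ _+_ (ι-* (2^ k · n) d′) (ι-* (2^ k · n′) d))) ⟩
   ι (2^ k · n · d′ ∔ 2^ k · n′ · d) ≡⟨ cong ι (lem₂ (2^ k) n n′ d d′) ⟩
   ι (2^ k · (n · d′ ∔ n′ · d)) ∎)
   where
   open ≡-Reasoning
   lem₁ : ∀ p q d d′ → (p + q) * (d * d′) ≡ (p * d) * d′ + (q * d′) * d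
   lem₁ = ℚ-solve 4 (λ p q d d′ → (p :+ q) :* (d :* d′) , (p :* d) :* d′ :+ (q :* d′) :* d) refl
   lem₂ : ∀ k n n′ d d′ → k · n · d′ ∔ k · n′ · d ≡ k · (n · d′ ∔ n′ · d)
   lem₂ = ℤ-solve 5 (λ k n n′ d d′ → k :* n :* d′ :+ k :* n′ :* d , k :* (n :* d′ :+ n′ :* d)) refl

 Div-* : ∀ {j k p q} → Div j p → Div k q → Div (j ℕ.+ k) (p * q)
 Div-* {j} {k} {p} {q} (div n d o e) (div n′ d′ o′ e′) = div (n · n′) (d · d′) (Odd-* {d} {d′} o o′) (begin
   p * q * ι (d · d′) ≡⟨ cong (p * q *_) (ι-* d d′) ⟩
   p * q * (ι d * ι d′) ≡⟨ lem₁ p q (ι d) (ι d′) ⟩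
   (p * ι d) * (q * ι d′) ≡⟨ cong₂ _*_ e e′ ⟩
   ι (2^ j · n) * ι (2^ k · n′) ≡⟨ sym (ι-* (2^ j · n) (2^ k · n′)) ⟩
   ι (2^ j · n · (2^ k · n′)) ≡⟨ cong ι (trans (lem₂ (2^ j) n (2^ k) n′) (cong (_· (n · n′)) (sym (ℤₚ.^-distribˡ-+-* (+ 2) j k)))) ⟩
   ι (2^ (j ℕ.+ k) · (n · n′)) ∎)
   where
   open ≡-Reasoning
   lem₁ : ∀ p q d d′ → p * q * (d * d′) ≡ (p * d) * (q * d′)
   lem₁ = ℚ-solve 4 (λ p q d d′ → p :* q :* (d :* d′) , (p :* d) :* (q :* d′)) refl
   lem₂ : ∀ k n k′ n′ → k · n · (k′ · n′) ≡ k · k′ · (n · n′)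
   lem₂ = ℤ-solve 4 (λ k n k′ n′ → k :* n :* (k′ :* n′) , k :* k′ :* (n :* n′)) refl

 Div-neg : ∀ {k q} → Div k q → Div k (- q)
 Div-neg {k} {q} (div n d o e) = div (ℤ.- n) d o (trans (lem₁ q (ι d)) (trans (cong -_ e) (trans (sym (ι-neg (2^ k · n))) (cong ι (lem₂ (2^ k) n)))))
   where
   lem₁ : ∀ q d → - q * d ≡ - (q * d)
   lem₁ = ℚ-solve 2 (λ q d → :- q :* d , :- (q :* d)) refl
   lem₂ : ∀ k n → ℤ.- (k · n) ≡ k · ℤ.- n
   lem₂ = ℤ-solve 2 (λ k n → :- (k :* n) , k :* :- n) refl

 Div-- : ∀ {k p q} → Div k p → Div k q → Div k (p - q)
 Div-- h h′ = Div-+ h (Div-neg h′)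

 2^-mono : ∀ {j k} → j ℕ.≤ k → 2^ j ∣ 2^ k
 2^-mono {j} {k} j≤k = divides (2^ (k ℕ.∸ j)) (trans (cong 2^_ (sym (ℕₚ.m∸n+n≡m j≤k))) (ℤₚ.^-distribˡ-+-* (+ 2) (k ℕ.∸ j) j))

 Div-mono : ∀ {j k q} → j ℕ.≤ k → Div k q → Div j q
 Div-mono {j} {k} j≤k (div n d o e) with 2^-mono j≤k
 ... | divides r e′ = div (r · n) d o (trans e (cong ι (trans (cong (_· n) e′) (lem r (2^ j) n))))
   where
   lem : ∀ r k n → r · k · n ≡ k · (r · n)
   lem = ℤ-solve 3 (λ r k n → r :* k :* n , k :* (r :* n)) refl

 Div-ι : ∀ {k i} → 2^ k ∣ i → Div k (ι i)
 Div-ι {k} {i} (divides r e) = div r 1ℤ (∤-1 prime[2]) (trans (ℚₚ.*-identityʳ (ι i)) (cong ι (trans e (ℤₚ.*-comm r (2^ k)))))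

 ∣2^-cancel : ∀ k {i d} → Odd d → 2^ k ∣ i · d → 2^ k ∣ i
 ∣2^-cancel k {i} {d} o h = ∣-cancel prime[2] k {i} {d} o h

 ι-Div : ∀ {k i} → Div k (ι i) → 2^ k ∣ i
 ι-Div {k} {i} (div n d o e) = ∣2^-cancel k {i} {d} o (divides n (trans (ι-injective (trans (ι-* i d) e)) (ℤₚ.*-comm (2^ k) n)))

 Div-cancel : ∀ {k q r} → Odd r → Div k (q * ι r) → Div k q
 Div-cancel {k} {q} {r} o (div n d o′ e) = div n (r · d) (Odd-* {r} {d} o o′)
   (trans (cong (q *_) (ι-* r d)) (trans (sym (ℚₚ.*-assoc q (ι r) (ι d))) e))

 Div-0 : ∀ {k} → Div k 0ℚ
 Div-0 {k} = Div-ι {k} {0ℤ} (divides 0ℤ refl)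

 Div-1 : Div 0 1ℚ
 Div-1 = Div-ι {0} {1ℤ} (divides 1ℤ refl)

 Seq : Set
 Seq = ℕ → ℚ

 Δ : Seq → Seq
 Δ f j = f (suc j) - f j

 -- The i-th differences of f lie in 2^(c+i) ℤ₍₂₎ for all i ≤ t.
 Adm : ℕ → ℕ → Seq → Set
 Adm zero    c f = ∀ j → Div c (f j)
 Adm (suc t) c f = (∀ j → Div c (f j)) × Adm t (suc c) (Δ f)

 Adm-cong : ∀ t {c f g} → (∀ j → f j ≡ g j) → Adm t c f → Adm t c g
 Adm-cong zero    e h = λ j → subst (Div _) (e j) (h j)
 Adm-cong (suc t) e (h , h′) = (λ j → subst (Div _) (e j) (h j)) , Adm-cong t (λ j → cong₂ _-_ (e (suc j)) (e j)) h′

 Adm-mono : ∀ t {c c′ f} → c′ ℕ.≤ c → Adm t c f → Adm t c′ f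
 Adm-mono zero    le h = λ j → Div-mono le (h j)
 Adm-mono (suc t) le (h , h′) = (λ j → Div-mono le (h j)) , Adm-mono t (ℕ.s≤s le) h′

 Adm-down : ∀ t {c f} → Adm (suc t) c f → Adm t c f
 Adm-down zero    h = proj₁ h
 Adm-down (suc t) (h , h′) = h , Adm-down t h′

 Adm-shift : ∀ t {c f} → Adm t c f → Adm t c (λ j → f (suc j))
 Adm-shift zero    h = λ j → h (suc j)
 Adm-shift (suc t) (h , h′) = (λ j → h (suc j)) , Adm-shift t h′

 Adm-+ : ∀ t {c f g} → Adm t c f → Adm t c g → Adm t c (λ j → f j + g j)
 Adm-+ zero    h h′ = λ j → Div-+ (h j) (h′ j)
 Adm-+ (suc t) {f = f} {g} (h , k) (h′ , k′) = (λ j → Div-+ (h j) (h′ j)) ,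
   Adm-cong t (λ j → lem (f (suc j)) (f j) (g (suc j)) (g j)) (Adm-+ t k k′)
   where
   lem : ∀ a b c d → (a - b) + (c - d) ≡ (a + c) - (b + d)
   lem = ℚ-solve 4 (λ a b c d → (a :- b) :+ (c :- d) , (a :+ c) :- (b :+ d)) refl

 Adm-neg : ∀ t {c f} → Adm t c f → Adm t c (λ j → - f j)
 Adm-neg zero    h = λ j → Div-neg (h j)
 Adm-neg (suc t) {f = f} (h , k) = (λ j → Div-neg (h j)) , Adm-cong t (λ j → lem (f (suc j)) (f j)) (Adm-neg t k)
   where
   lem : ∀ a b → - (a - b) ≡ - a - - b
   lem = ℚ-solve 2 (λ a b → :- (a :- b) , :- a :- :- b) refl

 -- By the Leibniz rule, Δ(f g) is Δf times the shifted g plus f Δg; each summand has one difference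
 -- less to control and one more factor 2.
 Adm-* : ∀ t {c c′ f g} → Adm t c f → Adm t c′ g → Adm t (c ℕ.+ c′) (λ j → f j * g j)
 Adm-* zero    h h′ = λ j → Div-* (h j) (h′ j)
 Adm-* (suc t) {c} {c′} {f} {g} (h , k) (h′ , k′) = (λ j → Div-* (h j) (h′ j)) ,
   Adm-cong t (λ j → lem (f (suc j)) (f j) (g (suc j)) (g j))
     (Adm-+ t (Adm-* t k (Adm-shift t (Adm-down t (h′ , k′))))
              (subst (λ c″ → Adm t c″ (λ j → f j * (g (suc j) - g j))) (ℕₚ.+-suc c c′) (Adm-* t (Adm-down t (h , k)) k′)))
   where
   lem : ∀ a b c d → (a - b) * c + b * (c - d) ≡ a * c - b * d
   lem = ℚ-solve 4 (λ a b c d → (a :- b) :* c :+ b :* (c :- d) , a :* c :- b :* d) refl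

 Adm-const : ∀ t {c q} → Div c q → Adm t c (λ _ → q)
 Adm-const zero    h = λ _ → h
 Adm-const (suc t) {c} {q} h = (λ _ → h) , Adm-cong t (λ _ → sym (ℚₚ.+-inverseʳ q)) (Adm-const t Div-0)

 -- The power with exponent 2^k, as iterated squaring: each squaring is what gains a digit in the
 -- estimates.
 sqs : ℕ → ℚ → ℚ
 sqs zero    q = q
 sqs (suc k) q = sqs k q * sqs k q

 sqs-* : ∀ k p q → sqs k (p * q) ≡ sqs k p * sqs k q
 sqs-* zero    p q = refl
 sqs-* (suc k) p q = trans (cong₂ _*_ (sqs-* k p q) (sqs-* k p q)) (lem (sqs k p) (sqs k q))
   where
   lem : ∀ a b → a * b * (a * b) ≡ a * a * (b * b)
   lem = ℚ-solve 2 (λ a b → a :* b :* (a :* b) , a :* a :* (b :* b)) refl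

 -- Written as a fourth power of a cube, so that its two squarings account for the 2 in the exponent
 -- 2 + μ of `Δtwelfth`.
 twelfth : ℚ → ℚ
 twelfth q = sqs 2 (q * q * q)

 -- The sequence of multiples near a torsion point has 2-adically small differences of all orders.
 module Recursion (U D : Seq) (β : ℚ) (μ u : ℕ) (1≤u : 1 ℕ.≤ u) (u<μ : u ℕ.< μ) (μ≤2u : μ ℕ.≤ u ℕ.+ u)
   (β-small : Div (suc μ) (2ℚ * (2ℚ * β))) (U-small : ∀ j → Div u (U j)) (ΔU-small : ∀ j → Div μ (Δ U j))
   (D-int : ∀ j → Div 0 (D j)) (inverse : ∀ j → (1ℚ - U j) * D j ≡ 1ℚ)
   (recursion : ∀ j → (U (2 ℕ.+ j) + U j) * ((1ℚ - U (suc j)) * (1ℚ - U (suc j))) ≡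
                      2ℚ * (U (suc j) + U (suc j) * U (suc j) + 2ℚ * β)) where

   rhs : Seq
   rhs j = (2ℚ * (3ℚ * (U j * U j)) + 2ℚ * (2ℚ * β) + - (2ℚ * (U j * U j * U j))) * (D j * D j)

   -- A discrete form of ℘″ = 6 ℘². Subtracting 2U(1 - U)² from the recursion cancels the linear
   -- term; what is left, 6U² + 4β - 2U³, lies in 2^(μ+1) because μ ≤ 2u.
   ΔΔU : ∀ j → Δ (Δ U) j ≡ rhs (suc j)
   ΔΔU j = begin
     (U₂ - U₁) - (U₁ - U₀) ≡⟨ lem₁ U₀ U₁ U₂ ⟩
     (U₂ + U₀ - 2ℚ * U₁) * (1ℚ * 1ℚ) ≡⟨ cong (λ z → (U₂ + U₀ - 2ℚ * U₁) * (z * z)) (sym (inverse (suc j))) ⟩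
     (U₂ + U₀ - 2ℚ * U₁) * ((1ℚ - U₁) * d * ((1ℚ - U₁) * d)) ≡⟨ lem₂ (U₂ + U₀) U₁ d ⟩
     ((U₂ + U₀) * ((1ℚ - U₁) * (1ℚ - U₁)) - 2ℚ * U₁ * ((1ℚ - U₁) * (1ℚ - U₁))) * (d * d)
       ≡⟨ cong (λ z → (z - 2ℚ * U₁ * ((1ℚ - U₁) * (1ℚ - U₁))) * (d * d)) (recursion j) ⟩
     (2ℚ * (U₁ + U₁ * U₁ + 2ℚ * β) - 2ℚ * U₁ * ((1ℚ - U₁) * (1ℚ - U₁))) * (d * d) ≡⟨ lem₃ U₁ β d ⟩
     rhs (suc j) ∎
     where
     open ≡-Reasoning
     U₀ = U j
     U₁ = U (suc j)
     U₂ = U (2 ℕ.+ j)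
     d = D (suc j)
     lem₁ : ∀ a b c → (c - b) - (b - a) ≡ (c + a - 2ℚ * b) * (1ℚ * 1ℚ)
     lem₁ = ℚ-solve 3 (λ a b c → (c :- b) :- (b :- a) , (c :+ a :- Κ 2ℚ :* b) :* (Κ 1ℚ :* Κ 1ℚ)) refl
     lem₂ : ∀ s u d → (s - 2ℚ * u) * ((1ℚ - u) * d * ((1ℚ - u) * d)) ≡ (s * ((1ℚ - u) * (1ℚ - u)) - 2ℚ * u * ((1ℚ - u) * (1ℚ - u))) * (d * d)
     lem₂ = ℚ-solve 3 (λ s u d → (s :- Κ 2ℚ :* u) :* ((Κ 1ℚ :- u) :* d :* ((Κ 1ℚ :- u) :* d)) , (s :* ((Κ 1ℚ :- u) :* (Κ 1ℚ :- u)) :- Κ 2ℚ :* u :* ((Κ 1ℚ :- u) :* (Κ 1ℚ :- u))) :* (d :* d)) refl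
     lem₃ : ∀ u β d → (2ℚ * (u + u * u + 2ℚ * β) - 2ℚ * u * ((1ℚ - u) * (1ℚ - u))) * (d * d) ≡
            (2ℚ * (3ℚ * (u * u)) + 2ℚ * (2ℚ * β) + - (2ℚ * (u * u * u))) * (d * d)
     lem₃ = ℚ-solve 3 (λ u β d → (Κ 2ℚ :* (u :+ u :* u :+ Κ 2ℚ :* β) :- Κ 2ℚ :* u :* ((Κ 1ℚ :- u) :* (Κ 1ℚ :- u))) :* (d :* d) , (Κ 2ℚ :* (Κ 3ℚ :* (u :* u)) :+ Κ 2ℚ :* (Κ 2ℚ :* β) :+ :- (Κ 2ℚ :* (u :* u :* u))) :* (d :* d)) refl

   2-Div : Div 1 2ℚ
   2-Div = Div-ι {1} {+ 2} (divides 1ℤ refl)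
   3-Div : Div 0 3ℚ
   3-Div = Div-ι {0} {+ 3} (divides (+ 3) refl)

   -- Since `D` inverts 1 - U, its difference is the product of two consecutive values of `D` and
   -- ΔU, which reduces the order t + 1 to the order t.
   D-adm : ∀ t → Adm t u U → Adm t 0 D
   D-adm zero    _ = D-int
   D-adm (suc t) (h , k) = D-int , Adm-cong t ΔD≡
       (Adm-mono t (ℕ.s≤s ℕ.z≤n) (Adm-* t {0} {suc u} (Adm-* t {0} {0} (Adm-shift t D-t) D-t) k))
     where
     D-t = D-adm t (Adm-down t (h , k))
     ΔD≡ : ∀ j → D (suc j) * D j * (U (suc j) - U j) ≡ D (suc j) - D j
     ΔD≡ j = trans (lem₁ (D (suc j)) (D j) (U (suc j)) (U j))
       (trans (cong₂ (λ a b → D (suc j) * a - D j * b) (inverse j) (inverse (suc j))) (lem₂ (D (suc j)) (D j)))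
       where
       lem₁ : ∀ d′ d u′ u → d′ * d * (u′ - u) ≡ d′ * ((1ℚ - u) * d) - d * ((1ℚ - u′) * d′)
       lem₁ = ℚ-solve 4 (λ d′ d u′ u → d′ :* d :* (u′ :- u) , d′ :* ((Κ 1ℚ :- u) :* d) :- d :* ((Κ 1ℚ :- u′) :* d′)) refl
       lem₂ : ∀ d′ d → d′ * 1ℚ - d * 1ℚ ≡ d′ - d
       lem₂ = ℚ-solve 2 (λ d′ d → d′ :* Κ 1ℚ :- d :* Κ 1ℚ , d′ :- d) refl

   rhs-adm : ∀ t → Adm t u U → Adm t (suc μ) rhs
   rhs-adm t h = subst (λ c → Adm t c rhs) (ℕₚ.+-identityʳ (suc μ)) (Adm-* t
       (Adm-+ t (Adm-+ t (Adm-mono t le₁ (Adm-* t (Adm-const t 2-Div) (Adm-* t {0} (Adm-const t 3-Div) hh)))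
                         (Adm-const t β-small))
                (Adm-neg t (Adm-mono t le₂ (Adm-* t (Adm-const t 2-Div) (Adm-* t hh h)))))
       (Adm-* t {0} {0} (D-adm t h) (D-adm t h)))
     where
     hh : Adm t (u ℕ.+ u) (λ j → U j * U j)
     hh = Adm-* t h h
     le₁ : suc μ ℕ.≤ suc (u ℕ.+ u)
     le₁ = ℕ.s≤s μ≤2u
     le₂ : suc μ ℕ.≤ suc (u ℕ.+ u ℕ.+ u)
     le₂ = ℕ.s≤s (ℕₚ.≤-trans μ≤2u (ℕₚ.m≤m+n (u ℕ.+ u) u))

   -- A bootstrap: control of U to order t gives control of `rhs`, that is of ΔΔU, to the same
   -- order, which is one order more for ΔU. The inequality u < μ passes the gain on to U.
   ΔU-adm : ∀ t → Adm t μ (Δ U)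
   U-adm : ∀ t → Adm t u U
   U-adm zero = U-small
   U-adm (suc t) = U-small , Adm-mono t u<μ (ΔU-adm t)
   ΔU-adm zero = ΔU-small
   ΔU-adm (suc t) = ΔU-small , Adm-cong t (λ j → sym (ΔΔU j)) (Adm-shift t (rhs-adm t (Adm-down t (U-small , Adm-mono t u<μ (ΔU-adm t)))))

   -- Δ(g²) = Δg (2g + Δg), and the second factor is divisible by 2 because m ≥ 1.
   sq-adm : ∀ t {m g} → 1 ℕ.≤ m → (∀ t → Adm t 0 g) → Adm t m (Δ g) → Adm t (suc m) (Δ (λ j → g j * g j))
   sq-adm t {m} {g} 1≤m gh h = Adm-cong t (λ j → lem (g (suc j)) (g j))
       (subst (λ c → Adm t c (λ j → (g (suc j) - g j) * (2ℚ * g j + (g (suc j) - g j)))) (ℕₚ.+-comm m 1)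
         (Adm-* t h (Adm-+ t (Adm-* t (Adm-const t 2-Div) (gh t)) (Adm-mono t 1≤m h))))
     where
     lem : ∀ a b → (a - b) * (2ℚ * b + (a - b)) ≡ a * a - b * b
     lem = ℚ-solve 2 (λ a b → (a :- b) :* (Κ 2ℚ :* b :+ (a :- b)) , a :* a :- b :* b) refl

   cube-adm : ∀ t {m g} → (∀ t → Adm t 0 g) → Adm t m (Δ g) → Adm t m (Δ (λ j → g j * g j * g j))
   cube-adm t {m} {g} gh h = Adm-cong t (λ j → lem (g (suc j)) (g j))
       (subst (λ c → Adm t c (λ j → (g (suc j) - g j) * (g (suc j) * g (suc j) + g (suc j) * g j + g j * g j))) (ℕₚ.+-identityʳ m)
         (Adm-* t h (Adm-+ t (Adm-+ t (Adm-* t {0} {0} gs gs) (Adm-* t {0} {0} gs (gh t))) (Adm-* t {0} {0} (gh t) (gh t)))))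
     where
     gs = Adm-shift t (gh t)
     lem : ∀ a b → (a - b) * (a * a + a * b + b * b) ≡ a * a * a - b * b * b
     lem = ℚ-solve 2 (λ a b → (a :- b) :* (a :* a :+ a :* b :+ b :* b) , a :* a :* a :- b :* b :* b) refl

   1-U : Seq
   1-U j = 1ℚ - U j

   1-U-adm : ∀ t → Adm t 0 1-U
   1-U-adm t = Adm-+ t (Adm-const t Div-1) (Adm-neg t (Adm-mono t ℕ.z≤n (U-adm t)))

   Δ1-U-adm : ∀ t → Adm t μ (Δ 1-U)
   Δ1-U-adm t = Adm-cong t (λ j → lem (U (suc j)) (U j)) (Adm-neg t (ΔU-adm t))
     where
     lem : ∀ a b → - (a - b) ≡ (1ℚ - a) - (1ℚ - b)
     lem = ℚ-solve 2 (λ a b → :- (a :- b) , (Κ 1ℚ :- a) :- (Κ 1ℚ :- b)) refl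

   twelfth-0 : ∀ t → Adm t 0 (λ j → twelfth (1-U j))
   twelfth-0 t = sq (sq (Adm-* t {0} {0} (Adm-* t {0} {0} h h) h))
     where
     h = 1-U-adm t
     sq : ∀ {g} → Adm t 0 g → Adm t 0 (λ j → g j * g j)
     sq h = Adm-* t {0} {0} h h

   Δtwelfth : ∀ t → Adm t (2 ℕ.+ μ) (Δ (λ j → twelfth (1-U j)))
   Δtwelfth t = sq-adm t (ℕ.s≤s ℕ.z≤n) sq₁ (sq-adm t 1≤μ cu (cube-adm t 1-U-adm (Δ1-U-adm t)))
     where
     1≤μ = ℕₚ.≤-trans 1≤u (ℕₚ.<⇒≤ u<μ)
     cu : ∀ t → Adm t 0 (λ j → 1-U j * 1-U j * 1-U j)
     cu t = Adm-* t {0} {0} (Adm-* t {0} {0} (1-U-adm t) (1-U-adm t)) (1-U-adm t)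
     sq₁ : ∀ t → Adm t 0 (λ j → sqs 1 (1-U j * 1-U j * 1-U j))
     sq₁ t = Adm-* t {0} {0} (cu t) (cu t)

   -- (1 - U)^(12 · 2^K), which up to a constant factor will be the ratio f(j+1) f(j-1) / f(j)² of
   -- the 2^K-th powers of F.
   ε : ℕ → Seq
   ε K j = sqs K (twelfth (1-U j))

   ε-0 : ∀ K t → Adm t 0 (ε K)
   ε-0 zero    t = twelfth-0 t
   ε-0 (suc K) t = Adm-* t {0} {0} (ε-0 K t) (ε-0 K t)

   Δε : ∀ K t → Adm t (2 ℕ.+ μ ℕ.+ K) (Δ (ε K))
   Δε zero    t = subst (λ c → Adm t c (Δ (ε 0))) (sym (ℕₚ.+-identityʳ (2 ℕ.+ μ))) (Δtwelfth t)
   Δε (suc K) t = subst (λ c → Adm t c (Δ (ε (suc K)))) (sym (ℕₚ.+-suc (2 ℕ.+ μ) K)) (sq-adm t (ℕ.s≤s ℕ.z≤n) (ε-0 K) (Δε K t))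

 sq-near-1 : ∀ {m q} → 1 ℕ.≤ m → Div m (q - 1ℚ) → Div (suc m) (q * q - 1ℚ)
 sq-near-1 {m} {q} 1≤m h = subst (Div (suc m)) (lem q)
     (Div-+ (Div-mono (ℕₚ.+-monoˡ-≤ m 1≤m) (Div-* h h)) (Div-* {1} {m} (Div-ι {1} {+ 2} (divides 1ℤ refl)) h))
   where
   lem : ∀ q → (q - 1ℚ) * (q - 1ℚ) + 2ℚ * (q - 1ℚ) ≡ q * q - 1ℚ
   lem = ℚ-solve 1 (λ q → (q :- Κ 1ℚ) :* (q :- Κ 1ℚ) :+ Κ 2ℚ :* (q :- Κ 1ℚ) , q :* q :- Κ 1ℚ) refl

 sqs-near-1 : ∀ K {m q} → 1 ℕ.≤ m → Div m (q - 1ℚ) → Div (K ℕ.+ m) (sqs K q - 1ℚ)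
 sqs-near-1 zero    {m} {q} 1≤m h = h
 sqs-near-1 (suc K) {m} {q} 1≤m h = sq-near-1 {K ℕ.+ m} {sqs K q} (ℕₚ.≤-trans 1≤m (ℕₚ.m≤n+m m K)) (sqs-near-1 K {m} {q} 1≤m h)

 mul-near-1 : ∀ {m p q} → Div m (p - 1ℚ) → Div m (q - 1ℚ) → Div m (p * q - 1ℚ)
 mul-near-1 {m} {p} {q} h h′ = subst (Div m) (lem p q)
     (Div-+ (Div-+ (Div-mono (ℕₚ.m≤m+n m m) (Div-* h h′)) h) h′)
   where
   lem : ∀ p q → (p - 1ℚ) * (q - 1ℚ) + (p - 1ℚ) + (q - 1ℚ) ≡ p * q - 1ℚ
   lem = ℚ-solve 2 (λ p q → (p :- Κ 1ℚ) :* (q :- Κ 1ℚ) :+ (p :- Κ 1ℚ) :+ (q :- Κ 1ℚ) , p :* q :- Κ 1ℚ) refl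

 -- p = 1 + l to first order.
 record Lin (K : ℕ) (p l : ℚ) : Set where
   constructor lin
   field
     small : Div K l
     close : Div (K ℕ.+ K) (p - 1ℚ - l)

 Lin-* : ∀ {K p q l m} → Lin K p l → Lin K q m → Lin K (p * q) (l + m)
 Lin-* {K} {p} {q} {l} {m} (lin h₁ h₂) (lin k₁ k₂) = lin (Div-+ h₁ k₁) (subst (Div (K ℕ.+ K)) (lem p q l m)
     (Div-+ (Div-+ (Div-* {K} {K} h₁ k₁) (weak (Div-* h₂ q-int))) (weak (Div-* k₂ (Div-+ Div-1 (Div-mono ℕ.z≤n h₁))))))
   where
   weak : ∀ {z} → Div (K ℕ.+ K ℕ.+ 0) z → Div (K ℕ.+ K) z
   weak {z} = subst (λ k → Div k z) (ℕₚ.+-identityʳ (K ℕ.+ K))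
   lem′ : ∀ q m → (q - 1ℚ - m) + (m + 1ℚ) ≡ q
   lem′ = ℚ-solve 2 (λ q m → (q :- Κ 1ℚ :- m) :+ (m :+ Κ 1ℚ) , q) refl
   q-int : Div 0 q
   q-int = subst (Div 0) (lem′ q m) (Div-+ (Div-mono ℕ.z≤n k₂) (Div-+ (Div-mono ℕ.z≤n k₁) Div-1))
   lem : ∀ p q l m → l * m + (p - 1ℚ - l) * q + (q - 1ℚ - m) * (1ℚ + l) ≡ p * q - 1ℚ - (l + m)
   lem = ℚ-solve 4 (λ p q l m → l :* m :+ (p :- Κ 1ℚ :- l) :* q :+ (q :- Κ 1ℚ :- m) :* (Κ 1ℚ :+ l) , p :* q :- Κ 1ℚ :- (l :+ m)) refl

 lin-refl : ∀ {K} p → Div K (p - 1ℚ) → Lin K p (p - 1ℚ)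
 lin-refl {K} p h = lin h (subst (Div (K ℕ.+ K)) (sym (ℚₚ.+-inverseʳ (p - 1ℚ))) Div-0)

 Δⁿ : ℕ → Seq → Seq
 Δⁿ zero    f = f
 Δⁿ (suc i) f = Δⁿ i (Δ f)

 Δⁿ-cong : ∀ i {f g} → (∀ j → f j ≡ g j) → ∀ j → Δⁿ i f j ≡ Δⁿ i g j
 Δⁿ-cong zero    e = e
 Δⁿ-cong (suc i) e = Δⁿ-cong i (λ j → cong₂ _-_ (e (suc j)) (e j))

 Δⁿ-+ : ∀ i f g j → Δⁿ i (λ j → f j + g j) j ≡ Δⁿ i f j + Δⁿ i g j
 Δⁿ-+ zero    f g j = refl
 Δⁿ-+ (suc i) f g j = trans (Δⁿ-cong i (λ j → lem (f (suc j)) (g (suc j)) (f j) (g j)) j) (Δⁿ-+ i (Δ f) (Δ g) j)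
   where
   lem : ∀ a b c d → (a + b) - (c + d) ≡ (a - c) + (b - d)
   lem = ℚ-solve 4 (λ a b c d → (a :+ b) :- (c :+ d) , (a :- c) :+ (b :- d)) refl

 Adm⇒Div : ∀ i {c f} → Adm i c f → ∀ j → Div (c ℕ.+ i) (Δⁿ i f j)
 Adm⇒Div zero    {c} {f} h j = subst (λ k → Div k (f j)) (sym (ℕₚ.+-identityʳ c)) (h j)
 Adm⇒Div (suc i) {c} {f} (_ , h) j = subst (λ k → Div k (Δⁿ i (Δ f) j)) (sym (ℕₚ.+-suc c i)) (Adm⇒Div i h j)

 Δⁿ-Div : ∀ i {k f} → (∀ j → Div k (f j)) → ∀ j → Div k (Δⁿ i f j)
 Δⁿ-Div zero    h = h
 Δⁿ-Div (suc i) h = Δⁿ-Div i (λ j → Div-- (h (suc j)) (h j))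

 Δℤ : (ℕ → ℤ) → ℕ → ℤ
 Δℤ f j = f (suc j) ℤ.- f j

 Δℤⁿ : ℕ → (ℕ → ℤ) → ℕ → ℤ
 Δℤⁿ zero    f = f
 Δℤⁿ (suc i) f = Δℤⁿ i (Δℤ f)

 ι-Δⁿ : ∀ i f j → ι (Δℤⁿ i f j) ≡ Δⁿ i (λ j → ι (f j)) j
 ι-Δⁿ zero    f j = refl
 ι-Δⁿ (suc i) f j = trans (ι-Δⁿ i (Δℤ f) j) (Δⁿ-cong i (λ j → ι-- (f (suc j)) (f j)) j)

 sqsℤ : ℕ → ℤ → ℤ
 sqsℤ zero    i = i
 sqsℤ (suc k) i = sqsℤ k i · sqsℤ k i

 ι-sqs : ∀ k i → ι (sqsℤ k i) ≡ sqs k (ι i)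
 ι-sqs zero    i = refl
 ι-sqs (suc k) i = trans (ι-* (sqsℤ k i) (sqsℤ k i)) (cong₂ _*_ (ι-sqs k i) (ι-sqs k i))

 -- `ratios` says that the multiplicative third difference of F is the multiplicative first
 -- difference of (1 - U)¹²; the constant of proportionality has dropped out. All 2^K-th powers are
 -- 1 modulo 2^K, so modulo 2^(2K) products become sums and Δ³f agrees with Δε. This is the source
 -- of the two bounds in `third-difference`: one for Δε, one for the linearisation error.
 module ThirdDifference (U D : Seq) (β : ℚ) (μ u : ℕ) (1≤u : 1 ℕ.≤ u) (u<μ : u ℕ.< μ) (μ≤2u : μ ℕ.≤ u ℕ.+ u)
   (β-small : Div (suc μ) (2ℚ * (2ℚ * β))) (U-small : ∀ j → Div u (U j)) (ΔU-small : ∀ j → Div μ (Δ U j))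
   (D-int : ∀ j → Div 0 (D j)) (inverse : ∀ j → (1ℚ - U j) * D j ≡ 1ℚ)
   (recursion : ∀ j → (U (2 ℕ.+ j) + U j) * ((1ℚ - U (suc j)) * (1ℚ - U (suc j))) ≡
                      2ℚ * (U (suc j) + U (suc j) * U (suc j) + 2ℚ * β))
   (F : ℕ → ℤ) (F-odd : ∀ j → + 2 ∣ F j ℤ.- 1ℤ)
   (ratios : ∀ j → ι (F (3 ℕ.+ j)) * (ι (F (1 ℕ.+ j)) * ι (F (1 ℕ.+ j)) * ι (F (1 ℕ.+ j))) * twelfth (1ℚ - U (1 ℕ.+ j)) ≡
                   ι (F j) * (ι (F (2 ℕ.+ j)) * ι (F (2 ℕ.+ j)) * ι (F (2 ℕ.+ j))) * twelfth (1ℚ - U (2 ℕ.+ j)))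
   (K : ℕ) where

   open Recursion U D β μ u 1≤u u<μ μ≤2u β-small U-small ΔU-small D-int inverse recursion

   f : Seq
   f j = sqs K (ι (F j))

   near : ∀ {q} → Div 1 (q - 1ℚ) → Div K (sqs K q - 1ℚ)
   near {q} h = Div-mono (ℕₚ.m≤m+n K 1) (sqs-near-1 K {1} {q} ℕₚ.≤-refl h)

   f-near : ∀ j → Div K (f j - 1ℚ)
   f-near j = near {ι (F j)} (subst (Div 1) (ι-- (F j) 1ℤ) (Div-ι (subst (_∣ F j ℤ.- 1ℤ) (sym (ℤₚ.*-identityʳ (+ 2))) (F-odd j))))

   ε-near : ∀ j → Div K (ε K j - 1ℚ)
   ε-near j = near {twelfth (1-U j)} (Div-mono {1} {3} (ℕ.s≤s ℕ.z≤n) (sqs-near-1 2 {1} {1-U j * 1-U j * 1-U j} ℕₚ.≤-refl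
     (mul-near-1 {1} {1-U j * 1-U j} {1-U j} (mul-near-1 {1} {1-U j} {1-U j} h h) h)))
     where
     lem : ∀ u → - u ≡ (1ℚ - u) - 1ℚ
     lem = ℚ-solve 1 (λ u → :- u , (Κ 1ℚ :- u) :- Κ 1ℚ) refl
     h : Div 1 (1-U j - 1ℚ)
     h = subst (Div 1) (lem (U j)) (Div-neg (Div-mono 1≤u (U-small j)))

   ratios′ : ∀ j → f (3 ℕ.+ j) * (f (1 ℕ.+ j) * f (1 ℕ.+ j) * f (1 ℕ.+ j)) * ε K (1 ℕ.+ j) ≡
                   f j * (f (2 ℕ.+ j) * f (2 ℕ.+ j) * f (2 ℕ.+ j)) * ε K (2 ℕ.+ j)
   ratios′ j = trans (sym (split (ι (F (3 ℕ.+ j))) (ι (F (1 ℕ.+ j))) (twelfth (1-U (1 ℕ.+ j)))))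
     (trans (cong (sqs K) (ratios j)) (split (ι (F j)) (ι (F (2 ℕ.+ j))) (twelfth (1-U (2 ℕ.+ j)))))
     where
     split : ∀ p q r → sqs K (p * (q * q * q) * r) ≡ sqs K p * (sqs K q * sqs K q * sqs K q) * sqs K r
     split p q r = trans (sqs-* K (p * (q * q * q)) r) (cong (_* sqs K r) (trans (sqs-* K p (q * q * q))
       (cong (sqs K p *_) (trans (sqs-* K (q * q) q) (cong (_* sqs K q) (sqs-* K q q))))))

   error : Seq
   error j = Δ (Δ (Δ f)) j - Δ (ε K) (suc j)

   error-small : ∀ j → Div (K ℕ.+ K) (error j)
   error-small j = subst (Div (K ℕ.+ K)) (lem (f (3 ℕ.+ j)) (f (2 ℕ.+ j)) (f (1 ℕ.+ j)) (f j) (ε K (1 ℕ.+ j)) (ε K (2 ℕ.+ j))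
       (f (3 ℕ.+ j) * (f (1 ℕ.+ j) * f (1 ℕ.+ j) * f (1 ℕ.+ j)) * ε K (1 ℕ.+ j)) (f j * (f (2 ℕ.+ j) * f (2 ℕ.+ j) * f (2 ℕ.+ j)) * ε K (2 ℕ.+ j)) (ratios′ j))
       (Div-- (Lin.close R) (Lin.close L))
     where
     l : ∀ j → Lin K (f j) (f j - 1ℚ)
     l j = lin-refl (f j) (f-near j)
     cubeL : ∀ j → Lin K (f j * f j * f j) ((f j - 1ℚ) + (f j - 1ℚ) + (f j - 1ℚ))
     cubeL j = Lin-* {K} {f j * f j} {f j} (Lin-* {K} {f j} {f j} (l j) (l j)) (l j)
     side : ∀ i j k → Lin K (f i * (f j * f j * f j) * ε K k) (f i - 1ℚ + ((f j - 1ℚ) + (f j - 1ℚ) + (f j - 1ℚ)) + (ε K k - 1ℚ))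
     side i j k = Lin-* {K} {f i * (f j * f j * f j)} {ε K k} (Lin-* {K} {f i} {f j * f j * f j} (l i) (cubeL j)) (lin-refl (ε K k) (ε-near k))
     L = side (3 ℕ.+ j) (1 ℕ.+ j) (1 ℕ.+ j)
     R = side j (2 ℕ.+ j) (2 ℕ.+ j)
     lem₀ : ∀ f₃ f₂ f₁ f₀ e₁ e₂ P →
       (P - 1ℚ - ((f₀ - 1ℚ) + ((f₂ - 1ℚ) + (f₂ - 1ℚ) + (f₂ - 1ℚ)) + (e₂ - 1ℚ))) -
       (P - 1ℚ - ((f₃ - 1ℚ) + ((f₁ - 1ℚ) + (f₁ - 1ℚ) + (f₁ - 1ℚ)) + (e₁ - 1ℚ))) ≡
       ((f₃ - f₂) - (f₂ - f₁)) - ((f₂ - f₁) - (f₁ - f₀)) - (e₂ - e₁)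
     lem₀ = ℚ-solve 7 (λ f₃ f₂ f₁ f₀ e₁ e₂ P → (P :- Κ 1ℚ :- ((f₀ :- Κ 1ℚ) :+ ((f₂ :- Κ 1ℚ) :+ (f₂ :- Κ 1ℚ) :+ (f₂ :- Κ 1ℚ)) :+ (e₂ :- Κ 1ℚ))) :- (P :- Κ 1ℚ :- ((f₃ :- Κ 1ℚ) :+ ((f₁ :- Κ 1ℚ) :+ (f₁ :- Κ 1ℚ) :+ (f₁ :- Κ 1ℚ)) :+ (e₁ :- Κ 1ℚ))) , ((f₃ :- f₂) :- (f₂ :- f₁)) :- ((f₂ :- f₁) :- (f₁ :- f₀)) :- (e₂ :- e₁)) refl
     lem : ∀ f₃ f₂ f₁ f₀ e₁ e₂ P Q → P ≡ Q →
       (Q - 1ℚ - ((f₀ - 1ℚ) + ((f₂ - 1ℚ) + (f₂ - 1ℚ) + (f₂ - 1ℚ)) + (e₂ - 1ℚ))) -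
       (P - 1ℚ - ((f₃ - 1ℚ) + ((f₁ - 1ℚ) + (f₁ - 1ℚ) + (f₁ - 1ℚ)) + (e₁ - 1ℚ))) ≡
       ((f₃ - f₂) - (f₂ - f₁)) - ((f₂ - f₁) - (f₁ - f₀)) - (e₂ - e₁)
     lem f₃ f₂ f₁ f₀ e₁ e₂ P _ refl = lem₀ f₃ f₂ f₁ f₀ e₁ e₂ P

   third-difference : ∀ e i j → e ℕ.≤ 2 ℕ.+ μ ℕ.+ K ℕ.+ i → e ℕ.≤ K ℕ.+ K → 2^ e ∣ Δℤⁿ (3 ℕ.+ i) (λ j → sqsℤ K (F j)) j
   third-difference e i j h h′ = ι-Div (subst (Div e) (sym (begin
       ι (Δℤⁿ (3 ℕ.+ i) (λ j → sqsℤ K (F j)) j) ≡⟨ ι-Δⁿ (3 ℕ.+ i) (λ j → sqsℤ K (F j)) j ⟩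
       Δⁿ (3 ℕ.+ i) (λ j → ι (sqsℤ K (F j))) j ≡⟨ Δⁿ-cong (3 ℕ.+ i) (λ j → ι-sqs K (F j)) j ⟩
       Δⁿ i (Δ (Δ (Δ f))) j ≡⟨ Δⁿ-cong i (λ j → lem (Δ (Δ (Δ f)) j) (Δ (ε K) (suc j))) j ⟩
       Δⁿ i (λ j → Δ (ε K) (suc j) + error j) j ≡⟨ Δⁿ-+ i (λ j → Δ (ε K) (suc j)) error j ⟩
       Δⁿ i (λ j → Δ (ε K) (suc j)) j + Δⁿ i error j ∎))
       (Div-+ (Div-mono h (Adm⇒Div i (Adm-shift i (Δε K i)) j)) (Div-mono h′ (Δⁿ-Div i error-small j))))
     where
     open ≡-Reasoning
     lem : ∀ a b → a ≡ b + (a - b)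
     lem = ℚ-solve 2 (λ a b → a , b :+ (a :- b)) refl

-- Newton interpolation and a functional that annihilates quadratics

module Newton where

 open Indices using (dbl; dbl≡; even⊎odd)
 open DyadicIntegers using (Odd; Odd-*; 2^_; 2^-mono; ∣2^-cancel; Δℤ; Δℤⁿ)
 open import Data.Nat.Induction using (<-rec)
 open import Data.Nat.Primality using (prime[2])
 open import Data.Integer using (+_)
 open import Data.Integer.Divisibility.Signed using (_∣_; divides)

 ∑ : ℕ → (ℕ → ℤ) → ℤ
 ∑ zero    g = 0ℤ
 ∑ (suc n) g = g 0 ∔ ∑ n (λ i → g (suc i))

 ∑-cong : ∀ n {g h} → (∀ i → g i ≡ h i) → ∑ n g ≡ ∑ n h
 ∑-cong zero    e = refl
 ∑-cong (suc n) e = cong₂ _∔_ (e 0) (∑-cong n (λ i → e (suc i)))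

 ∑-0 : ∀ n {g} → (∀ i → g i ≡ 0ℤ) → ∑ n g ≡ 0ℤ
 ∑-0 zero    e = refl
 ∑-0 (suc n) e = cong₂ _∔_ (e 0) (∑-0 n (λ i → e (suc i)))

 ∑-+ : ∀ n g h → ∑ n (λ i → g i ∔ h i) ≡ ∑ n g ∔ ∑ n h
 ∑-+ zero    g h = refl
 ∑-+ (suc n) g h = trans (cong (λ z → g 0 ∔ h 0 ∔ z) (∑-+ n (λ i → g (suc i)) (λ i → h (suc i)))) (lem (g 0) (h 0) (∑ n (λ i → g (suc i))) (∑ n (λ i → h (suc i))))
   where
   lem : ∀ a b c d → a ∔ b ∔ (c ∔ d) ≡ a ∔ c ∔ (b ∔ d)
   lem = ℤ-solve 4 (λ a b c d → a :+ b :+ (c :+ d) , a :+ c :+ (b :+ d)) refl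

 ∑-* : ∀ n z g → z · ∑ n g ≡ ∑ n (λ i → z · g i)
 ∑-* zero    z g = ℤₚ.*-zeroʳ z
 ∑-* (suc n) z g = trans (ℤₚ.*-distribˡ-+ z (g 0) _) (cong (λ r → z · g 0 ∔ r) (∑-* n z (λ i → g (suc i))))

 ∑-∣ : ∀ n {k g} → (∀ i → k ∣ g i) → k ∣ ∑ n g
 ∑-∣ zero    h = divides 0ℤ refl
 ∑-∣ (suc n) h = ℤD.∣m∣n⇒∣m+n (h 0) (∑-∣ n (λ i → h (suc i)))

 bin : ℕ → ℕ → ℤ
 bin j       zero    = 1ℤ
 bin zero    (suc i) = 0ℤ
 bin (suc j) (suc i) = bin j i ∔ bin j (suc i)

 -- The forward-difference formula. The length `L` only has to exceed j, so values at several points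
 -- can be expanded to a common length and combined term by term.
 newton : ∀ j L f → j ℕ.< L → f j ≡ ∑ L (λ i → bin j i · Δℤⁿ i f 0)
 newton zero (suc L) f _ = sym (trans (cong₂ _∔_ (ℤₚ.*-identityˡ (f 0)) (∑-0 L (λ i → ℤₚ.*-zeroˡ (Δℤⁿ i (Δℤ f) 0)))) (ℤₚ.+-identityʳ (f 0)))
 newton (suc j) (suc L) f (ℕ.s≤s j<L) = begin
   f (suc j) ≡⟨ lem₁ (f (suc j)) (f j) ⟩
   f j ∔ Δℤ f j ≡⟨ cong₂ _∔_ (newton j (suc L) f (ℕₚ.m≤n⇒m≤1+n j<L)) (newton j L (Δℤ f) j<L) ⟩
   (1ℤ · f 0 ∔ ∑ L (λ i → bin j (suc i) · D i)) ∔ ∑ L (λ i → bin j i · D i)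
     ≡⟨ trans (ℤₚ.+-assoc (1ℤ · f 0) (∑ L (λ i → bin j (suc i) · D i)) (∑ L (λ i → bin j i · D i)))
          (cong (λ z → 1ℤ · f 0 ∔ z) (sym (∑-+ L (λ i → bin j (suc i) · D i) (λ i → bin j i · D i)))) ⟩
   1ℤ · f 0 ∔ ∑ L (λ i → bin j (suc i) · D i ∔ bin j i · D i)
     ≡⟨ cong (λ z → 1ℤ · f 0 ∔ z) (∑-cong L (λ i → lem₂ (bin j (suc i)) (bin j i) (D i))) ⟩
   1ℤ · f 0 ∔ ∑ L (λ i → (bin j i ∔ bin j (suc i)) · D i) ∎
   where
   open ≡-Reasoning
   D : ℕ → ℤ
   D i = Δℤⁿ i (Δℤ f) 0
   lem₁ : ∀ a b → a ≡ b ∔ (a ℤ.- b)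
   lem₁ = ℤ-solve 2 (λ a b → a , b :+ (a :- b)) refl
   lem₂ : ∀ a b c → a · c ∔ b · c ≡ (b ∔ a) · c
   lem₂ = ℤ-solve 3 (λ a b c → a :* c :+ b :* c , (b :+ a) :* c) refl

 fact : ℕ → ℤ
 fact zero    = 1ℤ
 fact (suc i) = + suc i · fact i

 fall : ℤ → ℕ → ℤ
 fall x zero    = 1ℤ
 fall x (suc i) = fall x i · (x ℤ.- + i)

 fall-suc : ∀ x i → fall (1ℤ ∔ x) (suc i) ≡ (1ℤ ∔ x) · fall x i
 fall-suc x zero = lem x
   where
   lem : ∀ x → 1ℤ · (1ℤ ∔ x ℤ.- 0ℤ) ≡ (1ℤ ∔ x) · 1ℤ
   lem = ℤ-solve 1 (λ x → Κ 1ℤ :* (Κ 1ℤ :+ x :- Κ 0ℤ) , (Κ 1ℤ :+ x) :* Κ 1ℤ) refl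
 fall-suc x (suc i) = trans (cong (_· (1ℤ ∔ x ℤ.- + suc i)) (fall-suc x i)) (lem x (fall x i) (+ i))
   where
   lem : ∀ x p i → (1ℤ ∔ x) · p · (1ℤ ∔ x ℤ.- (1ℤ ∔ i)) ≡ (1ℤ ∔ x) · (p · (x ℤ.- i))
   lem = ℤ-solve 3 (λ x p i → (Κ 1ℤ :+ x) :* p :* (Κ 1ℤ :+ x :- (Κ 1ℤ :+ i)) , (Κ 1ℤ :+ x) :* (p :* (x :- i))) refl

 fact-bin : ∀ j i → fact i · bin j i ≡ fall (+ j) i
 fact-bin j zero = refl
 fact-bin zero (suc i) = trans (ℤₚ.*-zeroʳ (fact (suc i))) (sym (fall-0 i))
   where
   fall-0 : ∀ i → fall 0ℤ (suc i) ≡ 0ℤ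
   fall-0 zero = refl
   fall-0 (suc i) = trans (cong (_· (0ℤ ℤ.- + suc i)) (fall-0 i)) (ℤₚ.*-zeroˡ (0ℤ ℤ.- + suc i))
 fact-bin (suc j) (suc i) = begin
   + suc i · fact i · (bin j i ∔ bin j (suc i)) ≡⟨ lem₁ (+ suc i) (fact i) (bin j i) (bin j (suc i)) ⟩
   + suc i · (fact i · bin j i) ∔ fact (suc i) · bin j (suc i) ≡⟨ cong₂ (λ p q → + suc i · p ∔ q) (fact-bin j i) (fact-bin j (suc i)) ⟩
   + suc i · fall (+ j) i ∔ fall (+ j) i · (+ j ℤ.- + i) ≡⟨ lem₂ (+ i) (+ j) (fall (+ j) i) ⟩
   (1ℤ ∔ + j) · fall (+ j) i ≡⟨ sym (fall-suc (+ j) i) ⟩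
   fall (1ℤ ∔ + j) (suc i) ∎
   where
   open ≡-Reasoning
   lem₁ : ∀ s p q r → s · p · (q ∔ r) ≡ s · (p · q) ∔ s · p · r
   lem₁ = ℤ-solve 4 (λ s p q r → s :* p :* (q :+ r) , s :* (p :* q) :+ s :* p :* r) refl
   lem₂ : ∀ i j p → (1ℤ ∔ i) · p ∔ p · (j ℤ.- i) ≡ (1ℤ ∔ j) · p
   lem₂ = ℤ-solve 3 (λ i j p → (Κ 1ℤ :+ i) :* p :+ p :* (j :- i) , (Κ 1ℤ :+ j) :* p) refl

 odd-dbl : ∀ k → Odd (+ suc (dbl k 0))
 odd-dbl k h = ∤-1 prime[2] (subst (+ 2 ∣_) (lem (+ dbl k 0)) (ℤD.∣m∣n⇒∣m-n h (even k)))
   where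
   even : ∀ k → + 2 ∣ + dbl k 0
   even k = divides (+ k) (trans (cong +_ (trans (dbl≡ k 0) (trans (ℕₚ.+-identityʳ (k ℕ.+ k)) (trans (cong (k ℕ.+_) (sym (ℕₚ.+-identityʳ k))) (ℕₚ.*-comm 2 k))))) (ℤₚ.pos-* k 2))
   lem : ∀ z → (1ℤ ∔ z) ℤ.- z ≡ 1ℤ
   lem = ℤ-solve 1 (λ z → (Κ 1ℤ :+ z) :- z , Κ 1ℤ) refl

 -- The 2-adic valuation of (i+1)! is at most i, phrased by a cofactor. The induction halves the
 -- index: (2k)! is 2^k k! times an odd number.
 legendre : ∀ i → Σ ℤ λ r → Σ ℤ λ o → Odd o × fact (suc i) · r ≡ 2^ i · o
 legendre = <-rec _ body
   where
   double-fact : ∀ k → Σ ℤ λ o → Odd o × fact (dbl k 0) ≡ 2^ k · fact k · o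
   double-fact zero = 1ℤ , ∤-1 prime[2] , refl
   double-fact (suc k) with double-fact k
   ... | o , oo , e = + suc (dbl k 0) · o , Odd-* {+ suc (dbl k 0)} {o} (odd-dbl k) oo ,
       trans (cong₂ (λ p q → p · (+ suc (dbl k 0) · q)) (trans (cong (λ n → + suc (suc n)) (trans (dbl≡ k 0) (ℕₚ.+-identityʳ (k ℕ.+ k)))) refl) e)
             (lem (+ k) (+ suc (dbl k 0)) (2^ k) (fact k) o)
     where
     lem : ∀ k s p f o → (1ℤ ∔ (1ℤ ∔ (k ∔ k))) · (s · (p · f · o)) ≡ + 2 · p · ((1ℤ ∔ k) · f) · (s · o)
     lem = ℤ-solve 5 (λ k s p f o → (Κ 1ℤ :+ (Κ 1ℤ :+ (k :+ k))) :* (s :* (p :* f :* o)) , Κ (+ 2) :* p :* ((Κ 1ℤ :+ k) :* f) :* (s :* o)) refl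
   k<dbl : ∀ k → k ℕ.< dbl k 1
   k<dbl zero = ℕ.s≤s ℕ.z≤n
   k<dbl (suc k) = ℕ.s≤s (ℕₚ.m≤n⇒m≤1+n (k<dbl k))
   dbl-1 : ∀ k → suc (dbl k 0) ≡ dbl k 1
   dbl-1 zero = refl
   dbl-1 (suc k) = cong (2 ℕ.+_) (dbl-1 k)
   body : ∀ i → (∀ {m} → m ℕ.< i → Σ ℤ λ r → Σ ℤ λ o → Odd o × fact (suc m) · r ≡ 2^ m · o) →
          Σ ℤ λ r → Σ ℤ λ o → Odd o × fact (suc i) · r ≡ 2^ i · o
   body i rec with even⊎odd i
   ... | inj₂ (k , refl) with rec (k<dbl k) | double-fact (suc k)
   ...   | r , o , oo , e | o′ , oo′ , e′ = r , o · o′ , Odd-* {o} {o′} oo oo′ , (begin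
       fact (suc (dbl k 1)) · r ≡⟨ cong (λ n → fact (suc n) · r) (sym (dbl-1 k)) ⟩
       fact (dbl (suc k) 0) · r ≡⟨ cong (_· r) e′ ⟩
       2^ suc k · fact (suc k) · o′ · r ≡⟨ lem (2^ suc k) (fact (suc k)) o′ r ⟩
       2^ suc k · (fact (suc k) · r) · o′ ≡⟨ cong (λ z → 2^ suc k · z · o′) e ⟩
       2^ suc k · (2^ k · o) · o′ ≡⟨ lem₂ (2^ suc k) (2^ k) o o′ ⟩
       2^ suc k · 2^ k · (o · o′) ≡⟨ cong (_· (o · o′)) (trans (sym (ℤₚ.^-distribˡ-+-* (+ 2) (suc k) k)) (cong 2^_ (trans (cong suc (sym (trans (dbl≡ k 0) (ℕₚ.+-identityʳ (k ℕ.+ k))))) (dbl-1 k)))) ⟩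
       2^ dbl k 1 · (o · o′) ∎)
     where
     open ≡-Reasoning
     lem : ∀ p f o r → p · f · o · r ≡ p · (f · r) · o
     lem = ℤ-solve 4 (λ p f o r → p :* f :* o :* r , p :* (f :* r) :* o) refl
     lem₂ : ∀ p q o o′ → p · (q · o) · o′ ≡ p · q · (o · o′)
     lem₂ = ℤ-solve 4 (λ p q o o′ → p :* (q :* o) :* o′ , p :* q :* (o :* o′)) refl
   body i rec | inj₁ (zero , refl) = 1ℤ , 1ℤ , ∤-1 prime[2] , refl
   body i rec | inj₁ (suc k , refl) with rec (ℕ.s≤s (ℕₚ.≤-trans (k≤dbl k) (ℕₚ.n≤1+n _))) | double-fact (suc k)
     where
     k≤dbl : ∀ k → k ℕ.≤ dbl k 0
     k≤dbl zero = ℕ.z≤n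
     k≤dbl (suc k) = ℕ.s≤s (ℕₚ.m≤n⇒m≤1+n (k≤dbl k))
   ...   | r , o , oo , e | o′ , oo′ , e′ = + 2 · r , (s · (o · o′)) , Odd-* {s} {o · o′} (odd-dbl (suc k)) (Odd-* {o} {o′} oo oo′) , (begin
       s · fact (dbl (suc k) 0) · (+ 2 · r) ≡⟨ cong (λ z → s · z · (+ 2 · r)) e′ ⟩
       s · (2^ suc k · fact (suc k) · o′) · (+ 2 · r) ≡⟨ lem s (2^ suc k) (fact (suc k)) o′ r ⟩
       2^ suc k · (+ 2 · (fact (suc k) · r)) · (s · o′) ≡⟨ cong (λ z → 2^ suc k · (+ 2 · z) · (s · o′)) e ⟩
       2^ suc k · (+ 2 · (2^ k · o)) · (s · o′) ≡⟨ lem₂ (2^ suc k) (2^ k) o s o′ ⟩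
       2^ suc k · 2^ suc k · (s · (o · o′)) ≡⟨ cong (_· (s · (o · o′))) (trans (sym (ℤₚ.^-distribˡ-+-* (+ 2) (suc k) (suc k))) (cong 2^_ (sym (trans (dbl≡ (suc k) 0) (ℕₚ.+-identityʳ (suc k ℕ.+ suc k)))))) ⟩
       2^ dbl (suc k) 0 · (s · (o · o′)) ∎)
     where
     open ≡-Reasoning
     s = + suc (dbl (suc k) 0)
     lem : ∀ s p f o r → s · (p · f · o) · (+ 2 · r) ≡ p · (+ 2 · (f · r)) · (s · o)
     lem = ℤ-solve 5 (λ s p f o r → s :* (p :* f :* o) :* (Κ (+ 2) :* r) , p :* (Κ (+ 2) :* (f :* r)) :* (s :* o)) refl
     lem₂ : ∀ p q o s o′ → p · (+ 2 · (q · o)) · (s · o′) ≡ p · (+ 2 · q) · (s · (o · o′))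
     lem₂ = ℤ-solve 5 (λ p q o s o′ → p :* (Κ (+ 2) :* (q :* o)) :* (s :* o′) , p :* (Κ (+ 2) :* q) :* (s :* (o :* o′))) refl

 factorial-cancel : ∀ i {e n} → 2^ e ∣ fact (suc i) · n → 2^ e ∣ 2^ i · n
 factorial-cancel i {e} {n} h with legendre i
 ... | r , o , oo , eq = ∣2^-cancel e {2^ i · n} {o} oo (subst (2^ e ∣_)
       (trans (lem₁ (fact (suc i)) n r) (trans (cong (_· n) eq) (lem₂ (2^ i) o n))) (ℤD.∣m⇒∣m*n r h))
   where
   lem₁ : ∀ f n r → f · n · r ≡ f · r · n
   lem₁ = ℤ-solve 3 (λ f n r → f :* n :* r , f :* r :* n) refl
   lem₂ : ∀ p o n → p · o · n ≡ p · n · o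
   lem₂ = ℤ-solve 3 (λ p o n → p :* o :* n , p :* n :* o) refl

 -- Integer functions whose first and second divided differences at 0 are integral, such as integer polynomials.
 record Smooth (ψ : ℤ → ℤ) : Set where
   field
     quot : ℤ → ℤ
     eq   : ∀ k → ψ k ≡ ψ 0ℤ ∔ k · quot k
     lip  : ∀ k l → (k ℤ.- l) ∣ (quot k ℤ.- quot l)

 smooth-const : ∀ c → Smooth (λ _ → c)
 smooth-const c = record { quot = λ _ → 0ℤ ; eq = λ k → lem c k ; lip = λ k l → divides 0ℤ refl }
   where
   lem : ∀ c k → c ≡ c ∔ k · 0ℤ
   lem = ℤ-solve 2 (λ c k → c , c :+ k :* Κ 0ℤ) refl

 smooth-linear : ∀ {ψ} c → Smooth ψ → Smooth (λ k → ψ k · (k ∔ c))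
 smooth-linear {ψ} c S = record { quot = λ k → ψ 0ℤ ∔ k · q k ∔ c · q k ; eq = eq′ ; lip = lip′ }
   where
   q = Smooth.quot S
   eq′ : ∀ k → ψ k · (k ∔ c) ≡ ψ 0ℤ · (0ℤ ∔ c) ∔ k · (ψ 0ℤ ∔ k · q k ∔ c · q k)
   eq′ k = trans (cong (_· (k ∔ c)) (Smooth.eq S k)) (lem (ψ 0ℤ) k (q k) c)
     where
     lem : ∀ p k q c → (p ∔ k · q) · (k ∔ c) ≡ p · (0ℤ ∔ c) ∔ k · (p ∔ k · q ∔ c · q)
     lem = ℤ-solve 4 (λ p k q c → (p :+ k :* q) :* (k :+ c) , p :* (Κ 0ℤ :+ c) :+ k :* (p :+ k :* q :+ c :* q)) refl
   lip′ : ∀ k l → (k ℤ.- l) ∣ (ψ 0ℤ ∔ k · q k ∔ c · q k ℤ.- (ψ 0ℤ ∔ l · q l ∔ c · q l))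
   lip′ k l = subst ((k ℤ.- l) ∣_) (lem (ψ 0ℤ) k l c (q k) (q l))
       (ℤD.∣m∣n⇒∣m+n (ℤD.∣m⇒∣m*n (q k) ℤD.∣-refl) (ℤD.∣n⇒∣m*n (l ∔ c) (Smooth.lip S k l)))
     where
     lem : ∀ p k l c q r → (k ℤ.- l) · q ∔ (l ∔ c) · (q ℤ.- r) ≡ p ∔ k · q ∔ c · q ℤ.- (p ∔ l · r ∔ c · r)
     lem = ℤ-solve 6 (λ p k l c q r → (k :- l) :* q :+ (l :+ c) :* (q :- r) , p :+ k :* q :+ c :* q :- (p :+ l :* r :+ c :* r)) refl

 smooth-fall : ∀ J i → Smooth (λ k → fall (k ∔ J) i)
 smooth-fall J zero    = smooth-const 1ℤ
 smooth-fall J (suc i) = record { quot = Smooth.quot S ; eq = λ k → trans (e k) (trans (Smooth.eq S k) (cong (_∔ k · Smooth.quot S k) (sym (e 0ℤ)))) ; lip = Smooth.lip S }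
   where
   S = smooth-linear (J ℤ.- + i) (smooth-fall J i)
   e : ∀ k → fall (k ∔ J) i · (k ∔ J ℤ.- + i) ≡ fall (k ∔ J) i · (k ∔ (J ℤ.- + i))
   e k = cong (fall (k ∔ J) i ·_) (ℤₚ.+-assoc k J (ℤ.- + i))

 -- A second divided difference at 0, κ, λ, corrected by the values at 0 and ±1 so as to vanish on quadratic polynomials.
 module Functional (t κ l : ℤ) where
   P : ℤ
   P = κ · l · (κ ℤ.- l)

   -- On A k + C k² both the divided difference, doubled, and the corner equal 2(C - tA), up to the
   -- factor `P`. So the weight t is free; it will be 3 or 2, where the corner approximates 2(F₋² -
   -- F₊) or F₋³ - F₊ for 2^K-th powers and factors well.
   corner : ℤ → ℤ → ℤ → ℤ
   corner f₀ f₋ f₊ = (1ℤ ∔ t) · f₋ ∔ (1ℤ ℤ.- t) · f₊ ℤ.- + 2 · f₀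

   𝓛 : ℤ → ℤ → ℤ → ℤ → ℤ → ℤ
   𝓛 fκ fl f₀ f₋ f₊ = + 2 · (l · (t · l ∔ 1ℤ) · (fκ ℤ.- f₀) ℤ.- κ · (t · κ ∔ 1ℤ) · (fl ℤ.- f₀)) ℤ.- P · corner f₀ f₋ f₊

   -- In the first part the values of `quot` at κ and l differ by a multiple of κ - l, which
   -- completes the factor κ l to `P`. In the corner the values at 1 and -1 differ by a multiple of
   -- 2, which supplies the 2.
   𝓛-smooth : ∀ {ψ} → Smooth ψ → (+ 2 · P) ∣ 𝓛 (ψ κ) (ψ l) (ψ 0ℤ) (ψ (ℤ.- 1ℤ)) (ψ 1ℤ)
   𝓛-smooth {ψ} S with Smooth.lip S κ l | Smooth.lip S 1ℤ (ℤ.- 1ℤ)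
   ... | divides m e | divides m′ e′ = divides ((t · l ∔ 1ℤ) · m ℤ.- t · q l ℤ.- ((1ℤ ℤ.- t) · m′ ℤ.- t · q (ℤ.- 1ℤ)))
     (trans (subst₂ (λ a b → 𝓛 (ψ κ) (ψ l) (ψ 0ℤ) (ψ (ℤ.- 1ℤ)) (ψ 1ℤ) ≡ 𝓛 a b (ψ 0ℤ) (ψ 0ℤ ∔ ℤ.- 1ℤ · q (ℤ.- 1ℤ)) (ψ 0ℤ ∔ 1ℤ · (q (ℤ.- 1ℤ) ∔ m′ · (1ℤ ℤ.- ℤ.- 1ℤ))))
             (trans (Smooth.eq S κ) (cong (λ z → ψ 0ℤ ∔ κ · z) (diff (q κ) (q l) e))) (Smooth.eq S l)
             (cong₂ (𝓛 (ψ κ) (ψ l) (ψ 0ℤ)) (Smooth.eq S (ℤ.- 1ℤ)) (trans (Smooth.eq S 1ℤ) (cong (λ z → ψ 0ℤ ∔ 1ℤ · z) (diff (q 1ℤ) (q (ℤ.- 1ℤ)) e′)))))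
       (lem t κ l (ψ 0ℤ) m m′ (q l) (q (ℤ.- 1ℤ))))
     where
     q = Smooth.quot S
     diff : ∀ a b {z} → a ℤ.- b ≡ z → a ≡ b ∔ z
     diff a b refl = lem′ a b
       where
       lem′ : ∀ a b → a ≡ b ∔ (a ℤ.- b)
       lem′ = ℤ-solve 2 (λ a b → a , b :+ (a :- b)) refl
     lem : ∀ t κ l p m m′ ql q₋ →
       + 2 · (l · (t · l ∔ 1ℤ) · ((p ∔ κ · (ql ∔ m · (κ ℤ.- l))) ℤ.- p) ℤ.- κ · (t · κ ∔ 1ℤ) · ((p ∔ l · ql) ℤ.- p))
         ℤ.- κ · l · (κ ℤ.- l) · ((1ℤ ∔ t) · (p ∔ ℤ.- 1ℤ · q₋) ∔ (1ℤ ℤ.- t) · (p ∔ 1ℤ · (q₋ ∔ m′ · (1ℤ ℤ.- ℤ.- 1ℤ))) ℤ.- + 2 · p)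
       ≡ ((t · l ∔ 1ℤ) · m ℤ.- t · ql ℤ.- ((1ℤ ℤ.- t) · m′ ℤ.- t · q₋)) · (+ 2 · (κ · l · (κ ℤ.- l)))
     lem = ℤ-solve 8 (λ t κ l p m m′ ql q₋ → Κ (+ 2) :* (l :* (t :* l :+ Κ 1ℤ) :* ((p :+ κ :* (ql :+ m :* (κ :- l))) :- p) :- κ :* (t :* κ :+ Κ 1ℤ) :* ((p :+ l :* ql) :- p)) :- κ :* l :* (κ :- l) :* ((Κ 1ℤ :+ t) :* (p :+ :- Κ 1ℤ :* q₋) :+ (Κ 1ℤ :- t) :* (p :+ Κ 1ℤ :* (q₋ :+ m′ :* (Κ 1ℤ :- :- Κ 1ℤ))) :- Κ (+ 2) :* p) , ((t :* l :+ Κ 1ℤ) :* m :- t :* ql :- ((Κ 1ℤ :- t) :* m′ :- t :* q₋)) :* (Κ (+ 2) :* (κ :* l :* (κ :- l)))) refl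

   𝓛-scale : ∀ z a b c d e → z · 𝓛 a b c d e ≡ 𝓛 (z · a) (z · b) (z · c) (z · d) (z · e)
   𝓛-scale = lem t κ l
     where
     lem : ∀ t κ l z a b c d e → z · (+ 2 · (l · (t · l ∔ 1ℤ) · (a ℤ.- c) ℤ.- κ · (t · κ ∔ 1ℤ) · (b ℤ.- c)) ℤ.- κ · l · (κ ℤ.- l) · ((1ℤ ∔ t) · d ∔ (1ℤ ℤ.- t) · e ℤ.- + 2 · c)) ≡
       + 2 · (l · (t · l ∔ 1ℤ) · (z · a ℤ.- z · c) ℤ.- κ · (t · κ ∔ 1ℤ) · (z · b ℤ.- z · c)) ℤ.- κ · l · (κ ℤ.- l) · ((1ℤ ∔ t) · (z · d) ∔ (1ℤ ℤ.- t) · (z · e) ℤ.- + 2 · (z · c))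
     lem = ℤ-solve 9 (λ t κ l z a b c d e → z :* (Κ (+ 2) :* (l :* (t :* l :+ Κ 1ℤ) :* (a :- c) :- κ :* (t :* κ :+ Κ 1ℤ) :* (b :- c)) :- κ :* l :* (κ :- l) :* ((Κ 1ℤ :+ t) :* d :+ (Κ 1ℤ :- t) :* e :- Κ (+ 2) :* c)) , Κ (+ 2) :* (l :* (t :* l :+ Κ 1ℤ) :* (z :* a :- z :* c) :- κ :* (t :* κ :+ Κ 1ℤ) :* (z :* b :- z :* c)) :- κ :* l :* (κ :- l) :* ((Κ 1ℤ :+ t) :* (z :* d) :+ (Κ 1ℤ :- t) :* (z :* e) :- Κ (+ 2) :* (z :* c))) refl

   𝓛-+ : ∀ a b c d e a′ b′ c′ d′ e′ → 𝓛 (a ∔ a′) (b ∔ b′) (c ∔ c′) (d ∔ d′) (e ∔ e′) ≡ 𝓛 a b c d e ∔ 𝓛 a′ b′ c′ d′ e′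
   𝓛-+ = lem t κ l
     where
     lem : ∀ t κ l a b c d e a′ b′ c′ d′ e′ →
       + 2 · (l · (t · l ∔ 1ℤ) · ((a ∔ a′) ℤ.- (c ∔ c′)) ℤ.- κ · (t · κ ∔ 1ℤ) · ((b ∔ b′) ℤ.- (c ∔ c′))) ℤ.- κ · l · (κ ℤ.- l) · ((1ℤ ∔ t) · (d ∔ d′) ∔ (1ℤ ℤ.- t) · (e ∔ e′) ℤ.- + 2 · (c ∔ c′)) ≡
       (+ 2 · (l · (t · l ∔ 1ℤ) · (a ℤ.- c) ℤ.- κ · (t · κ ∔ 1ℤ) · (b ℤ.- c)) ℤ.- κ · l · (κ ℤ.- l) · ((1ℤ ∔ t) · d ∔ (1ℤ ℤ.- t) · e ℤ.- + 2 · c)) ∔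
       (+ 2 · (l · (t · l ∔ 1ℤ) · (a′ ℤ.- c′) ℤ.- κ · (t · κ ∔ 1ℤ) · (b′ ℤ.- c′)) ℤ.- κ · l · (κ ℤ.- l) · ((1ℤ ∔ t) · d′ ∔ (1ℤ ℤ.- t) · e′ ℤ.- + 2 · c′))
     lem = ℤ-solve 13 (λ t κ l a b c d e a′ b′ c′ d′ e′ → Κ (+ 2) :* (l :* (t :* l :+ Κ 1ℤ) :* ((a :+ a′) :- (c :+ c′)) :- κ :* (t :* κ :+ Κ 1ℤ) :* ((b :+ b′) :- (c :+ c′))) :- κ :* l :* (κ :- l) :* ((Κ 1ℤ :+ t) :* (d :+ d′) :+ (Κ 1ℤ :- t) :* (e :+ e′) :- Κ (+ 2) :* (c :+ c′)) , (Κ (+ 2) :* (l :* (t :* l :+ Κ 1ℤ) :* (a :- c) :- κ :* (t :* κ :+ Κ 1ℤ) :* (b :- c)) :- κ :* l :* (κ :- l) :* ((Κ 1ℤ :+ t) :* d :+ (Κ 1ℤ :- t) :* e :- Κ (+ 2) :* c)) :+ (Κ (+ 2) :* (l :* (t :* l :+ Κ 1ℤ) :* (a′ :- c′) :- κ :* (t :* κ :+ Κ 1ℤ) :* (b′ :- c′)) :- κ :* l :* (κ :- l) :* ((Κ 1ℤ :+ t) :* d′ :+ (Κ 1ℤ :- t) :* e′ :- Κ (+ 2) :* c′))) refl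

   𝓛-∑ : ∀ L (c a b d e f : ℕ → ℤ) → 𝓛 (∑ L λ i → a i · c i) (∑ L λ i → b i · c i) (∑ L λ i → d i · c i) (∑ L λ i → e i · c i) (∑ L λ i → f i · c i) ≡
                              ∑ L λ i → c i · 𝓛 (a i) (b i) (d i) (e i) (f i)
   𝓛-∑ zero c a b d e f = lem t κ l
     where
     lem : ∀ t κ l → + 2 · (l · (t · l ∔ 1ℤ) · 0ℤ ℤ.- κ · (t · κ ∔ 1ℤ) · 0ℤ) ℤ.- κ · l · (κ ℤ.- l) · ((1ℤ ∔ t) · 0ℤ ∔ (1ℤ ℤ.- t) · 0ℤ ℤ.- 0ℤ) ≡ 0ℤ
     lem = ℤ-solve 3 (λ t κ l → Κ (+ 2) :* (l :* (t :* l :+ Κ 1ℤ) :* Κ 0ℤ :- κ :* (t :* κ :+ Κ 1ℤ) :* Κ 0ℤ) :- κ :* l :* (κ :- l) :* ((Κ 1ℤ :+ t) :* Κ 0ℤ :+ (Κ 1ℤ :- t) :* Κ 0ℤ :- Κ 0ℤ) , Κ 0ℤ) refl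
   𝓛-∑ (suc L) c a b d e f = trans (𝓛-+ (a 0 · c 0) (b 0 · c 0) (d 0 · c 0) (e 0 · c 0) (f 0 · c 0) _ _ _ _ _)
     (cong₂ _∔_ (trans (cong₂ (λ p q → 𝓛 p q (d 0 · c 0) (e 0 · c 0) (f 0 · c 0)) (comm a) (comm b))
                   (trans (cong₂ (λ p q → 𝓛 (c 0 · a 0) (c 0 · b 0) p q (f 0 · c 0)) (comm d) (comm e))
                   (trans (cong (𝓛 (c 0 · a 0) (c 0 · b 0) (c 0 · d 0) (c 0 · e 0)) (comm f))
                          (sym (𝓛-scale (c 0) (a 0) (b 0) (d 0) (e 0) (f 0))))))
                  (𝓛-∑ L (λ i → c (suc i)) (λ i → a (suc i)) (λ i → b (suc i)) (λ i → d (suc i)) (λ i → e (suc i)) (λ i → f (suc i))))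
     where
     comm : ∀ (g : ℕ → ℤ) → g 0 · c 0 ≡ c 0 · g 0
     comm g = ℤₚ.*-comm (g 0) (c 0)

-- Exact 2-adic valuations and the contradiction on a progression

module Progressions where

 open DyadicIntegers
 open Newton
 open import Data.Nat.Induction using (<-rec)
 open import Data.Nat.Primality using (prime[2])
 open import Data.Integer using (+_)
 open import Data.Integer.Divisibility.Signed using (_∣_; divides)
 open import Data.Rational using (_+_; _-_; _*_; -_)

 Exact : ℕ → ℤ → Set
 Exact m z = Σ ℤ λ o → Odd o × z ≡ 2^ m · o

 Exact-* : ∀ {m n y z} → Exact m y → Exact n z → Exact (m ℕ.+ n) (y · z)
 Exact-* {m} {n} (o , oo , refl) (o′ , oo′ , refl) = o · o′ , Odd-* {o} {o′} oo oo′ ,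
     trans (lem (2^ m) o (2^ n) o′) (cong (_· (o · o′)) (sym (ℤₚ.^-distribˡ-+-* (+ 2) m n)))
   where
   lem : ∀ p o q o′ → p · o · (q · o′) ≡ p · q · (o · o′)
   lem = ℤ-solve 4 (λ p o q o′ → p :* o :* (q :* o′) , p :* q :* (o :* o′)) refl

 Exact-odd : ∀ {z} → Odd z → Exact 0 z
 Exact-odd {z} o = z , o , sym (ℤₚ.*-identityˡ z)

 Exact-small : ∀ {m n z} → Exact m z → m ℕ.< n → ¬ (2^ n ∣ z)
 Exact-small {m} {n} (o , oo , refl) m<n h = oo (ℤD.*-cancelˡ-∣ (2^ m) {{ℤ.≢-nonZero (ℤ-^-≢0 {+ 2} m λ ())}}
     (ℤD.∣-trans (subst (_∣ 2^ n) (ℤₚ.*-comm (+ 2) (2^ m)) (2^-mono m<n)) h))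

 Exact-2 : Exact 1 (+ 2)
 Exact-2 = 1ℤ , ∤-1 prime[2] , refl

 exact : ∀ z → z ≢ 0ℤ → Σ ℕ λ m → Exact m z
 exact z = go ℤ.∣ z ∣ z refl
   where
   Goal : ℕ → Set
   Goal n = ∀ z → ℤ.∣ z ∣ ≡ n → z ≢ 0ℤ → Σ ℕ λ m → Exact m z
   go : ∀ n → Goal n
   go = <-rec Goal λ n rec z abs z≢0 → step rec z abs z≢0 (+ 2 ℤD.∣? z)
     where
     step : ∀ {n} → (∀ {m} → m ℕ.< n → Goal m) → ∀ z → ℤ.∣ z ∣ ≡ n → z ≢ 0ℤ → _ → Σ ℕ λ m → Exact m z
     step rec z abs z≢0 (no odd) = 0 , Exact-odd odd
     step rec z abs z≢0 (yes (divides q refl)) with rec (subst (ℤ.∣ q ∣ ℕ.<_) abs smaller) q refl q≢0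
       where
       q≢0 : q ≢ 0ℤ
       q≢0 refl = z≢0 refl
       smaller : ℤ.∣ q ∣ ℕ.< ℤ.∣ q · + 2 ∣
       smaller = subst (ℤ.∣ q ∣ ℕ.<_) (sym (ℤₚ.abs-* q (+ 2))) (ℕₚ.m<m*n ℤ.∣ q ∣ 2 {{ℤ.≢-nonZero q≢0}} (ℕ.s≤s (ℕ.s≤s ℕ.z≤n)))
     ... | m , e = suc m , subst (Exact (suc m)) (ℤₚ.*-comm (+ 2) q) (Exact-* {1} {m} {+ 2} {q} Exact-2 e)

 even-+-odd : ∀ {i j} → + 2 ∣ i → Odd j → Odd (i ∔ j)
 even-+-odd {i} {j} h o h′ = o (ℤD.∣m+n∣m⇒∣n {m = i} h′ h)

 Exact-even : ∀ {m z} → Exact (suc m) z → + 2 ∣ z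
 Exact-even {m} (o , _ , refl) = ℤD.∣m⇒∣m*n o (ℤD.∣m⇒∣m*n (2^ m) ℤD.∣-refl)

 -- Because 4 divides y - z, the sum y + z = (y - z) + 2z is twice an odd number; a mere factor 2 in
 -- y - z would not determine its valuation.
 Exact-sq : ∀ {m y z} → Odd z → Exact (2 ℕ.+ m) (y ℤ.- z) → Exact (3 ℕ.+ m) (y · y ℤ.- z · z)
 Exact-sq {m} {y} {z} oz E@(o , oo , e) = subst (Exact (3 ℕ.+ m)) (lem y z) (Exact-* {1} {2 ℕ.+ m} {y ∔ z} {y ℤ.- z} (o′ , oo′ , e′) E)
   where
   o′ = 2^ suc m · o ∔ z
   oo′ : Odd o′
   oo′ = even-+-odd {2^ suc m · o} {z} (ℤD.∣m⇒∣m*n o (ℤD.∣m⇒∣m*n (2^ m) ℤD.∣-refl)) oz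
   lem : ∀ y z → (y ∔ z) · (y ℤ.- z) ≡ y · y ℤ.- z · z
   lem = ℤ-solve 2 (λ y z → (y :+ z) :* (y :- z) , y :* y :- z :* z) refl
   lem₁ : ∀ y z → y ∔ z ≡ (y ℤ.- z) ∔ + 2 · z
   lem₁ = ℤ-solve 2 (λ y z → y :+ z , (y :- z) :+ Κ (+ 2) :* z) refl
   lem₂ : ∀ p o z → + 2 · p · o ∔ + 2 · z ≡ + 2 · 1ℤ · (p · o ∔ z)
   lem₂ = ℤ-solve 3 (λ p o z → Κ (+ 2) :* p :* o :+ Κ (+ 2) :* z , Κ (+ 2) :* Κ 1ℤ :* (p :* o :+ z)) refl
   e′ : y ∔ z ≡ 2^ 1 · o′
   e′ = trans (lem₁ y z) (trans (cong (_∔ + 2 · z) e) (lem₂ (2^ suc m) o z))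

 Exact-cube : ∀ {m y z} → Odd z → Exact (suc m) (y ℤ.- z) → Exact (suc m) (y · y · y ℤ.- z · z · z)
 Exact-cube {m} {y} {z} oz E = subst (Exact (suc m)) (lem y z) (Exact-* {0} {suc m} {c} {y ℤ.- z} (Exact-odd odd) E)
   where
   c = (y ℤ.- z) · (y ∔ + 2 · z) ∔ (+ 2 · z · z ∔ z · z)
   lem : ∀ y z → ((y ℤ.- z) · (y ∔ + 2 · z) ∔ (+ 2 · z · z ∔ z · z)) · (y ℤ.- z) ≡ y · y · y ℤ.- z · z · z
   lem = ℤ-solve 2 (λ y z → ((y :- z) :* (y :+ Κ (+ 2) :* z) :+ (Κ (+ 2) :* z :* z :+ z :* z)) :* (y :- z) , y :* y :* y :- z :* z :* z) refl
   odd : Odd ((y ℤ.- z) · (y ∔ + 2 · z) ∔ (+ 2 · z · z ∔ z · z))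
   odd = even-+-odd {(y ℤ.- z) · (y ∔ + 2 · z)} (ℤD.∣m⇒∣m*n (y ∔ + 2 · z) (Exact-even {m} {y ℤ.- z} E))
           (even-+-odd {+ 2 · z · z} (ℤD.∣m⇒∣m*n z (ℤD.∣m⇒∣m*n z ℤD.∣-refl)) (Odd-* {z} {z} oz oz))

 sqsℤ-odd : ∀ K {z} → Odd z → Odd (sqsℤ K z)
 sqsℤ-odd zero    o = o
 sqsℤ-odd (suc K) {z} o = Odd-* {sqsℤ K z} {sqsℤ K z} (sqsℤ-odd K o) (sqsℤ-odd K o)

 Exact-sqs : ∀ K {m y z} → Odd z → Exact (2 ℕ.+ m) (y ℤ.- z) → Exact (2 ℕ.+ K ℕ.+ m) (sqsℤ K y ℤ.- sqsℤ K z)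
 Exact-sqs zero    o E = E
 Exact-sqs (suc K) {m} {y} {z} o E = Exact-sq {K ℕ.+ m} {sqsℤ K y} {sqsℤ K z} (sqsℤ-odd K o) (Exact-sqs K {m} {y} {z} o E)

 sqsℤ-* : ∀ k i j → sqsℤ k (i · j) ≡ sqsℤ k i · sqsℤ k j
 sqsℤ-* zero    i j = refl
 sqsℤ-* (suc k) i j = trans (cong₂ _·_ (sqsℤ-* k i j) (sqsℤ-* k i j)) (lem (sqsℤ k i) (sqsℤ k j))
   where
   lem : ∀ a b → a · b · (a · b) ≡ a · a · (b · b)
   lem = ℤ-solve 2 (λ a b → a :* b :* (a :* b) , a :* a :* (b :* b)) refl

 sqsℤ-1 : ∀ k {i} → i ≡ 1ℤ → sqsℤ k i ≡ 1ℤ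
 sqsℤ-1 zero    e = e
 sqsℤ-1 (suc k) e = cong₂ _·_ (sqsℤ-1 k e) (sqsℤ-1 k e)

 module _ (t κ l : ℤ) (J₀ j₁ j₂ : ℕ) (e₁ : + j₁ ≡ κ ∔ + suc J₀) (e₂ : + j₂ ≡ l ∔ + suc J₀)
          (f : ℕ → ℤ) (K μ m : ℕ)
          (differences : ∀ e i → e ℕ.≤ 2 ℕ.+ μ ℕ.+ K ℕ.+ i → e ℕ.≤ K ℕ.+ K → 2^ e ∣ Δℤⁿ (3 ℕ.+ i) f 0)
          (m∣P : 2^ m ∣ κ · l · (κ ℤ.- l)) (K-large : suc (μ ℕ.+ m) ℕ.≤ K)
          (f₁ : f j₁ ≡ 1ℤ) (f₂ : f j₂ ≡ 1ℤ) (f₀ : f (suc J₀) ≡ 1ℤ) where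
   open Functional t κ l

   private
     J = + suc J₀
     Z = suc (μ ℕ.+ m) ℕ.+ K

     𝓑 : ℕ → ℤ
     𝓑 i = 𝓛 (bin j₁ i) (bin j₂ i) (bin (suc J₀) i) (bin J₀ i) (bin (2 ℕ.+ J₀) i)

     𝓕 : ℕ → ℤ
     𝓕 i = 𝓛 (fall (κ ∔ J) i) (fall (l ∔ J) i) (fall (0ℤ ∔ J) i) (fall (ℤ.- 1ℤ ∔ J) i) (fall (1ℤ ∔ J) i)

     fact-𝓑 : ∀ i → fact i · 𝓑 i ≡ 𝓕 i
     fact-𝓑 i = trans (𝓛-scale (fact i) (bin j₁ i) (bin j₂ i) (bin (suc J₀) i) (bin J₀ i) (bin (2 ℕ.+ J₀) i))
       (trans (cong₂ (λ a b → 𝓛 a b (fact i · bin (suc J₀) i) (fact i · bin J₀ i) (fact i · bin (2 ℕ.+ J₀) i))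
                (trans (fact-bin j₁ i) (cong (λ z → fall z i) e₁)) (trans (fact-bin j₂ i) (cong (λ z → fall z i) e₂)))
              (trans (cong₂ (λ a b → 𝓛 (fall (κ ∔ J) i) (fall (l ∔ J) i) a b (fact i · bin (2 ℕ.+ J₀) i))
                       (trans (fact-bin (suc J₀) i) (cong (λ z → fall z i) (sym (ℤₚ.+-identityˡ J)))) (fact-bin J₀ i))
                     (cong (𝓛 (fall (κ ∔ J) i) (fall (l ∔ J) i) (fall (0ℤ ∔ J) i) (fall (+ J₀) i)) (fact-bin (2 ℕ.+ J₀) i))))

     𝓕-∣ : ∀ i → 2^ suc m ∣ 𝓕 i
     𝓕-∣ i = ℤD.∣-trans (ℤD.*-monoʳ-∣ (+ 2) m∣P) (𝓛-smooth {λ k → fall (k ∔ J) i} (smooth-fall J i))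

     low : ∀ i {c} → fact i ≡ c → c ≢ 0ℤ → 𝓕 i ≡ 0ℤ → 𝓑 i ≡ 0ℤ
     low i {c} refl c≢0 e = ℤ-cancelʳ c c≢0 (trans (ℤₚ.*-comm (𝓑 i) c) (trans (fact-𝓑 i) (trans e (sym (ℤₚ.*-zeroˡ c)))))

     low₀ : 𝓕 0 ≡ 0ℤ
     low₀ = lem t κ l
       where
       lem : ∀ t κ l → + 2 · (l · (t · l ∔ 1ℤ) · 0ℤ ℤ.- κ · (t · κ ∔ 1ℤ) · 0ℤ) ℤ.- κ · l · (κ ℤ.- l) · ((1ℤ ∔ t) · 1ℤ ∔ (1ℤ ℤ.- t) · 1ℤ ℤ.- + 2) ≡ 0ℤ
       lem = ℤ-solve 3 (λ t κ l → Κ (+ 2) :* (l :* (t :* l :+ Κ 1ℤ) :* Κ 0ℤ :- κ :* (t :* κ :+ Κ 1ℤ) :* Κ 0ℤ) :- κ :* l :* (κ :- l) :* ((Κ 1ℤ :+ t) :* Κ 1ℤ :+ (Κ 1ℤ :- t) :* Κ 1ℤ :- Κ (+ 2)) , Κ 0ℤ) refl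

     low₁ : 𝓕 1 ≡ 0ℤ
     low₁ = lem t κ l J
       where
       lem : ∀ t κ l J → + 2 · (l · (t · l ∔ 1ℤ) · (1ℤ · (κ ∔ J ℤ.- 0ℤ) ℤ.- 1ℤ · (0ℤ ∔ J ℤ.- 0ℤ)) ℤ.- κ · (t · κ ∔ 1ℤ) · (1ℤ · (l ∔ J ℤ.- 0ℤ) ℤ.- 1ℤ · (0ℤ ∔ J ℤ.- 0ℤ)))
         ℤ.- κ · l · (κ ℤ.- l) · ((1ℤ ∔ t) · (1ℤ · (ℤ.- 1ℤ ∔ J ℤ.- 0ℤ)) ∔ (1ℤ ℤ.- t) · (1ℤ · (1ℤ ∔ J ℤ.- 0ℤ)) ℤ.- + 2 · (1ℤ · (0ℤ ∔ J ℤ.- 0ℤ))) ≡ 0ℤ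
       lem = ℤ-solve 4 (λ t κ l J → Κ (+ 2) :* (l :* (t :* l :+ Κ 1ℤ) :* (Κ 1ℤ :* (κ :+ J :- Κ 0ℤ) :- Κ 1ℤ :* (Κ 0ℤ :+ J :- Κ 0ℤ)) :- κ :* (t :* κ :+ Κ 1ℤ) :* (Κ 1ℤ :* (l :+ J :- Κ 0ℤ) :- Κ 1ℤ :* (Κ 0ℤ :+ J :- Κ 0ℤ))) :- κ :* l :* (κ :- l) :* ((Κ 1ℤ :+ t) :* (Κ 1ℤ :* (:- Κ 1ℤ :+ J :- Κ 0ℤ)) :+ (Κ 1ℤ :- t) :* (Κ 1ℤ :* (Κ 1ℤ :+ J :- Κ 0ℤ)) :- Κ (+ 2) :* (Κ 1ℤ :* (Κ 0ℤ :+ J :- Κ 0ℤ))) , Κ 0ℤ) refl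

     low₂ : 𝓕 2 ≡ 0ℤ
     low₂ = lem t κ l J
       where
       lem : ∀ t κ l J → + 2 · (l · (t · l ∔ 1ℤ) · (1ℤ · (κ ∔ J ℤ.- 0ℤ) · (κ ∔ J ℤ.- 1ℤ) ℤ.- 1ℤ · (0ℤ ∔ J ℤ.- 0ℤ) · (0ℤ ∔ J ℤ.- 1ℤ)) ℤ.- κ · (t · κ ∔ 1ℤ) · (1ℤ · (l ∔ J ℤ.- 0ℤ) · (l ∔ J ℤ.- 1ℤ) ℤ.- 1ℤ · (0ℤ ∔ J ℤ.- 0ℤ) · (0ℤ ∔ J ℤ.- 1ℤ)))
         ℤ.- κ · l · (κ ℤ.- l) · ((1ℤ ∔ t) · (1ℤ · (ℤ.- 1ℤ ∔ J ℤ.- 0ℤ) · (ℤ.- 1ℤ ∔ J ℤ.- 1ℤ)) ∔ (1ℤ ℤ.- t) · (1ℤ · (1ℤ ∔ J ℤ.- 0ℤ) · (1ℤ ∔ J ℤ.- 1ℤ)) ℤ.- + 2 · (1ℤ · (0ℤ ∔ J ℤ.- 0ℤ) · (0ℤ ∔ J ℤ.- 1ℤ))) ≡ 0ℤ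
       lem = ℤ-solve 4 (λ t κ l J → Κ (+ 2) :* (l :* (t :* l :+ Κ 1ℤ) :* (Κ 1ℤ :* (κ :+ J :- Κ 0ℤ) :* (κ :+ J :- Κ 1ℤ) :- Κ 1ℤ :* (Κ 0ℤ :+ J :- Κ 0ℤ) :* (Κ 0ℤ :+ J :- Κ 1ℤ)) :- κ :* (t :* κ :+ Κ 1ℤ) :* (Κ 1ℤ :* (l :+ J :- Κ 0ℤ) :* (l :+ J :- Κ 1ℤ) :- Κ 1ℤ :* (Κ 0ℤ :+ J :- Κ 0ℤ) :* (Κ 0ℤ :+ J :- Κ 1ℤ))) :- κ :* l :* (κ :- l) :* ((Κ 1ℤ :+ t) :* (Κ 1ℤ :* (:- Κ 1ℤ :+ J :- Κ 0ℤ) :* (:- Κ 1ℤ :+ J :- Κ 1ℤ)) :+ (Κ 1ℤ :- t) :* (Κ 1ℤ :* (Κ 1ℤ :+ J :- Κ 0ℤ) :* (Κ 1ℤ :+ J :- Κ 1ℤ)) :- Κ (+ 2) :* (Κ 1ℤ :* (Κ 0ℤ :+ J :- Κ 0ℤ) :* (Κ 0ℤ :+ J :- Κ 1ℤ))) , Κ 0ℤ) refl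

     zero-term : ∀ z {b} → b ≡ 0ℤ → 2^ Z ∣ z · b
     zero-term z refl = divides 0ℤ (ℤₚ.*-zeroʳ z)

     -- For i ≤ 2 the functional kills the binomial. For i + 3 the difference contributes 2 + μ + K
     -- + i digits, while i + 3 factorial loses at most i + 2 of the m + 1 digits of 2P; the sum is
     -- `Z`. If m + 1 ≤ i + 2, the difference alone suffices, capped by 2K.
     term : ∀ i → 2^ Z ∣ Δℤⁿ i f 0 · 𝓑 i
     term 0 = zero-term (f 0) (low 0 refl (λ ()) low₀)
     term 1 = zero-term (Δℤⁿ 1 f 0) (low 1 refl (λ ()) low₁)
     term 2 = zero-term (Δℤⁿ 2 f 0) (low 2 refl (λ ()) low₂)
     term (suc (suc (suc i))) = cases (ℕₚ.≤-total (suc m) (2 ℕ.+ i))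
       where
       n-∣ : 2^ suc m ∣ 2^ (2 ℕ.+ i) · 𝓑 (3 ℕ.+ i)
       n-∣ = factorial-cancel (2 ℕ.+ i) {suc m} {𝓑 (3 ℕ.+ i)} (subst (2^ suc m ∣_) (sym (fact-𝓑 (3 ℕ.+ i))) (𝓕-∣ (3 ℕ.+ i)))
       cases : _ → 2^ Z ∣ Δℤⁿ (3 ℕ.+ i) f 0 · 𝓑 (3 ℕ.+ i)
       cases (inj₁ le) = ℤD.∣m⇒∣m*n (𝓑 (3 ℕ.+ i)) (differences Z i
         (subst₂ ℕ._≤_ (a₁ m μ K) (a₂ i μ K) (ℕₚ.+-monoˡ-≤ (μ ℕ.+ K) le)) (ℕₚ.+-monoˡ-≤ K K-large))
         where
         a₁ : ∀ m μ K → suc m ℕ.+ (μ ℕ.+ K) ≡ suc (μ ℕ.+ m) ℕ.+ K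
         a₁ = ℕ-solve
         a₂ : ∀ i μ K → 2 ℕ.+ i ℕ.+ (μ ℕ.+ K) ≡ 2 ℕ.+ μ ℕ.+ K ℕ.+ i
         a₂ = ℕ-solve
       cases (inj₂ ge) = subst (λ z → 2^ z ∣ Δℤⁿ (3 ℕ.+ i) f 0 · 𝓑 (3 ℕ.+ i)) Z≡
           (subst (_∣ Δℤⁿ (3 ℕ.+ i) f 0 · 𝓑 (3 ℕ.+ i)) (sym (ℤₚ.^-distribˡ-+-* (+ 2) E r)) (*-mono-∣ dE rB))
         where
         E = 2 ℕ.+ μ ℕ.+ K ℕ.+ i
         r = suc m ℕ.∸ (2 ℕ.+ i)
         r≡ : 2 ℕ.+ i ℕ.+ r ≡ suc m
         r≡ = ℕₚ.m+[n∸m]≡n ge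
         rB : 2^ r ∣ 𝓑 (3 ℕ.+ i)
         rB = ℤD.*-cancelˡ-∣ (2^ (2 ℕ.+ i)) {{ℤ.≢-nonZero (ℤ-^-≢0 {+ 2} (2 ℕ.+ i) λ ())}}
                (subst (_∣ 2^ (2 ℕ.+ i) · 𝓑 (3 ℕ.+ i)) (trans (cong 2^_ (sym r≡)) (ℤₚ.^-distribˡ-+-* (+ 2) (2 ℕ.+ i) r)) n-∣)
         a₃ : ∀ i μ K → 2 ℕ.+ μ ℕ.+ K ℕ.+ i ≡ 2 ℕ.+ i ℕ.+ (μ ℕ.+ K)
         a₃ = ℕ-solve
         a₄ : ∀ m μ K → suc m ℕ.+ (μ ℕ.+ K) ≡ suc (μ ℕ.+ m) ℕ.+ K
         a₄ = ℕ-solve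
         dE : 2^ E ∣ Δℤⁿ (3 ℕ.+ i) f 0
         dE = differences E i ℕₚ.≤-refl (subst (ℕ._≤ K ℕ.+ K) (sym (a₃ i μ K))
                (ℕₚ.≤-trans (ℕₚ.+-monoˡ-≤ (μ ℕ.+ K) ge) (subst (ℕ._≤ K ℕ.+ K) (sym (a₄ m μ K)) (ℕₚ.+-monoˡ-≤ K K-large))))
         a₅ : ∀ i μ K r → 2 ℕ.+ μ ℕ.+ K ℕ.+ i ℕ.+ r ≡ 2 ℕ.+ i ℕ.+ r ℕ.+ (μ ℕ.+ K)
         a₅ = ℕ-solve
         Z≡ : E ℕ.+ r ≡ Z
         Z≡ = trans (a₅ i μ K r) (trans (cong (ℕ._+ (μ ℕ.+ K)) r≡) (a₄ m μ K))

   -- As f takes the value 1 at all three places, the divided difference vanishes and only - P times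
   -- the corner is left of 𝓛, whose Newton expansion is divisible termwise.
   corner-∣ : 2^ (suc (μ ℕ.+ m) ℕ.+ K) ∣ P · corner 1ℤ (f J₀) (f (2 ℕ.+ J₀))
   corner-∣ = subst (2^ Z ∣_) (neg t κ l (f J₀) (f (2 ℕ.+ J₀))) (ℤD.∣m⇒∣-m (subst (2^ Z ∣_) (sym 𝓛≡) (∑-∣ L term)))
     where
     L = suc (j₁ ℕ.+ j₂ ℕ.+ (2 ℕ.+ J₀))
     N : ∀ j → j ℕ.< L → f j ≡ ∑ L (λ i → bin j i · Δℤⁿ i f 0)
     N j = newton j L f
     top : 2 ℕ.+ J₀ ℕ.< L
     top = ℕ.s≤s (ℕₚ.m≤n+m (2 ℕ.+ J₀) (j₁ ℕ.+ j₂))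
     𝓛≡ : 𝓛 1ℤ 1ℤ 1ℤ (f J₀) (f (2 ℕ.+ J₀)) ≡ ∑ L (λ i → Δℤⁿ i f 0 · 𝓑 i)
     𝓛≡ = trans (cong₂ (λ a b → 𝓛 a b 1ℤ (f J₀) (f (2 ℕ.+ J₀)))
             (trans (sym f₁) (N j₁ (ℕ.s≤s (ℕₚ.≤-trans (ℕₚ.m≤m+n j₁ j₂) (ℕₚ.m≤m+n (j₁ ℕ.+ j₂) (2 ℕ.+ J₀))))))
             (trans (sym f₂) (N j₂ (ℕ.s≤s (ℕₚ.≤-trans (ℕₚ.m≤n+m j₂ j₁) (ℕₚ.m≤m+n (j₁ ℕ.+ j₂) (2 ℕ.+ J₀)))))))
       (trans (cong₂ (λ a b → 𝓛 (S j₁) (S j₂) a b (f (2 ℕ.+ J₀)))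
             (trans (sym f₀) (N (suc J₀) (ℕₚ.≤-trans (ℕₚ.n≤1+n _) top))) (N J₀ (ℕₚ.≤-trans (ℕₚ.n≤1+n _) (ℕₚ.≤-trans (ℕₚ.n≤1+n _) top))))
       (trans (cong (𝓛 (S j₁) (S j₂) (S (suc J₀)) (S J₀)) (N (2 ℕ.+ J₀) top))
              (𝓛-∑ L (λ i → Δℤⁿ i f 0) (bin j₁) (bin j₂) (bin (suc J₀)) (bin J₀) (bin (2 ℕ.+ J₀)))))
       where
       S : ℕ → ℤ
       S j = ∑ L (λ i → bin j i · Δℤⁿ i f 0)
     neg : ∀ t κ l f₋ f₊ → ℤ.- (+ 2 · (l · (t · l ∔ 1ℤ) · 0ℤ ℤ.- κ · (t · κ ∔ 1ℤ) · 0ℤ) ℤ.- κ · l · (κ ℤ.- l) · ((1ℤ ∔ t) · f₋ ∔ (1ℤ ℤ.- t) · f₊ ℤ.- + 2)) ≡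
       κ · l · (κ ℤ.- l) · ((1ℤ ∔ t) · f₋ ∔ (1ℤ ℤ.- t) · f₊ ℤ.- + 2)
     neg = ℤ-solve 5 (λ t κ l f₋ f₊ → :- (Κ (+ 2) :* (l :* (t :* l :+ Κ 1ℤ) :* Κ 0ℤ :- κ :* (t :* κ :+ Κ 1ℤ) :* Κ 0ℤ) :- κ :* l :* (κ :- l) :* ((Κ 1ℤ :+ t) :* f₋ :+ (Κ 1ℤ :- t) :* f₊ :- Κ (+ 2))) , κ :* l :* (κ :- l) :* ((Κ 1ℤ :+ t) :* f₋ :+ (Κ 1ℤ :- t) :* f₊ :- Κ (+ 2))) refl

 -- Two solutions κ ≠ l besides 0 are incompatible with a corner of small 2-adic valuation.
 module Incompatible (U D : Seq) (β : ℚ) (μ u : ℕ) (1≤u : 1 ℕ.≤ u) (u<μ : u ℕ.< μ) (μ≤2u : μ ℕ.≤ u ℕ.+ u)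
   (β-small : Div (suc μ) (2ℚ * (2ℚ * β))) (U-small : ∀ j → Div u (U j)) (ΔU-small : ∀ j → Div μ (Δ U j))
   (D-int : ∀ j → Div 0 (D j)) (inverse : ∀ j → (1ℚ - U j) * D j ≡ 1ℚ)
   (recursion : ∀ j → (U (2 ℕ.+ j) + U j) * ((1ℚ - U (suc j)) * (1ℚ - U (suc j))) ≡
                      2ℚ * (U (suc j) + U (suc j) * U (suc j) + 2ℚ * β))
   (F : ℕ → ℤ) (F-odd : ∀ j → + 2 ∣ F j ℤ.- 1ℤ)
   (ratios : ∀ j → ι (F (3 ℕ.+ j)) * (ι (F (1 ℕ.+ j)) * ι (F (1 ℕ.+ j)) * ι (F (1 ℕ.+ j))) * twelfth (1ℚ - U (1 ℕ.+ j)) ≡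
                   ι (F j) * (ι (F (2 ℕ.+ j)) * ι (F (2 ℕ.+ j)) * ι (F (2 ℕ.+ j))) * twelfth (1ℚ - U (2 ℕ.+ j)))
   (κ l : ℤ) (P≢0 : κ · l · (κ ℤ.- l) ≢ 0ℤ)
   (J₀ j₁ j₂ : ℕ) (e₁ : + j₁ ≡ κ ∔ + suc J₀) (e₂ : + j₂ ≡ l ∔ + suc J₀)
   (F₁ : F j₁ ≡ 1ℤ) (F₂ : F j₂ ≡ 1ℤ) (F₀ : F (suc J₀) ≡ 1ℤ) where

   private
     m = proj₁ (exact _ P≢0)
     P-exact = proj₂ (exact _ P≢0)
     -- The least admissible K. It makes the precision of the corner exactly 2K, so that quadratic
     -- errors in f - 1 may be discarded.
     K = suc (μ ℕ.+ m)
     F₋ = F J₀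
     F₊ = F (2 ℕ.+ J₀)
     f : ℕ → ℤ
     f j = sqsℤ K (F j)
     open ThirdDifference U D β μ u 1≤u u<μ μ≤2u β-small U-small ΔU-small D-int inverse recursion F F-odd ratios K
       using (third-difference; f-near)

     near : 2^ K ∣ f J₀ ℤ.- 1ℤ
     near = ι-Div (subst (Div K) (trans (cong (_- 1ℚ) (sym (ι-sqs K F₋))) (sym (ι-- (f J₀) 1ℤ))) (f-near J₀))

     F-Odd : ∀ j → Odd (F j)
     F-Odd j h = ∤-1 prime[2] (subst (+ 2 ∣_) (lem (F j)) (ℤD.∣m∣n⇒∣m-n h (F-odd j)))
       where
       lem : ∀ z → z ℤ.- (z ℤ.- 1ℤ) ≡ 1ℤ
       lem = ℤ-solve 1 (λ z → z :- (z :- Κ 1ℤ) , Κ 1ℤ) refl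

     -- With the error S absorbed, P times R would be divisible by 2^(2K), yet its valuation is m +
     -- E, at most m + K + μ = 2K - 1.
     absurd : ∀ t {E R S} → Exact E R → E ℕ.≤ K ℕ.+ μ → 2^ (K ℕ.+ K) ∣ S →
              (1ℤ ∔ t) · f J₀ ∔ (1ℤ ℤ.- t) · f (2 ℕ.+ J₀) ℤ.- + 2 · 1ℤ ≡ R ℤ.- S → ⊥
     absurd t {E} {R} {S} exactR E≤ K∣S eq = Exact-small {m ℕ.+ E} {Z} {P′ · R} (Exact-* {m} {E} {P′} {R} P-exact exactR) small
         (subst (2^ Z ∣_) (lem P′ R S) (ℤD.∣m∣n⇒∣m+n (subst (λ z → 2^ Z ∣ P′ · z) eq c) (ℤD.∣n⇒∣m*n P′ K∣S)))
       where
       P′ = κ · l · (κ ℤ.- l)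
       Z = suc (μ ℕ.+ m) ℕ.+ K
       c = corner-∣ t κ l J₀ j₁ j₂ e₁ e₂ f K μ m (λ e i → third-difference e i 0)
             (subst (2^ m ∣_) (sym (proj₂ (proj₂ P-exact))) (ℤD.∣m⇒∣m*n (proj₁ P-exact) ℤD.∣-refl)) ℕₚ.≤-refl
             (sqsℤ-1 K F₁) (sqsℤ-1 K F₂) (sqsℤ-1 K F₀)
       lem : ∀ P R S → P · (R ℤ.- S) ∔ P · S ≡ P · R
       lem = ℤ-solve 3 (λ P R S → P :* (R :- S) :+ P :* S , P :* R) refl
       small : m ℕ.+ E ℕ.< Z
       small = subst (m ℕ.+ E ℕ.<_) (a m μ K) (ℕ.s≤s (ℕₚ.+-monoʳ-≤ m E≤))
         where
         a : ∀ m μ K → suc (m ℕ.+ (K ℕ.+ μ)) ≡ suc (μ ℕ.+ m) ℕ.+ K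
         a = ℕ-solve

     sq-∣ : 2^ (K ℕ.+ K) ∣ (f J₀ ℤ.- 1ℤ) · (f J₀ ℤ.- 1ℤ)
     sq-∣ = subst (_∣ (f J₀ ℤ.- 1ℤ) · (f J₀ ℤ.- 1ℤ)) (sym (ℤₚ.^-distribˡ-+-* (+ 2) K K)) (*-mono-∣ near near)

   -- For t = 3 the corner is 2(f₋² - f₊) minus 2(f₋ - 1)², and the last square is divisible by
   -- 2^(2K). Each of the K squarings adds exactly 1 to the valuation of F₋² - F₊.
   incompatible₃ : ∀ n → Exact (2 ℕ.+ n) (F₋ · F₋ ℤ.- F₊) → 3 ℕ.+ n ℕ.≤ μ → ⊥
   incompatible₃ n E n≤ = absurd (+ 3) {1 ℕ.+ (2 ℕ.+ K ℕ.+ n)}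
       (Exact-* {1} {2 ℕ.+ K ℕ.+ n} {+ 2} {sqsℤ K (F₋ · F₋) ℤ.- f (2 ℕ.+ J₀)} Exact-2 (Exact-sqs K {n} {F₋ · F₋} {F₊} (F-Odd (2 ℕ.+ J₀)) E))
       (subst (ℕ._≤ K ℕ.+ μ) (a n K) (ℕₚ.+-monoʳ-≤ K n≤))
       (ℤD.∣n⇒∣m*n (+ 2) sq-∣)
       (trans (lem (f J₀) (f (2 ℕ.+ J₀))) (cong (λ z → + 2 · (z ℤ.- f (2 ℕ.+ J₀)) ℤ.- + 2 · ((f J₀ ℤ.- 1ℤ) · (f J₀ ℤ.- 1ℤ))) (sym (sqsℤ-* K F₋ F₋))))
     where
     a : ∀ n K → K ℕ.+ (3 ℕ.+ n) ≡ 1 ℕ.+ (2 ℕ.+ K ℕ.+ n)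
     a = ℕ-solve
     lem : ∀ p q → (1ℤ ∔ + 3) · p ∔ (1ℤ ℤ.- + 3) · q ℤ.- + 2 · 1ℤ ≡ + 2 · (p · p ℤ.- q) ℤ.- + 2 · ((p ℤ.- 1ℤ) · (p ℤ.- 1ℤ))
     lem = ℤ-solve 2 (λ p q → (Κ 1ℤ :+ Κ (+ 3)) :* p :+ (Κ 1ℤ :- Κ (+ 3)) :* q :- Κ (+ 2) :* Κ 1ℤ , Κ (+ 2) :* (p :* p :- q) :- Κ (+ 2) :* ((p :- Κ 1ℤ) :* (p :- Κ 1ℤ))) refl

   -- For t = 2 the corner is f₋³ - f₊ minus (f₋ - 1)² (f₋ + 2). No factor 2 stands in front, so the
   -- bound on n is weaker by one than for t = 3.
   incompatible₂ : ∀ n → Exact (2 ℕ.+ n) (F₋ · F₋ · F₋ ℤ.- F₊) → 2 ℕ.+ n ℕ.≤ μ → ⊥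
   incompatible₂ n E n≤ = absurd (+ 2) {2 ℕ.+ K ℕ.+ n}
       (Exact-sqs K {n} {F₋ · F₋ · F₋} {F₊} (F-Odd (2 ℕ.+ J₀)) E)
       (subst (ℕ._≤ K ℕ.+ μ) (a n K) (ℕₚ.+-monoʳ-≤ K n≤))
       (ℤD.∣m⇒∣m*n (f J₀ ∔ + 2) sq-∣)
       (trans (lem (f J₀) (f (2 ℕ.+ J₀))) (cong (λ z → (z ℤ.- f (2 ℕ.+ J₀)) ℤ.- (f J₀ ℤ.- 1ℤ) · (f J₀ ℤ.- 1ℤ) · (f J₀ ∔ + 2))
         (sym (trans (sqsℤ-* K (F₋ · F₋) F₋) (cong (_· f J₀) (sqsℤ-* K F₋ F₋))))))
     where
     a : ∀ n K → K ℕ.+ (2 ℕ.+ n) ≡ 2 ℕ.+ K ℕ.+ n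
     a = ℕ-solve
     lem : ∀ p q → (1ℤ ∔ + 2) · p ∔ (1ℤ ℤ.- + 2) · q ℤ.- + 2 · 1ℤ ≡ (p · p · p ℤ.- q) ℤ.- (p ℤ.- 1ℤ) · (p ℤ.- 1ℤ) · (p ∔ + 2)
     lem = ℤ-solve 2 (λ p q → (Κ 1ℤ :+ Κ (+ 2)) :* p :+ (Κ 1ℤ :- Κ (+ 2)) :* q :- Κ (+ 2) :* Κ 1ℤ , (p :* p :* p :- q) :- (p :- Κ 1ℤ) :* (p :- Κ 1ℤ) :* (p :+ Κ (+ 2))) refl

-- The normalising parameters and their properties at each prime

module Reduction where

 open DyadicIntegers using (Odd; Odd-*; 2^_; 2^-mono; Odd-≢0)
 open Progressions using (Exact; Exact-*; Exact-odd; Exact-2; exact; even-+-odd)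
 open import Data.Nat.GCD using (gcd; gcd[m,n]∣m; gcd[m,n]∣n; gcd-greatest; gcd[m,n]≡0⇒n≡0)
 open import Data.Nat.Primality using (Prime; prime[2]; prime?; prime⇒irreducible; ¬prime[1])
 open import Data.Integer using (+_; _^_)
 open import Data.Integer.Divisibility.Signed using (_∣_; divides; ∣⇒∣ᵤ; ∣ᵤ⇒∣)
 open import Relation.Nullary.Decidable using (from-yes)

 prime[3] : Prime 3
 prime[3] = from-yes (prime? 3)

 prime∣prime : ∀ {p q} → Prime p → Prime q → + p ∣ + q → p ≡ q
 prime∣prime pp pq h with prime⇒irreducible pq (∣⇒∣ᵤ h)
 ... | inj₁ refl = ⊥-elim (¬prime[1] pp)
 ... | inj₂ e = e

 3-odd : Odd (+ 3)
 3-odd h with prime∣prime prime[2] prime[3] h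
 ... | ()

 module _ {p : ℕ} (pp : Prime p) where
   private π = + p

   ^-∣-mono : ∀ {j k i} → j ℕ.≤ k → π ^ k ∣ i → π ^ j ∣ i
   ^-∣-mono {j} {k} j≤k h = ℤD.∣-trans (divides (π ^ (k ℕ.∸ j)) (trans (cong (π ^_) (sym (ℕₚ.m∸n+n≡m j≤k))) (ℤₚ.^-distribˡ-+-* π (k ℕ.∸ j) j))) h

   -- At most one factor p is lost to a prime cofactor.
   ∣-prime-cancel : ∀ k {q i} → Prime q → π ^ suc k ∣ + q · i → π ^ k ∣ i
   ∣-prime-cancel k {q} {i} pq h with π ℤD.∣? + q
   ... | no  p∤q = ^-∣-mono (ℕₚ.n≤1+n k) (∣-cancel pp (suc k) p∤q (subst (π ^ suc k ∣_) (ℤₚ.*-comm (+ q) i) h))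
   ... | yes p∣q with prime∣prime pp pq p∣q
   ...   | refl = ℤD.*-cancelˡ-∣ π {{ℤ.≢-nonZero (π≢0 pp)}} h

 -- 3 x³ / (2 y)² = N / (α σ) in lowest terms, where α γ = 3, and 3 ∤ α σ unless α = 3.
 record Reduced (x y : ℤ) : Set where
   field
     α γ N σ g : ℤ
     αγ       : α · γ ≡ + 3
     num      : + 3 · x ³ℤ ≡ N · g
     den      : (+ 2 · y) ²ℤ ≡ α · σ · g
     lowest   : ∀ {p} → Prime p → + p ∣ N → + p ∤ α · σ
     γ-lowest : ∀ {p} → Prime p → + p ∣ γ → + p ∤ α · σ
     α-odd    : Odd α
     γ-odd    : Odd γ
     γ-cases  : γ ≡ 1ℤ ⊎ γ ≡ + 3

 reduced : ∀ x y → y ≢ 0ℤ → Reduced x y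
 reduced x y y≢0 = by (+ 3 ℤD.∣? s)
   where
   n = + 3 · x ³ℤ
   a² = (+ 2 · y) ²ℤ
   a²≢0 : a² ≢ 0ℤ
   a²≢0 = ℤ-*-≢0 (ℤ-*-≢0 {+ 2} (λ ()) y≢0) (ℤ-*-≢0 {+ 2} (λ ()) y≢0)
   G = gcd ℤ.∣ n ∣ ℤ.∣ a² ∣
   g = + G
   G≢0 : g ≢ 0ℤ
   G≢0 e = a²≢0 (ℤₚ.∣i∣≡0⇒i≡0 (gcd[m,n]≡0⇒n≡0 ℤ.∣ n ∣ {ℤ.∣ a² ∣} (ℤₚ.+-injective e)))
   g∣n : g ∣ n
   g∣n = ∣ᵤ⇒∣ (gcd[m,n]∣m ℤ.∣ n ∣ ℤ.∣ a² ∣)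
   g∣a² : g ∣ a²
   g∣a² = ∣ᵤ⇒∣ (gcd[m,n]∣n ℤ.∣ n ∣ ℤ.∣ a² ∣)
   N = ℤD._∣_.quotient g∣n
   s = ℤD._∣_.quotient g∣a²
   n≡ : n ≡ N · g
   n≡ = ℤD._∣_.equality g∣n
   a²≡ : a² ≡ s · g
   a²≡ = ℤD._∣_.equality g∣a²
   coprime : ∀ {p} → Prime p → + p ∣ N → + p ∤ s
   coprime {p} pp h h′ = ∤-1 pp (ℤD.*-cancelʳ-∣ g {{ℤ.≢-nonZero G≢0}} (subst ((+ p · g) ∣_) (sym (ℤₚ.*-identityˡ g)) pg∣g))
     where
     pg∣g : (+ p · g) ∣ g
     pg∣g = ∣ᵤ⇒∣ (gcd-greatest (∣⇒∣ᵤ (subst ((+ p · g) ∣_) (sym n≡) (ℤD.*-monoˡ-∣ g h))) (∣⇒∣ᵤ (subst ((+ p · g) ∣_) (sym a²≡) (ℤD.*-monoˡ-∣ g h′))))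
   one : ∀ s → s ≡ 1ℤ · s
   one s = sym (ℤₚ.*-identityˡ s)
   by : _ → Reduced x y
   by (yes (divides σ e)) = record
     { α = + 3 ; γ = 1ℤ ; N = N ; σ = σ ; g = g ; αγ = refl ; num = n≡
     ; den = trans a²≡ (cong (_· g) s≡)
     ; lowest = λ pp h h′ → coprime pp h (subst (_ ∣_) (sym s≡) h′)
     ; γ-lowest = λ pp h _ → ∤-1 pp h
     ; α-odd = 3-odd ; γ-odd = ∤-1 prime[2] ; γ-cases = inj₁ refl }
     where
     s≡ : s ≡ + 3 · σ
     s≡ = trans e (ℤₚ.*-comm σ (+ 3))
   by (no 3∤s) = record
     { α = 1ℤ ; γ = + 3 ; N = N ; σ = s ; g = g ; αγ = refl ; num = n≡
     ; den = trans a²≡ (cong (_· g) (one s))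
     ; lowest = λ pp h h′ → coprime pp h (subst (_ ∣_) (sym (one s)) h′)
     ; γ-lowest = λ {p} pp h h′ → 3∤s (subst (λ p → + p ∣ s) (prime∣prime pp prime[3] h) (subst (+ p ∣_) (sym (one s)) h′))
     ; α-odd = ∤-1 prime[2] ; γ-odd = 3-odd ; γ-cases = inj₂ refl }

 -- The case where the step is 6 and `b` is even. The expression in `main` is v₅² - v₇; the
 -- inequalities between ω and u become those required of the progression after powers of v 6 have
 -- been added.
 record Case₆ (T b c h : ℤ) : Set where
   field
     T-odd : Odd T
     c-odd : Odd c
     ω u η : ℕ
     1≤ω   : 1 ℕ.≤ ω
     b∣    : 2^ ω ∣ b
     h∣    : 2^ u ∣ h
     u≤ω   : u ℕ.≤ ω
     ω≤2u  : ω ℕ.≤ u ℕ.+ u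
     main  : Exact (suc η) (c ²ℤ · T · (T ∔ c) ℤ.- + 3 · b · c · T ∔ + 2 · b ²ℤ)
     η≤    : suc η ℕ.≤ ω

 -- The case where the step is 4 and `T` is even. Here `T` is an odd multiple of a square, and suc ν
 -- is the valuation of the square root.
 record Case₄ (T b c h k : ℤ) : Set where
   field
     b-odd : Odd b
     c₁    : Exact 1 c
     ν     : ℕ
     T∣    : Exact (suc ν ℕ.+ suc ν) T
     h∣    : 2^ suc ν ∣ h
     k∣    : 2^ (suc ν ℕ.+ suc ν) ∣ k

 -- The residues of T, b, c modulo 3; in the first case 3 ∤ T.
 Residues : ℤ → ℤ → ℤ → Set
 Residues T b c = (+ 3 ∣ b × + 3 ∣ c ∔ T) ⊎ (+ 3 ∣ T × + 3 ∣ b ∔ 1ℤ × + 3 ∣ c ℤ.- 1ℤ)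

 -- `k` is the coefficient B in the normalisation of `Params`. The 12 is 4 · 3: the 4 belongs to
 -- 4B/x(sP)³, the 3 makes the quotient by G² integral and is odd, hence harmless.
 record TwoAdic {x y : ℤ} (Pm : Params x y) (B : ℤ) : Set where
   open Params Pm
   field
     k    : ℤ
     k≡   : + 12 · B · (a ³ℤ · a ³ℤ) ≡ k · G ²ℤ
     case : Case₆ T b c h ⊎ Case₄ T b c h k

 Exact-mul-odd : ∀ {m z r} → Exact m z → Odd r → Exact m (z · r)
 Exact-mul-odd {m} {z} {r} E o = subst (λ n → Exact n (z · r)) (ℕₚ.+-identityʳ m) (Exact-* {m} {0} {z} {r} E (Exact-odd o))

 Exact⇒∣ : ∀ {m z} → Exact m z → 2^ m ∣ z
 Exact⇒∣ (o , _ , refl) = ℤD.∣m⇒∣m*n o ℤD.∣-refl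

 parity : ∀ z → + 2 ∣ z ⊎ + 2 ∣ (z ℤ.- 1ℤ)
 parity z = go (z % + 2) (z / + 2) (a≡a%n+[a/n]*n z (+ 2)) (n%d<d z (+ 2))
   where
   open import Data.Integer.DivMod using (_%_; a≡a%n+[a/n]*n; n%d<d; _/_)
   go : ∀ r k → z ≡ + r ∔ k · + 2 → r ℕ.< 2 → + 2 ∣ z ⊎ + 2 ∣ z ℤ.- 1ℤ
   go 0 k e _ = inj₁ (divides k (trans e (ℤₚ.+-identityˡ (k · + 2))))
   go 1 k e _ = inj₂ (divides k (trans (cong (ℤ._- 1ℤ) e) (lem k)))
     where
     lem : ∀ k → (1ℤ ∔ k · + 2) ℤ.- 1ℤ ≡ k · + 2
     lem = ℤ-solve 1 (λ k → (Κ 1ℤ :+ k :* Κ (+ 2)) :- Κ 1ℤ , k :* Κ (+ 2)) refl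
   go (suc (suc _)) _ _ (ℕ.s≤s (ℕ.s≤s ()))

 odd-odd : ∀ {y z} → Odd y → Odd z → + 2 ∣ (y ℤ.- z)
 odd-odd {y} {z} oy oz with parity y | parity z
 ... | inj₁ h | _ = ⊥-elim (oy h)
 ... | _ | inj₁ h = ⊥-elim (oz h)
 ... | inj₂ h | inj₂ h′ = subst (+ 2 ∣_) (lem y z) (ℤD.∣m∣n⇒∣m-n h h′)
   where
   lem : ∀ y z → (y ℤ.- 1ℤ) ℤ.- (z ℤ.- 1ℤ) ≡ y ℤ.- z
   lem = ℤ-solve 2 (λ y z → (y :- Κ 1ℤ) :- (z :- Κ 1ℤ) , y :- z) refl

 Odd-neg : ∀ {z} → Odd z → Odd (ℤ.- z)
 Odd-neg {z} o h = o (subst (+ 2 ∣_) (ℤₚ.neg-involutive z) (ℤD.∣m⇒∣-m h))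

 even--odd : ∀ {i j} → + 2 ∣ i → Odd j → Odd (i ℤ.- j)
 even--odd {i} {j} h o = even-+-odd {i} {ℤ.- j} h (Odd-neg {j} o)

 odd--even : ∀ {i j} → Odd i → + 2 ∣ j → Odd (i ℤ.- j)
 odd--even {i} {j} o h = subst Odd (ℤₚ.+-comm (ℤ.- j) i) (even-+-odd {ℤ.- j} {i} (ℤD.∣m⇒∣-m h) o)

 ∣2* : ∀ z → + 2 ∣ + 2 · z
 ∣2* z = ℤD.∣m⇒∣m*n z ℤD.∣-refl

 exact-pos : ∀ z → z ≢ 0ℤ → + 2 ∣ z → Σ ℕ λ ν → Exact (suc ν) z
 exact-pos z z≢0 h with exact z z≢0
 ... | suc ν , e = ν , e
 ... | zero , (o , oo , e) = ⊥-elim (oo (subst (+ 2 ∣_) (trans e (ℤₚ.*-identityˡ o)) h))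

 mod-3 : ∀ z → + 3 ∣ z ⊎ (+ 3 ∣ z ℤ.- 1ℤ ⊎ + 3 ∣ z ∔ 1ℤ)
 mod-3 z = go (z % + 3) (z / + 3) (a≡a%n+[a/n]*n z (+ 3)) (n%d<d z (+ 3))
   where
   open import Data.Integer.DivMod using (_%_; a≡a%n+[a/n]*n; n%d<d; _/_)
   go : ∀ r k → z ≡ + r ∔ k · + 3 → r ℕ.< 3 → + 3 ∣ z ⊎ (+ 3 ∣ z ℤ.- 1ℤ ⊎ + 3 ∣ z ∔ 1ℤ)
   go 0 k e _ = inj₁ (divides k (trans e (ℤₚ.+-identityˡ (k · + 3))))
   go 1 k e _ = inj₂ (inj₁ (divides k (trans (cong (ℤ._- 1ℤ) e) (lem k))))
     where
     lem : ∀ k → (1ℤ ∔ k · + 3) ℤ.- 1ℤ ≡ k · + 3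
     lem = ℤ-solve 1 (λ k → (Κ 1ℤ :+ k :* Κ (+ 3)) :- Κ 1ℤ , k :* Κ (+ 3)) refl
   go 2 k e _ = inj₂ (inj₂ (divides (k ∔ 1ℤ) (trans (cong (_∔ 1ℤ) e) (lem k))))
     where
     lem : ∀ k → (+ 2 ∔ k · + 3) ∔ 1ℤ ≡ (k ∔ 1ℤ) · + 3
     lem = ℤ-solve 1 (λ k → (Κ (+ 2) :+ k :* Κ (+ 3)) :+ Κ 1ℤ , (k :+ Κ 1ℤ) :* Κ (+ 3)) refl
   go (suc (suc (suc _))) _ _ (ℕ.s≤s (ℕ.s≤s (ℕ.s≤s ())))

 unit-square : ∀ {z} → + 3 ∤ z → + 3 ∣ z ²ℤ ℤ.- 1ℤ
 unit-square {z} u with mod-3 z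
 ... | inj₁ h = ⊥-elim (u h)
 ... | inj₂ (inj₁ h) = subst (+ 3 ∣_) (lem z) (ℤD.∣m⇒∣m*n (z ∔ 1ℤ) h)
   where
   lem : ∀ z → (z ℤ.- 1ℤ) · (z ∔ 1ℤ) ≡ z · z ℤ.- 1ℤ
   lem = ℤ-solve 1 (λ z → (z :- Κ 1ℤ) :* (z :+ Κ 1ℤ) , z :* z :- Κ 1ℤ) refl
 ... | inj₂ (inj₂ h) = subst (+ 3 ∣_) (lem z) (ℤD.∣n⇒∣m*n (z ℤ.- 1ℤ) h)
   where
   lem : ∀ z → (z ℤ.- 1ℤ) · (z ∔ 1ℤ) ≡ z · z ℤ.- 1ℤ
   lem = ℤ-solve 1 (λ z → (z :- Κ 1ℤ) :* (z :+ Κ 1ℤ) , z :* z :- Κ 1ℤ) refl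

 module Build {x y : ℤ} (R : Reduced x y) (free : SixthPowerFree (y ²ℤ ℤ.- x ³ℤ)) (x≢0 : x ≢ 0ℤ) (y≢0 : y ≢ 0ℤ) (d≢0 : ψ₃ x y ≢ 0ℤ) where
   open Reduced R

   -- With (2y)² = s g and 3x³ = N g one has 4y² - 3x³ = q g, so a⁴ = s² g² and d³ = 9 N q³ g⁴. Put
   -- s = α σ and 9 = α² γ²: the common part G = α g² leaves T = α σ² and b = γ² N q³. The lowest
   -- terms of N/s make T and b coprime, and the splitting 3 = α γ keeps the prime 3 on one side.
   a d q s T b c G h k : ℤ
   a = + 2 · y
   d = ψ₃ x y
   s = α · σ
   q = s ℤ.- N
   T = α · σ ²ℤ
   b = γ ²ℤ · N · q ³ℤ
   c = + 2 · γ · N · q ℤ.- T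
   G = α · g ²ℤ
   h = γ · N · σ · q ²ℤ
   k = α · σ ³ℤ · (+ 3 · s ℤ.- + 4 · N)

   a²-n : + 4 · y ²ℤ ℤ.- + 3 · x ³ℤ ≡ q · g
   a²-n = trans (lem₁ x y) (trans (cong₂ ℤ._-_ den num) (lem₂ s N g))
     where
     lem₁ : ∀ x y → + 4 · (y · y) ℤ.- + 3 · (x · x · x) ≡ + 2 · y · (+ 2 · y) ℤ.- + 3 · (x · x · x)
     lem₁ = ℤ-solve 2 (λ x y → Κ (+ 4) :* (y :* y) :- Κ (+ 3) :* (x :* x :* x) , Κ (+ 2) :* y :* (Κ (+ 2) :* y) :- Κ (+ 3) :* (x :* x :* x)) refl
     lem₂ : ∀ s N g → s · g ℤ.- N · g ≡ (s ℤ.- N) · g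
     lem₂ = ℤ-solve 3 (λ s N g → s :* g :- N :* g , (s :- N) :* g) refl

   params : Params x y
   params = record { T = T ; b = b ; c = c ; G = G ; h = h ; a⁴ = a⁴ ; d³ = d³ ; ψ₄≡ = ψ₄≡ ; xa²d² = xa²d² }
     where
     open ≡-Reasoning
     a⁴ : a · a · (a · a) ≡ T · G
     a⁴ = trans (cong₂ _·_ den den) (lem α σ g)
       where
       lem : ∀ α σ g → α · σ · g · (α · σ · g) ≡ α · (σ · σ) · (α · (g · g))
       lem = ℤ-solve 3 (λ α σ g → α :* σ :* g :* (α :* σ :* g) , α :* (σ :* σ) :* (α :* (g :* g))) refl
     d³ : d · d · d ≡ b · (G · G)
     d³ = begin
       d · d · d ≡⟨ lem₁ x (+ 4 · y ²ℤ ℤ.- + 3 · x ³ℤ) ⟩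
       + 3 · + 3 · (+ 3 · x ³ℤ) · (+ 4 · y ²ℤ ℤ.- + 3 · x ³ℤ) ³ℤ ≡⟨ cong₂ (λ u v → + 3 · + 3 · u · v ³ℤ) num a²-n ⟩
       + 3 · + 3 · (N · g) · (q · g) ³ℤ ≡⟨ cong (λ t → t · t · (N · g) · (q · g) ³ℤ) (sym αγ) ⟩
       α · γ · (α · γ) · (N · g) · (q · g) ³ℤ ≡⟨ lem₂ α γ N g q ⟩
       b · (G · G) ∎
       where
       lem₁ : ∀ x z → + 3 · x · z · (+ 3 · x · z) · (+ 3 · x · z) ≡ + 3 · + 3 · (+ 3 · (x · x · x)) · (z · z · z)
       lem₁ = ℤ-solve 2 (λ x z → Κ (+ 3) :* x :* z :* (Κ (+ 3) :* x :* z) :* (Κ (+ 3) :* x :* z) , Κ (+ 3) :* Κ (+ 3) :* (Κ (+ 3) :* (x :* x :* x)) :* (z :* z :* z)) refl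
       lem₂ : ∀ α γ N g q → α · γ · (α · γ) · (N · g) · (q · g · (q · g) · (q · g)) ≡
         γ · γ · N · (q · q · q) · (α · (g · g) · (α · (g · g)))
       lem₂ = ℤ-solve 5 (λ α γ N g q → α :* γ :* (α :* γ) :* (N :* g) :* (q :* g :* (q :* g) :* (q :* g)) , γ :* γ :* N :* (q :* q :* q) :* (α :* (g :* g) :* (α :* (g :* g)))) refl
     ψ₄≡ : ψ₄ x y ≡ a · c · G
     ψ₄≡ = begin
       ψ₄ x y ≡⟨ lem₁ x y ⟩
       a · (+ 2 · + 3 · (+ 3 · x ³ℤ) · (a ²ℤ ℤ.- + 3 · x ³ℤ) ℤ.- a ²ℤ · a ²ℤ)
         ≡⟨ cong₂ (λ u v → a · (+ 2 · + 3 · u · (v ℤ.- u) ℤ.- v · v)) num den ⟩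
       a · (+ 2 · + 3 · (N · g) · (s · g ℤ.- N · g) ℤ.- s · g · (s · g))
         ≡⟨ cong (λ t → a · (+ 2 · t · (N · g) · (s · g ℤ.- N · g) ℤ.- s · g · (s · g))) (sym αγ) ⟩
       a · (+ 2 · (α · γ) · (N · g) · (s · g ℤ.- N · g) ℤ.- s · g · (s · g)) ≡⟨ lem₂ a α γ N g σ ⟩
       a · c · G ∎
       where
       lem₁ : ∀ x y → + 4 · y · (+ 36 · (x · x · x) · (y · y) ℤ.- + 27 · (x · x · x) · (x · x · x) ℤ.- + 8 · (y · y) · (y · y)) ≡
         + 2 · y · (+ 2 · + 3 · (+ 3 · (x · x · x)) · (+ 2 · y · (+ 2 · y) ℤ.- + 3 · (x · x · x)) ℤ.- + 2 · y · (+ 2 · y) · (+ 2 · y · (+ 2 · y)))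
       lem₁ = ℤ-solve 2 (λ x y → Κ (+ 4) :* y :* (Κ (+ 36) :* (x :* x :* x) :* (y :* y) :- Κ (+ 27) :* (x :* x :* x) :* (x :* x :* x) :- Κ (+ 8) :* (y :* y) :* (y :* y)) , Κ (+ 2) :* y :* (Κ (+ 2) :* Κ (+ 3) :* (Κ (+ 3) :* (x :* x :* x)) :* (Κ (+ 2) :* y :* (Κ (+ 2) :* y) :- Κ (+ 3) :* (x :* x :* x)) :- Κ (+ 2) :* y :* (Κ (+ 2) :* y) :* (Κ (+ 2) :* y :* (Κ (+ 2) :* y)))) refl
       lem₂ : ∀ a α γ N g σ → a · (+ 2 · (α · γ) · (N · g) · (α · σ · g ℤ.- N · g) ℤ.- α · σ · g · (α · σ · g)) ≡
         a · (+ 2 · γ · N · (α · σ ℤ.- N) ℤ.- α · (σ · σ)) · (α · (g · g))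
       lem₂ = ℤ-solve 6 (λ a α γ N g σ → a :* (Κ (+ 2) :* (α :* γ) :* (N :* g) :* (α :* σ :* g :- N :* g) :- α :* σ :* g :* (α :* σ :* g)) , a :* (Κ (+ 2) :* γ :* N :* (α :* σ :- N) :- α :* (σ :* σ)) :* (α :* (g :* g))) refl
     xa²d² : x · a ²ℤ · d ²ℤ ≡ h · G ²ℤ
     xa²d² = begin
       x · a ²ℤ · d ²ℤ ≡⟨ lem₁ x (a ²ℤ) (+ 4 · y ²ℤ ℤ.- + 3 · x ³ℤ) ⟩
       + 3 · (+ 3 · x ³ℤ) · (+ 4 · y ²ℤ ℤ.- + 3 · x ³ℤ) ²ℤ · a ²ℤ ≡⟨ cong₂ (λ u v → + 3 · u · v ²ℤ · a ²ℤ) num a²-n ⟩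
       + 3 · (N · g) · (q · g) ²ℤ · a ²ℤ ≡⟨ cong₂ (λ t z → t · (N · g) · (q · g) ²ℤ · z) (sym αγ) den ⟩
       α · γ · (N · g) · (q · g) ²ℤ · (s · g) ≡⟨ lem₂ α γ N g q σ ⟩
       h · G ²ℤ ∎
       where
       lem₁ : ∀ x a z → x · a · (+ 3 · x · z · (+ 3 · x · z)) ≡ + 3 · (+ 3 · (x · x · x)) · (z · z) · a
       lem₁ = ℤ-solve 3 (λ x a z → x :* a :* (Κ (+ 3) :* x :* z :* (Κ (+ 3) :* x :* z)) , Κ (+ 3) :* (Κ (+ 3) :* (x :* x :* x)) :* (z :* z) :* a) refl
       lem₂ : ∀ α γ N g q σ → α · γ · (N · g) · (q · g · (q · g)) · (α · σ · g) ≡ γ · N · σ · (q · q) · (α · (g · g) · (α · (g · g)))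
       lem₂ = ℤ-solve 6 (λ α γ N g q σ → α :* γ :* (N :* g) :* (q :* g :* (q :* g)) :* (α :* σ :* g) , γ :* N :* σ :* (q :* q) :* (α :* (g :* g) :* (α :* (g :* g)))) refl

   k≡ : + 12 · (y ²ℤ ℤ.- x ³ℤ) · (a ³ℤ · a ³ℤ) ≡ k · G ²ℤ
   k≡ = trans (lem₁ x y) (trans (cong₂ (λ u v → (+ 3 · v ℤ.- + 4 · u) · v ³ℤ) num den) (lem₂ α σ g N))
     where
     lem₁ : ∀ x y → let a = + 2 · y in + 12 · (y · y ℤ.- x · x · x) · (a · a · a · (a · a · a)) ≡
       (+ 3 · (a · a) ℤ.- + 4 · (+ 3 · (x · x · x))) · (a · a · (a · a) · (a · a))
     lem₁ = ℤ-solve 2 (λ x y →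
                    let a = Κ (+ 2) :* y in Κ (+ 12) :* (y :* y :- x :* x :* x) :* (a :* a :* a :* (a :* a :* a)) ,
       (Κ (+ 3) :* (a :* a) :- Κ (+ 4) :* (Κ (+ 3) :* (x :* x :* x))) :* (a :* a :* (a :* a) :* (a :* a))) refl
     lem₂ : ∀ α σ g N → (+ 3 · (α · σ · g) ℤ.- + 4 · (N · g)) · (α · σ · g · (α · σ · g) · (α · σ · g)) ≡
       α · (σ · σ · σ) · (+ 3 · (α · σ) ℤ.- + 4 · N) · (α · (g · g) · (α · (g · g)))
     lem₂ = ℤ-solve 4 (λ α σ g N → (Κ (+ 3) :* (α :* σ :* g) :- Κ (+ 4) :* (N :* g)) :* (α :* σ :* g :* (α :* σ :* g) :* (α :* σ :* g)) , α :* (σ :* σ :* σ) :* (Κ (+ 3) :* (α :* σ) :- Κ (+ 4) :* N) :* (α :* (g :* g) :* (α :* (g :* g)))) refl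

   module _ {p : ℕ} (pp : Prime p) where
     private π = + p

     not-free : π ^ 2 ∣ x → π ^ 3 ∣ y → ⊥
     not-free hx hy = ¬prime[1] (subst Prime (free p (subst (ℕD._∣ ℤ.∣ y ²ℤ ℤ.- x ³ℤ ∣) (abs-^ π 6) (∣⇒∣ᵤ
         (ℤD.∣m∣n⇒∣m-n (subst (_∣ y ²ℤ) (lem₁ π) (*-mono-∣ hy hy)) (subst (_∣ x ³ℤ) (lem₂ π) (*-mono-∣ (*-mono-∣ hx hx) hx)))))) pp)
       where
       lem₁ : ∀ π → π · (π · (π · 1ℤ)) · (π · (π · (π · 1ℤ))) ≡ π · (π · (π · (π · (π · (π · 1ℤ)))))
       lem₁ = ℤ-solve 1 (λ π → π :* (π :* (π :* Κ 1ℤ)) :* (π :* (π :* (π :* Κ 1ℤ))) , π :* (π :* (π :* (π :* (π :* (π :* Κ 1ℤ)))))) refl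
       lem₂ : ∀ π → π · (π · 1ℤ) · (π · (π · 1ℤ)) · (π · (π · 1ℤ)) ≡ π · (π · (π · (π · (π · (π · 1ℤ)))))
       lem₂ = ℤ-solve 1 (λ π → π :* (π :* Κ 1ℤ) :* (π :* (π :* Κ 1ℤ)) :* (π :* (π :* Κ 1ℤ)) , π :* (π :* (π :* (π :* (π :* (π :* Κ 1ℤ)))))) refl

     a-chain : ∀ n → π ^ suc n ∣ a → π ^ n ∣ y
     a-chain n h = ∣-prime-cancel pp n prime[2] h

     x-chain : ∀ n → π ^ suc n ∣ N · g → π ^ n ∣ x ³ℤ
     x-chain n h = ∣-prime-cancel pp n prime[3] (subst (π ^ suc n ∣_) (sym num) h)

     g⁶⇒x² : π ^ 6 ∣ g → π ^ 2 ∣ x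
     g⁶⇒x² h = ∣-∛ pp 1 {x} (^-∣-mono pp {4} {5} {x ³ℤ} (ℕ.s≤s (ℕ.s≤s (ℕ.s≤s (ℕ.s≤s ℕ.z≤n)))) (x-chain 5 (ℤD.∣n⇒∣m*n {π ^ 6} N {g} h)))

     ∣T⇒∣s : π ∣ T → π ∣ s
     ∣T⇒∣s h with ∣-* pp α h
     ... | inj₁ h′ = ℤD.∣m⇒∣m*n σ h′
     ... | inj₂ h′ with ∣-* pp σ h′
     ...   | inj₁ h″ = ℤD.∣n⇒∣m*n α h″
     ...   | inj₂ h″ = ℤD.∣n⇒∣m*n α h″

     ∣s⇒∣T : π ∣ s → π ∣ T
     ∣s⇒∣T h = subst (π ∣_) (ℤₚ.*-assoc α σ σ) (ℤD.∣m⇒∣m*n σ h)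

     ∣b⇒ : π ∣ b → π ∣ γ ⊎ (π ∣ N ⊎ π ∣ q)
     ∣b⇒ h with ∣-* pp (γ ²ℤ · N) h
     ∣b⇒ h | inj₁ h′ with ∣-* pp (γ ²ℤ) h′
     ...   | inj₂ h″ = inj₂ (inj₁ h″)
     ...   | inj₁ h″ with ∣-* pp γ h″
     ...     | inj₁ r = inj₁ r
     ...     | inj₂ r = inj₁ r
     ∣b⇒ h | inj₂ h′ with ∣-* pp (q ²ℤ) h′
     ...   | inj₂ h″ = inj₂ (inj₂ h″)
     ...   | inj₁ h″ with ∣-* pp q h″
     ...     | inj₁ r = inj₂ (inj₂ r)
     ...     | inj₂ r = inj₂ (inj₂ r)

     T∤b : π ∣ T → π ∤ b
     T∤b hT hb with ∣T⇒∣s hT | ∣b⇒ hb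
     ... | hs | inj₁ h = γ-lowest pp h hs
     ... | hs | inj₂ (inj₁ h) = lowest pp h hs
     ... | hs | inj₂ (inj₂ h) = lowest pp (subst (π ∣_) (lem s N) (ℤD.∣m∣n⇒∣m-n hs h)) hs
       where
       lem : ∀ s N → s ℤ.- (s ℤ.- N) ≡ N
       lem = ℤ-solve 2 (λ s N → s :- (s :- N) , N) refl

     b∤c : π ∣ b → π ∤ T → π ∤ c
     b∤c hb hT hc = hT (subst (π ∣_) (lem (+ 2 · γ · N · q) T) (ℤD.∣m∣n⇒∣m-n (divisor (∣b⇒ hb)) hc))
       where
       lem : ∀ u T → u ℤ.- (u ℤ.- T) ≡ T
       lem = ℤ-solve 2 (λ u T → u :- (u :- T) , T) refl
       divisor : _ → π ∣ + 2 · γ · N · q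
       divisor (inj₁ h) = ℤD.∣m⇒∣m*n q (ℤD.∣m⇒∣m*n N (ℤD.∣n⇒∣m*n (+ 2) h))
       divisor (inj₂ (inj₁ h)) = ℤD.∣m⇒∣m*n q (ℤD.∣n⇒∣m*n (+ 2 · γ) h)
       divisor (inj₂ (inj₂ h)) = ℤD.∣n⇒∣m*n (+ 2 · γ · N) h

     ∣N⇒∣b : π ∣ N → π ∣ b
     ∣N⇒∣b h = ℤD.∣m⇒∣m*n (q ³ℤ) (ℤD.∣n⇒∣m*n (γ ²ℤ) h)

     Tb∤3 : π ∤ T → π ∤ b → π ∤ + 3
     Tb∤3 hT hb h with ∣-* pp α (subst (π ∣_) (sym αγ) h)
     ... | inj₁ r = hT (ℤD.∣m⇒∣m*n (σ ²ℤ) r)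
     ... | inj₂ r = hb (ℤD.∣m⇒∣m*n (q ³ℤ) (ℤD.∣m⇒∣m*n N (ℤD.∣m⇒∣m*n γ r)))

     Tb∤2 : π ∤ T → π ∤ b → π ∤ + 2
     Tb∤2 hT hb h with prime∣prime pp prime[2] h
     -- The prime 2 always divides `T` or `b`: when s and N are both odd, their difference q is
     -- even.
     ... | refl = hb (ℤD.∣n⇒∣m*n (γ ²ℤ · N) (ℤD.∣n⇒∣m*n (q ²ℤ) (odd-odd {s} {N} (λ e → hT (∣s⇒∣T e)) (λ e → hb (∣N⇒∣b e)))))

     -- At such p the numbers 2, 3, s and N are units, so x³, (2y)² and g have equal valuations. A
     -- positive common value is divisible by 6: the chain p ∣ x, p² ∣ a, p² ∣ x, p³ ∣ y climbs to
     -- it and contradicts `not-free`.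
     Tb∤G : π ∤ T → π ∤ b → π ∤ G
     Tb∤G hT hb hG = not-free p²∣x p³∣y
       where
       p∤3 = Tb∤3 hT hb
       p∤2 = Tb∤2 hT hb
       p∤s : π ∤ s
       p∤s e = hT (∣s⇒∣T e)
       p∤N : π ∤ N
       p∤N e = hb (∣N⇒∣b e)
       to-x : ∀ n → π ^ n ∣ g → π ^ n ∣ x ³ℤ
       to-x n h = ∣-cancel pp n {x ³ℤ} {+ 3} p∤3 (subst (π ^ n ∣_) (trans (sym num) (ℤₚ.*-comm (+ 3) (x ³ℤ))) (ℤD.∣n⇒∣m*n N h))
       from-x : ∀ n → π ^ n ∣ x ³ℤ → π ^ n ∣ g
       from-x n h = ∣-cancel pp n {g} {N} p∤N (subst (π ^ n ∣_) (trans num (ℤₚ.*-comm N g)) (ℤD.∣n⇒∣m*n (+ 3) h))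
       to-a : ∀ n → π ^ n ∣ g → π ^ n ∣ a · a
       to-a n h = subst (π ^ n ∣_) (sym den) (ℤD.∣n⇒∣m*n s h)
       from-a : ∀ n → π ^ n ∣ a · a → π ^ n ∣ g
       from-a n h = ∣-cancel pp n {g} {s} p∤s (subst (π ^ n ∣_) (trans den (ℤₚ.*-comm s g)) h)
       ^1≡ : ∀ {i} → π ∣ i → π ^ 1 ∣ i
       ^1≡ {i} = subst (_∣ i) (sym (ℤₚ.*-identityʳ π))
       p∣g : π ∣ g
       p∣g with ∣-* pp α hG
       ... | inj₁ e = ⊥-elim (hT (ℤD.∣m⇒∣m*n (σ ²ℤ) e))
       ... | inj₂ e with ∣-* pp g e
       ...   | inj₁ r = r
       ...   | inj₂ r = r
       cubed : ∀ n → π ^ n ∣ x → π ^ n · π ^ n · π ^ n ∣ x ³ℤ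
       cubed n h = *-mono-∣ (*-mono-∣ h h) h
       lem₁ : ∀ π → π · 1ℤ · (π · 1ℤ) · (π · 1ℤ) ≡ π · (π · (π · 1ℤ))
       lem₁ = ℤ-solve 1 (λ π → π :* Κ 1ℤ :* (π :* Κ 1ℤ) :* (π :* Κ 1ℤ) , π :* (π :* (π :* Κ 1ℤ))) refl
       lem₂ : ∀ π → π · (π · 1ℤ) · (π · (π · 1ℤ)) ≡ π · (π · (π · (π · 1ℤ)))
       lem₂ = ℤ-solve 1 (λ π → π :* (π :* Κ 1ℤ) :* (π :* (π :* Κ 1ℤ)) , π :* (π :* (π :* (π :* Κ 1ℤ)))) refl
       lem₃ : ∀ π → π · (π · 1ℤ) · (π · (π · 1ℤ)) · (π · (π · 1ℤ)) ≡ π · (π · (π · (π · (π · (π · 1ℤ)))))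
       lem₃ = ℤ-solve 1 (λ π → π :* (π :* Κ 1ℤ) :* (π :* (π :* Κ 1ℤ)) :* (π :* (π :* Κ 1ℤ)) , π :* (π :* (π :* (π :* (π :* (π :* Κ 1ℤ)))))) refl
       p∣x : π ^ 1 ∣ x
       p∣x = ∣-∛ pp 0 (to-x 1 (^1≡ p∣g))
       p²∣a : π ^ 2 ∣ a
       p²∣a = ∣-√ pp 1 (to-a 3 (from-x 3 (subst (_∣ x ³ℤ) (lem₁ π) (cubed 1 p∣x))))
       p²∣x : π ^ 2 ∣ x
       p²∣x = ∣-∛ pp 1 (to-x 4 (from-a 4 (subst (_∣ a · a) (lem₂ π) (*-mono-∣ p²∣a p²∣a))))
       p³∣y : π ^ 3 ∣ y
       p³∣y = ∣-cancel pp 3 {y} {+ 2} p∤2 (subst (π ^ 3 ∣_) (ℤₚ.*-comm (+ 2) y)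
                (∣-√ pp 2 {a} (^-∣-mono pp {5} {6} {a · a} (ℕₚ.n≤1+n 5) (to-a 6 (from-x 6 (subst (_∣ x ³ℤ) (lem₃ π) (cubed 2 p²∣x)))))))

     a⁴⇒y³ : π ^ 7 ∣ a · a → π ^ 3 ∣ y
     a⁴⇒y³ h = a-chain 3 (∣-√ pp 3 {a} h)

     -- Since p ∤ s, all of p⁸ goes into g. Even if one p is lost to the factor 3 in 3x³ or to the
     -- factor 2 in 2y, the rest forces p² ∣ x and p³ ∣ y.
     b-bad : π ∣ b → π ∤ T → ∀ {u} → π ∤ u → π ^ 8 ∤ a ²ℤ · u
     b-bad hb hT {u} hu h = not-free
         (g⁶⇒x² (^-∣-mono pp {6} {8} {g} (ℕₚ.≤-trans (ℕₚ.n≤1+n 6) (ℕₚ.n≤1+n 7)) (∣-cancel pp 8 {g} {s} (λ e → hT (∣s⇒∣T e)) (subst (π ^ 8 ∣_) (trans den (ℤₚ.*-comm s g)) h′))))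
         (a⁴⇒y³ (^-∣-mono pp {7} {8} {a ²ℤ} (ℕₚ.n≤1+n 7) h′))
       where
       h′ : π ^ 8 ∣ a ²ℤ
       h′ = ∣-cancel pp 8 {a ²ℤ} {u} hu h

     -- T² contains the factor s, which cancels against a² = s g and leaves p⁶ ∣ g. As p ∣ s, this
     -- also gives p⁷ ∣ a², one digit beyond p⁶, which makes up for a possible factor 2.
     T-bad : π ∣ T → ∀ {u} → π ∤ u → (π ^ 6) · T ²ℤ ∤ a ²ℤ · u
     T-bad hT {u} hu h = not-free (g⁶⇒x² p⁶∣g) (a⁴⇒y³ (subst (π ^ 7 ∣_) (sym den) (*-mono-∣ (∣T⇒∣s hT) p⁶∣g)))
       where
       s≢0 : s ≢ 0ℤ
       s≢0 e = y≢0 (2y (trans den (trans (cong (_· g) e) (ℤₚ.*-zeroˡ g))))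
         where
         2y : a ²ℤ ≡ 0ℤ → y ≡ 0ℤ
         2y e with ℤₚ.i*j≡0⇒i≡0∨j≡0 a e
         ... | inj₁ r = ℤ-cancelʳ (+ 2) (λ ()) (trans (ℤₚ.*-comm y (+ 2)) r)
         ... | inj₂ r = ℤ-cancelʳ (+ 2) (λ ()) (trans (ℤₚ.*-comm y (+ 2)) r)
       lem₁ : ∀ P α σ → P · (α · (σ · σ) · (α · (σ · σ))) ≡ α · σ · (P · (α · (σ · σ · σ)))
       lem₁ = ℤ-solve 3 (λ P α σ → P :* (α :* (σ :* σ) :* (α :* (σ :* σ))) , α :* σ :* (P :* (α :* (σ :* σ :* σ)))) refl
       lem₂ : ∀ s g u → s · g · u ≡ s · (g · u)
       lem₂ = ℤ-solve 3 (λ s g u → s :* g :* u , s :* (g :* u)) refl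
       p⁶∣g : π ^ 6 ∣ g
       p⁶∣g = ∣-cancel pp 6 {g} {u} hu (ℤD.∣-trans (ℤD.∣m⇒∣m*n (α · σ ³ℤ) ℤD.∣-refl)
           (ℤD.*-cancelˡ-∣ s {{ℤ.≢-nonZero s≢0}} (subst₂ _∣_ (lem₁ (π ^ 6) α σ) (trans (cong (_· u) den) (lem₂ s g u)) h)))

   localParams : LocalParams params
   localParams = record { T∤b = T∤b ; b∤c = b∤c ; Tb∤G = Tb∤G ; b-bad = b-bad ; T-bad = T-bad }

   N≢0 : N ≢ 0ℤ
   N≢0 e = ℤ-*-≢0 {+ 3} (λ ()) (ℤ-*-≢0 (ℤ-*-≢0 x≢0 x≢0) x≢0) (trans num (trans (cong (_· g) e) (ℤₚ.*-zeroˡ g)))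

   q≢0 : q ≢ 0ℤ
   q≢0 e = d≢0 (trans (cong (+ 3 · x ·_) (trans a²-n (trans (cong (_· g) e) (ℤₚ.*-zeroˡ g)))) (ℤₚ.*-zeroʳ (+ 3 · x)))

   σ≢0 : σ ≢ 0ℤ
   σ≢0 refl = ℤ-*-≢0 (ℤ-*-≢0 {+ 2} (λ ()) y≢0) (ℤ-*-≢0 {+ 2} (λ ()) y≢0) (trans den (trans (cong (_· g) (ℤₚ.*-zeroʳ α)) (ℤₚ.*-zeroˡ g)))

   α∣3 : ∀ {z} → Odd z → Odd (α · z)
   α∣3 {z} = Odd-* {α} {z} α-odd

   -- What remains of v₅² - v₇ after division by γ N q; its parity is visible from the two summands.
   bracket : ℤ
   bracket = + 2 · (c ²ℤ · T ∔ γ ³ℤ · N · q ³ℤ · q ²ℤ) ℤ.- + 3 · (γ · c · T · q ²ℤ)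

   main≡ : γ · N · q · bracket ≡ c ²ℤ · T · (T ∔ c) ℤ.- + 3 · b · c · T ∔ + 2 · b ²ℤ
   main≡ = lem γ N q T
     where
     lem : ∀ γ N q T → let c = + 2 · γ · N · q ℤ.- T ; b = γ · γ · N · (q · q · q) in
       γ · N · q · (+ 2 · (c · c · T ∔ γ · γ · γ · N · (q · q · q) · (q · q)) ℤ.- + 3 · (γ · c · T · (q · q))) ≡
       c · c · T · (T ∔ c) ℤ.- + 3 · b · c · T ∔ + 2 · (b · b)
     lem = ℤ-solve 4 (λ γ N q T →
                       let c = Κ (+ 2) :* γ :* N :* q :- T ; b = γ :* γ :* N :* (q :* q :* q) in
       γ :* N :* q :* (Κ (+ 2) :* (c :* c :* T :+ γ :* γ :* γ :* N :* (q :* q :* q) :* (q :* q)) :- Κ (+ 3) :* (γ :* c :* T :* (q :* q))) ,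
       c :* c :* T :* (T :+ c) :- Κ (+ 3) :* b :* c :* T :+ Κ (+ 2) :* (b :* b)) refl

   c-odd : Odd T → Odd c
   c-odd = even--odd {+ 2 · γ · N · q} {T} (ℤD.∣m⇒∣m*n q (ℤD.∣m⇒∣m*n N (∣2* γ)))

   T-odd : Odd σ → Odd T
   T-odd oσ = α∣3 {σ ²ℤ} (Odd-* {σ} {σ} oσ oσ)

   -- Here s, q and `bracket` are odd, so `b`, `h` and v₅² - v₇ all have the valuation of N.
   even-N : + 2 ∣ N → Case₆ T b c h
   even-N e = record
     { T-odd = T-odd oσ ; c-odd = c-odd (T-odd oσ) ; ω = suc ν ; u = suc ν ; η = ν
     ; 1≤ω = ℕ.s≤s ℕ.z≤n
     ; b∣ = ℤD.∣m⇒∣m*n (q ³ℤ) (ℤD.∣n⇒∣m*n (γ ²ℤ) N∣)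
     ; h∣ = ℤD.∣m⇒∣m*n (q ²ℤ) (ℤD.∣m⇒∣m*n σ (ℤD.∣n⇒∣m*n γ N∣))
     ; u≤ω = ℕₚ.≤-refl ; ω≤2u = ℕₚ.m≤m+n (suc ν) (suc ν)
     ; main = subst (Exact (suc ν)) (trans (lem γ N q bracket) main≡) (Exact-mul-odd {suc ν} {N} {γ · q · bracket} N-exact
         (Odd-* {γ · q} {bracket} (Odd-* {γ} {q} γ-odd oq) obr))
     ; η≤ = ℕₚ.≤-refl }
     where
     os : Odd s
     os = lowest prime[2] e
     oσ : Odd σ
     oσ r = os (ℤD.∣n⇒∣m*n α r)
     oq : Odd q
     oq = odd--even {s} {N} os e
     ν = proj₁ (exact-pos N N≢0 e)
     N-exact = proj₂ (exact-pos N N≢0 e)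
     N∣ = Exact⇒∣ {suc ν} {N} N-exact
     obr : Odd bracket
     obr = even--odd {+ 2 · (c ²ℤ · T ∔ γ ³ℤ · N · q ³ℤ · q ²ℤ)} {+ 3 · (γ · c · T · q ²ℤ)} (∣2* (c ²ℤ · T ∔ γ ³ℤ · N · q ³ℤ · q ²ℤ)) (Odd-* {+ 3} {γ · c · T · q ²ℤ} 3-odd
         (Odd-* {γ · c · T} {q ²ℤ} (Odd-* {γ · c} {T} (Odd-* {γ} {c} γ-odd (c-odd (T-odd oσ))) (T-odd oσ)) (Odd-* {q} {q} oq oq)))
     lem : ∀ γ N q B → N · (γ · q · B) ≡ γ · N · q · B
     lem = ℤ-solve 4 (λ γ N q B → N :* (γ :* q :* B) , γ :* N :* q :* B) refl

   -- Here `b` and `h` have three and two times the valuation of q, and `bracket` is twice an odd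
   -- number, so v₅² - v₇ has one digit more than q.
   even-q : Odd N → Odd σ → Case₆ T b c h
   even-q oN oσ = record
     { T-odd = T-odd oσ ; c-odd = c-odd (T-odd oσ) ; ω = suc ν ℕ.+ suc ν ℕ.+ suc ν ; u = suc ν ℕ.+ suc ν ; η = suc ν
     ; 1≤ω = ℕ.s≤s ℕ.z≤n
     ; b∣ = ℤD.∣n⇒∣m*n (γ ²ℤ · N) (subst (_∣ q ³ℤ) (sym (trans (ℤₚ.^-distribˡ-+-* (+ 2) (suc ν ℕ.+ suc ν) (suc ν)) (cong (_· 2^ suc ν) (ℤₚ.^-distribˡ-+-* (+ 2) (suc ν) (suc ν))))) (*-mono-∣ (*-mono-∣ q∣ q∣) q∣))
     ; h∣ = ℤD.∣n⇒∣m*n (γ · N · σ) (subst (_∣ q ²ℤ) (sym (ℤₚ.^-distribˡ-+-* (+ 2) (suc ν) (suc ν))) (*-mono-∣ q∣ q∣))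
     ; u≤ω = ℕₚ.m≤m+n (suc ν ℕ.+ suc ν) (suc ν) ; ω≤2u = ℕₚ.+-monoʳ-≤ (suc ν ℕ.+ suc ν) (ℕₚ.m≤m+n (suc ν) (suc ν))
     ; main = subst₂ Exact (ℕₚ.+-comm (suc ν) 1) (trans (lem₁ γ N q Z) (trans (cong (γ · N · q ·_) (sym bracket≡)) main≡))
         (Exact-* {suc ν} {1} {q} {+ 2 · (γ · N · Z)} q-exact (Exact-mul-odd {1} {+ 2} {γ · N · Z} Exact-2
           (Odd-* {γ · N} {Z} (Odd-* {γ} {N} γ-odd oN) oZ)))
     ; η≤ = subst (ℕ._≤ suc ν ℕ.+ suc ν ℕ.+ suc ν) (ℕₚ.+-comm (suc ν) 1) (ℕₚ.≤-trans (ℕₚ.+-monoʳ-≤ (suc ν) (ℕ.s≤s ℕ.z≤n)) (ℕₚ.m≤m+n (suc ν ℕ.+ suc ν) (suc ν))) }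
     where
     e : + 2 ∣ q
     e = odd-odd {s} {N} (α∣3 {σ} oσ) oN
     ν = proj₁ (exact-pos q q≢0 e)
     q-exact = proj₂ (exact-pos q q≢0 e)
     q∣ = Exact⇒∣ {suc ν} {q} q-exact
     q′ = ℤD._∣_.quotient e
     Z = c ²ℤ · T ∔ (γ ³ℤ · N · q ³ℤ · q ²ℤ ℤ.- + 3 · (γ · c · T · q′ · q))
     bracket≡ : bracket ≡ + 2 · Z
     bracket≡ = trans (cong (λ z → + 2 · (c ²ℤ · T ∔ γ ³ℤ · N · q ³ℤ · q ²ℤ) ℤ.- + 3 · (γ · c · T · (z · q))) (ℤD._∣_.equality e))
         (lem₂ (c ²ℤ · T) (γ ³ℤ · N · q ³ℤ · q ²ℤ) (γ · c · T) q′ q)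
       where
       lem₂ : ∀ A B C q′ q → + 2 · (A ∔ B) ℤ.- + 3 · (C · (q′ · + 2 · q)) ≡ + 2 · (A ∔ (B ℤ.- + 3 · (C · q′ · q)))
       lem₂ = ℤ-solve 5 (λ A B C q′ q → Κ (+ 2) :* (A :+ B) :- Κ (+ 3) :* (C :* (q′ :* Κ (+ 2) :* q)) , Κ (+ 2) :* (A :+ (B :- Κ (+ 3) :* (C :* q′ :* q)))) refl
     oZ : Odd Z
     oZ = subst Odd (ℤₚ.+-comm (γ ³ℤ · N · q ³ℤ · q ²ℤ ℤ.- + 3 · (γ · c · T · q′ · q)) (c ²ℤ · T)) (even-+-odd {γ ³ℤ · N · q ³ℤ · q ²ℤ ℤ.- + 3 · (γ · c · T · q′ · q)} {c ²ℤ · T}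
         (ℤD.∣m∣n⇒∣m-n (ℤD.∣n⇒∣m*n (γ ³ℤ · N · q ³ℤ) (ℤD.∣n⇒∣m*n q e)) (ℤD.∣n⇒∣m*n (+ 3) (ℤD.∣n⇒∣m*n (γ · c · T · q′) e)))
         (Odd-* {c ²ℤ} {T} (Odd-* {c} {c} (c-odd (T-odd oσ)) (c-odd (T-odd oσ))) (T-odd oσ)))
     lem₁ : ∀ γ N q Z → q · (+ 2 · (γ · N · Z)) ≡ γ · N · q · (+ 2 · Z)
     lem₁ = ℤ-solve 4 (λ γ N q Z → q :* (Κ (+ 2) :* (γ :* N :* Z)) , γ :* N :* q :* (Κ (+ 2) :* Z)) refl

   -- An even s makes N, q and `b` odd, so c is twice an odd number, and the valuations of `T`, `h`
   -- and `k` are read off from the powers of σ in them.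
   even-σ : + 2 ∣ σ → Case₄ T b c h k
   even-σ e = record
     { b-odd = Odd-* {γ ²ℤ · N} {q ³ℤ} (Odd-* {γ ²ℤ} {N} (Odd-* {γ} {γ} γ-odd γ-odd) oN) (Odd-* {q ²ℤ} {q} (Odd-* {q} {q} oq oq) oq)
     ; c₁ = subst (Exact 1) (sym c≡) (Exact-mul-odd {1} {+ 2} {γ · N · q ℤ.- α · σ′ · σ} Exact-2
         (odd--even {γ · N · q} {α · σ′ · σ} (Odd-* {γ · N} {q} (Odd-* {γ} {N} γ-odd oN) oq) (ℤD.∣n⇒∣m*n (α · σ′) e)))
     ; ν = ν
     ; T∣ = subst (Exact (suc ν ℕ.+ suc ν)) (ℤₚ.*-comm (σ ²ℤ) α) (Exact-mul-odd {suc ν ℕ.+ suc ν} {σ ²ℤ} {α} (Exact-* {suc ν} {suc ν} {σ} {σ} σ-exact σ-exact) α-odd)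
     ; h∣ = ℤD.∣m⇒∣m*n (q ²ℤ) (ℤD.∣n⇒∣m*n (γ · N) σ∣)
     ; k∣ = ℤD.∣m⇒∣m*n (+ 3 · s ℤ.- + 4 · N) (ℤD.∣n⇒∣m*n α (ℤD.∣m⇒∣m*n σ (subst (_∣ σ ²ℤ) (sym (ℤₚ.^-distribˡ-+-* (+ 2) (suc ν) (suc ν))) (*-mono-∣ σ∣ σ∣)))) }
     where
     e′ : + 2 ∣ s
     e′ = ℤD.∣n⇒∣m*n α e
     oN : Odd N
     oN r = lowest prime[2] r e′
     oq : Odd q
     oq = even--odd {s} {N} e′ oN
     ν = proj₁ (exact-pos σ σ≢0 e)
     σ-exact = proj₂ (exact-pos σ σ≢0 e)
     σ∣ = Exact⇒∣ {suc ν} {σ} σ-exact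
     σ′ = ℤD._∣_.quotient e
     c≡ : c ≡ + 2 · (γ · N · q ℤ.- α · σ′ · σ)
     c≡ = trans (cong (λ z → + 2 · γ · N · q ℤ.- α · (z · σ)) (ℤD._∣_.equality e)) (lem γ N q α σ′ σ)
       where
       lem : ∀ γ N q α σ′ σ → + 2 · γ · N · q ℤ.- α · (σ′ · + 2 · σ) ≡ + 2 · (γ · N · q ℤ.- α · σ′ · σ)
       lem = ℤ-solve 6 (λ γ N q α σ′ σ → Κ (+ 2) :* γ :* N :* q :- α :* (σ′ :* Κ (+ 2) :* σ) , Κ (+ 2) :* (γ :* N :* q :- α :* σ′ :* σ)) refl

   twoAdic : TwoAdic params (y ²ℤ ℤ.- x ³ℤ)
   twoAdic = record { k = k ; k≡ = k≡ ; case = split (+ 2 ℤD.∣? σ) (+ 2 ℤD.∣? N) }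
     where
     split : _ → _ → Case₆ T b c h ⊎ Case₄ T b c h k
     split (yes e) _ = inj₂ (even-σ e)
     split (no oσ) (yes e) = inj₁ (even-N e)
     split (no oσ) (no oN) = inj₁ (even-q oN oσ)

   residues : Residues T b c
   residues with γ-cases
   ... | inj₂ refl = inj₁ (ℤD.∣m⇒∣m*n (q ³ℤ) (ℤD.∣m⇒∣m*n N (divides (+ 3) refl)) , subst (+ 3 ∣_) (lem N q T) (ℤD.∣m⇒∣m*n (+ 2 · N · q) ℤD.∣-refl))
     where
     lem : ∀ N q T → + 3 · (+ 2 · N · q) ≡ + 2 · + 3 · N · q ℤ.- T ∔ T
     lem = ℤ-solve 3 (λ N q T → Κ (+ 3) :* (Κ (+ 2) :* N :* q) , Κ (+ 2) :* Κ (+ 3) :* N :* q :- T :+ T) refl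
   ... | inj₁ refl = inj₂ (3∣T , subst (+ 3 ∣_) (lem₁ s N (N ²ℤ)) (ℤD.∣m∣n⇒∣m-n (ℤD.∣m⇒∣m*n (R₁ s N) 3∣s) (ℤD.∣m⇒∣m*n (N ²ℤ ∔ 1ℤ) 3∣N²-1)) ,
       subst (+ 3 ∣_) (lem₂ s N T) (ℤD.∣m∣n⇒∣m+n (ℤD.∣m∣n⇒∣m-n (ℤD.∣m⇒∣m*n (+ 2 · N) 3∣s) 3∣T) (ℤD.∣m∣n⇒∣m-n 3∣N²-1 (ℤD.∣m⇒∣m*n (N ²ℤ) ℤD.∣-refl))))
     where
     α≡ : α ≡ + 3
     α≡ = trans (sym (ℤₚ.*-identityʳ α)) αγ
     3∣T : + 3 ∣ T
     3∣T = ℤD.∣m⇒∣m*n (σ ²ℤ) (subst (+ 3 ∣_) (sym α≡) ℤD.∣-refl)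
     3∣s : + 3 ∣ s
     3∣s = ℤD.∣m⇒∣m*n σ (subst (+ 3 ∣_) (sym α≡) ℤD.∣-refl)
     3∣N²-1 : + 3 ∣ N ²ℤ ℤ.- 1ℤ
     3∣N²-1 = unit-square {N} (λ h → lowest prime[3] h 3∣s)
     R₁ : ℤ → ℤ → ℤ
     R₁ s N = N · (s · s ℤ.- + 3 · s · N ∔ + 3 · (N · N))
     lem₁ : ∀ s N n → s · (N · (s · s ℤ.- + 3 · s · N ∔ + 3 · (N · N))) ℤ.- (N · N ℤ.- 1ℤ) · (N · N ∔ 1ℤ) ≡
       1ℤ · 1ℤ · N · ((s ℤ.- N) · (s ℤ.- N) · (s ℤ.- N)) ∔ 1ℤ
     lem₁ = ℤ-solve 3 (λ s N n → s :* (N :* (s :* s :- Κ (+ 3) :* s :* N :+ Κ (+ 3) :* (N :* N))) :- (N :* N :- Κ 1ℤ) :* (N :* N :+ Κ 1ℤ) , Κ 1ℤ :* Κ 1ℤ :* N :* ((s :- N) :* (s :- N) :* (s :- N)) :+ Κ 1ℤ) refl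
     lem₂ : ∀ s N T → s · (+ 2 · N) ℤ.- T ∔ (N · N ℤ.- 1ℤ ℤ.- + 3 · (N · N)) ≡ + 2 · 1ℤ · N · (s ℤ.- N) ℤ.- T ℤ.- 1ℤ
     lem₂ = ℤ-solve 3 (λ s N T → s :* (Κ (+ 2) :* N) :- T :+ (N :* N :- Κ 1ℤ :- Κ (+ 3) :* (N :* N)) , Κ (+ 2) :* Κ 1ℤ :* N :* (s :- N) :- T :- Κ 1ℤ) refl

-- Normalised twelfth powers and signed indices

module TwelfthPowers {B x y : ℤ} (B≡ : B ≡ y ²ℤ ℤ.- x ³ℤ) (M : Multiples (ι B) (ι x) (ι y)) (Pm : Params x y) (Lp : LocalParams Pm) where
 open Indices
 open DyadicIntegers
 open import Data.Integer using (+_; _^_)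

 open import Data.Rational using (_+_; _-_; _*_; -_)

 open LocalAnalysis B≡ M Pm Lp public

 twelfth-* : ∀ p q → twelfth (p * q) ≡ twelfth p * twelfth q
 twelfth-* = lem
   where
   lem : ∀ p q → (((p * q) * (p * q) * (p * q)) * ((p * q) * (p * q) * (p * q))) * (((p * q) * (p * q) * (p * q)) * ((p * q) * (p * q) * (p * q))) ≡
     ((p * p * p) * (p * p * p)) * ((p * p * p) * (p * p * p)) * (((q * q * q) * (q * q * q)) * ((q * q * q) * (q * q * q)))
   lem = ℚ-solve 2 (λ p q → (((p :* q) :* (p :* q) :* (p :* q)) :* ((p :* q) :* (p :* q) :* (p :* q))) :* (((p :* q) :* (p :* q) :* (p :* q)) :* ((p :* q) :* (p :* q) :* (p :* q))) , ((p :* p :* p) :* (p :* p :* p)) :* ((p :* p :* p) :* (p :* p :* p)) :* (((q :* q :* q) :* (q :* q :* q)) :* ((q :* q :* q) :* (q :* q :* q)))) refl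

 twelfth-neg : ∀ p → twelfth (- p) ≡ twelfth p
 twelfth-neg = lem
   where
   lem : ∀ p → (((- p) * (- p) * (- p)) * ((- p) * (- p) * (- p))) * (((- p) * (- p) * (- p)) * ((- p) * (- p) * (- p))) ≡
     ((p * p * p) * (p * p * p)) * ((p * p * p) * (p * p * p))
   lem = ℚ-solve 1 (λ p → (((:- p) :* (:- p) :* (:- p)) :* ((:- p) :* (:- p) :* (:- p))) :* (((:- p) :* (:- p) :* (:- p)) :* ((:- p) :* (:- p) :* (:- p))) , ((p :* p :* p) :* (p :* p :* p)) :* ((p :* p :* p) :* (p :* p :* p))) refl

 twelfthℤ : ℤ → ℤ
 twelfthℤ i = (i ³ℤ) ²ℤ ²ℤ

 ι-twelfth : ∀ i → ι (twelfthℤ i) ≡ twelfth (ι i)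
 ι-twelfth i = trans (ι-sqs 2 (i ³ℤ)) (cong (sqs 2) (trans (ι-* (i · i) i) (cong (_* ι i) (ι-* i i))))

 twelfthℤ-* : ∀ i j → twelfthℤ (i · j) ≡ twelfthℤ i · twelfthℤ j
 twelfthℤ-* = lem
   where
   lem : ∀ p q → (((p · q) · (p · q) · (p · q)) · ((p · q) · (p · q) · (p · q))) · (((p · q) · (p · q) · (p · q)) · ((p · q) · (p · q) · (p · q))) ≡
     ((p · p · p) · (p · p · p)) · ((p · p · p) · (p · p · p)) · (((q · q · q) · (q · q · q)) · ((q · q · q) · (q · q · q)))
   lem = ℤ-solve 2 (λ p q → (((p :* q) :* (p :* q) :* (p :* q)) :* ((p :* q) :* (p :* q) :* (p :* q))) :* (((p :* q) :* (p :* q) :* (p :* q)) :* ((p :* q) :* (p :* q) :* (p :* q))) , ((p :* p :* p) :* (p :* p :* p)) :* ((p :* p :* p) :* (p :* p :* p)) :* (((q :* q :* q) :* (q :* q :* q)) :* ((q :* q :* q) :* (q :* q :* q)))) refl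

 -- F n = W n ¹² / G ^ (n² − 1).
 abstract
   F : ℕ → ℤ
   F n = twelfthℤ (v n) · (T ^ τ n) ³ℤ · (b ^ δ n) ²ℤ ²ℤ

   F≡ : ∀ n → F n ≡ twelfthℤ (v n) · (T ^ τ n) ³ℤ · (b ^ δ n) ²ℤ ²ℤ
   F≡ n = refl

 -- The identity of weights, with 8 and 12 factored in the way in which `sq^` and `cube^` produce
 -- the exponents of a twelfth power.
 e-square : ∀ n → 3 ℕ.* τ (suc n) ℕ.+ 2 ℕ.* (2 ℕ.* (2 ℕ.* δ (suc n))) ℕ.+ 2 ℕ.* (2 ℕ.* (3 ℕ.* e (suc n))) ℕ.+ 1 ≡ suc n ℕ.* suc n
 e-square = by-six _ refl refl refl refl refl refl λ n h →
   trans (lem₁ (τ (suc n)) (δ (suc n)) (e (suc n)) n) (trans (cong (ℕ._+ (12 ℕ.* n ℕ.+ 48)) h) (lem₂ n))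
   where
   lem₁ : ∀ t d e n → 3 ℕ.* t ℕ.+ 2 ℕ.* (2 ℕ.* (2 ℕ.* d)) ℕ.+ 2 ℕ.* (2 ℕ.* (3 ℕ.* (e ℕ.+ suc n ℕ.+ 3))) ℕ.+ 1 ≡
     3 ℕ.* t ℕ.+ 2 ℕ.* (2 ℕ.* (2 ℕ.* d)) ℕ.+ 2 ℕ.* (2 ℕ.* (3 ℕ.* e)) ℕ.+ 1 ℕ.+ (12 ℕ.* n ℕ.+ 48)
   lem₁ = ℕ-solve
   lem₂ : ∀ n → suc n ℕ.* suc n ℕ.+ (12 ℕ.* n ℕ.+ 48) ≡ (7 ℕ.+ n) ℕ.* (7 ℕ.+ n)
   lem₂ = ℕ-solve

 σ-twelfth : ∀ n → twelfthℤ (σ (suc n)) · G ≡ (T ^ τ (suc n)) ³ℤ · (b ^ δ (suc n)) ²ℤ ²ℤ · G ^ (suc n ℕ.* suc n)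
 σ-twelfth n = begin
   twelfthℤ (A · Q · E) · G ≡⟨ cong (_· G) (trans (twelfthℤ-* (A · Q) E) (cong (_· twelfthℤ E) (twelfthℤ-* A Q))) ⟩
   twelfthℤ A · twelfthℤ Q · twelfthℤ E · G ≡⟨ cong₂ (λ p q → p · q · twelfthℤ E · G) twA twQ ⟩
   (T ^ t · G ^ t) ³ℤ · (b ^ f · G ^ (2 ℕ.* f)) ²ℤ ²ℤ · twelfthℤ E · G ≡⟨ lem (T ^ t) (G ^ t) (b ^ f) (G ^ (2 ℕ.* f)) (twelfthℤ E) G ⟩
   Tb · (cube (G ^ t) · sq (sq (G ^ (2 ℕ.* f))) · twelfthℤ E · (G · 1ℤ))
     ≡⟨ cong (λ p → Tb · p) (cong₂ _·_ (cong₂ _·_ (cong₂ _·_ (cube^ t) (trans (cong sq (sq^ (2 ℕ.* f))) (sq^ (2 ℕ.* (2 ℕ.* f)))))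
          (trans (cong (λ p → sq (sq p)) (cube^ (e (suc n)))) (trans (cong sq (sq^ (3 ℕ.* e (suc n)))) (sq^ (2 ℕ.* (3 ℕ.* e (suc n))))))) (refl {x = G ^ 1})) ⟩
   Tb · (G ^ (3 ℕ.* t) · G ^ (2 ℕ.* (2 ℕ.* (2 ℕ.* f))) · G ^ (2 ℕ.* (2 ℕ.* (3 ℕ.* e (suc n)))) · G ^ 1)
     ≡⟨ cong (Tb ·_) (trans (pow-sum₄ (3 ℕ.* t) (2 ℕ.* (2 ℕ.* (2 ℕ.* f))) (2 ℕ.* (2 ℕ.* (3 ℕ.* e (suc n)))) 1) (cong (G ^_) (e-square n))) ⟩
   Tb · G ^ (suc n ℕ.* suc n) ∎
   where
   open ≡-Reasoning
   t = τ (suc n)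
   f = δ (suc n)
   A = a ^ t
   Q = d ^ f
   E = G ^ e (suc n)
   Tb = (T ^ t) ³ℤ · (b ^ f) ²ℤ ²ℤ
   twA : twelfthℤ A ≡ (T ^ t · G ^ t) ³ℤ
   twA = trans (lem₁ A) (cong _³ℤ (pow₄ t))
     where
     lem₁ : ∀ p → ((p · p · p) · (p · p · p)) · ((p · p · p) · (p · p · p)) ≡
       (p · (p · p · p)) · (p · (p · p · p)) · (p · (p · p · p))
     lem₁ = ℤ-solve 1 (λ p → ((p :* p :* p) :* (p :* p :* p)) :* ((p :* p :* p) :* (p :* p :* p)) , (p :* (p :* p :* p)) :* (p :* (p :* p :* p)) :* (p :* (p :* p :* p))) refl
   twQ : twelfthℤ Q ≡ (b ^ f · G ^ (2 ℕ.* f)) ²ℤ ²ℤ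
   twQ = cong (λ p → p ²ℤ ²ℤ) (pow₃ f)
   lem : ∀ T g b h E G → (T · g) · (T · g) · (T · g) · (((b · h) · (b · h)) · ((b · h) · (b · h))) · E · G ≡
     T · T · T · ((b · b) · (b · b)) · (g · g · g · ((h · h) · (h · h)) · E · (G · 1ℤ))
   lem = ℤ-solve 6 (λ T g b h E G → (T :* g) :* (T :* g) :* (T :* g) :* (((b :* h) :* (b :* h)) :* ((b :* h) :* (b :* h))) :* E :* G , T :* T :* T :* ((b :* b) :* (b :* b)) :* (g :* g :* g :* ((h :* h) :* (h :* h)) :* E :* (G :* Κ 1ℤ))) refl

 W-int-twelfth : ∀ n → twelfthℤ (W-int n) · G ≡ F n · G ^ (n ℕ.* n)
 W-int-twelfth zero = trans (cong (λ z → twelfthℤ (z · σ 0) · G) v-zero)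
     (trans (lem (σ 0) G ((T ^ τ 0) ³ℤ) ((b ^ δ 0) ²ℤ ²ℤ)) (cong (_· 1ℤ) (sym (trans (F≡ 0) (cong (λ z → twelfthℤ z · (T ^ τ 0) ³ℤ · (b ^ δ 0) ²ℤ ²ℤ) v-zero)))))
   where
   lem : ∀ s G t b → let p = 0ℤ · s in ((p · p · p) · (p · p · p)) · ((p · p · p) · (p · p · p)) · G ≡ 0ℤ · t · b · 1ℤ
   lem = ℤ-solve 4 (λ s G t b → let p = Κ 0ℤ :* s in ((p :* p :* p) :* (p :* p :* p)) :* ((p :* p :* p) :* (p :* p :* p)) :* G , Κ 0ℤ :* t :* b :* Κ 1ℤ) refl
 W-int-twelfth (suc n) = trans (cong (_· G) (twelfthℤ-* (v (suc n)) (σ (suc n)))) (trans (lem₁ (twelfthℤ (v (suc n))) (twelfthℤ (σ (suc n))) G)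
     (trans (cong (twelfthℤ (v (suc n)) ·_) (σ-twelfth n)) (trans (lem₂ (twelfthℤ (v (suc n))) ((T ^ τ (suc n)) ³ℤ) ((b ^ δ (suc n)) ²ℤ ²ℤ) (G ^ (suc n ℕ.* suc n))) (cong (_· G ^ (suc n ℕ.* suc n)) (sym (F≡ (suc n)))))))
   where
   lem₁ : ∀ v s G → v · s · G ≡ v · (s · G)
   lem₁ = ℤ-solve 3 (λ v s G → v :* s :* G , v :* (s :* G)) refl
   lem₂ : ∀ v t b G → v · (t · b · G) ≡ v · t · b · G
   lem₂ = ℤ-solve 4 (λ v t b G → v :* (t :* b :* G) , v :* t :* b :* G) refl

 Ĝ : ℚ
 Ĝ = ι G

 g : ℕ → ℚ
 g n = ι (G ^ (n ℕ.* n))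

 g≢0 : ∀ n → g n ≢ 0ℚ
 g≢0 n = ι-≢0 (ℤ-^-≢0 (n ℕ.* n) G≢0)

 W-twelfth : ∀ n → twelfth (W n) * Ĝ ≡ ι (F n) * g n
 W-twelfth n = begin
   twelfth (W n) * Ĝ ≡⟨ cong (_* Ĝ) (trans (cong twelfth (W≡W-int n)) (sym (ι-twelfth (W-int n)))) ⟩
   ι (twelfthℤ (W-int n)) * ι G ≡⟨ sym (ι-* (twelfthℤ (W-int n)) G) ⟩
   ι (twelfthℤ (W-int n) · G) ≡⟨ cong ι (W-int-twelfth n) ⟩
   ι (F n · G ^ (n ℕ.* n)) ≡⟨ ι-* (F n) (G ^ (n ℕ.* n)) ⟩
   ι (F n) * g n ∎
   where open ≡-Reasoning

 Diff : ℕ → ℕ → ℕ → Set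
 Diff n m q = n ≡ q ℕ.+ m ⊎ m ≡ q ℕ.+ n

 Diff-sym : ∀ {n m q} → Diff n m q → Diff m n q
 Diff-sym (inj₁ h) = inj₂ h
 Diff-sym (inj₂ h) = inj₁ h

 Diff-⊖ : ∀ n m → Diff n m ℤ.∣ n ℤ.⊖ m ∣
 Diff-⊖ n m with ℕₚ.≤-total m n
 ... | inj₁ m≤n = inj₁ (sym (trans (cong (ℕ._+ m) (cong ℤ.∣_∣ (ℤₚ.⊖-≥ m≤n))) (ℕₚ.m∸n+n≡m m≤n)))
 ... | inj₂ n≤m = inj₂ (sym (trans (cong (ℕ._+ n) (trans (cong ℤ.∣_∣ (ℤₚ.⊖-≤ n≤m)) (ℤₚ.∣-i∣≡∣i∣ (+ (m ℕ.∸ n))))) (ℕₚ.m∸n+n≡m n≤m)))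

 Both : ℕ → ℕ → ℕ → ℕ → Set
 Both n m p q = p ≡ n ℕ.+ m × Diff n m q

 -- {|i + j| , |i − j|} = {|i| + |j| , ||i| − |j||}
 abs-± : ∀ i j → Both ℤ.∣ i ∣ ℤ.∣ j ∣ ℤ.∣ i ∔ j ∣ ℤ.∣ i ℤ.- j ∣ ⊎ Both ℤ.∣ i ∣ ℤ.∣ j ∣ ℤ.∣ i ℤ.- j ∣ ℤ.∣ i ∔ j ∣
 abs-± (+ n) (+ zero) = inj₁ (refl , inj₁ (sym (trans (ℕₚ.+-identityʳ (n ℕ.+ 0)) (ℕₚ.+-identityʳ n))))
 abs-± (+ n) (+ suc m) = inj₁ (refl , Diff-⊖ n (suc m))
 abs-± (+ n) ℤ.-[1+ m ] = inj₂ (refl , Diff-⊖ n (suc m))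
 abs-± ℤ.-[1+ n ] (+ zero) = inj₁ (sym (ℕₚ.+-identityʳ (suc n)) , inj₁ (sym (ℕₚ.+-identityʳ (suc n))))
 abs-± ℤ.-[1+ n ] (+ suc m) = inj₂ (cong suc (sym (ℕₚ.+-suc n m)) , Diff-sym (Diff-⊖ (suc m) (suc n)))
 abs-± ℤ.-[1+ n ] ℤ.-[1+ m ] = inj₁ (cong suc (sym (ℕₚ.+-suc n m)) , Diff-sym (Diff-⊖ (suc m) (suc n)))

 -- The class of 1 modulo s runs through negative integers as well, while W, X and F are indexed by
 -- natural numbers. Relations symmetric in the two indices carry over to absolute values.
 both : ∀ {A : ℕ → ℕ → Set} i j → (∀ {p q} → A p q → A q p) → (∀ {p q} → Both ℤ.∣ i ∣ ℤ.∣ j ∣ p q → A p q) → A ℤ.∣ i ∔ j ∣ ℤ.∣ i ℤ.- j ∣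
 both i j s f with abs-± i j
 ... | inj₁ h = f h
 ... | inj₂ h = s (f h)

 -- Absolute values lose a sign, because ψ is odd in its index; the even power makes the addition
 -- formula insensitive to it.
 twelfth-cross : ∀ i j → twelfth (W ℤ.∣ i ∔ j ∣ * W ℤ.∣ i ℤ.- j ∣) ≡ twelfth (cross ℤ.∣ j ∣ ℤ.∣ i ∣)
 twelfth-cross i j = both {λ p q → twelfth (W p * W q) ≡ twelfth (cross m n)} i j (λ {p} {q} h → trans (cong twelfth (ℚₚ.*-comm (W q) (W p))) h) by
   where
   n = ℤ.∣ i ∣
   m = ℤ.∣ j ∣
   swap : ∀ a b c d → a * b - c * d ≡ - (d * c - b * a)
   swap = ℚ-solve 4 (λ a b c d → a :* b :- c :* d , :- (d :* c :- b :* a)) refl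
   by : ∀ {p q} → Both n m p q → twelfth (W p * W q) ≡ twelfth (cross m n)
   by {p} {q} (e , inj₁ e′) = cong twelfth (W-W′ {p} {q} {m} {n} e (trans (ℕₚ.+-comm m q) (sym e′)))
   by {p} {q} (e , inj₂ e′) = trans (cong twelfth (trans (W-W′ {p} {q} {n} {m} (trans e (ℕₚ.+-comm n m)) (trans (ℕₚ.+-comm n q) (sym e′))) (swap (Φ n) (w m) (w n) (Φ m))))
     (twelfth-neg (cross m n))

 sum-squares : ∀ {n m p q} → Both n m p q → p ℕ.* p ℕ.+ q ℕ.* q ≡ n ℕ.* n ℕ.+ n ℕ.* n ℕ.+ (m ℕ.* m ℕ.+ m ℕ.* m)
 sum-squares {n} {m} {_} {q} (refl , inj₁ refl) = lem q m
   where
   lem : ∀ q m → let n = q ℕ.+ m ; p = n ℕ.+ m in p ℕ.* p ℕ.+ q ℕ.* q ≡ n ℕ.* n ℕ.+ n ℕ.* n ℕ.+ (m ℕ.* m ℕ.+ m ℕ.* m)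
   lem = ℕ-solve
 sum-squares {n} {m} {_} {q} (refl , inj₂ refl) = lem q n
   where
   lem : ∀ q n → let m = q ℕ.+ n ; p = n ℕ.+ m in p ℕ.* p ℕ.+ q ℕ.* q ≡ n ℕ.* n ℕ.+ n ℕ.* n ℕ.+ (m ℕ.* m ℕ.+ m ℕ.* m)
   lem = ℕ-solve

 g-parallelogram : ∀ i j → g ℤ.∣ i ∔ j ∣ * g ℤ.∣ i ℤ.- j ∣ ≡ g ℤ.∣ i ∣ * g ℤ.∣ i ∣ * (g ℤ.∣ j ∣ * g ℤ.∣ j ∣)
 g-parallelogram i j = both {λ p q → g p * g q ≡ g n * g n * (g m * g m)} i j (λ {p} {q} h → trans (ℚₚ.*-comm (g q) (g p)) h)
   λ {p} {q} h → trans (g-+ p q) (trans (cong (λ k → ι (G ^ k)) (sum-squares h)) (sym (trans (cong₂ _*_ (g-+ n n) (g-+ m m)) (ι-^ (n ℕ.* n ℕ.+ n ℕ.* n) (m ℕ.* m ℕ.+ m ℕ.* m)))))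
   where
   n = ℤ.∣ i ∣
   m = ℤ.∣ j ∣
   ι-^ : ∀ k l → ι (G ^ k) * ι (G ^ l) ≡ ι (G ^ (k ℕ.+ l))
   ι-^ k l = trans (sym (ι-* (G ^ k) (G ^ l))) (cong ι (sym (ℤₚ.^-distribˡ-+-* G k l)))
   g-+ : ∀ p q → g p * g q ≡ ι (G ^ (p ℕ.* p ℕ.+ q ℕ.* q))
   g-+ p q = ι-^ (p ℕ.* p) (q ℕ.* q)

 X-sumℤ : ∀ i j {n m} → ℤ.∣ i ∣ ≡ suc n → ℤ.∣ j ∣ ≡ suc m → suc n ≢ suc m →
   (X (suc n) - X (suc m)) ² * (X ℤ.∣ i ∔ j ∣ + X ℤ.∣ i ℤ.- j ∣) ≡ 2ℚ * (X (suc n) * X (suc m) * (X (suc n) + X (suc m)) + 2ℚ * ι B)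
 X-sumℤ i j {n} {m} n≡ m≡ n≢m = both {λ p q → (X (suc n) - X (suc m)) ² * (X p + X q) ≡ 2ℚ * (X (suc n) * X (suc m) * (X (suc n) + X (suc m)) + 2ℚ * ι B)} i j
     (λ {p} {q} h → trans (cong ((X (suc n) - X (suc m)) ² *_) (ℚₚ.+-comm (X q) (X p))) h)
     (λ {p} {q} h → by p q (subst₂ (λ n m → Both n m p q) n≡ m≡ h))
   where
   ordered : ∀ {n m p q} → suc n ≢ suc m → p ≡ suc n ℕ.+ suc m → suc n ≡ q ℕ.+ suc m →
     (X (suc n) - X (suc m)) ² * (X p + X q) ≡ 2ℚ * (X (suc n) * X (suc m) * (X (suc n) + X (suc m)) + 2ℚ * ι B)
   ordered {q = zero} ne e e′ = ⊥-elim (ne e′)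
   ordered {n} {m} {q = suc q} ne refl e′ with trans e′ (ℕₚ.+-suc (suc q) m)
   ... | refl = X-sum {q} {m} {q ℕ.+ m} (cong suc (trans (ℕₚ.+-suc m q) (cong suc (ℕₚ.+-comm m q))))
   flip₁ : ∀ a b s → (a - b) * (a - b) * s ≡ (b - a) * (b - a) * s
   flip₁ = ℚ-solve 3 (λ a b s → (a :- b) :* (a :- b) :* s , (b :- a) :* (b :- a) :* s) refl
   flip₂ : ∀ a b β → 2ℚ * (b * a * (b + a) + 2ℚ * β) ≡ 2ℚ * (a * b * (a + b) + 2ℚ * β)
   flip₂ = ℚ-solve 3 (λ a b β → Κ 2ℚ :* (b :* a :* (b :+ a) :+ Κ 2ℚ :* β) , Κ 2ℚ :* (a :* b :* (a :+ b) :+ Κ 2ℚ :* β)) refl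
   by : ∀ p q → Both (suc n) (suc m) p q → _
   by p q (e , inj₁ e′) = ordered n≢m e e′
   by p q (e , inj₂ e′) = trans (flip₁ (X (suc n)) (X (suc m)) (X p + X q)) (trans (ordered (λ h → n≢m (sym h)) (trans e (ℕₚ.+-comm (suc n) (suc m))) e′) (flip₂ (X (suc n)) (X (suc m)) (ι B)))

-- Translation by s P

module Steps {B x y : ℤ} (B≡ : B ≡ y ²ℤ ℤ.- x ³ℤ) (M : Multiples (ι B) (ι x) (ι y)) (Pm : Params x y) (Lp : LocalParams Pm) where
 open Indices
 open DyadicIntegers
 open Progressions
 open import Data.Integer using (+_; _^_)

 open import Data.Integer.Divisibility.Signed using (_∣_; divides)
 open import Data.Rational using (_+_; _-_; _*_; -_; _÷_; ≢-nonZero)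
 open Reduction using (parity)
 open Denominators using (clear-den)

 open TwelfthPowers B≡ M Pm Lp public

 twelve : ℕ → ℕ
 twelve m = m ℕ.+ m ℕ.+ m ℕ.+ (m ℕ.+ m ℕ.+ m) ℕ.+ (m ℕ.+ m ℕ.+ m ℕ.+ (m ℕ.+ m ℕ.+ m))

 Exact-twelfth : ∀ {m z} → Exact m z → Exact (twelve m) (twelfthℤ z)
 Exact-twelfth {m} {z} h = Exact-* {m₆} {m₆} {z₃ ²ℤ} {z₃ ²ℤ} h₆ h₆
   where
   m₃ = m ℕ.+ m ℕ.+ m
   m₆ = m₃ ℕ.+ m₃
   z₃ = z ³ℤ
   h₃ = Exact-* {m ℕ.+ m} {m} {z · z} {z} (Exact-* {m} {m} {z} {z} h h) h
   h₆ = Exact-* {m₃} {m₃} {z₃} {z₃} h₃ h₃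

 2^-∣-* : ∀ {k l i j} → 2^ k ∣ i → 2^ l ∣ j → 2^ (k ℕ.+ l) ∣ i · j
 2^-∣-* {k} {l} {i} {j} h h′ = subst (_∣ i · j) (sym (ℤₚ.^-distribˡ-+-* (+ 2) k l)) (*-mono-∣ h h′)

 ∣-twelfth : ∀ {m z} → 2^ m ∣ z → 2^ twelve m ∣ twelfthℤ z
 ∣-twelfth {m} {z} h = 2^-∣-* {m₃ ℕ.+ m₃} {m₃ ℕ.+ m₃} {z ³ℤ ²ℤ} {z ³ℤ ²ℤ} (2^-∣-* {m₃} {m₃} {z ³ℤ} {z ³ℤ} h₃ h₃) (2^-∣-* {m₃} {m₃} {z ³ℤ} {z ³ℤ} h₃ h₃)
   where
   m₃ = m ℕ.+ m ℕ.+ m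
   h₃ : 2^ m₃ ∣ z ³ℤ
   h₃ = 2^-∣-* {m ℕ.+ m} {m} {z ²ℤ} {z} (2^-∣-* {m} {m} {z} {z} h h) h

 twelve-mono-< : ∀ {k m} → k ℕ.< m → twelve k ℕ.< twelve m
 twelve-mono-< h = ℕₚ.+-mono-< h₆ h₆
   where
   h₃ = ℕₚ.+-mono-< (ℕₚ.+-mono-< h h) h
   h₆ = ℕₚ.+-mono-< h₃ h₃

 twelve-+ : ∀ k m → twelve k ℕ.+ twelve m ≡ twelve (k ℕ.+ m)
 twelve-+ = lem
   where
   lem : ∀ k m → k ℕ.+ k ℕ.+ k ℕ.+ (k ℕ.+ k ℕ.+ k) ℕ.+ (k ℕ.+ k ℕ.+ k ℕ.+ (k ℕ.+ k ℕ.+ k)) ℕ.+ (m ℕ.+ m ℕ.+ m ℕ.+ (m ℕ.+ m ℕ.+ m) ℕ.+ (m ℕ.+ m ℕ.+ m ℕ.+ (m ℕ.+ m ℕ.+ m))) ≡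
     (k ℕ.+ m) ℕ.+ (k ℕ.+ m) ℕ.+ (k ℕ.+ m) ℕ.+ ((k ℕ.+ m) ℕ.+ (k ℕ.+ m) ℕ.+ (k ℕ.+ m)) ℕ.+ ((k ℕ.+ m) ℕ.+ (k ℕ.+ m) ℕ.+ (k ℕ.+ m) ℕ.+ ((k ℕ.+ m) ℕ.+ (k ℕ.+ m) ℕ.+ (k ℕ.+ m)))
   lem = ℕ-solve

 -- Numerator and denominator of q are written with their exact powers of 2; a deficit of one digit
 -- in q would become twelve digits in the power.
 Div-twelfth-root : ∀ {μ q} → Div (twelve μ) (twelfth q) → Div μ q
 Div-twelfth-root {μ} {q} (div n′ d′ od′ e′) = by (ℚ.↥ q) (ℚ.↧ q) (λ ()) (clear-den q) (ℚ.↥ q ℤ.≟ 0ℤ)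
   where
   by : ∀ n d → d ≢ 0ℤ → q * ι d ≡ ι n → Dec (n ≡ 0ℤ) → Div μ q
   by n d d≢0 e (yes refl) = subst (Div μ) (sym (*-cancelʳ (ι d) (ι-≢0 d≢0) (trans e (sym (ℚₚ.*-zeroˡ (ι d)))))) Div-0
   by n d d≢0 e (no n≢0) with exact n n≢0 | exact d d≢0
   ... | m , En@(o , oo , refl) | t , Ed@(o′ , oo′ , refl) = fin (ℕₚ.≤-total (μ ℕ.+ t) m)
     where
     eq : twelfthℤ n · d′ ≡ 2^ twelve μ · n′ · twelfthℤ d
     eq = ι-injective (trans (ι-* (twelfthℤ n) d′) (trans (cong (_* ι d′) (trans (ι-twelfth n) (trans (cong twelfth (sym e)) (twelfth-* q (ι d)))))
       (trans (lem (twelfth q) (twelfth (ι d)) (ι d′)) (trans (cong₂ _*_ e′ (sym (ι-twelfth d))) (sym (ι-* (2^ twelve μ · n′) (twelfthℤ d)))))))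
       where
       lem : ∀ a b c → a * b * c ≡ a * c * b
       lem = ℚ-solve 3 (λ a b c → a :* b :* c , a :* c :* b) refl
     reduce : ∀ {i} → μ ℕ.+ t ℕ.+ i ≡ m → Div μ q
     reduce {i} refl = div (2^ i · o) o′ oo′ (*-cancelʳ (ι (2^ t)) (ι-≢0 (ℤ-^-≢0 t λ ())) (trans (ℚₚ.*-assoc q (ι o′) (ι (2^ t)))
       (trans (cong (q *_) (trans (sym (ι-* o′ (2^ t))) (cong ι (ℤₚ.*-comm o′ (2^ t))))) (trans e (trans (cong ι eq′) (ι-* (2^ μ · (2^ i · o)) (2^ t)))))))
       where
       lem : ∀ p q r o → p · q · r · o ≡ p · (r · o) · q
       lem = ℤ-solve 4 (λ p q r o → p :* q :* r :* o , p :* (r :* o) :* q) refl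
       eq′ : 2^ (μ ℕ.+ t ℕ.+ i) · o ≡ 2^ μ · (2^ i · o) · 2^ t
       eq′ = trans (cong (_· o) (trans (ℤₚ.^-distribˡ-+-* (+ 2) (μ ℕ.+ t) i) (cong (_· 2^ i) (ℤₚ.^-distribˡ-+-* (+ 2) μ t)))) (lem (2^ μ) (2^ t) (2^ i) o)
     fin : _ → Div μ q
     fin (inj₁ le) = reduce (ℕₚ.m+[n∸m]≡n le)
     fin (inj₂ ge) with ℕₚ.m≤n⇒m<n∨m≡n ge
     ... | inj₂ m≡ = reduce {0} (trans (ℕₚ.+-identityʳ (μ ℕ.+ t)) (sym m≡))
     ... | inj₁ m< = ⊥-elim (Exact-small {twelve m} {twelve (μ ℕ.+ t)} {twelfthℤ n · d′}
             (subst (λ k → Exact k (twelfthℤ n · d′)) (ℕₚ.+-identityʳ (twelve m)) (Exact-* {twelve m} {0} {twelfthℤ n} {d′} (Exact-twelfth {m} {n} En) (Exact-odd od′)))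
             (twelve-mono-< m<)
             (subst₂ _∣_ (cong 2^_ (twelve-+ μ t)) (sym eq)
               (2^-∣-* {twelve μ} {twelve t} {2^ twelve μ · n′} {twelfthℤ d} (ℤD.∣m⇒∣m*n {2^ twelve μ} {2^ twelve μ} n′ ℤD.∣-refl)
                 (∣-twelfth {t} {d} (ℤD.∣m⇒∣m*n {2^ t} {2^ t} o′ ℤD.∣-refl)))))

 Div-inverse : ∀ {u q} → Div (suc u) q → Σ ℚ λ r → (1ℚ - q) * r ≡ 1ℚ × Div 0 r
 Div-inverse {u} {q} (div n d od e) = r , inv , Div-cancel {0} {r} {o} oo (subst (Div 0) (sym (÷-* (ι d) (ι o) o≢0)) (Div-ι {0} {d} (divides d (sym (ℤₚ.*-identityʳ d)))))
   where
   o = d ℤ.- 2^ (suc u) · n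
   oo : Odd o
   oo h = od (subst (+ 2 ∣_) (lem d (2^ (suc u) · n)) (ℤD.∣m∣n⇒∣m+n h (ℤD.∣m⇒∣m*n n (ℤD.∣m⇒∣m*n (2^ u) ℤD.∣-refl))))
     where
     lem : ∀ d z → d ℤ.- z ∔ z ≡ d
     lem = ℤ-solve 2 (λ d z → d :- z :+ z , d) refl
   o≢0 : ι o ≢ 0ℚ
   o≢0 = ι-≢0 (Odd-≢0 oo)
   r = (ι d ÷ ι o) {{≢-nonZero o≢0}}
   o≡ : ι o ≡ (1ℚ - q) * ι d
   o≡ = trans (ι-- d (2^ (suc u) · n)) (trans (cong (λ z → ι d - z) (sym e)) (lem (ι d) q))
     where
     lem : ∀ d q → d - q * d ≡ (1ℚ - q) * d
     lem = ℚ-solve 2 (λ d q → d :- q :* d , (Κ 1ℚ :- q) :* d) refl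
   inv : (1ℚ - q) * r ≡ 1ℚ
   inv = *-cancelʳ (ι o) o≢0 (trans (ℚₚ.*-assoc (1ℚ - q) r (ι o)) (trans (cong ((1ℚ - q) *_) (÷-* (ι d) (ι o) o≢0)) (trans (sym o≡) (sym (ℚₚ.*-identityˡ (ι o))))))

 Div-from-differences : ∀ {u} (U : Seq) → (∀ j → Div u (Δ U j)) → ∀ i → Div u (U i) → ∀ j → Div u (U j)
 Div-from-differences U h i hi = up
   where
   lem₁ : ∀ a b → b - (b - a) ≡ a
   lem₁ = ℚ-solve 2 (λ a b → b :- (b :- a) , a) refl
   lem₂ : ∀ a b → a + (b - a) ≡ b
   lem₂ = ℚ-solve 2 (λ a b → a :+ (b :- a) , b) refl
   down : ∀ i → Div _ (U i) → Div _ (U 0)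
   down zero    hi = hi
   down (suc i) hi = down i (subst (Div _) (lem₁ (U i) (U (suc i))) (Div-- hi (h i)))
   up : ∀ j → Div _ (U j)
   up zero    = down i hi
   up (suc j) = subst (Div _) (lem₂ (U j) (U (suc j))) (Div-+ (up j) (h j))

 τ-of-even : ∀ n → 2 ℕD.∣ n → τ n ≡ 1
 τ-of-even 0 _ = refl
 τ-of-even 1 h with ℕD.∣1⇒≡1 h
 ... | ()
 τ-of-even (suc (suc n)) h = τ-of-even n (ℕD.∣m+n∣m⇒∣n h ℕD.∣-refl)

 F-unit : ∀ n → τ n ≡ 0 → δ n ≡ 0 → ℤ.∣ v n ∣ ≡ 1 → F n ≡ 1ℤ
 F-unit n t f h = trans (F≡ n) (cong₂ _·_ (cong₂ _·_ (twelfth-unit (v n) h) (cong (λ k → (T ^ k) ³ℤ) t)) (cong (λ k → (b ^ k) ²ℤ ²ℤ) f))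
   where
   twelfth-unit : ∀ i → ℤ.∣ i ∣ ≡ 1 → twelfthℤ i ≡ 1ℤ
   twelfth-unit (+ 1) refl = refl
   twelfth-unit ℤ.-[1+ 0 ] refl = refl

 -- `Φ-s` says that the numerator of x(sP) is odd up to its power of G. The factor p is 1 for s = 6;
 -- for s = 4 it is b⁸, since there the numerator is known only after multiplication by `b`.
 module Step (s′ : ℕ) (p D : ℤ) (p≢0 : p ≢ 0ℤ) (D-odd : Odd D)
   (Φ-s : ι p * twelfth (Φ (suc s′)) ≡ g (suc s′) * g (suc s′) * twelfth (ι D)) where

   s = suc s′

   ιp≢0 : ι p ≢ 0ℚ
   ιp≢0 = ι-≢0 p≢0

   twelfth-≢0 : ∀ {q} → q ≢ 0ℚ → twelfth q ≢ 0ℚ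
   twelfth-≢0 {q} h = *-≢0 (*-≢0 q³≢0 q³≢0) (*-≢0 q³≢0 q³≢0)
     where q³≢0 = *-≢0 (*-≢0 h h) h

   D≢0 : twelfth (ι D) ≢ 0ℚ
   D≢0 = twelfth-≢0 (ι-≢0 (Odd-≢0 D-odd))

   X≢0 : X s ≢ 0ℚ
   X≢0 e = *-≢0 (*-≢0 (g≢0 s) (g≢0 s)) D≢0 (trans (sym Φ-s) (trans (cong (λ z → ι p * twelfth z) (trans (cong (w s *_) e) (ℚₚ.*-zeroʳ (w s)))) (ℚₚ.*-zeroʳ (ι p))))

   abstract
     X⁻¹ : ℚ
     X⁻¹ = (1ℚ ÷ X s) {{≢-nonZero X≢0}}

     X⁻¹-* : X⁻¹ * X s ≡ 1ℚ
     X⁻¹-* = ÷-* 1ℚ (X s) X≢0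

   U : ℕ → ℚ
   U n = X n * X⁻¹

   U-* : ∀ n → X n ≡ U n * X s
   U-* n = trans (sym (ℚₚ.*-identityʳ (X n))) (trans (cong (X n *_) (sym X⁻¹-*)) (sym (ℚₚ.*-assoc (X n) X⁻¹ (X s))))

   f : ℕ → ℚ
   f n = ι (F n)

   -- The addition formula for nP and sP, with x(sP) - x(nP) written as x(sP) (1 - U n). The powers
   -- of G cancel by the parallelogram law for n².
   step-ratio : ∀ i {n} → ℤ.∣ i ∣ ≡ suc n →
     ι p * (f ℤ.∣ i ∔ + s ∣ * f ℤ.∣ i ℤ.- + s ∣) ≡ twelfth (ι D) * (f (suc n) * f (suc n)) * twelfth (1ℚ - U (suc n))
   step-ratio i {n} n≡ = *-cancelʳ (gn * gn * (gs * gs)) (*-≢0 (*-≢0 (g≢0 (suc n)) (g≢0 (suc n))) (*-≢0 (g≢0 s) (g≢0 s))) (begin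
     ι p * (f P * f R) * (gn * gn * (gs * gs)) ≡⟨ cong (ι p * (f P * f R) *_) (sym gPR) ⟩
     ι p * (f P * f R) * (g P * g R) ≡⟨ lem₁ (ι p) (f P) (f R) (g P) (g R) ⟩
     ι p * ((f P * g P) * (f R * g R)) ≡⟨ cong₂ (λ a b → ι p * (a * b)) (sym (W-twelfth P)) (sym (W-twelfth R)) ⟩
     ι p * (twelfth (W P) * Ĝ * (twelfth (W R) * Ĝ)) ≡⟨ lem₂ (ι p) (twelfth (W P)) (twelfth (W R)) Ĝ ⟩
     ι p * (twelfth (W P) * twelfth (W R)) * (Ĝ * Ĝ) ≡⟨ cong (λ z → ι p * z * (Ĝ * Ĝ)) cr ⟩
     ι p * (tn * tn * (twelfth (Φ s) * E)) * (Ĝ * Ĝ) ≡⟨ lem₃ (ι p) tn (twelfth (Φ s)) E Ĝ ⟩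
     (ι p * twelfth (Φ s)) * ((tn * Ĝ) * (tn * Ĝ)) * E ≡⟨ cong₂ (λ a b → a * (b * b) * E) Φ-s (W-twelfth (suc n)) ⟩
     gs * gs * twelfth (ι D) * (f (suc n) * gn * (f (suc n) * gn)) * E ≡⟨ lem₄ gs (twelfth (ι D)) (f (suc n)) gn E ⟩
     twelfth (ι D) * (f (suc n) * f (suc n)) * E * (gn * gn * (gs * gs)) ∎)
     where
     open ≡-Reasoning
     P = ℤ.∣ i ∔ + s ∣
     R = ℤ.∣ i ℤ.- + s ∣
     gn = g (suc n)
     gs = g s
     tn = twelfth (W (suc n))
     E = twelfth (1ℚ - U (suc n))
     gPR : g P * g R ≡ gn * gn * (gs * gs)
     gPR = trans (g-parallelogram i (+ s)) (cong (λ k → g k * g k * (gs * gs)) n≡)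
     cr : twelfth (W P) * twelfth (W R) ≡ tn * tn * (twelfth (Φ s) * E)
     cr = trans (sym (twelfth-* (W P) (W R))) (trans (twelfth-cross i (+ s)) (trans (cong (λ k → twelfth (cross s k)) n≡)
       (trans (cong twelfth (trans (cong (λ z → Φ s * w (suc n) - w s * (w (suc n) * z)) (U-* (suc n))) (lem (w s) (X s) (w (suc n)) (U (suc n)))))
       (trans (twelfth-* (w (suc n)) (Φ s * (1ℚ - U (suc n)))) (cong₂ _*_ (twelfth-* (W (suc n)) (W (suc n))) (twelfth-* (Φ s) (1ℚ - U (suc n))))))))
       where
       lem : ∀ w X v U → w * X * v - w * (v * (U * X)) ≡ v * (w * X * (1ℚ - U))
       lem = ℚ-solve 4 (λ w X v U → w :* X :* v :- w :* (v :* (U :* X)) , v :* (w :* X :* (Κ 1ℚ :- U))) refl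
     lem₁ : ∀ p a b c d → p * (a * b) * (c * d) ≡ p * ((a * c) * (b * d))
     lem₁ = ℚ-solve 5 (λ p a b c d → p :* (a :* b) :* (c :* d) , p :* ((a :* c) :* (b :* d))) refl
     lem₂ : ∀ p a b G → p * (a * G * (b * G)) ≡ p * (a * b) * (G * G)
     lem₂ = ℚ-solve 4 (λ p a b G → p :* (a :* G :* (b :* G)) , p :* (a :* b) :* (G :* G)) refl
     lem₃ : ∀ p t Φ E G → p * (t * t * (Φ * E)) * (G * G) ≡ (p * Φ) * ((t * G) * (t * G)) * E
     lem₃ = ℚ-solve 5 (λ p t Φ E G → p :* (t :* t :* (Φ :* E)) :* (G :* G) , (p :* Φ) :* ((t :* G) :* (t :* G)) :* E) refl
     lem₄ : ∀ s D f g E → s * s * D * (f * g * (f * g)) * E ≡ D * (f * f) * E * (g * g * (s * s))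
     lem₄ = ℚ-solve 5 (λ s D f g E → s :* s :* D :* (f :* g :* (f :* g)) :* E , D :* (f :* f) :* E :* (g :* g :* (s :* s))) refl

   -- The addition formula for two multiples whose difference is sP. It expresses ΔU along the
   -- progression by F at the sum of the indices and at s, where the powers of 2 are known.
   step-difference : ∀ i j {n m} → ℤ.∣ i ∣ ≡ suc n → ℤ.∣ j ∣ ≡ suc m → ℤ.∣ i ℤ.- j ∣ ≡ s →
     ι p * (f ℤ.∣ i ∔ j ∣ * (f s * f s * f s)) ≡ twelfth (ι D) * ((f (suc n) * f (suc n)) * (f (suc m) * f (suc m))) * twelfth (U (suc n) - U (suc m))
   step-difference i j {n} {m} n≡ m≡ s≡ = *-cancelʳ (gn * gn * (gm * gm) * (gs * gs))
     (*-≢0 (*-≢0 (*-≢0 (g≢0 (suc n)) (g≢0 (suc n))) (*-≢0 (g≢0 (suc m)) (g≢0 (suc m)))) (*-≢0 (g≢0 s) (g≢0 s))) (begin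
     ι p * (f R * (f s * f s * f s)) * (gn * gn * (gm * gm) * (gs * gs)) ≡⟨ cong (λ z → ι p * (f R * (f s * f s * f s)) * (z * (gs * gs))) (sym gRs) ⟩
     ι p * (f R * (f s * f s * f s)) * (g R * gs * (gs * gs)) ≡⟨ lem₁ (ι p) (f R) (f s) (g R) gs ⟩
     ι p * ((f R * g R) * ((f s * gs) * (f s * gs) * (f s * gs))) ≡⟨ cong₂ (λ a b → ι p * (a * (b * b * b))) (sym (W-twelfth R)) (sym (W-twelfth s)) ⟩
     ι p * (twelfth (W R) * Ĝ * (ts * Ĝ * (ts * Ĝ) * (ts * Ĝ))) ≡⟨ lem₂ (ι p) (twelfth (W R)) ts Ĝ ⟩
     ι p * (twelfth (W R) * ts) * (ts * ts) * (Ĝ * Ĝ * (Ĝ * Ĝ)) ≡⟨ cong (λ z → ι p * z * (ts * ts) * (Ĝ * Ĝ * (Ĝ * Ĝ))) cr ⟩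
     ι p * (tn * tn * (tm * tm) * (twelfth (X s) * E)) * (ts * ts) * (Ĝ * Ĝ * (Ĝ * Ĝ)) ≡⟨ lem₃ (ι p) tn tm (twelfth (X s)) E ts Ĝ ⟩
     (ι p * (ts * ts * twelfth (X s))) * ((tn * Ĝ) * (tn * Ĝ) * ((tm * Ĝ) * (tm * Ĝ))) * E
       ≡⟨ cong (λ z → z * ((tn * Ĝ) * (tn * Ĝ) * ((tm * Ĝ) * (tm * Ĝ))) * E) (trans (cong (ι p *_) (sym (trans (twelfth-* (w s) (X s)) (cong (_* twelfth (X s)) (twelfth-* (W s) (W s)))))) Φ-s) ⟩
     gs * gs * twelfth (ι D) * ((tn * Ĝ) * (tn * Ĝ) * ((tm * Ĝ) * (tm * Ĝ))) * E ≡⟨ cong₂ (λ a b → gs * gs * twelfth (ι D) * (a * a * (b * b)) * E) (W-twelfth (suc n)) (W-twelfth (suc m)) ⟩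
     gs * gs * twelfth (ι D) * ((f (suc n) * gn) * (f (suc n) * gn) * ((f (suc m) * gm) * (f (suc m) * gm))) * E ≡⟨ lem₄ gs (twelfth (ι D)) (f (suc n)) gn (f (suc m)) gm E ⟩
     twelfth (ι D) * ((f (suc n) * f (suc n)) * (f (suc m) * f (suc m))) * E * (gn * gn * (gm * gm) * (gs * gs)) ∎)
     where
     open ≡-Reasoning
     R = ℤ.∣ i ∔ j ∣
     gn = g (suc n)
     gm = g (suc m)
     gs = g s
     tn = twelfth (W (suc n))
     tm = twelfth (W (suc m))
     ts = twelfth (W s)
     E = twelfth (U (suc n) - U (suc m))
     gRs : g R * gs ≡ gn * gn * (gm * gm)
     gRs = trans (cong (λ k → g R * g k) (sym s≡)) (trans (g-parallelogram i j) (cong₂ (λ k l → g k * g k * (g l * g l)) n≡ m≡))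
     cr : twelfth (W R) * ts ≡ tn * tn * (tm * tm) * (twelfth (X s) * E)
     cr = trans (cong (λ k → twelfth (W R) * twelfth (W k)) (sym s≡)) (trans (sym (twelfth-* (W R) (W ℤ.∣ i ℤ.- j ∣))) (trans (twelfth-cross i j)
       (trans (cong₂ (λ k l → twelfth (cross k l)) m≡ n≡)
       (trans (cong twelfth (trans (cong₂ (λ a b → w (suc m) * a * w (suc n) - w (suc m) * (w (suc n) * b)) (U-* (suc m)) (U-* (suc n))) (lem (w (suc m)) (U (suc m)) (X s) (w (suc n)) (U (suc n)))))
       (trans (twelfth-neg (w (suc n) * w (suc m) * (X s * (U (suc n) - U (suc m)))))
       (trans (twelfth-* (w (suc n) * w (suc m)) (X s * (U (suc n) - U (suc m)))) (cong₂ _*_ (trans (twelfth-* (w (suc n)) (w (suc m))) (cong₂ _*_ (twelfth-* (W (suc n)) (W (suc n))) (twelfth-* (W (suc m)) (W (suc m)))))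
         (twelfth-* (X s) (U (suc n) - U (suc m))))))))))
       where
       lem : ∀ w U X v V → w * (U * X) * v - w * (v * (V * X)) ≡ - (v * w * (X * (V - U)))
       lem = ℚ-solve 5 (λ w U X v V → w :* (U :* X) :* v :- w :* (v :* (V :* X)) , :- (v :* w :* (X :* (V :- U)))) refl
     lem₁ : ∀ p a b c d → p * (a * (b * b * b)) * (c * d * (d * d)) ≡ p * ((a * c) * ((b * d) * (b * d) * (b * d)))
     lem₁ = ℚ-solve 5 (λ p a b c d → p :* (a :* (b :* b :* b)) :* (c :* d :* (d :* d)) , p :* ((a :* c) :* ((b :* d) :* (b :* d) :* (b :* d)))) refl
     lem₂ : ∀ p a t G → p * (a * G * (t * G * (t * G) * (t * G))) ≡ p * (a * t) * (t * t) * (G * G * (G * G))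
     lem₂ = ℚ-solve 4 (λ p a t G → p :* (a :* G :* (t :* G :* (t :* G) :* (t :* G))) , p :* (a :* t) :* (t :* t) :* (G :* G :* (G :* G))) refl
     lem₃ : ∀ p n m X E t G → p * (n * n * (m * m) * (X * E)) * (t * t) * (G * G * (G * G)) ≡
       (p * (t * t * X)) * ((n * G) * (n * G) * ((m * G) * (m * G))) * E
     lem₃ = ℚ-solve 7 (λ p n m X E t G → p :* (n :* n :* (m :* m) :* (X :* E)) :* (t :* t) :* (G :* G :* (G :* G)) , (p :* (t :* t :* X)) :* ((n :* G) :* (n :* G) :* ((m :* G) :* (m :* G))) :* E) refl
     lem₄ : ∀ s D f g h k E → s * s * D * ((f * g) * (f * g) * ((h * k) * (h * k))) * E ≡ D * ((f * f) * (h * h)) * E * (g * g * (k * k) * (s * s))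
     lem₄ = ℚ-solve 7 (λ s D f g h k E → s :* s :* D :* ((f :* g) :* (f :* g) :* ((h :* k) :* (h :* k))) :* E , D :* ((f :* f) :* (h :* h)) :* E :* (g :* g :* (k :* k) :* (s :* s))) refl

-- The progression 1 modulo s

module Runs {B x y : ℤ} (B≡ : B ≡ y ²ℤ ℤ.- x ³ℤ) (M : Multiples (ι B) (ι x) (ι y)) (Pm : Params x y) (Lp : LocalParams Pm) where
 open Indices
 open DyadicIntegers
 open Progressions
 open import Data.Integer using (+_)

 open import Data.Nat.Primality using (prime[2])
 open import Data.Integer.Divisibility.Signed using (_∣_; ∣⇒∣ᵤ; ∣ᵤ⇒∣)
 open import Data.Rational using (_+_; _-_; _*_; -_; ≢-nonZero)
 open Reduction using (parity)

 open Steps B≡ M Pm Lp public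

 shifted : ∀ κ m → ℤ.∣ κ ∣ ℕ.≤ m → Σ ℕ λ j → + j ≡ κ ∔ + suc m
 shifted (+ k) m h = k ℕ.+ suc m , refl
 shifted ℤ.-[1+ k ] m h = m ℕ.∸ k , sym (trans (ℤₚ.[1+m]⊖[1+n]≡m⊖n m k) (ℤₚ.⊖-≥ (ℕₚ.≤-trans (ℕₚ.n≤1+n k) h)))

 4β : ℚ → ℚ
 4β r = 2ℚ * (2ℚ * (ι B * (r * r * r)))

 -- Supplies all hypotheses of `Incompatible` from the 2-adic data of one step: `spread` bounds the
 -- differences of U, `U₁-small` bounds U at the index 1 and hence everywhere, and κ, l locate the
 -- two further places where F is 1.
 module Run (s′ : ℕ) (p D : ℤ) (p≢0 : p ≢ 0ℤ) (D-odd : Odd D)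
   (Φ-s : ι p * twelfth (Φ (suc s′)) ≡ g (suc s′) * g (suc s′) * twelfth (ι D)) (s-even : + 2 ∣ + suc s′)
   (μ u : ℕ) (u<μ : suc u ℕ.< μ) (μ≤2u : μ ℕ.≤ suc u ℕ.+ suc u)
   (spread : ∀ r → τ r ≡ 1 → 2^ twelve μ ∣ p · (F r · F (suc s′) ³ℤ))
   (β-small : Div (suc μ) (4β (Step.X⁻¹ s′ p D p≢0 D-odd Φ-s)))
   (U₁-small : Div (suc u) (ι x * Step.X⁻¹ s′ p D p≢0 D-odd Φ-s))
   (F-odd : ∀ i → Odd (F ℤ.∣ + suc s′ · i ∔ 1ℤ ∣))
   (κ l : ℤ) (P≢0 : κ · l · (κ ℤ.- l) ≢ 0ℤ)
   (F-κ : F ℤ.∣ + suc s′ · κ ∔ 1ℤ ∣ ≡ 1ℤ) (F-l : F ℤ.∣ + suc s′ · l ∔ 1ℤ ∣ ≡ 1ℤ) where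

   open Step s′ p D p≢0 D-odd Φ-s

   -- Large enough that κ and l become natural numbers after a shift by suc J₀. The index 1 then
   -- sits at suc J₀ and the indices 1 - s and 1 + s on either side of it.
   J₀ : ℕ
   J₀ = ℤ.∣ κ ∣ ℕ.+ ℤ.∣ l ∣

   c₁ = shifted κ J₀ (ℕₚ.m≤m+n ℤ.∣ κ ∣ ℤ.∣ l ∣)
   c₂ = shifted l J₀ (ℕₚ.m≤n+m ℤ.∣ l ∣ ℤ.∣ κ ∣)

   offset : ℕ → ℤ
   offset j = + j ℤ.- + suc J₀

   abstract
     z : ℕ → ℤ
     z j = + s · offset j ∔ 1ℤ

     z≡ : ∀ j → z j ≡ + s · offset j ∔ 1ℤ
     z≡ j = refl

   n : ℕ → ℕ
   n j = ℤ.∣ z j ∣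

   z-up : ∀ j → z j ∔ + s ≡ z (suc j)
   z-up j = trans (cong (_∔ + s) (z≡ j)) (trans (lem (+ s) (+ j) (+ suc J₀)) (sym (z≡ (suc j))))
     where
     lem : ∀ s j J → s · (j ℤ.- J) ∔ 1ℤ ∔ s ≡ s · (1ℤ ∔ j ℤ.- J) ∔ 1ℤ
     lem = ℤ-solve 3 (λ s j J → s :* (j :- J) :+ Κ 1ℤ :+ s , s :* (Κ 1ℤ :+ j :- J) :+ Κ 1ℤ) refl

   z-down : ∀ j → z (suc j) ℤ.- + s ≡ z j
   z-down j = trans (cong (ℤ._- + s) (z≡ (suc j))) (trans (lem (+ s) (+ j) (+ suc J₀)) (sym (z≡ j)))
     where
     lem : ∀ s j J → s · (1ℤ ∔ j ℤ.- J) ∔ 1ℤ ℤ.- s ≡ s · (j ℤ.- J) ∔ 1ℤ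
     lem = ℤ-solve 3 (λ s j J → s :* (Κ 1ℤ :+ j :- J) :+ Κ 1ℤ :- s , s :* (j :- J) :+ Κ 1ℤ) refl

   z-gap : ∀ j → z (suc j) ℤ.- z j ≡ + s
   z-gap j = trans (cong₂ ℤ._-_ (z≡ (suc j)) (z≡ j)) (lem (+ s) (+ j) (+ suc J₀))
     where
     lem : ∀ s j J → s · (1ℤ ∔ j ℤ.- J) ∔ 1ℤ ℤ.- (s · (j ℤ.- J) ∔ 1ℤ) ≡ s
     lem = ℤ-solve 3 (λ s j J → s :* (Κ 1ℤ :+ j :- J) :+ Κ 1ℤ :- (s :* (j :- J) :+ Κ 1ℤ) , s) refl

   z-even : ∀ j → + 2 ∣ z (suc j) ∔ z j
   z-even j = subst (+ 2 ∣_) (lem (z (suc j)) (z j)) (ℤD.∣m∣n⇒∣m+n (subst (+ 2 ∣_) (sym (z-gap j)) s-even) (ℤD.∣m⇒∣m*n (z j) ℤD.∣-refl))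
     where
     lem : ∀ a b → a ℤ.- b ∔ + 2 · b ≡ a ∔ b
     lem = ℤ-solve 2 (λ a b → a :- b :+ Κ (+ 2) :* b , a :+ b) refl

   z-odd : ∀ j → Odd (z j)
   z-odd j = subst Odd (sym (z≡ j)) (even-+-odd {+ s · offset j} {1ℤ} (ℤD.∣m⇒∣m*n (offset j) s-even) (∤-1 prime[2]))

   n-suc : ∀ j → n j ≡ suc (ℕ.pred (n j))
   n-suc j = sym (ℕₚ.suc-pred (n j) {{ℤ.≢-nonZero (Odd-≢0 (z-odd j))}})

   n≢s : ∀ j → n j ≢ s
   n≢s j e = z-odd j (∣ᵤ⇒∣ (subst (2 ℕD.∣_) (sym e) (∣⇒∣ᵤ s-even)))

   at-suc : (A : ℕ → Set) → ∀ j → A (suc (ℕ.pred (n j))) → A (n j)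
   at-suc A j = subst A (sym (n-suc j))

   ratio : ∀ j → ι p * (f (n (2 ℕ.+ j)) * f (n j)) ≡ twelfth (ι D) * (f (n (1 ℕ.+ j)) * f (n (1 ℕ.+ j))) * twelfth (1ℚ - U (n (1 ℕ.+ j)))
   ratio j = at-suc (λ k → ι p * (f (n (2 ℕ.+ j)) * f (n j)) ≡ twelfth (ι D) * (f k * f k) * twelfth (1ℚ - U k)) (suc j)
     (subst₂ (λ a b → ι p * (f ℤ.∣ a ∣ * f ℤ.∣ b ∣) ≡ twelfth (ι D) * (f k′ * f k′) * twelfth (1ℚ - U k′)) (z-up (suc j)) (z-down j) (step-ratio (z (suc j)) (n-suc (suc j))))
     where k′ = suc (ℕ.pred (n (suc j)))

   ratios : ∀ j → f (n (3 ℕ.+ j)) * (f (n (1 ℕ.+ j)) * f (n (1 ℕ.+ j)) * f (n (1 ℕ.+ j))) * twelfth (1ℚ - U (n (1 ℕ.+ j))) ≡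
                  f (n j) * (f (n (2 ℕ.+ j)) * f (n (2 ℕ.+ j)) * f (n (2 ℕ.+ j))) * twelfth (1ℚ - U (n (2 ℕ.+ j)))
   ratios j = *-cancelʳ (ι p * twelfth (ι D)) (*-≢0 ιp≢0 D≢0) (begin
     f₃ * (f₁ * f₁ * f₁) * E₁ * (ι p * tD) ≡⟨ lem₁ f₃ f₁ E₁ (ι p) tD ⟩
     (ι p * (f₃ * f₁)) * (tD * (f₁ * f₁) * E₁) ≡⟨ cong₂ _*_ (ratio (suc j)) (sym (ratio j)) ⟩
     tD * (f₂ * f₂) * E₂ * (ι p * (f₂ * f₀)) ≡⟨ lem₂ tD f₂ E₂ (ι p) f₀ ⟩
     f₀ * (f₂ * f₂ * f₂) * E₂ * (ι p * tD) ∎)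
     where
     open ≡-Reasoning
     tD = twelfth (ι D)
     f₀ = f (n j)
     f₁ = f (n (1 ℕ.+ j))
     f₂ = f (n (2 ℕ.+ j))
     f₃ = f (n (3 ℕ.+ j))
     E₁ = twelfth (1ℚ - U (n (1 ℕ.+ j)))
     E₂ = twelfth (1ℚ - U (n (2 ℕ.+ j)))
     lem₁ : ∀ f h E p D → f * (h * h * h) * E * (p * D) ≡ (p * (f * h)) * (D * (h * h) * E)
     lem₁ = ℚ-solve 5 (λ f h E p D → f :* (h :* h :* h) :* E :* (p :* D) , (p :* (f :* h)) :* (D :* (h :* h) :* E)) refl
     lem₂ : ∀ D f E p h → D * (f * f) * E * (p * (f * h)) ≡ h * (f * f * f) * E * (p * D)
     lem₂ = ℚ-solve 5 (λ D f E p h → D :* (f :* f) :* E :* (p :* (f :* h)) , h :* (f :* f :* f) :* E :* (p :* D)) refl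

   recursion : ∀ j → (U (n (2 ℕ.+ j)) + U (n j)) * ((1ℚ - U (n (suc j))) * (1ℚ - U (n (suc j)))) ≡
     2ℚ * (U (n (suc j)) + U (n (suc j)) * U (n (suc j)) + 2ℚ * (ι B * (X⁻¹ * X⁻¹ * X⁻¹)))
   recursion j = begin
     (U n₂ + U n₀) * ((1ℚ - U n₁) * (1ℚ - U n₁)) ≡⟨ cong (λ t → (U n₂ + U n₀) * ((t - U n₁) * (t - U n₁))) (sym X⁻¹-*) ⟩
     (U n₂ + U n₀) * ((X⁻¹ * X s - U n₁) * (X⁻¹ * X s - U n₁)) ≡⟨ lem₁ (X n₂) (X n₀) X⁻¹ (X s) (X n₁) ⟩
     X⁻¹ * X⁻¹ * X⁻¹ * ((X n₁ - X s) * (X n₁ - X s) * (X n₂ + X n₀)) ≡⟨ cong (X⁻¹ * X⁻¹ * X⁻¹ *_) sum ⟩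
     X⁻¹ * X⁻¹ * X⁻¹ * (2ℚ * (X n₁ * X s * (X n₁ + X s) + 2ℚ * ι B)) ≡⟨ lem₂ X⁻¹ (X n₁) (X s) (ι B) ⟩
     2ℚ * (U n₁ * (X⁻¹ * X s) * (X⁻¹ * X s) + U n₁ * U n₁ * (X⁻¹ * X s) + 2ℚ * (ι B * (X⁻¹ * X⁻¹ * X⁻¹)))
       ≡⟨ cong (λ t → 2ℚ * (U n₁ * t * t + U n₁ * U n₁ * t + 2ℚ * (ι B * (X⁻¹ * X⁻¹ * X⁻¹)))) X⁻¹-* ⟩
     2ℚ * (U n₁ * 1ℚ * 1ℚ + U n₁ * U n₁ * 1ℚ + 2ℚ * (ι B * (X⁻¹ * X⁻¹ * X⁻¹))) ≡⟨ lem₃ (U n₁) (ι B * (X⁻¹ * X⁻¹ * X⁻¹)) ⟩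
     2ℚ * (U n₁ + U n₁ * U n₁ + 2ℚ * (ι B * (X⁻¹ * X⁻¹ * X⁻¹))) ∎
     where
     open ≡-Reasoning
     n₀ = n j
     n₁ = n (suc j)
     n₂ = n (2 ℕ.+ j)
     sum : (X n₁ - X s) * (X n₁ - X s) * (X n₂ + X n₀) ≡ 2ℚ * (X n₁ * X s * (X n₁ + X s) + 2ℚ * ι B)
     sum = at-suc (λ k → (X k - X s) * (X k - X s) * (X n₂ + X n₀) ≡ 2ℚ * (X k * X s * (X k + X s) + 2ℚ * ι B)) (suc j)
       (subst₂ (λ a b → (X k′ - X s) ² * (X ℤ.∣ a ∣ + X ℤ.∣ b ∣) ≡ 2ℚ * (X k′ * X s * (X k′ + X s) + 2ℚ * ι B)) (z-up (suc j)) (z-down j)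
         (X-sumℤ (z (suc j)) (+ s) (n-suc (suc j)) refl (λ e → n≢s (suc j) (trans (n-suc (suc j)) e))))
       where k′ = suc (ℕ.pred n₁)
     lem₁ : ∀ a b i s c → (a * i + b * i) * ((i * s - c * i) * (i * s - c * i)) ≡ i * i * i * ((c - s) * (c - s) * (a + b))
     lem₁ = ℚ-solve 5 (λ a b i s c → (a :* i :+ b :* i) :* ((i :* s :- c :* i) :* (i :* s :- c :* i)) , i :* i :* i :* ((c :- s) :* (c :- s) :* (a :+ b))) refl
     lem₂ : ∀ i c s B → i * i * i * (2ℚ * (c * s * (c + s) + 2ℚ * B)) ≡ 2ℚ * (c * i * (i * s) * (i * s) + c * i * (c * i) * (i * s) + 2ℚ * (B * (i * i * i)))
     lem₂ = ℚ-solve 4 (λ i c s B → i :* i :* i :* (Κ 2ℚ :* (c :* s :* (c :+ s) :+ Κ 2ℚ :* B)) , Κ 2ℚ :* (c :* i :* (i :* s) :* (i :* s) :+ c :* i :* (c :* i) :* (i :* s) :+ Κ 2ℚ :* (B :* (i :* i :* i)))) refl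
     lem₃ : ∀ U β → 2ℚ * (U * 1ℚ * 1ℚ + U * U * 1ℚ + 2ℚ * β) ≡ 2ℚ * (U + U * U + 2ℚ * β)
     lem₃ = ℚ-solve 2 (λ U β → Κ 2ℚ :* (U :* Κ 1ℚ :* Κ 1ℚ :+ U :* U :* Κ 1ℚ :+ Κ 2ℚ :* β) , Κ 2ℚ :* (U :+ U :* U :+ Κ 2ℚ :* β)) refl

   Fn-odd : ∀ j → Odd (F (n j))
   Fn-odd j = subst (λ t → Odd (F ℤ.∣ t ∣)) (sym (z≡ j)) (F-odd (offset j))

   -- `step-difference` applies with an even sum of indices, since both are odd. The cofactor `H` of
   -- the twelfth power of ΔU is odd, so `spread` bounds that power.
   ΔU-small : ∀ j → Div μ (Δ (λ j → U (n j)) j)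
   ΔU-small j = Div-twelfth-root {μ} (Div-cancel {twelve μ} {twelfth (U n₁ - U n₀)} {H} H-odd (subst (Div (twelve μ)) eq (Div-ι (spread r (τ-of-even r (∣⇒∣ᵤ (z-even j)))))))
     where
     n₀ = n j
     n₁ = n (suc j)
     r = ℤ.∣ z (suc j) ∔ z j ∣
     F₀ = F n₀
     F₁ = F n₁
     H = twelfthℤ D · ((F₁ ²ℤ) · (F₀ ²ℤ))
     sq-odd : ∀ {i} → Odd i → Odd (i ²ℤ)
     sq-odd {i} o = Odd-* {i} {i} o o
     D³-odd : Odd (D ³ℤ)
     D³-odd = Odd-* {D ²ℤ} {D} (sq-odd {D} D-odd) D-odd
     H-odd : Odd H
     H-odd = Odd-* {twelfthℤ D} {F₁ ²ℤ · F₀ ²ℤ} (sq-odd {D ³ℤ ²ℤ} (sq-odd {D ³ℤ} D³-odd)) (Odd-* {F₁ ²ℤ} {F₀ ²ℤ} (sq-odd {F₁} (Fn-odd (suc j))) (sq-odd {F₀} (Fn-odd j)))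
     diff : ι p * (f r * (f s * f s * f s)) ≡ twelfth (ι D) * ((f n₁ * f n₁) * (f n₀ * f n₀)) * twelfth (U n₁ - U n₀)
     diff = at-suc (λ k → ι p * (f r * (f s * f s * f s)) ≡ twelfth (ι D) * ((f k * f k) * (f n₀ * f n₀)) * twelfth (U k - U n₀)) (suc j)
       (at-suc (λ k → ι p * (f r * (f s * f s * f s)) ≡ twelfth (ι D) * ((f k′ * f k′) * (f k * f k)) * twelfth (U k′ - U k)) j
         (step-difference (z (suc j)) (z j) (n-suc (suc j)) (n-suc j) (cong ℤ.∣_∣ (z-gap j))))
       where k′ = suc (ℕ.pred n₁)
     eq : ι (p · (F r · F s ³ℤ)) ≡ twelfth (U n₁ - U n₀) * ι H
     eq = trans (trans (ι-* p (F r · F s ³ℤ)) (cong (ι p *_) (trans (ι-* (F r) (F s ³ℤ)) (cong (f r *_) (trans (ι-* (F s ²ℤ) (F s)) (cong (_* f s) (ι-* (F s) (F s))))))))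
       (trans diff (trans (ℚₚ.*-comm _ (twelfth (U n₁ - U n₀))) (cong (twelfth (U n₁ - U n₀) *_) (sym (trans (ι-* (twelfthℤ D) (F₁ ²ℤ · F₀ ²ℤ))
         (cong₂ _*_ (ι-twelfth D) (trans (ι-* (F₁ ²ℤ) (F₀ ²ℤ)) (cong₂ _*_ (ι-* F₁ F₁) (ι-* F₀ F₀)))))))))

   z-J : z (suc J₀) ≡ 1ℤ
   z-J = trans (z≡ (suc J₀)) (trans (cong (λ t → + s · t ∔ 1ℤ) (ℤₚ.+-inverseʳ (+ suc J₀))) (cong (_∔ 1ℤ) (ℤₚ.*-zeroʳ (+ s))))

   U-small : ∀ j → Div (suc u) (U (n j))
   U-small = Div-from-differences (λ j → U (n j)) (λ j → Div-mono (ℕₚ.<⇒≤ u<μ) (ΔU-small j)) (suc J₀)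
     (subst (λ t → Div (suc u) (U ℤ.∣ t ∣)) (sym z-J) (subst (λ t → Div (suc u) (t * X⁻¹)) (sym X₁) U₁-small))

   z-at : ∀ {j κ} → + j ≡ κ ∔ + suc J₀ → z j ≡ + s · κ ∔ 1ℤ
   z-at {j} {κ} e = trans (z≡ j) (cong (λ t → + s · t ∔ 1ℤ) (trans (cong (ℤ._- + suc J₀) e) (lem κ (+ suc J₀))))
     where
     lem : ∀ κ J → κ ∔ J ℤ.- J ≡ κ
     lem = ℤ-solve 2 (λ κ J → κ :+ J :- J , κ) refl

   F-one : F 1 ≡ 1ℤ
   F-one = F-unit 1 refl refl (cong ℤ.∣_∣ v₁)

   inverses : ∀ j → Σ ℚ λ r → (1ℚ - U (n j)) * r ≡ 1ℚ × Div 0 r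
   inverses j = Div-inverse {u} {U (n j)} (U-small j)

   odd⇒even-1 : ∀ {i} → Odd i → + 2 ∣ i ℤ.- 1ℤ
   odd⇒even-1 {i} o with parity i
   ... | inj₁ h = ⊥-elim (o h)
   ... | inj₂ h = h

   module At = Incompatible (λ j → U (n j)) (λ j → proj₁ (inverses j)) (ι B * (X⁻¹ * X⁻¹ * X⁻¹)) μ (suc u) (ℕ.s≤s ℕ.z≤n) u<μ μ≤2u
     β-small U-small ΔU-small (λ j → proj₂ (proj₂ (inverses j))) (λ j → proj₁ (proj₂ (inverses j))) recursion
     (λ j → F (n j)) (λ j → odd⇒even-1 {F (n j)} (Fn-odd j)) ratios κ l P≢0 J₀ (proj₁ c₁) (proj₁ c₂) (proj₂ c₁) (proj₂ c₂)
     (trans (cong (λ t → F ℤ.∣ t ∣) (z-at {proj₁ c₁} {κ} (proj₂ c₁))) F-κ) (trans (cong (λ t → F ℤ.∣ t ∣) (z-at {proj₁ c₂} {l} (proj₂ c₂))) F-l)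
     (trans (cong (λ t → F ℤ.∣ t ∣) z-J) F-one)

   before after : ℤ
   before = F ℤ.∣ 1ℤ ℤ.- + s ∣
   after = F ℤ.∣ 1ℤ ∔ + s ∣

   before≡ : F (n J₀) ≡ before
   before≡ = cong (λ t → F ℤ.∣ t ∣) (trans (sym (z-down J₀)) (cong (ℤ._- + s) z-J))

   after≡ : F (n (2 ℕ.+ J₀)) ≡ after
   after≡ = cong (λ t → F ℤ.∣ t ∣) (trans (sym (z-up (suc J₀))) (cong (_∔ + s) z-J))

   contradiction₃ : ∀ n → Exact (2 ℕ.+ n) (before · before ℤ.- after) → 3 ℕ.+ n ℕ.≤ μ → ⊥
   contradiction₃ n E = At.incompatible₃ n (subst₂ (λ p q → Exact (2 ℕ.+ n) (p · p ℤ.- q)) (sym before≡) (sym after≡) E)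

   contradiction₂ : ∀ n → Exact (2 ℕ.+ n) (before · before · before ℤ.- after) → 2 ℕ.+ n ℕ.≤ μ → ⊥
   contradiction₂ n E = At.incompatible₂ n (subst₂ (λ p q → Exact (2 ℕ.+ n) (p · p · p ℤ.- q)) (sym before≡) (sym after≡) E)

open Reduction using (TwoAdic; Case₆; Case₄; parity; odd-odd; Exact-mul-odd; Exact⇒∣)

-- Explicit terms up to index 7 and the numerators at 4 and 6

module SmallMultiples {B x y : ℤ} (B≡ : B ≡ y ²ℤ ℤ.- x ³ℤ) (M : Multiples (ι B) (ι x) (ι y)) (Pm : Params x y) (Lp : LocalParams Pm) (Ta : TwoAdic Pm B) where
 open Indices
 open DyadicIntegers
 open Progressions
 open import Data.Integer using (+_; _^_)

 open import Data.Rational using (_+_; _-_; _*_; -_)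

 open Runs B≡ M Pm Lp public

 v₅≡ : v 5 ≡ T · c ℤ.- b
 v₅≡ = trans (v-odd 0) (trans (cong₂ (λ p q → T · 1ℤ · 1ℤ · (p · (v 2 · v 2 · v 2)) ℤ.- 1ℤ · (b · 1ℤ) · (q · (v 3 · v 3 · v 3))) v₄ v₁)
   (trans (cong₂ (λ p q → T · 1ℤ · 1ℤ · (c · (p · p · p)) ℤ.- 1ℤ · (b · 1ℤ) · (1ℤ · (q · q · q))) v₂ v₃) (lem T b c)))
   where
   lem : ∀ T b c → T · 1ℤ · 1ℤ · (c · (1ℤ · 1ℤ · 1ℤ)) ℤ.- 1ℤ · (b · 1ℤ) · (1ℤ · (1ℤ · 1ℤ · 1ℤ)) ≡ T · c ℤ.- b
   lem = ℤ-solve 3 (λ T b c → T :* Κ 1ℤ :* Κ 1ℤ :* (c :* (Κ 1ℤ :* Κ 1ℤ :* Κ 1ℤ)) :- Κ 1ℤ :* (b :* Κ 1ℤ) :* (Κ 1ℤ :* (Κ 1ℤ :* Κ 1ℤ :* Κ 1ℤ)) , T :* c :- b) refl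

 v₆≡ : v 6 ≡ v 5 ℤ.- c ²ℤ
 v₆≡ = trans (v-even 0) (trans (cong₂ (λ p q → 1ℤ · (v 3 · v 5 · (v 2 · v 2)) ℤ.- 1ℤ · (v 3 · q · (p · p))) v₄ v₁)
   (trans (cong₂ (λ p q → 1ℤ · (q · v 5 · (p · p)) ℤ.- 1ℤ · (q · 1ℤ · (c · c))) v₂ v₃) (lem (v 5) c)))
   where
   lem : ∀ z c → 1ℤ · (1ℤ · z · (1ℤ · 1ℤ)) ℤ.- 1ℤ · (1ℤ · 1ℤ · (c · c)) ≡ z ℤ.- c · c
   lem = ℤ-solve 2 (λ z c → Κ 1ℤ :* (Κ 1ℤ :* z :* (Κ 1ℤ :* Κ 1ℤ)) :- Κ 1ℤ :* (Κ 1ℤ :* Κ 1ℤ :* (c :* c)) , z :- c :* c) refl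

 v₇≡ : v 7 ≡ b · v 5 ℤ.- T · c ³ℤ
 v₇≡ = trans (v-odd 1) (trans (cong₂ (λ p q → 1ℤ · (b · 1ℤ) · (v 5 · (q · q · q)) ℤ.- T · 1ℤ · 1ℤ · (v 2 · (p · p · p))) v₄ v₃)
   (trans (cong (λ p → 1ℤ · (b · 1ℤ) · (v 5 · (1ℤ · 1ℤ · 1ℤ)) ℤ.- T · 1ℤ · 1ℤ · (p · (c · c · c))) v₂) (lem (v 5) T b c)))
   where
   lem : ∀ z T b c → 1ℤ · (b · 1ℤ) · (z · (1ℤ · 1ℤ · 1ℤ)) ℤ.- T · 1ℤ · 1ℤ · (1ℤ · (c · c · c)) ≡ b · z ℤ.- T · (c · c · c)
   lem = ℤ-solve 4 (λ z T b c → Κ 1ℤ :* (b :* Κ 1ℤ) :* (z :* (Κ 1ℤ :* Κ 1ℤ :* Κ 1ℤ)) :- T :* Κ 1ℤ :* Κ 1ℤ :* (Κ 1ℤ :* (c :* c :* c)) , b :* z :- T :* (c :* c :* c)) refl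

 -- Together with `v₅²+v₇` this factors v₅⁴ - v₇², from which the valuation of F 5 ² - F 7 is
 -- computed.
 v₅²-v₇ : v 5 ²ℤ ℤ.- v 7 ≡ c ²ℤ · T · (T ∔ c) ℤ.- + 3 · b · c · T ∔ + 2 · b ²ℤ
 v₅²-v₇ = trans (cong (v 5 ²ℤ ℤ.-_) v₇≡) (trans (cong (λ z → z ²ℤ ℤ.- (b · z ℤ.- T · c ³ℤ)) v₅≡) (lem T b c))
   where
   lem : ∀ T b c → let z = T · c ℤ.- b in z · z ℤ.- (b · z ℤ.- T · (c · c · c)) ≡
     c · c · T · (T ∔ c) ℤ.- + 3 · b · c · T ∔ + 2 · (b · b)
   lem = ℤ-solve 3 (λ T b c →
                   let z = T :* c :- b in z :* z :- (b :* z :- T :* (c :* c :* c)) ,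
     c :* c :* T :* (T :+ c) :- Κ (+ 3) :* b :* c :* T :+ Κ (+ 2) :* (b :* b)) refl

 v₅²+v₇ : v 5 ²ℤ ∔ v 7 ≡ v 6 · (c · T)
 v₅²+v₇ = trans (cong (λ z → v 5 ²ℤ ∔ z) v₇≡) (trans (cong (λ z → z ²ℤ ∔ (b · z ℤ.- T · c ³ℤ)) v₅≡) (trans (lem T b c)
   (cong (_· (c · T)) (sym (trans v₆≡ (cong (ℤ._- c ²ℤ) v₅≡))))))
   where
   lem : ∀ T b c → let z = T · c ℤ.- b in z · z ∔ (b · z ℤ.- T · (c · c · c)) ≡ (z ℤ.- c · c) · (c · T)
   lem = ℤ-solve 3 (λ T b c → let z = T :* c :- b in z :* z :+ (b :* z :- T :* (c :* c :* c)) , (z :- c :* c) :* (c :* T)) refl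

 -- For the step 4 the relevant difference is F 3 ³ - F 5 = b¹² - v₅¹², whose valuation comes from
 -- this one.
 b²-v₅² : b ²ℤ ℤ.- v 5 ²ℤ ≡ (+ 2 · b ℤ.- c · T) · (c · T)
 b²-v₅² = trans (cong (λ z → b ²ℤ ℤ.- z ²ℤ) v₅≡) (lem T b c)
   where
   lem : ∀ T b c → b · b ℤ.- (T · c ℤ.- b) · (T · c ℤ.- b) ≡ (+ 2 · b ℤ.- c · T) · (c · T)
   lem = ℤ-solve 3 (λ T b c → b :* b :- (T :* c :- b) :* (T :* c :- b) , (Κ (+ 2) :* b :- c :* T) :* (c :* T)) refl

 Φ-int : ∀ n → Φ (suc n) ≡ ι (x · W-int (suc n) ²ℤ ℤ.- W-int (2 ℕ.+ n) · W-int n)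
 Φ-int n = trans (Φ≡ n) (sym (trans (ι-- (x · W-int (suc n) ²ℤ) (W-int (2 ℕ.+ n) · W-int n)) (cong₂ _-_
   (trans (ι-* x (W-int (suc n) ²ℤ)) (cong (ι x *_) (trans (ι-* (W-int (suc n)) (W-int (suc n))) (sym (cong₂ _*_ (W≡W-int (suc n)) (W≡W-int (suc n)))))))
   (trans (ι-* (W-int (2 ℕ.+ n)) (W-int n)) (sym (cong₂ _*_ (W≡W-int (2 ℕ.+ n)) (W≡W-int n)))))))

 -- The numerators Φ 6 and Φ 4 stripped of powers of `G` and, at 4, of d/b. In the case where the
 -- respective step is used they are odd, whereas v 6 or v 4 is even: x(sP) is 2-adically large
 -- compared with x.
 D₆ D₄ : ℤ
 D₆ = v 6 ²ℤ · h ℤ.- v 5 · v 7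
 D₄ = h · c ²ℤ ℤ.- b · v 5

 Φ₆≡ : Φ 6 ≡ ι (G ^ 6 · D₆)
 Φ₆≡ = trans (Φ-int 5) (cong ι (trans (lem₁ x (v 6) a d G (v 7) (v 5)) (trans (cong (λ z → z · (G · G · (G · G)) · (v 6 · v 6) ℤ.- G ^ 6 · (v 5 · v 7)) xa²d²) (lem₂ h (v 6) G (v 7) (v 5)))))
   where
   lem₁ : ∀ x v₆ a d G v₇ v₅ → let W₆ = v₆ · (a · 1ℤ · (d · 1ℤ) · (G · (G · 1ℤ))) in
     x · (W₆ · W₆) ℤ.- v₇ · (1ℤ · 1ℤ · (G · (G · (G · (G · 1ℤ))))) · (v₅ · (1ℤ · 1ℤ · (G · (G · 1ℤ)))) ≡
     x · (a · a) · (d · d) · (G · G · (G · G)) · (v₆ · v₆) ℤ.- G · (G · (G · (G · (G · (G · 1ℤ))))) · (v₅ · v₇)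
   lem₁ = ℤ-solve 7 (λ x v₆ a d G v₇ v₅ →
                               let W₆ = v₆ :* (a :* Κ 1ℤ :* (d :* Κ 1ℤ) :* (G :* (G :* Κ 1ℤ))) in
     x :* (W₆ :* W₆) :- v₇ :* (Κ 1ℤ :* Κ 1ℤ :* (G :* (G :* (G :* (G :* Κ 1ℤ))))) :* (v₅ :* (Κ 1ℤ :* Κ 1ℤ :* (G :* (G :* Κ 1ℤ)))) ,
     x :* (a :* a) :* (d :* d) :* (G :* G :* (G :* G)) :* (v₆ :* v₆) :- G :* (G :* (G :* (G :* (G :* (G :* Κ 1ℤ))))) :* (v₅ :* v₇)) refl
   lem₂ : ∀ h v₆ G v₇ v₅ → h · (G · G) · (G · G · (G · G)) · (v₆ · v₆) ℤ.- G · (G · (G · (G · (G · (G · 1ℤ))))) · (v₅ · v₇) ≡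
     G · (G · (G · (G · (G · (G · 1ℤ))))) · (v₆ · v₆ · h ℤ.- v₅ · v₇)
   lem₂ = ℤ-solve 5 (λ h v₆ G v₇ v₅ → h :* (G :* G) :* (G :* G :* (G :* G)) :* (v₆ :* v₆) :- G :* (G :* (G :* (G :* (G :* (G :* Κ 1ℤ))))) :* (v₅ :* v₇) , G :* (G :* (G :* (G :* (G :* (G :* Κ 1ℤ))))) :* (v₆ :* v₆ :* h :- v₅ :* v₇)) refl

 xa²b : x · a ²ℤ · b ≡ h · d
 xa²b = ℤ-cancelʳ (G · G) (ℤ-*-≢0 G≢0 G≢0) (ℤ-cancelʳ (d · d) (ℤ-*-≢0 d≢0 d≢0)
   (trans (lem₁ x (a ²ℤ) b (G · G) (d · d)) (trans (cong₂ _·_ xa²d² (sym d³)) (lem₂ h (G · G) d))))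
   where
   lem₁ : ∀ x a b g d → x · a · b · g · d ≡ x · a · d · (b · g)
   lem₁ = ℤ-solve 5 (λ x a b g d → x :* a :* b :* g :* d , x :* a :* d :* (b :* g)) refl
   lem₂ : ∀ h g d → h · g · (d · d · d) ≡ h · d · g · (d · d)
   lem₂ = ℤ-solve 3 (λ h g d → h :* g :* (d :* d :* d) , h :* d :* g :* (d :* d)) refl

 Φ₄≡ : ι b * Φ 4 ≡ ι (d · G ^ 2 · D₄)
 Φ₄≡ = trans (cong (ι b *_) (Φ-int 3)) (trans (sym (ι-* b (x · W-int 4 ²ℤ ℤ.- W-int 5 · W-int 3))) (cong ι
   (trans (cong₂ (λ p q → b · (x · (p · σ 4) ²ℤ ℤ.- v 5 · σ 5 · (q · σ 3))) v₄ v₃)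
   (trans (lem₁ x c a d G (v 5) b) (trans (cong (λ z → z · (G · G) · (c · c) ℤ.- d · G ^ 2 · (b · v 5)) xa²b) (lem₂ h c d G (v 5) b))))))
   where
   lem₁ : ∀ x c a d G v₅ b → let W₄ = c · (a · 1ℤ · 1ℤ · (G · 1ℤ)) in
     b · (x · (W₄ · W₄) ℤ.- v₅ · (1ℤ · 1ℤ · (G · (G · 1ℤ))) · (1ℤ · (1ℤ · (d · 1ℤ) · 1ℤ))) ≡
     x · (a · a) · b · (G · G) · (c · c) ℤ.- d · (G · (G · 1ℤ)) · (b · v₅)
   lem₁ = ℤ-solve 7 (λ x c a d G v₅ b →
                             let W₄ = c :* (a :* Κ 1ℤ :* Κ 1ℤ :* (G :* Κ 1ℤ)) in
     b :* (x :* (W₄ :* W₄) :- v₅ :* (Κ 1ℤ :* Κ 1ℤ :* (G :* (G :* Κ 1ℤ))) :* (Κ 1ℤ :* (Κ 1ℤ :* (d :* Κ 1ℤ) :* Κ 1ℤ))) ,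
     x :* (a :* a) :* b :* (G :* G) :* (c :* c) :- d :* (G :* (G :* Κ 1ℤ)) :* (b :* v₅)) refl
   lem₂ : ∀ h c d G v₅ b → h · d · (G · G) · (c · c) ℤ.- d · (G · (G · 1ℤ)) · (b · v₅) ≡ d · (G · (G · 1ℤ)) · (h · (c · c) ℤ.- b · v₅)
   lem₂ = ℤ-solve 6 (λ h c d G v₅ b → h :* d :* (G :* G) :* (c :* c) :- d :* (G :* (G :* Κ 1ℤ)) :* (b :* v₅) , d :* (G :* (G :* Κ 1ℤ)) :* (h :* (c :* c) :- b :* v₅)) refl

 w-int : ∀ n → w n ≡ ι (W-int n ²ℤ)
 w-int n = trans (cong₂ _*_ (W≡W-int n) (W≡W-int n)) (sym (ι-* (W-int n) (W-int n)))

 F-form : ∀ n {t e} → τ n ≡ t → δ n ≡ e → F n ≡ twelfthℤ (v n) · (T ^ t) ³ℤ · (b ^ e) ²ℤ ²ℤ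
 F-form n refl refl = F≡ n

 -- If i Φ(s) = j D, then x / X(s) = z / D for x i w(s) = j z, and 4 B / X(s)³ = z / 3 D³ for 12 B i³ w(s)³ = j³ z.
 module Quotients (s′ : ℕ) (X⁻¹ : ℚ) (X⁻¹-* : X⁻¹ * X (suc s′) ≡ 1ℚ) (i j D : ℤ) (j≢0 : j ≢ 0ℤ) (eq : ι i * Φ (suc s′) ≡ ι (j · D)) where

   X⁻¹-D : X⁻¹ * ι (j · D) ≡ ι (i · W-int (suc s′) ²ℤ)
   X⁻¹-D = trans (cong (X⁻¹ *_) (sym eq)) (trans (lem X⁻¹ (ι i) (w (suc s′)) (X (suc s′))) (trans (cong₂ _*_ X⁻¹-* (cong (ι i *_) (w-int (suc s′))))
     (trans (ℚₚ.*-identityˡ _) (sym (ι-* i (W-int (suc s′) ²ℤ))))))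
     where
     lem : ∀ r i w X → r * (i * (w * X)) ≡ r * X * (i * w)
     lem = ℚ-solve 4 (λ r i w X → r :* (i :* (w :* X)) , r :* X :* (i :* w)) refl

   U₁-D : ∀ z → x · (i · W-int (suc s′) ²ℤ) ≡ z · j → ι x * X⁻¹ * ι D ≡ ι z
   U₁-D z e = *-cancelʳ (ι j) (ι-≢0 j≢0) (trans (lem (ι x) X⁻¹ (ι D) (ι j)) (trans (cong (ι x *_) (trans (cong (X⁻¹ *_) (sym (ι-* j D))) X⁻¹-D))
     (trans (sym (ι-* x (i · W-int (suc s′) ²ℤ))) (trans (cong ι e) (ι-* z j)))))
     where
     lem : ∀ x r D j → x * r * D * j ≡ x * (r * (j * D))
     lem = ℚ-solve 4 (λ x r D j → x :* r :* D :* j , x :* (r :* (j :* D))) refl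

   β-D : ∀ z → + 12 · B · (i · W-int (suc s′) ²ℤ) ³ℤ ≡ z · j ³ℤ →
         2ℚ * (2ℚ * (ι B * (X⁻¹ * X⁻¹ * X⁻¹))) * ι (+ 3 · D ³ℤ) ≡ ι z
   β-D z e = *-cancelʳ (ι (j ³ℤ)) (ι-≢0 (ℤ-*-≢0 (ℤ-*-≢0 j≢0 j≢0) j≢0)) (trans (cong₂ (λ p q → 2ℚ * (2ℚ * (ι B * (X⁻¹ * X⁻¹ * X⁻¹))) * p * q)
       (trans (ι-* (+ 3) (D ³ℤ)) (cong (ι (+ 3) *_) (ι-cube D))) (ι-cube j))
     (trans (lem (ι B) X⁻¹ (ι D) (ι j)) (trans (cong (λ p → ι (+ 12) * ι B * (p * p * p)) (trans (cong (X⁻¹ *_) (sym (ι-* j D))) X⁻¹-D))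
     (trans (cong₂ _*_ (sym (ι-* (+ 12) B)) (sym (ι-cube (i · W-int (suc s′) ²ℤ))))
     (trans (sym (ι-* (+ 12 · B) ((i · W-int (suc s′) ²ℤ) ³ℤ))) (trans (cong ι e) (ι-* z (j ³ℤ))))))))
     where
     ι-cube : ∀ i → ι (i ³ℤ) ≡ ι i * ι i * ι i
     ι-cube i = trans (ι-* (i · i) i) (cong (_* ι i) (ι-* i i))
     lem : ∀ B r D j → 2ℚ * (2ℚ * (B * (r * r * r))) * (ι (+ 3) * (D * D * D)) * (j * j * j) ≡ ι (+ 12) * B * (r * (j * D) * (r * (j * D)) * (r * (j * D)))
     lem B r D j = trans (lem′ B r D j) (cong (λ t → t * B * (r * (j * D) * (r * (j * D)) * (r * (j * D)))) (sym (ι-* (+ 4) (+ 3))))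
       where
       lem′ : ∀ B r D j → 2ℚ * (2ℚ * (B * (r * r * r))) * (3ℚ * (D * D * D)) * (j * j * j) ≡ (4ℚ * 3ℚ) * B * (r * (j * D) * (r * (j * D)) * (r * (j * D)))
       lem′ = ℚ-solve 4 (λ B r D j → Κ 2ℚ :* (Κ 2ℚ :* (B :* (r :* r :* r))) :* (Κ 3ℚ :* (D :* D :* D)) :* (j :* j :* j) , (Κ 4ℚ :* Κ 3ℚ) :* B :* (r :* (j :* D) :* (r :* (j :* D)) :* (r :* (j :* D)))) refl

open Reduction using (prime[3]; 3-odd; TwoAdic; Case₆; Case₄; parity; odd-odd; even--odd; odd--even; exact-pos; Exact-mul-odd; Exact⇒∣)

-- Two units prime to 6 are impossible

module TwoUnits {B x y : ℤ} (B≡ : B ≡ y ²ℤ ℤ.- x ³ℤ) (M : Multiples (ι B) (ι x) (ι y)) (Pm : Params x y) (Lp : LocalParams Pm) (Ta : TwoAdic Pm B) where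
 open Indices
 open DyadicIntegers
 open Progressions
 open import Data.Integer using (+_; _^_)

 open import Data.Nat.Primality using (Prime; prime[2])
 open import Data.Integer.Divisibility.Signed using (_∣_; divides; ∣ᵤ⇒∣)
 open import Data.Rational using (_+_; _*_)

 open SmallMultiples B≡ M Pm Lp Ta public
 open TwoAdic Ta

 τ-of-odd : ∀ n → ¬ (2 ℕD.∣ n) → τ n ≡ 0
 τ-of-odd 0 o = ⊥-elim (o (ℕD.divides-refl 0))
 τ-of-odd 1 o = refl
 τ-of-odd (suc (suc n)) o = τ-of-odd n (λ h → o (ℕD.∣m∣n⇒∣m+n ℕD.∣-refl h))

 δ-of-∤3 : ∀ n → ¬ (3 ℕD.∣ n) → δ n ≡ 0
 δ-of-∤3 0 o = ⊥-elim (o (ℕD.divides-refl 0))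
 δ-of-∤3 1 o = refl
 δ-of-∤3 2 o = refl
 δ-of-∤3 (suc (suc (suc n))) o = δ-of-∤3 n (λ h → o (ℕD.∣m∣n⇒∣m+n ℕD.∣-refl h))

 -- One of n and - n lies in the class of 1 modulo s. As F is read at absolute values, this single
 -- progression reaches every index prime to 6.
 Signed : ℤ → ℕ → Set
 Signed s n = Σ ℤ λ κ → s · κ ∔ 1ℤ ≡ + n ⊎ s · κ ∔ 1ℤ ≡ ℤ.- + n

 signed-step : ∀ s {n} → Signed (+ s) n → Signed (+ s) (s ℕ.+ n)
 signed-step s {n} (κ , inj₁ e) = κ ∔ 1ℤ , inj₁ (trans (lem (+ s) κ) (cong (λ t → + s ∔ t) e))
   where
   lem : ∀ s κ → s · (κ ∔ 1ℤ) ∔ 1ℤ ≡ s ∔ (s · κ ∔ 1ℤ)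
   lem = ℤ-solve 2 (λ s κ → s :* (κ :+ Κ 1ℤ) :+ Κ 1ℤ , s :+ (s :* κ :+ Κ 1ℤ)) refl
 signed-step s {n} (κ , inj₂ e) = κ ℤ.- 1ℤ , inj₂ (trans (lem₁ (+ s) κ) (trans (cong (ℤ._- + s) e) (lem₂ (+ s) (+ n))))
   where
   lem₁ : ∀ s κ → s · (κ ℤ.- 1ℤ) ∔ 1ℤ ≡ (s · κ ∔ 1ℤ) ℤ.- s
   lem₁ = ℤ-solve 2 (λ s κ → s :* (κ :- Κ 1ℤ) :+ Κ 1ℤ , (s :* κ :+ Κ 1ℤ) :- s) refl
   lem₂ : ∀ s n → (ℤ.- n) ℤ.- s ≡ ℤ.- (s ∔ n)
   lem₂ = ℤ-solve 2 (λ s n → (:- n) :- s , :- (s :+ n)) refl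

 signed₆ : ∀ n → τ n ≡ 0 → δ n ≡ 0 → Signed (+ 6) n
 signed₆ = by-six _ (λ ()) (λ _ _ → 0ℤ , inj₁ refl) (λ ()) (λ _ ()) (λ ()) (λ _ _ → ℤ.- 1ℤ , inj₂ refl)
   (λ n h t f → signed-step 6 (h t f))

 signed₄ : ∀ n → τ n ≡ 0 → Signed (+ 4) n
 signed₄ 0 ()
 signed₄ 1 _ = 0ℤ , inj₁ refl
 signed₄ 2 ()
 signed₄ 3 _ = ℤ.- 1ℤ , inj₂ refl
 signed₄ (suc (suc (suc (suc n)))) t = signed-step 4 (signed₄ n t)

 signed-abs : ∀ {s n} (c : Signed s n) → ℤ.∣ s · proj₁ c ∔ 1ℤ ∣ ≡ n
 signed-abs (κ , inj₁ e) = cong ℤ.∣_∣ e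
 signed-abs {n = n} (κ , inj₂ e) = trans (cong ℤ.∣_∣ e) (ℤₚ.∣-i∣≡∣i∣ (+ n))

 signed-product : ∀ {s n m} (c : Signed s n) (c′ : Signed s m) → n ≢ 1 → m ≢ 1 → n ≢ m →
   proj₁ c · proj₁ c′ · (proj₁ c ℤ.- proj₁ c′) ≢ 0ℤ
 signed-product {s} {n} {m} c c′ n≢1 m≢1 n≢m = ℤ-*-≢0 {proj₁ c · proj₁ c′} {proj₁ c ℤ.- proj₁ c′} (ℤ-*-≢0 (nz c n≢1) (nz c′ m≢1)) λ e → n≢m (trans (sym (signed-abs {s} c))
     (trans (cong (λ κ → ℤ.∣ s · κ ∔ 1ℤ ∣) (ℤₚ.i-j≡0⇒i≡j (proj₁ c) (proj₁ c′) e)) (signed-abs {s} c′)))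
   where
   nz : ∀ {n} (c : Signed s n) → n ≢ 1 → proj₁ c ≢ 0ℤ
   nz c n≢1 e = n≢1 (trans (sym (signed-abs {s} c)) (cong (λ t → ℤ.∣ t ∔ 1ℤ ∣) (trans (cong (s ·_) e) (ℤₚ.*-zeroʳ s))))

 Odd-sq : ∀ {i} → Odd i → Odd (i ²ℤ)
 Odd-sq {i} o = Odd-* {i} {i} o o

 Odd-cube : ∀ {i} → Odd i → Odd (i ³ℤ)
 Odd-cube {i} o = Odd-* {i ²ℤ} {i} (Odd-sq {i} o) o

 Odd-F : ∀ n {f} → τ n ≡ 0 → δ n ≡ f → Odd (v n) → Odd (b ^ f) → Odd (F n)
 Odd-F n {f} t e ov ob = subst Odd (sym (F-form n t e)) (Odd-* {twelfthℤ (v n) · 1ℤ} {(b ^ f) ²ℤ ²ℤ} (Odd-* {twelfthℤ (v n)} {1ℤ}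
   (Odd-sq {v n ³ℤ ²ℤ} (Odd-sq {v n ³ℤ} (Odd-cube {v n} ov))) (∤-1 prime[2])) (Odd-sq {(b ^ f) ²ℤ} (Odd-sq {b ^ f} ob)))

 F-coprime : ∀ n → τ n ≡ 0 → δ n ≡ 0 → F n ≡ twelfthℤ (v n)
 F-coprime n t f = trans (F-form n t f) (lem (twelfthℤ (v n)))
   where
   lem : ∀ z → z · 1ℤ · 1ℤ ≡ z
   lem = ℤ-solve 1 (λ z → z :* Κ 1ℤ :* Κ 1ℤ , z) refl

 Φ-scale : ∀ p s k D {q} → ι p * twelfth (Φ s) ≡ twelfth q → q ≡ ι (G ^ k · D) → 2 ℕ.* (3 ℕ.* k) ≡ s ℕ.* s →
           ι p * twelfth (Φ s) ≡ g s * g s * twelfth (ι D)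
 Φ-scale p s k D e q≡ k≡ = trans e (trans (cong twelfth (trans q≡ (ι-* (G ^ k) D))) (trans (twelfth-* (ι (G ^ k)) (ι D))
   (cong (_* twelfth (ι D)) (trans (sym (ι-twelfth (G ^ k))) (trans (cong ι (trans (cong (λ t → sq (sq t)) (cube^ k)) (cong sq (trans (sq^ (3 ℕ.* k)) (cong (G ^_) k≡)))))
     (ι-* (G ^ (s ℕ.* s)) (G ^ (s ℕ.* s))))))))

 twelfthℤ-³ : ∀ i → twelfthℤ (i ³ℤ) ≡ twelfthℤ i ³ℤ
 twelfthℤ-³ i = trans (twelfthℤ-* (i ²ℤ) i) (cong (_· twelfthℤ i) (twelfthℤ-* i i))

 three : ∀ {m z} → 2^ m ∣ z → 2^ (m ℕ.+ m ℕ.+ m) ∣ z ³ℤ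
 three {m} {z} h = 2^-∣-* {m ℕ.+ m} {m} {z ²ℤ} {z} (2^-∣-* {m} {m} {z} {z} h h) h

 module Six (C : Case₆ T b c h) where
   open Case₆ C

   b-even : + 2 ∣ b
   b-even = ℤD.∣-trans (2^-mono 1≤ω) b∣

   v₅-odd : Odd (v 5)
   v₅-odd = subst Odd (sym v₅≡) (odd--even {T · c} {b} (Odd-* {T} {c} T-odd c-odd) b-even)

   v₆-even : + 2 ∣ v 6
   v₆-even = subst (+ 2 ∣_) (sym v₆≡) (odd-odd {v 5} {c ²ℤ} v₅-odd (Odd-sq {c} c-odd))

   v₇-odd : Odd (v 7)
   v₇-odd = subst Odd (sym v₇≡) (even--odd {b · v 5} {T · c ³ℤ} (ℤD.∣m⇒∣m*n (v 5) b-even) (Odd-* {T} {c ³ℤ} T-odd (Odd-cube {c} c-odd)))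

   v-odd-at : ∀ n → τ n ≡ 0 → δ n ≡ 0 → Odd (v n)
   v-odd-at zero ()
   v-odd-at (suc n) _ f = b∣⇒∤v prime[2] b-even T-odd n f

   D₆-odd : Odd D₆
   D₆-odd = even--odd {v 6 ²ℤ · h} {v 5 · v 7} (ℤD.∣m⇒∣m*n h (ℤD.∣m⇒∣m*n (v 6) v₆-even)) (Odd-* {v 5} {v 7} v₅-odd v₇-odd)

   v₆-exact : Σ ℕ λ w′ → Exact (suc w′) (v 6)
   v₆-exact = exact-pos (v 6) (v≢0 5) v₆-even

   -- `μ` bounds the valuation of v₆³ b from below, and (v₆³ b)¹² divides F 6 ³. The bound for U
   -- itself will be 2 w₆ + u.
   w′ w₆ μ : ℕ
   w′ = proj₁ v₆-exact
   w₆ = suc w′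
   μ = w₆ ℕ.+ w₆ ℕ.+ w₆ ℕ.+ ω

   2^w : 2^ w₆ ∣ v 6
   2^w = Exact⇒∣ {w₆} {v 6} (proj₂ v₆-exact)

   Φ-s : ι 1ℤ * twelfth (Φ 6) ≡ g 6 * g 6 * twelfth (ι D₆)
   Φ-s = Φ-scale 1ℤ 6 6 D₆ (ℚₚ.*-identityˡ (twelfth (Φ 6))) Φ₆≡ refl

   open Step 5 1ℤ D₆ (λ ()) D₆-odd Φ-s using (X⁻¹; X⁻¹-*)
   open Quotients 5 X⁻¹ X⁻¹-* 1ℤ (G ^ 6) D₆ (ℤ-^-≢0 6 G≢0) (trans (ℚₚ.*-identityˡ _) Φ₆≡)

   -- After removal of the powers of G, x/x(6P) is v₆² h divided by the odd `D₆`.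
   U₁-small : Div (w₆ ℕ.+ (u ℕ.+ w₆)) (ι x * X⁻¹)
   U₁-small = Div-cancel {r = D₆} D₆-odd (subst (Div (w₆ ℕ.+ (u ℕ.+ w₆))) (sym (U₁-D z eq))
     (Div-ι (2^-∣-* {w₆} {u ℕ.+ w₆} {v 6} {h · v 6} 2^w (2^-∣-* {u} {w₆} {h} {v 6} h∣ 2^w))))
     where
     z = v 6 · (h · v 6)
     lem₁ : ∀ x v a d G → let W₆ = v · (a · 1ℤ · (d · 1ℤ) · (G · (G · 1ℤ))) in
       x · (1ℤ · (W₆ · W₆)) ≡ x · (a · a) · (d · d) · (v · v · (G · G · (G · G)))
     lem₁ = ℤ-solve 5 (λ x v a d G →
                          let W₆ = v :* (a :* Κ 1ℤ :* (d :* Κ 1ℤ) :* (G :* (G :* Κ 1ℤ))) in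
       x :* (Κ 1ℤ :* (W₆ :* W₆)) , x :* (a :* a) :* (d :* d) :* (v :* v :* (G :* G :* (G :* G)))) refl
     lem₂ : ∀ h v G → h · (G · G) · (v · v · (G · G · (G · G))) ≡ v · (h · v) · (G · (G · (G · (G · (G · (G · 1ℤ))))))
     lem₂ = ℤ-solve 3 (λ h v G → h :* (G :* G) :* (v :* v :* (G :* G :* (G :* G))) , v :* (h :* v) :* (G :* (G :* (G :* (G :* (G :* (G :* Κ 1ℤ))))))) refl
     eq : x · (1ℤ · W-int 6 ²ℤ) ≡ z · G ^ 6
     eq = trans (lem₁ x (v 6) a d G) (trans (cong (_· (v 6 · v 6 · (G · G · (G · G)))) xa²d²) (lem₂ h (v 6) G))

   3D³-odd : Odd (+ 3 · D₆ ³ℤ)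
   3D³-odd = Odd-* {+ 3} {D₆ ³ℤ} 3-odd (Odd-cube {D₆} D₆-odd)

   β-small : Div (suc μ) (2ℚ * (2ℚ * (ι B * (X⁻¹ * X⁻¹ * X⁻¹))))
   β-small = Div-cancel {r = + 3 · D₆ ³ℤ} 3D³-odd (subst (Div (suc μ)) (sym (β-D z eq))
     (Div-ι (ℤD.∣m⇒∣m*n (k · v 6 ³ℤ) (2^-∣-* {1} {μ} {b} {v 6 ³ℤ · b} b-even (2^-∣-* {w₆ ℕ.+ w₆ ℕ.+ w₆} {ω} {v 6 ³ℤ} {b} (three {w₆} {v 6} 2^w) b∣)))))
     where
     z = b · (v 6 ³ℤ · b) · (k · v 6 ³ℤ)
     G² = G · G
     lem₀ : ∀ v a d G → v · (a · 1ℤ · (d · 1ℤ) · (G · (G · 1ℤ))) ≡ v · (a · d · (G · G))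
     lem₀ = ℤ-solve 4 (λ v a d G → v :* (a :* Κ 1ℤ :* (d :* Κ 1ℤ) :* (G :* (G :* Κ 1ℤ))) , v :* (a :* d :* (G :* G))) refl
     G⁶ : ∀ G → G · (G · (G · (G · (G · (G · 1ℤ))))) ≡ G · G · (G · G) · (G · G)
     G⁶ = ℤ-solve 1 (λ G → G :* (G :* (G :* (G :* (G :* (G :* Κ 1ℤ))))) , G :* G :* (G :* G) :* (G :* G)) refl
     lem₁ : ∀ B v a d g → let w = 1ℤ · (v · (a · d · g) · (v · (a · d · g))) in
       + 12 · B · (w · w · w) ≡
       + 12 · B · (a · a · a · (a · a · a)) · ((d · d · d) · (d · d · d)) · (v · v · v · (v · v · v) · (g · g · g · (g · g · g)))
     lem₁ = ℤ-solve 5 (λ B v a d g →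
                          let w = Κ 1ℤ :* (v :* (a :* d :* g) :* (v :* (a :* d :* g))) in
       Κ (+ 12) :* B :* (w :* w :* w) ,
       Κ (+ 12) :* B :* (a :* a :* a :* (a :* a :* a)) :* ((d :* d :* d) :* (d :* d :* d)) :* (v :* v :* v :* (v :* v :* v) :* (g :* g :* g :* (g :* g :* g)))) refl
     lem₂ : ∀ k b v g → let g³ = g · g · g in
       k · g · (b · g · (b · g)) · (v · v · v · (v · v · v) · (g³ · g³)) ≡
       b · (v · v · v · b) · (k · (v · v · v)) · (g³ · g³ · g³)
     lem₂ = ℤ-solve 4 (λ k b v g →
                        let g³ = g :* g :* g in
       k :* g :* (b :* g :* (b :* g)) :* (v :* v :* v :* (v :* v :* v) :* (g³ :* g³)) ,
       b :* (v :* v :* v :* b) :* (k :* (v :* v :* v)) :* (g³ :* g³ :* g³)) refl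
     eq : + 12 · B · (1ℤ · W-int 6 ²ℤ) ³ℤ ≡ z · (G ^ 6) ³ℤ
     eq = trans (cong (λ p → + 12 · B · (1ℤ · p ²ℤ) ³ℤ) (lem₀ (v 6) a d G)) (trans (lem₁ B (v 6) a d G²)
       (trans (cong₂ (λ p q → p · (q · q) · (v 6 ³ℤ · v 6 ³ℤ · (G² ³ℤ · G² ³ℤ))) k≡ d³)
       (trans (lem₂ k b (v 6) G²) (cong (λ p → z · p ³ℤ) (sym (G⁶ G))))))

   spread : ∀ r → τ r ≡ 1 → 2^ twelve μ ∣ 1ℤ · (F r · F 6 ³ℤ)
   spread r _ = ℤD.∣n⇒∣m*n 1ℤ (ℤD.∣n⇒∣m*n (F r) (subst (2^ twelve μ ∣_) (sym F₆³)
     (ℤD.∣m⇒∣m*n ((T ^ 1) ³ℤ ³ℤ) (∣-twelfth {μ} {v 6 ³ℤ · b} (2^-∣-* {w₆ ℕ.+ w₆ ℕ.+ w₆} {ω} {v 6 ³ℤ} {b} (three {w₆} {v 6} 2^w) b∣)))))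
     where
     lem₁ : ∀ b → let b⁴ = b · 1ℤ · (b · 1ℤ) · (b · 1ℤ · (b · 1ℤ)) ; b³ = b · b · b in b⁴ · b⁴ · b⁴ ≡ b³ · b³ · (b³ · b³)
     lem₁ = ℤ-solve 1 (λ b → let b⁴ = b :* Κ 1ℤ :* (b :* Κ 1ℤ) :* (b :* Κ 1ℤ :* (b :* Κ 1ℤ)) ; b³ = b :* b :* b in b⁴ :* b⁴ :* b⁴ , b³ :* b³ :* (b³ :* b³)) refl
     lem₂ : ∀ t A q → t · A · q · (t · A · q) · (t · A · q) ≡ t · t · t · (q · q · q) · (A · A · A)
     lem₂ = ℤ-solve 3 (λ t A q → t :* A :* q :* (t :* A :* q) :* (t :* A :* q) , t :* t :* t :* (q :* q :* q) :* (A :* A :* A)) refl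
     F₆³ : F 6 ³ℤ ≡ twelfthℤ (v 6 ³ℤ · b) · (T ^ 1) ³ℤ ³ℤ
     F₆³ = trans (cong _³ℤ (F≡ 6)) (trans (lem₂ (twelfthℤ (v 6)) ((T ^ 1) ³ℤ) ((b ^ 1) ²ℤ ²ℤ)) (cong (_· (T ^ 1) ³ℤ ³ℤ)
       (trans (cong₂ _·_ (sym (twelfthℤ-³ (v 6))) (lem₁ b)) (sym (twelfthℤ-* (v 6 ³ℤ) b)))))

   F-odd : ∀ i → Odd (F ℤ.∣ + 6 · i ∔ 1ℤ ∣)
   F-odd i = Odd-F n {0} t f (v-odd-at n t f) (∤-1 prime[2])
     where
     n = ℤ.∣ + 6 · i ∔ 1ℤ ∣
     indivisible : ∀ {q} → Prime q → + q ∣ + 6 → ¬ (q ℕD.∣ n)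
     indivisible pq h h′ = ∤-1 pq (ℤD.∣m+n∣m⇒∣n {m = + 6 · i} (∣ᵤ⇒∣ h′) (ℤD.∣m⇒∣m*n i h))
     t = τ-of-odd n (indivisible prime[2] (divides (+ 3) refl))
     f = δ-of-∤3 n (indivisible prime[3] (divides (+ 2) refl))

   -- F 5 ² - F 7 is V⁶ - V′⁶ with V = v₅⁴ and V′ = v₇². Here V - V′ has valuation suc η + w₆ from
   -- its two factors; cubing preserves it and squaring adds 1.
   main₆ : Exact (3 ℕ.+ (η ℕ.+ w′)) (F 5 · F 5 ℤ.- F 7)
   main₆ = subst (Exact (3 ℕ.+ (η ℕ.+ w′))) (sym eq) (Exact-sq {η ℕ.+ w′} {V ³ℤ} {V′ ³ℤ} (Odd-cube {V′} (Odd-sq {v 7} v₇-odd))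
       (subst (λ n → Exact (suc n) (V ³ℤ ℤ.- V′ ³ℤ)) (ℕₚ.+-suc η w′) (Exact-cube {η ℕ.+ w₆} {V} {V′} (Odd-sq {v 7} v₇-odd)
         (subst (Exact (suc (η ℕ.+ w₆))) (lem₁ (v 5) (v 7)) (Exact-* {suc η} {w₆} {v 5 ²ℤ ℤ.- v 7} {v 5 ²ℤ ∔ v 7} (subst (Exact (suc η)) (sym v₅²-v₇) main)
           (subst (Exact w₆) (sym v₅²+v₇) (Exact-mul-odd {w₆} {v 6} {c · T} (proj₂ v₆-exact) (Odd-* {c} {T} c-odd T-odd))))))))
     where
     V = v 5 ²ℤ ²ℤ
     V′ = v 7 ²ℤ
     lem₁ : ∀ p q → (p · p ℤ.- q) · (p · p ∔ q) ≡ p · p · (p · p) ℤ.- q · q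
     lem₁ = ℤ-solve 2 (λ p q → (p :* p :- q) :* (p :* p :+ q) , p :* p :* (p :* p) :- q :* q) refl
     lem₂ : ∀ p q → let p³ = p · p · p ; q³ = q · q · q ; P = p³ · p³ · (p³ · p³) ; Q = q³ · q³ · (q³ · q³)
                        y = p · p · (p · p) ; z = q · q ; y³ = y · y · y ; z³ = z · z · z in
       P · P ℤ.- Q ≡ y³ · y³ ℤ.- z³ · z³
     lem₂ = ℤ-solve 2 (λ p q →
                    let p³ = p :* p :* p ; q³ = q :* q :* q ; P = p³ :* p³ :* (p³ :* p³) ; Q = q³ :* q³ :* (q³ :* q³)
                        y = p :* p :* (p :* p) ; z = q :* q ; y³ = y :* y :* y ; z³ = z :* z :* z in
       P :* P :- Q , y³ :* y³ :- z³ :* z³) refl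
     eq : F 5 · F 5 ℤ.- F 7 ≡ V ³ℤ · V ³ℤ ℤ.- V′ ³ℤ · V′ ³ℤ
     eq = trans (cong₂ (λ p q → p · p ℤ.- q) (F-coprime 5 refl refl) (F-coprime 7 refl refl)) (lem₂ (v 5) (v 7))

   u<μ : w₆ ℕ.+ (u ℕ.+ w₆) ℕ.< μ
   u<μ = subst (ℕ._< μ) (lem w₆ u) (ℕₚ.+-mono-<-≤ (ℕₚ.m<m+n (w₆ ℕ.+ w₆) (ℕ.s≤s ℕ.z≤n)) u≤ω)
     where
     lem : ∀ w u → w ℕ.+ w ℕ.+ u ≡ w ℕ.+ (u ℕ.+ w)
     lem = ℕ-solve

   μ≤2u : μ ℕ.≤ w₆ ℕ.+ (u ℕ.+ w₆) ℕ.+ (w₆ ℕ.+ (u ℕ.+ w₆))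
   μ≤2u = subst (μ ℕ.≤_) (lem w₆ u) (ℕₚ.+-mono-≤ (ℕₚ.m≤m+n (w₆ ℕ.+ w₆ ℕ.+ w₆) w₆) ω≤2u)
     where
     lem : ∀ w u → w ℕ.+ w ℕ.+ w ℕ.+ w ℕ.+ (u ℕ.+ u) ≡ w ℕ.+ (u ℕ.+ w) ℕ.+ (w ℕ.+ (u ℕ.+ w))
     lem = ℕ-solve

   small : 3 ℕ.+ (1 ℕ.+ (η ℕ.+ w′)) ℕ.≤ μ
   small = subst (ℕ._≤ μ) (lem₁ η w′) (ℕₚ.+-mono-≤ (subst (3 ℕ.+ w′ ℕ.≤_) (lem₂ w′) (ℕₚ.m≤m+n (3 ℕ.+ w′) (w′ ℕ.+ w′))) η≤)
     where
     lem₁ : ∀ η w → 3 ℕ.+ w ℕ.+ suc η ≡ 3 ℕ.+ (1 ℕ.+ (η ℕ.+ w))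
     lem₁ = ℕ-solve
     lem₂ : ∀ w → 3 ℕ.+ w ℕ.+ (w ℕ.+ w) ≡ suc w ℕ.+ suc w ℕ.+ suc w
     lem₂ = ℕ-solve

   one-unit : ∀ {n m} → τ n ≡ 0 → δ n ≡ 0 → τ m ≡ 0 → δ m ≡ 0 → ℤ.∣ v n ∣ ≡ 1 → ℤ.∣ v m ∣ ≡ 1 → n ≢ 1 → m ≢ 1 → n ≢ m → ⊥
   one-unit {n} {m} tn fn tm fm vn vm n≢1 m≢1 n≢m =
     contradiction₃ (1 ℕ.+ (η ℕ.+ w′)) main₆ small
     where
     cn = signed₆ n tn fn
     cm = signed₆ m tm fm
     open Run 5 1ℤ D₆ (λ ()) D₆-odd Φ-s (divides (+ 3) refl) μ (w′ ℕ.+ (u ℕ.+ w₆)) u<μ μ≤2u spread β-small U₁-small F-odd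
       (proj₁ cn) (proj₁ cm) (signed-product {+ 6} cn cm n≢1 m≢1 n≢m)
       (trans (cong F (signed-abs {+ 6} cn)) (F-unit n tn fn vn)) (trans (cong F (signed-abs {+ 6} cm)) (F-unit m tm fm vm))

 module Four (C : Case₄ T b c h k) where
   open Case₄ C

   -- `N` is the valuation of `T`, and `μ` that of c³ T: F 4 ³ contains c³⁶ and T⁹, and the
   -- remaining T³ comes from F at an even index.
   N μ : ℕ
   N = suc ν ℕ.+ suc ν
   μ = 3 ℕ.+ N

   T∣′ : 2^ N ∣ T
   T∣′ = Exact⇒∣ {N} {T} T∣

   T-even : + 2 ∣ T
   T-even = Exact-even {ν ℕ.+ suc ν} {T} T∣

   c∣ : 2^ 1 ∣ c
   c∣ = Exact⇒∣ {1} {c} c₁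

   v₅-odd : Odd (v 5)
   v₅-odd = subst Odd (sym v₅≡) (even--odd {T · c} {b} (ℤD.∣m⇒∣m*n c T-even) b-odd)

   D₄-odd : Odd D₄
   D₄-odd = even--odd {h · c ²ℤ} {b · v 5} (ℤD.∣n⇒∣m*n h (ℤD.∣m⇒∣m*n c c∣)) (Odd-* {b} {v 5} b-odd v₅-odd)

   b²≢0 : b ²ℤ ≢ 0ℤ
   b²≢0 = ℤ-*-≢0 b≢0 b≢0

   b⁴≢0 : b ²ℤ ²ℤ ≢ 0ℤ
   b⁴≢0 = ℤ-*-≢0 b²≢0 b²≢0

   b⁸ : ℤ
   b⁸ = b ²ℤ ²ℤ ²ℤ

   b⁸≢0 : b⁸ ≢ 0ℤ
   b⁸≢0 = ℤ-*-≢0 b⁴≢0 b⁴≢0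

   -- The twelfth power of b Φ(4) = d G² D₄ has b¹² on the left, while d¹² = b⁴ G⁸ returns b⁴ on the
   -- right; cancelling it leaves b⁸.
   Φ-s : ι b⁸ * twelfth (Φ 4) ≡ g 4 * g 4 * twelfth (ι D₄)
   Φ-s = *-cancelʳ (ι (b ²ℤ ²ℤ)) (ι-≢0 b⁴≢0) (begin
     ι b⁸ * twelfth (Φ 4) * ι (b ²ℤ ²ℤ) ≡⟨ lem₁ (ι b⁸) (twelfth (Φ 4)) (ι (b ²ℤ ²ℤ)) ⟩
     ι b⁸ * ι (b ²ℤ ²ℤ) * twelfth (Φ 4) ≡⟨ cong (_* twelfth (Φ 4)) (trans (sym (ι-* b⁸ (b ²ℤ ²ℤ))) (trans (cong ι (lem₂ b)) (ι-twelfth b))) ⟩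
     twelfth (ι b) * twelfth (Φ 4) ≡⟨ sym (twelfth-* (ι b) (Φ 4)) ⟩
     twelfth (ι b * Φ 4) ≡⟨ cong twelfth (trans Φ₄≡ (ι-* (d · G ^ 2) D₄)) ⟩
     twelfth (ι (d · G ^ 2) * ι D₄) ≡⟨ twelfth-* (ι (d · G ^ 2)) (ι D₄) ⟩
     twelfth (ι (d · G ^ 2)) * twelfth (ι D₄) ≡⟨ cong (_* twelfth (ι D₄)) (trans (sym (ι-twelfth (d · G ^ 2))) (trans (cong ι scale) (trans (ι-* (G ^ 16 · G ^ 16) (b ²ℤ ²ℤ)) (cong (_* ι (b ²ℤ ²ℤ)) (ι-* (G ^ 16) (G ^ 16)))))) ⟩
     g 4 * g 4 * ι (b ²ℤ ²ℤ) * twelfth (ι D₄) ≡⟨ lem₁ (g 4 * g 4) (ι (b ²ℤ ²ℤ)) (twelfth (ι D₄)) ⟩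
     g 4 * g 4 * twelfth (ι D₄) * ι (b ²ℤ ²ℤ) ∎)
     where
     open ≡-Reasoning
     lem₁ : ∀ p q r → p * q * r ≡ p * r * q
     lem₁ = ℚ-solve 3 (λ p q r → p :* q :* r , p :* r :* q) refl
     lem₂ : ∀ b → let b² = b · b ; b⁴ = b² · b² ; b³ = b · b · b in b⁴ · b⁴ · b⁴ ≡ b³ · b³ · (b³ · b³)
     lem₂ = ℤ-solve 1 (λ b → let b² = b :* b ; b⁴ = b² :* b² ; b³ = b :* b :* b in b⁴ :* b⁴ :* b⁴ , b³ :* b³ :* (b³ :* b³)) refl
     lem₃ : ∀ b G → let z = b · (G · G) ; G⁴ = G · (G · (G · (G · 1ℤ))) in z · z · (z · z) ≡ G⁴ · G⁴ · (b · b · (b · b))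
     lem₃ = ℤ-solve 2 (λ b G → let z = b :* (G :* G) ; G⁴ = G :* (G :* (G :* (G :* Κ 1ℤ))) in z :* z :* (z :* z) , G⁴ :* G⁴ :* (b :* b :* (b :* b))) refl
     lem₄ : ∀ p b q → p · p · b · (q · q) ≡ (p · q) · (p · q) · b
     lem₄ = ℤ-solve 3 (λ p b q → p :* p :* b :* (q :* q) , (p :* q) :* (p :* q) :* b) refl
     power : ∀ k → twelfthℤ (G ^ k) ≡ (G ^ (2 ℕ.* (3 ℕ.* k))) ²ℤ
     power k = trans (cong (λ t → sq (sq t)) (cube^ k)) (cong sq (sq^ (3 ℕ.* k)))
     scale : twelfthℤ (d · G ^ 2) ≡ G ^ 16 · G ^ 16 · b ²ℤ ²ℤ
     scale = trans (twelfthℤ-* d (G ^ 2)) (trans (cong₂ _·_ (trans (cong (λ t → t ²ℤ ²ℤ) d³) (lem₃ b G)) (power 2))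
       (trans (lem₄ (G ^ 4) (b ²ℤ ²ℤ) (G ^ 12)) (cong (λ t → t · t · b ²ℤ ²ℤ) (sym (ℤₚ.^-distribˡ-+-* G 4 12)))))

   open Step 3 b⁸ D₄ b⁸≢0 D₄-odd Φ-s using (X⁻¹; X⁻¹-*)
   open Quotients 3 X⁻¹ X⁻¹-* b (d · G ^ 2) D₄ (ℤ-*-≢0 d≢0 (ℤ-^-≢0 2 G≢0)) Φ₄≡

   W-int₄ : W-int 4 ≡ c · (a · G)
   W-int₄ = trans (cong (_· σ 4) v₄) (lem c a G)
     where
     lem : ∀ c a G → c · (a · 1ℤ · 1ℤ · (G · 1ℤ)) ≡ c · (a · G)
     lem = ℤ-solve 3 (λ c a G → c :* (a :* Κ 1ℤ :* Κ 1ℤ :* (G :* Κ 1ℤ)) , c :* (a :* G)) refl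

   U₁-small : Div (2 ℕ.+ suc ν) (ι x * X⁻¹)
   U₁-small = Div-cancel {r = D₄} D₄-odd (subst (Div (2 ℕ.+ suc ν)) (sym (U₁-D z eq))
     (Div-ι (2^-∣-* {2} {suc ν} {c ²ℤ} {h} (2^-∣-* {1} {1} {c} {c} c∣ c∣) h∣)))
     where
     z = c ²ℤ · h
     lem₁ : ∀ x b c a G → x · (b · (c · (a · G) · (c · (a · G)))) ≡ x · (a · a) · b · (c · c · (G · G))
     lem₁ = ℤ-solve 5 (λ x b c a G → x :* (b :* (c :* (a :* G) :* (c :* (a :* G)))) , x :* (a :* a) :* b :* (c :* c :* (G :* G))) refl
     lem₂ : ∀ h d c G → h · d · (c · c · (G · G)) ≡ c · c · h · (d · (G · (G · 1ℤ)))
     lem₂ = ℤ-solve 4 (λ h d c G → h :* d :* (c :* c :* (G :* G)) , c :* c :* h :* (d :* (G :* (G :* Κ 1ℤ)))) refl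
     eq : x · (b · W-int 4 ²ℤ) ≡ z · (d · G ^ 2)
     eq = trans (cong (λ t → x · (b · t ²ℤ)) W-int₄) (trans (lem₁ x b c a G) (trans (cong (_· (c ²ℤ · G ²ℤ)) xa²b) (lem₂ h d c G)))

   3D³-odd : Odd (+ 3 · D₄ ³ℤ)
   3D³-odd = Odd-* {+ 3} {D₄ ³ℤ} 3-odd (Odd-cube {D₄} D₄-odd)

   β-small : Div (suc μ) (2ℚ * (2ℚ * (ι B * (X⁻¹ * X⁻¹ * X⁻¹))))
   β-small = Div-cancel {r = + 3 · D₄ ³ℤ} 3D³-odd (subst (Div (suc μ)) (sym (β-D z eq))
     (Div-ι (ℤD.∣m⇒∣m*n (c ²ℤ · b ²ℤ) (2^-∣-* {3} {1 ℕ.+ N} {c ³ℤ} {c · k} (three {1} {c} c∣) (2^-∣-* {1} {N} {c} {k} c∣ k∣)))))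
     where
     z = c ³ℤ · (c · k) · (c ²ℤ · b ²ℤ)
     lem₁ : ∀ B b c a G → let w = b · (c · (a · G) · (c · (a · G))) in
       + 12 · B · (w · w · w) ≡ + 12 · B · (a · a · a · (a · a · a)) · (b · b · b · (c · c · c · (c · c · c)) · (G · G · G · (G · G · G)))
     lem₁ = ℤ-solve 5 (λ B b c a G →
                          let w = b :* (c :* (a :* G) :* (c :* (a :* G))) in
       Κ (+ 12) :* B :* (w :* w :* w) , Κ (+ 12) :* B :* (a :* a :* a :* (a :* a :* a)) :* (b :* b :* b :* (c :* c :* c :* (c :* c :* c)) :* (G :* G :* G :* (G :* G :* G)))) refl
     lem₂ : ∀ k G b c → k · (G · G) · (b · b · b · (c · c · c · (c · c · c)) · (G · G · G · (G · G · G))) ≡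
       c · c · c · (c · k) · (c · c · (b · b)) · (b · (G · G) · (G · G · G · (G · G · G)))
     lem₂ = ℤ-solve 4 (λ k G b c → k :* (G :* G) :* (b :* b :* b :* (c :* c :* c :* (c :* c :* c)) :* (G :* G :* G :* (G :* G :* G))) , c :* c :* c :* (c :* k) :* (c :* c :* (b :* b)) :* (b :* (G :* G) :* (G :* G :* G :* (G :* G :* G)))) refl
     lem₃ : ∀ d G → let w = d · (G · (G · 1ℤ)) in d · d · d · (G · G · G · (G · G · G)) ≡ w · w · w
     lem₃ = ℤ-solve 2 (λ d G → let w = d :* (G :* (G :* Κ 1ℤ)) in d :* d :* d :* (G :* G :* G :* (G :* G :* G)) , w :* w :* w) refl
     eq : + 12 · B · (b · W-int 4 ²ℤ) ³ℤ ≡ z · (d · G ^ 2) ³ℤ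
     eq = trans (cong (λ t → + 12 · B · (b · t ²ℤ) ³ℤ) W-int₄) (trans (lem₁ B b c a G)
       (trans (cong (_· (b ³ℤ · (c ³ℤ · c ³ℤ) · (G ³ℤ · G ³ℤ))) k≡) (trans (lem₂ k G b c)
       (cong (z ·_) (trans (cong (_· (G ³ℤ · G ³ℤ)) (sym d³)) (lem₃ d G))))))

   spread : ∀ r → τ r ≡ 1 → 2^ twelve μ ∣ b⁸ · (F r · F 4 ³ℤ)
   spread r t = ℤD.∣n⇒∣m*n b⁸ (subst (2^ twelve μ ∣_) (sym eq)
     (ℤD.∣m⇒∣m*n (twelfthℤ (v r) · (b ^ δ r) ²ℤ ²ℤ) (∣-twelfth {μ} {c ³ℤ · T} (2^-∣-* {3} {N} {c ³ℤ} {T} (three {1} {c} c∣) T∣′))))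
     where
     lem₁ : ∀ V T R C → V · T · R · (C · T · 1ℤ · (C · T · 1ℤ) · (C · T · 1ℤ)) ≡ C · C · C · (T · T · (T · T)) · (V · R)
     lem₁ = ℤ-solve 4 (λ V T R C → V :* T :* R :* (C :* T :* Κ 1ℤ :* (C :* T :* Κ 1ℤ) :* (C :* T :* Κ 1ℤ)) , C :* C :* C :* (T :* T :* (T :* T)) :* (V :* R)) refl
     lem₂ : ∀ T → let t = T · 1ℤ ; t³ = t · t · t ; T³ = T · T · T in t³ · t³ · (t³ · t³) ≡ T³ · T³ · (T³ · T³)
     lem₂ = ℤ-solve 1 (λ T → let t = T :* Κ 1ℤ ; t³ = t :* t :* t ; T³ = T :* T :* T in t³ :* t³ :* (t³ :* t³) , T³ :* T³ :* (T³ :* T³)) refl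
     eq : F r · F 4 ³ℤ ≡ twelfthℤ (c ³ℤ · T) · (twelfthℤ (v r) · (b ^ δ r) ²ℤ ²ℤ)
     eq = trans (cong₂ (λ p q → p · q ³ℤ) (F-form r t refl) (trans (F≡ 4) (cong (λ p → twelfthℤ p · (T ^ 1) ³ℤ · 1ℤ) v₄)))
       (trans (lem₁ (twelfthℤ (v r)) ((T ^ 1) ³ℤ) ((b ^ δ r) ²ℤ ²ℤ) (twelfthℤ c))
       (cong (_· (twelfthℤ (v r) · (b ^ δ r) ²ℤ ²ℤ)) (trans (cong₂ _·_ (sym (twelfthℤ-³ c)) (lem₂ T)) (sym (twelfthℤ-* (c ³ℤ) T)))))

   F-odd : ∀ i → Odd (F ℤ.∣ + 4 · i ∔ 1ℤ ∣)
   F-odd i = Odd-F n t refl (v-odd-at n t) (∤-^ prime[2] {b} (δ n) b-odd)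
     where
     n = ℤ.∣ + 4 · i ∔ 1ℤ ∣
     t = τ-of-odd n (λ h′ → ∤-1 prime[2] (ℤD.∣m+n∣m⇒∣n {m = + 4 · i} (∣ᵤ⇒∣ h′) (ℤD.∣m⇒∣m*n i (divides (+ 2) refl))))
     v-odd-at : ∀ n → τ n ≡ 0 → Odd (v n)
     v-odd-at zero ()
     v-odd-at (suc n) t = T∣⇒∤v-odd prime[2] T-even n t

   -- b² - v₅² has valuation 2 + N: one digit from 2b - cT, one from c and N from T. Cubing
   -- preserves it and squaring adds 1, which meets the bound μ = 3 + N with equality.
   main₄ : Exact (3 ℕ.+ N) (F 3 · F 3 · F 3 ℤ.- F 5)
   main₄ = subst (Exact (3 ℕ.+ N)) (sym eq) (Exact-sq {N} {V ³ℤ} {V′ ³ℤ} (Odd-cube {V′} (Odd-sq {v 5} v₅-odd))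
       (Exact-cube {1 ℕ.+ N} {V} {V′} (Odd-sq {v 5} v₅-odd) (subst (Exact (2 ℕ.+ N)) (sym b²-v₅²)
         (Exact-* {1} {1 ℕ.+ N} {+ 2 · b ℤ.- c · T} {c · T} (subst (Exact 1) (sym half) (Exact-mul-odd {1} {+ 2} {b ℤ.- c · t} Exact-2
           (odd--even {b} {c · t} b-odd (ℤD.∣m⇒∣m*n t c∣)))) (Exact-* {1} {N} {c} {T} c₁ T∣)))))
     where
     V = b ²ℤ
     V′ = v 5 ²ℤ
     t = ℤD._∣_.quotient T-even
     half : + 2 · b ℤ.- c · T ≡ + 2 · (b ℤ.- c · t)
     half = trans (cong (λ z → + 2 · b ℤ.- c · z) (ℤD._∣_.equality T-even)) (lem b c t)
       where
       lem : ∀ b c t → + 2 · b ℤ.- c · (t · + 2) ≡ + 2 · (b ℤ.- c · t)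
       lem = ℤ-solve 3 (λ b c t → Κ (+ 2) :* b :- c :* (t :* Κ (+ 2)) , Κ (+ 2) :* (b :- c :* t)) refl
     lem₂ : ∀ b q → let f = 1ℤ · 1ℤ · (b · 1ℤ · (b · 1ℤ) · (b · 1ℤ · (b · 1ℤ)))
                        tw = ((q · q · q) · (q · q · q)) · ((q · q · q) · (q · q · q))
                        y = b · b ; z = q · q ; y³ = y · y · y ; z³ = z · z · z in
       f · f · f ℤ.- tw ≡ y³ · y³ ℤ.- z³ · z³
     lem₂ = ℤ-solve 2 (λ b q →
                    let f = Κ 1ℤ :* Κ 1ℤ :* (b :* Κ 1ℤ :* (b :* Κ 1ℤ) :* (b :* Κ 1ℤ :* (b :* Κ 1ℤ)))
                        tw = ((q :* q :* q) :* (q :* q :* q)) :* ((q :* q :* q) :* (q :* q :* q))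
                        y = b :* b ; z = q :* q ; y³ = y :* y :* y ; z³ = z :* z :* z in
       f :* f :* f :- tw , y³ :* y³ :- z³ :* z³) refl
     eq : F 3 · F 3 · F 3 ℤ.- F 5 ≡ V ³ℤ · V ³ℤ ℤ.- V′ ³ℤ · V′ ³ℤ
     eq = trans (cong₂ (λ p q → p · p · p ℤ.- q) (trans (F≡ 3) (cong (λ p → twelfthℤ p · 1ℤ · (b ^ 1) ²ℤ ²ℤ) v₃)) (F-coprime 5 refl refl)) (lem₂ b (v 5))

   one-unit : ∀ {n m} → τ n ≡ 0 → δ n ≡ 0 → τ m ≡ 0 → δ m ≡ 0 → ℤ.∣ v n ∣ ≡ 1 → ℤ.∣ v m ∣ ≡ 1 → n ≢ 1 → m ≢ 1 → n ≢ m → ⊥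
   one-unit {n} {m} tn fn tm fm vn vm n≢1 m≢1 n≢m = contradiction₂ (suc N) main₄ ℕₚ.≤-refl
     where
     cn = signed₄ n tn
     cm = signed₄ m tm
     u<μ : 2 ℕ.+ suc ν ℕ.< μ
     u<μ = ℕₚ.+-monoʳ-≤ 3 (ℕₚ.m≤m+n (suc ν) (suc ν))
     μ≤2u : μ ℕ.≤ 2 ℕ.+ suc ν ℕ.+ (2 ℕ.+ suc ν)
     μ≤2u = subst (μ ℕ.≤_) (lem ν) (ℕₚ.n≤1+n μ)
       where
       lem : ∀ ν → 4 ℕ.+ (suc ν ℕ.+ suc ν) ≡ 2 ℕ.+ suc ν ℕ.+ (2 ℕ.+ suc ν)
       lem = ℕ-solve
     open Run 3 b⁸ D₄ b⁸≢0 D₄-odd Φ-s (divides (+ 2) refl) μ (1 ℕ.+ suc ν) u<μ μ≤2u spread β-small U₁-small F-odd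
       (proj₁ cn) (proj₁ cm) (signed-product {+ 4} cn cm n≢1 m≢1 n≢m)
       (trans (cong F (signed-abs {+ 4} cn)) (F-unit n tn fn vn)) (trans (cong F (signed-abs {+ 4} cm)) (F-unit m tm fm vm))

 one-unit : ∀ {n m} → τ n ≡ 0 → δ n ≡ 0 → τ m ≡ 0 → δ m ≡ 0 → ℤ.∣ v n ∣ ≡ 1 → ℤ.∣ v m ∣ ≡ 1 → n ≢ 1 → m ≢ 1 → n ≢ m → ⊥
 one-unit {n} {m} with case
 ... | inj₁ C = Six.one-unit C {n} {m}
 ... | inj₂ C = Four.one-unit C {n} {m}

open PrimeDivisors using (abs-^)

-- Descent of integrality to halves and thirds

module IntegralRoots {B : ℤ} {x y : ℚ} (M : Multiples (ι B) x y) where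
 open Indices
 open import Data.Integer using (+_; _^_)
 open import Data.Rational using (_+_; _-_; _*_; -_)

 import Data.Nat.Coprimality as Coprime
 open Denominators using (clear-den)
 open EllipticDivisibility M

 Int : ℚ → Set
 Int q = Σ ℤ λ z → q ≡ ι z

 int : ∀ z → Int (ι z)
 int z = z , refl

 infixl 6 _⊞_ _⊟_
 infixl 7 _⊠_

 _⊞_ : ∀ {p q} → Int p → Int q → Int (p + q)
 (i , refl) ⊞ (j , refl) = i ∔ j , sym (ι-+ i j)

 _⊟_ : ∀ {p q} → Int p → Int q → Int (p - q)
 (i , refl) ⊟ (j , refl) = i ℤ.- j , sym (ι-- i j)

 _⊠_ : ∀ {p q} → Int p → Int q → Int (p * q)
 (i , refl) ⊠ (j , refl) = i · j , sym (ι-* i j)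

 ∣-coprime-power : ∀ {q p} k → Coprime.Coprime q p → q ℕD.∣ p ℕ.^ k → q ≡ 1
 ∣-coprime-power zero    c h = ℕD.∣1⇒≡1 h
 ∣-coprime-power {q} {p} (suc k) c h = ∣-coprime-power k c (Coprime.coprime-divisor {q} {p} {p ℕ.^ k} c h)

 -- The hypothesis is a monic equation of degree k after clearing denominators: the denominator
 -- divides a power of the coprime numerator, so it is 1.
 integral-root : ∀ t k r → Int r → ι (ℚ.↥ t ^ k) ≡ ι (ℚ.↧ t) * r → Int t
 integral-root t@(ℚ.mkℚ n d-1 c) k r (i , refl) e = n , trans (sym (ℚₚ.*-identityʳ t)) (trans (cong (λ q → t * ι (+ q)) (sym q≡1)) (clear-den t))
   where
   q≡1 : suc d-1 ≡ 1
   q≡1 = ∣-coprime-power k (Coprime.sym (Coprime.recompute c))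
     (ℕD.divides ℤ.∣ i ∣ (trans (sym (abs-^ n k)) (trans (cong ℤ.∣_∣ (ι-injective {n ^ k} {+ suc d-1 · i} (trans e (sym (ι-* (+ suc d-1) i))))) (trans (ℤₚ.abs-* (+ suc d-1) i) (ℕₚ.*-comm (suc d-1) ℤ.∣ i ∣)))))

 ι-^⁴ : ∀ i → ι (i ^ 4) ≡ ι i * ι i * (ι i * ι i)
 ι-^⁴ i = trans (cong ι (lem i)) (trans (ι-* (i · i) (i · i)) (cong₂ _*_ (ι-* i i) (ι-* i i)))
   where
   lem : ∀ i → i · (i · (i · (i · 1ℤ))) ≡ i · i · (i · i)
   lem = ℤ-solve 1 (λ i → i :* (i :* (i :* (i :* Κ 1ℤ))) , i :* i :* (i :* i)) refl

 ι-^⁹ : ∀ i → ι (i ^ 9) ≡ let p³ = ι i * ι i * ι i in p³ * p³ * p³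
 ι-^⁹ i = trans (cong ι (lem i)) (trans (ι-³ (i ³ℤ)) (cong (λ p → p * p * p) (ι-³ i)))
   where
   ι-³ : ∀ i → ι (i ³ℤ) ≡ ι i * ι i * ι i
   ι-³ i = trans (ι-* (i · i) i) (cong (_* ι i) (ι-* i i))
   lem : ∀ i → i · (i · (i · (i · (i · (i · (i · (i · (i · 1ℤ)))))))) ≡ let p³ = i · i · i in p³ · p³ · p³
   lem = ℤ-solve 1 (λ i → i :* (i :* (i :* (i :* (i :* (i :* (i :* (i :* (i :* Κ 1ℤ)))))))) , let p³ = i :* i :* i in p³ :* p³ :* p³) refl

 -- With z = x(2Q), duplication reads t⁴ - 8Bt = 4z(t³ + B), monic of degree 4 in t = x(Q).
 integral-half : ∀ m → Int (X (suc m ℕ.+ suc m)) → Int (X (suc m))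
 integral-half m h@(z , ez) = integral-root t 4 r r-int (begin
   ι (ℚ.↥ t ^ 4) ≡⟨ trans (ι-^⁴ (ℚ.↥ t)) (cong (λ p → p * p * (p * p)) (sym (clear-den t))) ⟩
   t * q * (t * q) * (t * q * (t * q)) ≡⟨ -≡0⇒≡ (trans (lem t q (X (suc m ℕ.+ suc m)) (ι B)) (trans (cong (q * q * (q * q) *_) (≡⇒-≡0 (sym (X-double m)))) (ℚₚ.*-zeroʳ (q * q * (q * q))))) ⟩
   q * (8ℚ * ι B * (t * q) * (q * q) + 4ℚ * X (suc m ℕ.+ suc m) * (t * q * (t * q) * (t * q) + ι B * (q * q * q)))
     ≡⟨ cong₂ (λ p z → q * (8ℚ * ι B * p * (q * q) + 4ℚ * z * (p * p * p + ι B * (q * q * q)))) (clear-den t) ez ⟩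
   q * r ∎)
   where
   open ≡-Reasoning
   t = X (suc m)
   q = ι (ℚ.↧ t)
   p = ι (ℚ.↥ t)
   r = 8ℚ * ι B * p * (q * q) + 4ℚ * ι z * (p * p * p + ι B * (q * q * q))
   Iq = int (ℚ.↧ t)
   Ip = int (ℚ.↥ t)
   r-int : Int r
   r-int = int (+ 8) ⊠ int B ⊠ Ip ⊠ (Iq ⊠ Iq) ⊞ int (+ 4) ⊠ int z ⊠ (Ip ⊠ Ip ⊠ Ip ⊞ int B ⊠ (Iq ⊠ Iq ⊠ Iq))
   lem : ∀ t q z B → t * q * (t * q) * (t * q * (t * q)) - q * (8ℚ * B * (t * q) * (q * q) + 4ℚ * z * (t * q * (t * q) * (t * q) + B * (q * q * q))) ≡
     q * q * (q * q) * (t * (t * t * t - 8ℚ * B) - 4ℚ * (t * t * t + B) * z)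
   lem = ℚ-solve 4 (λ t q z B → t :* q :* (t :* q) :* (t :* q :* (t :* q)) :- q :* (Κ 8ℚ :* B :* (t :* q) :* (q :* q) :+ Κ 4ℚ :* z :* (t :* q :* (t :* q) :* (t :* q) :+ B :* (q :* q :* q))) , q :* q :* (q :* q) :* (t :* (t :* t :* t :- Κ 8ℚ :* B) :- Κ 4ℚ :* (t :* t :* t :+ B) :* z)) refl

 -- Triplication is t⁹ - 96Bt⁶ + 48B²t³ + 64B³ = 9z t²(t³ + 4B)², monic of degree 9. It is derived
 -- from duplication and the sum formula for x(2Q ± Q); `rest` is its homogenised remainder, with s
 -- for B times the cubed denominator.
 integral-third : ∀ m → Int (X (suc m ℕ.+ suc m ℕ.+ suc m)) → Int (X (suc m))
 integral-third m h@(z , ez) = integral-root t 9 r r-int (begin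
   ι (ℚ.↥ t ^ 9) ≡⟨ trans (ι-^⁹ (ℚ.↥ t)) (cong (λ p → let p³ = p * p * p in p³ * p³ * p³) (sym (clear-den t))) ⟩
   cube³ (t * q) ≡⟨ -≡0⇒≡ (trans (lem t q Z (ι B)) (trans (cong (cube³ q *_) (≡⇒-≡0 (sym tripled))) (ℚₚ.*-zeroʳ (cube³ q)))) ⟩
   q * rest (t * q) Z ≡⟨ cong₂ (λ p z → q * rest p z) (clear-den t) ez ⟩
   q * r ∎)
   where
   open ≡-Reasoning
   t = X (suc m)
   X² = X (suc m ℕ.+ suc m)
   Z = X (suc m ℕ.+ suc m ℕ.+ suc m)
   q = ι (ℚ.↧ t)
   cube³ : ℚ → ℚ
   cube³ p = let p³ = p * p * p in p³ * p³ * p³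
   rest : ℚ → ℚ → ℚ
   rest p z = let p³ = p * p * p ; s = ι B * (q * q * q) in
     ι (+ 9) * (p * p) * ((p³ + 4ℚ * s) * (p³ + 4ℚ * s)) * z + ι B * (q * q) * (ι (+ 96) * (p³ * p³) - ι (+ 48) * (p³ * s) - ι (+ 64) * (s * s))
   r = rest (ι (ℚ.↥ t)) (ι z)
   Iq = int (ℚ.↧ t)
   Ip = int (ℚ.↥ t)
   Ip³ = Ip ⊠ Ip ⊠ Ip
   Is = int B ⊠ (Iq ⊠ Iq ⊠ Iq)
   r-int : Int r
   r-int = int (+ 9) ⊠ (Ip ⊠ Ip) ⊠ ((Ip³ ⊞ int (+ 4) ⊠ Is) ⊠ (Ip³ ⊞ int (+ 4) ⊠ Is)) ⊠ int z
     ⊞ int B ⊠ (Iq ⊠ Iq) ⊠ (int (+ 96) ⊠ (Ip³ ⊠ Ip³) ⊟ int (+ 48) ⊠ (Ip³ ⊠ Is) ⊟ int (+ 64) ⊠ (Is ⊠ Is))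
   sum : (X² - t) * (X² - t) * (Z + t) ≡ 2ℚ * (X² * t * (X² + t) + 2ℚ * ι B)
   sum = subst (λ k → (X k - t) * (X k - t) * (X (k ℕ.+ suc m) + t) ≡ 2ℚ * (X k * t * (X k + t) + 2ℚ * ι B)) (cong suc (sym (ℕₚ.+-suc m m)))
     (X-sum {m} {m} {m ℕ.+ m} (cong suc (ℕₚ.+-suc m m)))
   Q = 4ℚ * (t * t * t + ι B)
   N₂ = t * (t * t * t - 8ℚ * ι B)
   tripled : (N₂ - t * Q) * (N₂ - t * Q) * (Z + t) ≡ 2ℚ * (N₂ * t * (N₂ + t * Q) + 2ℚ * ι B * (Q * Q))
   tripled = subst (λ n → (n - t * Q) * (n - t * Q) * (Z + t) ≡ 2ℚ * (n * t * (n + t * Q) + 2ℚ * ι B * (Q * Q))) (X-double m)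
     (trans (lem₁ Q X² t Z) (trans (cong (Q * Q *_) sum) (lem₂ Q X² t (ι B))))
     where
     lem₁ : ∀ Q X t Z → (Q * X - t * Q) * (Q * X - t * Q) * (Z + t) ≡ Q * Q * ((X - t) * (X - t) * (Z + t))
     lem₁ = ℚ-solve 4 (λ Q X t Z → (Q :* X :- t :* Q) :* (Q :* X :- t :* Q) :* (Z :+ t) , Q :* Q :* ((X :- t) :* (X :- t) :* (Z :+ t))) refl
     lem₂ : ∀ Q X t B → Q * Q * (2ℚ * (X * t * (X + t) + 2ℚ * B)) ≡ 2ℚ * (Q * X * t * (Q * X + t * Q) + 2ℚ * B * (Q * Q))
     lem₂ = ℚ-solve 4 (λ Q X t B → Q :* Q :* (Κ 2ℚ :* (X :* t :* (X :+ t) :+ Κ 2ℚ :* B)) , Κ 2ℚ :* (Q :* X :* t :* (Q :* X :+ t :* Q) :+ Κ 2ℚ :* B :* (Q :* Q))) refl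
   lem : ∀ t q Z B → let p = t * q ; p³ = p * p * p ; s = B * (q * q * q) ; q³ = q * q * q ; Q = 4ℚ * (t * t * t + B) ; N = t * (t * t * t - 8ℚ * B) in
     p³ * p³ * p³ - q * (ι (+ 9) * (p * p) * ((p³ + 4ℚ * s) * (p³ + 4ℚ * s)) * Z + B * (q * q) * (ι (+ 96) * (p³ * p³) - ι (+ 48) * (p³ * s) - ι (+ 64) * (s * s))) ≡
     q³ * q³ * q³ * (2ℚ * (N * t * (N + t * Q) + 2ℚ * B * (Q * Q)) - (N - t * Q) * (N - t * Q) * (Z + t))
   lem = ℚ-solve 4 (λ t q Z B →
                     let p = t :* q ; p³ = p :* p :* p ; s = B :* (q :* q :* q) ; q³ = q :* q :* q ; Q = Κ 4ℚ :* (t :* t :* t :+ B) ; N = t :* (t :* t :* t :- Κ 8ℚ :* B) in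
     p³ :* p³ :* p³ :- q :* (Κ (ι (+ 9)) :* (p :* p) :* ((p³ :+ Κ 4ℚ :* s) :* (p³ :+ Κ 4ℚ :* s)) :* Z :+ B :* (q :* q) :* (Κ (ι (+ 96)) :* (p³ :* p³) :- Κ (ι (+ 48)) :* (p³ :* s) :- Κ (ι (+ 64)) :* (s :* s))) ,
     q³ :* q³ :* q³ :* (Κ 2ℚ :* (N :* t :* (N :+ t :* Q) :+ Κ 2ℚ :* B :* (Q :* Q)) :- (N :- t :* Q) :* (N :- t :* Q) :* (Z :+ t))) refl

open Reduction using (Residues; mod-3; prime[3])

-- The sequence v modulo 3

module ModThree {B x y : ℤ} (B≡ : B ≡ y ²ℤ ℤ.- x ³ℤ) (M : Multiples (ι B) (ι x) (ι y)) (Pm : Params x y) (Lp : LocalParams Pm)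
  (res : Residues (Params.T Pm) (Params.b Pm) (Params.c Pm)) where
 open Indices
 open import Data.Integer using (+_; _^_)

 import Data.Nat.DivMod as ℕDM
 open import Data.Fin as Fin using (Fin; toℕ; fromℕ<)
 import Data.Fin.Properties as Finₚ
 open import Data.List.Base using (List; []; _∷_)
 open import Data.Integer.Divisibility.Signed using (_∣_; divides)
 open import Relation.Nullary.Decidable using (True; toWitness; _⊎-dec_)

 open LocalAnalysis B≡ M Pm Lp

 infix 4 _≈_
 _≈_ : ℤ → ℤ → Set
 i ≈ j = + 3 ∣ i ℤ.- j

 ≈-refl : ∀ {i} → i ≈ i
 ≈-refl {i} = subst (+ 3 ∣_) (sym (ℤₚ.+-inverseʳ i)) (divides 0ℤ refl)

 ≈-sym : ∀ {i j} → i ≈ j → j ≈ i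
 ≈-sym {i} {j} h = subst (+ 3 ∣_) (lem i j) (ℤD.∣m⇒∣-m h)
   where
   lem : ∀ i j → ℤ.- (i ℤ.- j) ≡ j ℤ.- i
   lem = ℤ-solve 2 (λ i j → :- (i :- j) , j :- i) refl

 ≈-trans : ∀ {i j k} → i ≈ j → j ≈ k → i ≈ k
 ≈-trans {i} {j} {k} h h′ = subst (+ 3 ∣_) (lem i j k) (ℤD.∣m∣n⇒∣m+n h h′)
   where
   lem : ∀ i j k → (i ℤ.- j) ∔ (j ℤ.- k) ≡ i ℤ.- k
   lem = ℤ-solve 3 (λ i j k → (i :- j) :+ (j :- k) , i :- k) refl

 ≈-- : ∀ {i j k l} → i ≈ j → k ≈ l → i ℤ.- k ≈ j ℤ.- l
 ≈-- {i} {j} {k} {l} h h′ = subst (+ 3 ∣_) (lem i j k l) (ℤD.∣m∣n⇒∣m-n h h′)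
   where
   lem : ∀ i j k l → (i ℤ.- j) ℤ.- (k ℤ.- l) ≡ (i ℤ.- k) ℤ.- (j ℤ.- l)
   lem = ℤ-solve 4 (λ i j k l → (i :- j) :- (k :- l) , (i :- k) :- (j :- l)) refl

 ≈-* : ∀ {i j k l} → i ≈ j → k ≈ l → i · k ≈ j · l
 ≈-* {i} {j} {k} {l} h h′ = subst (+ 3 ∣_) (lem i j k l) (ℤD.∣m∣n⇒∣m+n (ℤD.∣m⇒∣m*n k h) (ℤD.∣n⇒∣m*n j h′))
   where
   lem : ∀ i j k l → (i ℤ.- j) · k ∔ j · (k ℤ.- l) ≡ i · k ℤ.- j · l
   lem = ℤ-solve 4 (λ i j k l → (i :- j) :* k :+ j :* (k :- l) , i :* k :- j :* l) refl

 ≈-^ : ∀ {i j} n → i ≈ j → i ^ n ≈ j ^ n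
 ≈-^ zero    h = ≈-refl {1ℤ}
 ≈-^ {i} {j} (suc n) h = ≈-* {i} {j} {i ^ n} {j ^ n} h (≈-^ {i} {j} n h)

 ≈-³ : ∀ {i j} → i ≈ j → i ³ℤ ≈ j ³ℤ
 ≈-³ {i} {j} h = ≈-* {i ²ℤ} {j ²ℤ} {i} {j} (≈-* {i} {j} {i} {j} h h) h

 oddForm : ℤ → ℤ → ℕ → ℤ → ℤ → ℤ → ℤ → ℤ
 oddForm T b k v₁ v₂ v₃ v₄ = T ^ τ (2 ℕ.+ k) · b ^ δ (2 ℕ.+ k) · (v₄ · v₂ ³ℤ)
                   ℤ.- T ^ τ (3 ℕ.+ k) · b ^ δ (3 ℕ.+ k) · (v₁ · v₃ ³ℤ)

 evenForm : ℤ → ℕ → ℤ → ℤ → ℤ → ℤ → ℤ → ℤ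
 evenForm b k v₁ v₂ v₃ v₄ v₅ = b ^ δ (5 ℕ.+ k) · (v₃ · v₅ · v₂ ²ℤ)
                       ℤ.- b ^ δ (4 ℕ.+ k) · (v₃ · v₁ · v₄ ²ℤ)

 -- The periodic sequence with period y ∷ L, read off from the position of l in L.
 cyc : ℤ → List ℤ → List ℤ → ℕ → ℤ
 cyc y L []      zero    = y
 cyc y L []      (suc n) = cyc y L L n
 cyc y L (x ∷ l) zero    = x
 cyc y L (x ∷ l) (suc n) = cyc y L l n

 trp : ℕ → ℕ
 trp zero    = 0
 trp (suc n) = 3 ℕ.+ trp n

 -- 36 is a common multiple of the period 6 of the exponents and of the periods 12, 18 and 36 of the
 -- patterns, so the recursions need checking only at 36 indices; the shift by 36 then holds by
 -- computation.
 by-36 : (P : ℕ → Set) (P? : ∀ n → Dec (P n)) {_ : True (Finₚ.all? {36} λ i → P? (toℕ i))} → (∀ n → P n → P (36 ℕ.+ n)) → ∀ n → P n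
 by-36 P P? {w} s n = subst P (sym (trans (ℕDM.m≡m%n+[m/n]*n n 36) (ℕₚ.+-comm (n ℕDM.% 36) _))) (go (n ℕDM./ 36))
   where
   go : ∀ k → P (k ℕ.* 36 ℕ.+ n ℕDM.% 36)
   go zero = subst P (Finₚ.toℕ-fromℕ< (ℕDM.m%n<n n 36)) (toWitness w (fromℕ< (ℕDM.m%n<n n 36)))
   go (suc k) = s _ (go k)

 OddStep EvenStep TripleStep : ℤ → ℤ → (ℕ → ℤ) → ℕ → Set
 OddStep t b₀ p k = oddForm t b₀ k (p (1 ℕ.+ k)) (p (2 ℕ.+ k)) (p (3 ℕ.+ k)) (p (4 ℕ.+ k)) ≈ p (suc (dbl k 4))
 EvenStep t b₀ p k = evenForm b₀ k (p (1 ℕ.+ k)) (p (2 ℕ.+ k)) (p (3 ℕ.+ k)) (p (4 ℕ.+ k)) (p (5 ℕ.+ k)) ≈ p (suc (dbl k 5))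
 TripleStep t b₀ p k = τ k ≡ 1 ⊎ (δ k ≡ 1 ⊎ p (trp k) ≡ p k)

 OddStep? : ∀ t b₀ p k → Dec (OddStep t b₀ p k)
 OddStep? t b₀ p k = + 3 ℤD.∣? _
 EvenStep? : ∀ t b₀ p k → Dec (EvenStep t b₀ p k)
 EvenStep? t b₀ p k = + 3 ℤD.∣? _
 TripleStep? : ∀ t b₀ p k → Dec (TripleStep t b₀ p k)
 TripleStep? t b₀ p k = (τ k ℕ.≟ 1) ⊎-dec ((δ k ℕ.≟ 1) ⊎-dec (p (trp k) ℤ.≟ p k))

 -- A candidate for v modulo 3. Once it satisfies the recursions, it agrees with v because the
 -- initial terms do. `triple` fixes the relative sign of the units v(3q) and v(q); `ninth` is the
 -- corresponding input at index 27.
 record Pattern : Set where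
   field
     t b₀ : ℤ
     p : ℕ → ℤ
     p₁ : p 1 ≡ 1ℤ
     p₂ : p 2 ≡ 1ℤ
     p₃ : p 3 ≡ 1ℤ
     odd : ∀ k → OddStep t b₀ p k
     even : ∀ k → EvenStep t b₀ p k
     triple : ∀ k → TripleStep t b₀ p k
     ninth : p 9 ≡ 0ℤ ⊎ p 27 ≡ 1ℤ

 module _ (P : Pattern) (T≈ : T ≈ Pattern.t P) (b≈ : b ≈ Pattern.b₀ P) (c≈ : c ≈ Pattern.p P 4) where
   open Pattern P

   follows : ∀ n → v (suc n) ≈ p (suc n)
   follows = eds-induction (λ n → v n ≈ p n) (init v₁ p₁) (init v₂ p₂) (init v₃ p₃) (subst (_≈ p 4) (sym v₄) c≈)
     (λ k h₁ h₂ h₃ h₄ → ≈-trans {v (suc (dbl k 4))} {oddForm t b₀ k (p (1 ℕ.+ k)) (p (2 ℕ.+ k)) (p (3 ℕ.+ k)) (p (4 ℕ.+ k))} {p (suc (dbl k 4))}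
       (subst (_≈ oddForm t b₀ k (p (1 ℕ.+ k)) (p (2 ℕ.+ k)) (p (3 ℕ.+ k)) (p (4 ℕ.+ k))) (sym (v-odd k)) (odd≈ k {v (1 ℕ.+ k)} {v (2 ℕ.+ k)} {v (3 ℕ.+ k)} {v (4 ℕ.+ k)} {p (1 ℕ.+ k)} {p (2 ℕ.+ k)} {p (3 ℕ.+ k)} {p (4 ℕ.+ k)} h₁ h₂ h₃ h₄)) (odd k))
     (λ k h₁ h₂ h₃ h₄ h₅ → ≈-trans {v (suc (dbl k 5))} {evenForm b₀ k (p (1 ℕ.+ k)) (p (2 ℕ.+ k)) (p (3 ℕ.+ k)) (p (4 ℕ.+ k)) (p (5 ℕ.+ k))} {p (suc (dbl k 5))}
       (subst (_≈ evenForm b₀ k (p (1 ℕ.+ k)) (p (2 ℕ.+ k)) (p (3 ℕ.+ k)) (p (4 ℕ.+ k)) (p (5 ℕ.+ k))) (sym (v-even k)) (even≈ k {v (1 ℕ.+ k)} {v (2 ℕ.+ k)} {v (3 ℕ.+ k)} {v (4 ℕ.+ k)} {v (5 ℕ.+ k)} {p (1 ℕ.+ k)} {p (2 ℕ.+ k)} {p (3 ℕ.+ k)} {p (4 ℕ.+ k)} {p (5 ℕ.+ k)} h₁ h₂ h₃ h₄ h₅)) (even k))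
     where
     init : ∀ {i j} → i ≡ 1ℤ → j ≡ 1ℤ → i ≈ j
     init refl refl = ≈-refl {1ℤ}
     scale : ∀ n m {i j} → i ≈ j → T ^ n · b ^ m · i ≈ t ^ n · b₀ ^ m · j
     scale n m {i} {j} h = ≈-* {T ^ n · b ^ m} {t ^ n · b₀ ^ m} {i} {j} (≈-* {T ^ n} {t ^ n} {b ^ m} {b₀ ^ m} (≈-^ {T} {t} n T≈) (≈-^ {b} {b₀} m b≈)) h
     odd≈ : ∀ k {u₁ u₂ u₃ u₄ w₁ w₂ w₃ w₄} → u₁ ≈ w₁ → u₂ ≈ w₂ → u₃ ≈ w₃ → u₄ ≈ w₄ → oddForm T b k u₁ u₂ u₃ u₄ ≈ oddForm t b₀ k w₁ w₂ w₃ w₄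
     odd≈ k {u₁} {u₂} {u₃} {u₄} {w₁} {w₂} {w₃} {w₄} h₁ h₂ h₃ h₄ = ≈-- {T ^ τ (2 ℕ.+ k) · b ^ δ (2 ℕ.+ k) · (u₄ · u₂ ³ℤ)} {t ^ τ (2 ℕ.+ k) · b₀ ^ δ (2 ℕ.+ k) · (w₄ · w₂ ³ℤ)}
       {T ^ τ (3 ℕ.+ k) · b ^ δ (3 ℕ.+ k) · (u₁ · u₃ ³ℤ)} {t ^ τ (3 ℕ.+ k) · b₀ ^ δ (3 ℕ.+ k) · (w₁ · w₃ ³ℤ)}
       (scale (τ (2 ℕ.+ k)) (δ (2 ℕ.+ k)) {u₄ · u₂ ³ℤ} {w₄ · w₂ ³ℤ} (≈-* {u₄} {w₄} {u₂ ³ℤ} {w₂ ³ℤ} h₄ (≈-³ {u₂} {w₂} h₂)))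
       (scale (τ (3 ℕ.+ k)) (δ (3 ℕ.+ k)) {u₁ · u₃ ³ℤ} {w₁ · w₃ ³ℤ} (≈-* {u₁} {w₁} {u₃ ³ℤ} {w₃ ³ℤ} h₁ (≈-³ {u₃} {w₃} h₃)))
     term : ∀ m {i j k i′ j′ k′} → i ≈ i′ → j ≈ j′ → k ≈ k′ → b ^ m · (i · j · k ²ℤ) ≈ b₀ ^ m · (i′ · j′ · k′ ²ℤ)
     term m {i} {j} {k} {i′} {j′} {k′} h₁ h₂ h₃ = ≈-* {b ^ m} {b₀ ^ m} {i · j · k ²ℤ} {i′ · j′ · k′ ²ℤ} (≈-^ {b} {b₀} m b≈)
       (≈-* {i · j} {i′ · j′} {k ²ℤ} {k′ ²ℤ} (≈-* {i} {i′} {j} {j′} h₁ h₂) (≈-* {k} {k′} {k} {k′} h₃ h₃))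
     even≈ : ∀ k {u₁ u₂ u₃ u₄ u₅ w₁ w₂ w₃ w₄ w₅} → u₁ ≈ w₁ → u₂ ≈ w₂ → u₃ ≈ w₃ → u₄ ≈ w₄ → u₅ ≈ w₅ → evenForm b k u₁ u₂ u₃ u₄ u₅ ≈ evenForm b₀ k w₁ w₂ w₃ w₄ w₅
     even≈ k {u₁} {u₂} {u₃} {u₄} {u₅} {w₁} {w₂} {w₃} {w₄} {w₅} h₁ h₂ h₃ h₄ h₅ =
       ≈-- {b ^ δ (5 ℕ.+ k) · (u₃ · u₅ · u₂ ²ℤ)} {b₀ ^ δ (5 ℕ.+ k) · (w₃ · w₅ · w₂ ²ℤ)} {b ^ δ (4 ℕ.+ k) · (u₃ · u₁ · u₄ ²ℤ)} {b₀ ^ δ (4 ℕ.+ k) · (w₃ · w₁ · w₄ ²ℤ)}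
         (term (δ (5 ℕ.+ k)) {u₃} {u₅} {u₂} {w₃} {w₅} {w₂} h₃ h₅ h₂) (term (δ (4 ℕ.+ k)) {u₃} {u₁} {u₄} {w₃} {w₁} {w₄} h₃ h₁ h₄)

   v-triple : ∀ n → τ (suc n) ≡ 0 → δ (suc n) ≡ 0 → v (trp (suc n)) ≈ v (suc n)
   v-triple n t₀ f₀ with triple (suc n)
   ... | inj₁ e = contra t₀ e
   ... | inj₂ (inj₁ e) = contra f₀ e
   ... | inj₂ (inj₂ e) = ≈-trans {v (trp (suc n))} {p (trp (suc n))} {v (suc n)} (follows (2 ℕ.+ trp n)) (subst (_≈ v (suc n)) (sym e) (≈-sym {v (suc n)} {p (suc n)} (follows n)))

   v-ninth : + 3 ∣ v 9 ⊎ v 27 ≈ 1ℤ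
   v-ninth with ninth
   ... | inj₁ e = inj₁ (subst (+ 3 ∣_) (trans (cong (λ z → v 9 ℤ.- z) e) (ℤₚ.+-identityʳ (v 9))) (follows 8))
   ... | inj₂ e = inj₂ (subst (v 27 ≈_) e (follows 26))

 -- The solutions of the recursions modulo 3 for T ≡ 0, 1 and -1, with periods 12, 18 and 36.
 -- `Residues` determines b and c modulo 3 from T, so there are only these three.
 pattern₀ pattern₊ pattern₋ : Pattern
 pattern₀ = record { t = 0ℤ ; b₀ = ℤ.- 1ℤ ; p = p ; p₁ = refl ; p₂ = refl ; p₃ = refl ; ninth = inj₂ refl
   ; odd = by-36 _ (OddStep? 0ℤ (ℤ.- 1ℤ) p) (λ _ h → h) ; even = by-36 _ (EvenStep? 0ℤ (ℤ.- 1ℤ) p) (λ _ h → h) ; triple = by-36 _ (TripleStep? 0ℤ (ℤ.- 1ℤ) p) (λ _ h → h) }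
   where
   o = ℤ.- 1ℤ
   p = cyc 0ℤ (1ℤ ∷ 1ℤ ∷ 1ℤ ∷ 1ℤ ∷ 1ℤ ∷ 0ℤ ∷ o ∷ o ∷ o ∷ o ∷ o ∷ []) []
 pattern₊ = record { t = 1ℤ ; b₀ = 0ℤ ; p = p ; p₁ = refl ; p₂ = refl ; p₃ = refl ; ninth = inj₁ refl
   ; odd = by-36 _ (OddStep? 1ℤ 0ℤ p) (λ _ h → h) ; even = by-36 _ (EvenStep? 1ℤ 0ℤ p) (λ _ h → h) ; triple = by-36 _ (TripleStep? 1ℤ 0ℤ p) (λ _ h → h) }
   where
   o = ℤ.- 1ℤ
   p = cyc 0ℤ (1ℤ ∷ 1ℤ ∷ 1ℤ ∷ o ∷ o ∷ 1ℤ ∷ 1ℤ ∷ 1ℤ ∷ 0ℤ ∷ o ∷ o ∷ o ∷ 1ℤ ∷ 1ℤ ∷ o ∷ o ∷ o ∷ []) []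
 pattern₋ = record { t = ℤ.- 1ℤ ; b₀ = 0ℤ ; p = p ; p₁ = refl ; p₂ = refl ; p₃ = refl ; ninth = inj₁ refl
   ; odd = by-36 _ (OddStep? (ℤ.- 1ℤ) 0ℤ p) (λ _ h → h) ; even = by-36 _ (EvenStep? (ℤ.- 1ℤ) 0ℤ p) (λ _ h → h) ; triple = by-36 _ (TripleStep? (ℤ.- 1ℤ) 0ℤ p) (λ _ h → h) }
   where
   o = ℤ.- 1ℤ
   p = cyc 0ℤ (1ℤ ∷ 1ℤ ∷ 1ℤ ∷ 1ℤ ∷ o ∷ 1ℤ ∷ 1ℤ ∷ o ∷ 0ℤ ∷ o ∷ o ∷ 1ℤ ∷ 1ℤ ∷ 1ℤ ∷ o ∷ 1ℤ ∷ o ∷ 0ℤ ∷ 1ℤ ∷ o ∷ 1ℤ ∷ o ∷ o ∷ o ∷ 1ℤ ∷ 1ℤ ∷ 0ℤ ∷ 1ℤ ∷ o ∷ o ∷ 1ℤ ∷ o ∷ o ∷ o ∷ o ∷ []) []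

 Fits : Pattern → Set
 Fits P = T ≈ Pattern.t P × b ≈ Pattern.b₀ P × c ≈ Pattern.p P 4

 fitting : Residues T b c → Σ Pattern Fits
 fitting (inj₂ (hT , hb , hc)) = pattern₀ , subst (+ 3 ∣_) (sym (ℤₚ.+-identityʳ T)) hT , hb , hc
 fitting (inj₁ (hb , hc)) = by (mod-3 T)
   where
   hb′ : b ≈ 0ℤ
   hb′ = subst (+ 3 ∣_) (sym (ℤₚ.+-identityʳ b)) hb
   lem : ∀ c T r → (c ∔ T) ℤ.- (T ℤ.- r) ≡ c ℤ.- (ℤ.- r)
   lem = ℤ-solve 3 (λ c T r → (c :+ T) :- (T :- r) , c :- (:- r)) refl
   by : + 3 ∣ T ⊎ (+ 3 ∣ T ℤ.- 1ℤ ⊎ + 3 ∣ T ∔ 1ℤ) → Σ Pattern Fits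
   -- In this branch 3 divides `b`, and `T` shares no prime with `b`.
   by (inj₁ hT) = ⊥-elim (T∤b prime[3] hT hb)
   by (inj₂ (inj₁ hT)) = pattern₊ , hT , hb′ , subst (+ 3 ∣_) (lem c T 1ℤ) (ℤD.∣m∣n⇒∣m-n hc hT)
   by (inj₂ (inj₂ hT)) = pattern₋ , hT , hb′ , subst (+ 3 ∣_) (lem c T (ℤ.- 1ℤ)) (ℤD.∣m∣n⇒∣m-n hc hT)

 v-triple≈ : ∀ n → τ (suc n) ≡ 0 → δ (suc n) ≡ 0 → v (trp (suc n)) ≈ v (suc n)
 v-triple≈ = let P , T≈ , b≈ , c≈ = fitting res in v-triple P T≈ b≈ c≈

 v-ninth≈ : + 3 ∣ v 9 ⊎ v 27 ≈ 1ℤ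
 v-ninth≈ = let P , T≈ , b≈ , c≈ = fitting res in v-ninth P T≈ b≈ c≈

open Reduction using (TwoAdic; Case₆; Case₄; Residues)

-- Which multiples can be integral

module Classification {B x y : ℤ} (B≡ : B ≡ y ²ℤ ℤ.- x ³ℤ) (M : Multiples (ι B) (ι x) (ι y)) (Pm : Params x y) (Lp : LocalParams Pm) (Ta : TwoAdic Pm B)
  (res : Residues (Params.T Pm) (Params.b Pm) (Params.c Pm)) where
 open Indices
 open DyadicIntegers
 open Progressions
 open import Data.Integer using (+_; _^_)

 open import Data.Nat.Induction using (<-rec)
 open import Data.Integer.Divisibility.Signed using (_∣_; ∣⇒∣ᵤ)
 open import Data.Rational using (_+_; _-_; _*_; -_)
 open import Relation.Binary.Definitions using (tri<; tri≈; tri>)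

 open TwoUnits B≡ M Pm Lp Ta public
 open IntegralRoots {B} M public
 open ModThree B≡ M Pm Lp res public using (_≈_; trp; v-triple≈; v-ninth≈)
 open TwoAdic Ta using (case)

 sq-pos : ∀ p → p ≢ 0ℚ → 0ℚ ℚ.< p * p
 sq-pos p p≢0 with ℚₚ.<-cmp p 0ℚ
 ... | tri< p<0 _ _ = let instance _ = ℚ.negative p<0 in ℚₚ.positive⁻¹ (p * p) {{ℚₚ.neg*neg⇒pos p p}}
 ... | tri≈ _ e _ = ⊥-elim (p≢0 e)
 ... | tri> _ _ p>0 = let instance _ = ℚ.positive p>0 in ℚₚ.positive⁻¹ (p * p) {{ℚₚ.pos*pos⇒pos p p}}

 0≤sq : ∀ p → 0ℚ ℚ.≤ p * p
 0≤sq p with p ℚₚ.≟ 0ℚ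
 ... | yes refl = ℚₚ.≤-refl
 ... | no p≢0 = ℚₚ.<⇒≤ (sq-pos p p≢0)

 sq+nonneg≡0 : ∀ p {r} → 0ℚ ℚ.≤ r → p * p + r ≡ 0ℚ → p ≡ 0ℚ
 sq+nonneg≡0 p {r} 0≤r e with p ℚₚ.≟ 0ℚ
 ... | yes p≡0 = p≡0
 ... | no p≢0 = ⊥-elim (ℚₚ.<-irrefl (sym e) (ℚₚ.+-mono-<-≤ (sq-pos p p≢0) 0≤r))

 0≤+ : ∀ {p q} → 0ℚ ℚ.≤ p → 0ℚ ℚ.≤ q → 0ℚ ℚ.≤ p + q
 0≤+ = ℚₚ.+-mono-≤

 *≡0 : ∀ p q → p ≢ 0ℚ → p * q ≡ 0ℚ → q ≡ 0ℚ
 *≡0 p q p≢0 e = *-cancelʳ p p≢0 (trans (ℚₚ.*-comm q p) (trans e (sym (ℚₚ.*-zeroˡ p))))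

 -- X² + XZ + Z² is positive definite: its double is X² + Z² + (X + Z)², so it can vanish only at
 -- the origin.
 cube-injective : ∀ X Z → X * X * X ≡ Z * Z * Z → X ≡ Z
 cube-injective X Z e with X ℚₚ.≟ Z
 ... | yes X≡Z = X≡Z
 ... | no X≢Z = trans X≡0 (sym (sq+nonneg≡0 Z (0≤+ (0≤sq X) (0≤sq (X + Z))) (trans (lem₂ X Z) zero²)))
   where
   lem : ∀ X Z → X * X * X - Z * Z * Z ≡ (X - Z) * (X * X + X * Z + Z * Z)
   lem = ℚ-solve 2 (λ X Z → X :* X :* X :- Z :* Z :* Z , (X :- Z) :* (X :* X :+ X :* Z :+ Z :* Z)) refl
   lem₁ : ∀ X Z → X * X + (Z * Z + (X + Z) * (X + Z)) ≡ 2ℚ * (X * X + X * Z + Z * Z)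
   lem₁ = ℚ-solve 2 (λ X Z → X :* X :+ (Z :* Z :+ (X :+ Z) :* (X :+ Z)) , Κ 2ℚ :* (X :* X :+ X :* Z :+ Z :* Z)) refl
   lem₂ : ∀ X Z → Z * Z + (X * X + (X + Z) * (X + Z)) ≡ 2ℚ * (X * X + X * Z + Z * Z)
   lem₂ = ℚ-solve 2 (λ X Z → Z :* Z :+ (X :* X :+ (X :+ Z) :* (X :+ Z)) , Κ 2ℚ :* (X :* X :+ X :* Z :+ Z :* Z)) refl
   zero² : 2ℚ * (X * X + X * Z + Z * Z) ≡ 0ℚ
   zero² = cong (2ℚ *_) (*≡0 (X - Z) (X * X + X * Z + Z * Z) (λ h → X≢Z (-≡0⇒≡ h)) (trans (sym (lem X Z)) (≡⇒-≡0 e)))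
   X≡0 : X ≡ 0ℚ
   X≡0 = sq+nonneg≡0 X (0≤+ (0≤sq Z) (0≤sq (X + Z))) (trans (lem₁ X Z) zero²)

 -- The third division polynomial as a function of the abscissa.
 Ψ : ℚ → ℚ
 Ψ X = 3ℚ * X * (X * X * X + 4ℚ * ι B)

 -- If X ≠ Z then 4 Y² = (X − Z) q and 4 V² = (Z − X) r with positive definite q, r.
 Ψ-injective : ∀ {X Y Z V} → Y * Y ≡ X * X * X + ι B → V * V ≡ Z * Z * Z + ι B → Y ≢ 0ℚ → Ψ X ≡ Ψ Z → X ≡ Z
 Ψ-injective {X} {Y} {Z} {V} cX cZ Y≢0 e with X ℚₚ.≟ Z
 ... | yes X≡Z = X≡Z
 ... | no X≢Z = trans X≡0 (sym Z≡0)
   where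
   E = (X + Z) * (X * X + Z * Z) + 4ℚ * ι B
   lem₁ : ∀ X Z B → 3ℚ * X * (X * X * X + 4ℚ * B) - 3ℚ * Z * (Z * Z * Z + 4ℚ * B) ≡ 3ℚ * (X - Z) * ((X + Z) * (X * X + Z * Z) + 4ℚ * B)
   lem₁ = ℚ-solve 3 (λ X Z B → Κ 3ℚ :* X :* (X :* X :* X :+ Κ 4ℚ :* B) :- Κ 3ℚ :* Z :* (Z :* Z :* Z :+ Κ 4ℚ :* B) , Κ 3ℚ :* (X :- Z) :* ((X :+ Z) :* (X :* X :+ Z :* Z) :+ Κ 4ℚ :* B)) refl
   E≡0 : E ≡ 0ℚ
   E≡0 = *≡0 (3ℚ * (X - Z)) E (*-≢0 {3ℚ} (λ ()) (λ h → X≢Z (-≡0⇒≡ h))) (trans (sym (lem₁ X Z (ι B))) (≡⇒-≡0 e))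
   -- A vanishing sum of squares results from weighting the equations for 4Y² and 4V² by the
   -- opposite definite forms. `r₁` and `r₂` are its remainders after singling out the square of Y Z
   -- or of Y (X + Z).
   r₁ = Y * (X + Z) * (Y * (X + Z)) + (Y * Z * (Y * Z) + (V * X * (V * X) + (V * X * (V * X) + V * (X + Z) * (V * (X + Z)))))
   r₂ = Y * Z * (Y * Z) + (Y * Z * (Y * Z) + (V * X * (V * X) + (V * X * (V * X) + V * (X + Z) * (V * (X + Z)))))
   lem₂ : ∀ Y V X Z → 4ℚ * (Y * Z * (Y * Z) + (Y * (X + Z) * (Y * (X + Z)) + (Y * Z * (Y * Z) + (V * X * (V * X) + (V * X * (V * X) + V * (X + Z) * (V * (X + Z))))))) ≡
     4ℚ * (Y * Y) * (3ℚ * Z * Z + 2ℚ * X * Z + X * X) + 4ℚ * (V * V) * (3ℚ * X * X + 2ℚ * X * Z + Z * Z)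
   lem₂ = ℚ-solve 4 (λ Y V X Z → Κ 4ℚ :* (Y :* Z :* (Y :* Z) :+ (Y :* (X :+ Z) :* (Y :* (X :+ Z)) :+ (Y :* Z :* (Y :* Z) :+ (V :* X :* (V :* X) :+ (V :* X :* (V :* X) :+ V :* (X :+ Z) :* (V :* (X :+ Z))))))) , Κ 4ℚ :* (Y :* Y) :* (Κ 3ℚ :* Z :* Z :+ Κ 2ℚ :* X :* Z :+ X :* X) :+ Κ 4ℚ :* (V :* V) :* (Κ 3ℚ :* X :* X :+ Κ 2ℚ :* X :* Z :+ Z :* Z)) refl
   lem₃ : ∀ X Z B → 4ℚ * (X * X * X + B) * (3ℚ * Z * Z + 2ℚ * X * Z + X * X) + 4ℚ * (Z * Z * Z + B) * (3ℚ * X * X + 2ℚ * X * Z + Z * Z) ≡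
     ((X + Z) * (X * X + Z * Z) + 4ℚ * B) * (4ℚ * (X * X + X * Z + Z * Z))
   lem₃ = ℚ-solve 3 (λ X Z B → Κ 4ℚ :* (X :* X :* X :+ B) :* (Κ 3ℚ :* Z :* Z :+ Κ 2ℚ :* X :* Z :+ X :* X) :+ Κ 4ℚ :* (Z :* Z :* Z :+ B) :* (Κ 3ℚ :* X :* X :+ Κ 2ℚ :* X :* Z :+ Z :* Z) , ((X :+ Z) :* (X :* X :+ Z :* Z) :+ Κ 4ℚ :* B) :* (Κ 4ℚ :* (X :* X :+ X :* Z :+ Z :* Z))) refl
   sum≡0 : Y * Z * (Y * Z) + r₁ ≡ 0ℚ
   sum≡0 = *≡0 4ℚ (Y * Z * (Y * Z) + r₁) (λ ()) (trans (lem₂ Y V X Z) (trans (cong₂ (λ p q → 4ℚ * p * (3ℚ * Z * Z + 2ℚ * X * Z + X * X) + 4ℚ * q * (3ℚ * X * X + 2ℚ * X * Z + Z * Z)) cX cZ)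
     (trans (lem₃ X Z (ι B)) (trans (cong (_* (4ℚ * (X * X + X * Z + Z * Z))) E≡0) (ℚₚ.*-zeroˡ (4ℚ * (X * X + X * Z + Z * Z)))))))
   rest : 0ℚ ℚ.≤ V * X * (V * X) + (V * X * (V * X) + V * (X + Z) * (V * (X + Z)))
   rest = 0≤+ (0≤sq (V * X)) (0≤+ (0≤sq (V * X)) (0≤sq (V * (X + Z))))
   Z≡0 : Z ≡ 0ℚ
   Z≡0 = *≡0 Y Z Y≢0 (sq+nonneg≡0 (Y * Z) (0≤+ (0≤sq (Y * (X + Z))) (0≤+ (0≤sq (Y * Z)) rest)) sum≡0)
   swap : ∀ p q r → p + (q + r) ≡ q + (p + r)
   swap = ℚ-solve 3 (λ p q r → p :+ (q :+ r) , q :+ (p :+ r)) refl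
   X≡0 : X ≡ 0ℚ
   X≡0 = trans (sym (ℚₚ.+-identityʳ X)) (trans (cong (λ t → X + t) (sym Z≡0))
     (*≡0 Y (X + Z) Y≢0 (sq+nonneg≡0 (Y * (X + Z)) {r₂} (0≤+ (0≤sq (Y * Z)) (0≤+ (0≤sq (Y * Z)) rest)) (trans (swap (Y * (X + Z) * (Y * (X + Z))) (Y * Z * (Y * Z)) (Y * Z * (Y * Z) + (V * X * (V * X) + (V * X * (V * X) + V * (X + Z) * (V * (X + Z)))))) sum≡0))))

 X-distinct : ∀ {m q n} → suc m ℕ.+ suc q ≡ suc n → X (suc m) ≢ X (suc n)
 X-distinct {m} {q} {n} e h = *-≢0 (W≢0 (n ℕ.+ suc m)) (W≢0 q) (trans (W-W-X {suc n ℕ.+ suc m} {suc q} {m} {n} refl e)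
   (trans (cong (w (suc n) * w (suc m) *_) (≡⇒-≡0 h)) (ℚₚ.*-zeroʳ (w (suc n) * w (suc m)))))

 Y≢0 : ∀ n → Y (suc n) ≢ 0ℚ
 Y≢0 n e = W≢0 (n ℕ.+ suc n) (trans (W-double n) (trans (cong (λ t → 2ℚ * t * w (suc n) ²) e) (ℚₚ.*-zeroˡ (w (suc n) ²))))

 equal-Y² : ∀ m n → Y (suc m) * Y (suc m) ≡ Y (suc n) * Y (suc n) → X (suc m) ≡ X (suc n)
 equal-Y² m n e = cube-injective (X (suc m)) (X (suc n)) (+-cancel (trans (sym (curve m)) (trans e (curve n))))
   where
   lem : ∀ p b → p + b - b ≡ p
   lem = ℚ-solve 2 (λ p b → p :+ b :- b , p) refl
   +-cancel : ∀ {p q} → p + ι B ≡ q + ι B → p ≡ q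
   +-cancel {p} {q} h = trans (sym (lem p (ι B))) (trans (cong (_- ι B) h) (lem q (ι B)))

 IntegralMultiple : ℕ → Set
 IntegralMultiple n = Int (X n)

 v-unit : ∀ {n} → IntegralMultiple (suc n) → ℤ.∣ v (suc n) ∣ ≡ 1
 v-unit {n} (z , e) = integral⇒v-unit {n} {z} e

 unit-sq : ∀ {i} → ℤ.∣ i ∣ ≡ 1 → i · i ≡ 1ℤ
 unit-sq {+ 1} refl = refl
 unit-sq {ℤ.-[1+ 0 ]} refl = refl

 w-unit : ∀ n → ℤ.∣ v n ∣ ≡ 1 → w n ≡ ι (σ n ²ℤ)
 w-unit n h = trans (w-int n) (cong ι (trans (lem (v n) (σ n)) (trans (cong (_· σ n ²ℤ) (unit-sq {v n} h)) (ℤₚ.*-identityˡ (σ n ²ℤ)))))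
   where
   lem : ∀ v s → v · s · (v · s) ≡ v · v · (s · s)
   lem = ℤ-solve 2 (λ v s → v :* s :* (v :* s) , v :* v :* (s :* s)) refl

 double-Y² : ∀ n → 4ℚ * (Y (suc n) * Y (suc n)) * (w (suc n) ² * w (suc n) ²) ≡ w (suc n ℕ.+ suc n)
 double-Y² n = trans (lem (Y (suc n)) (w (suc n))) (sym (cong _² (W-double n)))
   where
   lem : ∀ Y w → 4ℚ * (Y * Y) * (w * w * (w * w)) ≡ 2ℚ * Y * (w * w) * (2ℚ * Y * (w * w))
   lem = ℚ-solve 2 (λ Y w → Κ 4ℚ :* (Y :* Y) :* (w :* w :* (w :* w)) , Κ 2ℚ :* Y :* (w :* w) :* (Κ 2ℚ :* Y :* (w :* w))) refl

 σ-form : ∀ n {t f k} → τ n ≡ t → δ n ≡ f → e n ≡ k → σ n ≡ a ^ t · d ^ f · G ^ k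
 σ-form n refl refl refl = refl

 e-coprime : ∀ n → τ (suc n) ≡ 0 → δ (suc n) ≡ 0 → 12 ℕ.* e (suc n) ℕ.+ 1 ≡ suc n ℕ.* suc n
 e-coprime n t f = trans (lem (e (suc n))) (trans (cong₂ (λ t f → 3 ℕ.* t ℕ.+ 2 ℕ.* (2 ℕ.* (2 ℕ.* f)) ℕ.+ 2 ℕ.* (2 ℕ.* (3 ℕ.* e (suc n))) ℕ.+ 1) (sym t) (sym f)) (e-square n))
   where
   lem : ∀ e → 12 ℕ.* e ℕ.+ 1 ≡ 2 ℕ.* (2 ℕ.* (3 ℕ.* e)) ℕ.+ 1
   lem = ℕ-solve

 e-double : ∀ n → τ (suc n) ≡ 0 → δ (suc n) ≡ 0 → τ (suc n ℕ.+ suc n) ≡ 1 → δ (suc n ℕ.+ suc n) ≡ 0 → e (suc n ℕ.+ suc n) ≡ 4 ℕ.* e (suc n)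
 e-double n t f t₂ f₂ = ℕₚ.*-cancelˡ-≡ (e (suc n ℕ.+ suc n)) (4 ℕ.* e (suc n)) 12 (ℕₚ.+-cancelʳ-≡ 4 _ _ (begin
   12 ℕ.* e (suc n ℕ.+ suc n) ℕ.+ 4 ≡⟨ lem₁ (e (suc n ℕ.+ suc n)) ⟩
   3 ℕ.* 1 ℕ.+ 2 ℕ.* (2 ℕ.* (2 ℕ.* 0)) ℕ.+ 2 ℕ.* (2 ℕ.* (3 ℕ.* e (suc n ℕ.+ suc n))) ℕ.+ 1
     ≡⟨ cong₂ (λ t f → 3 ℕ.* t ℕ.+ 2 ℕ.* (2 ℕ.* (2 ℕ.* f)) ℕ.+ 2 ℕ.* (2 ℕ.* (3 ℕ.* e (suc n ℕ.+ suc n))) ℕ.+ 1) (sym t₂) (sym f₂) ⟩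
   _ ≡⟨ e-square (n ℕ.+ suc n) ⟩
   (suc n ℕ.+ suc n) ℕ.* (suc n ℕ.+ suc n) ≡⟨ lem₂ (suc n) ⟩
   4 ℕ.* (suc n ℕ.* suc n) ≡⟨ cong (4 ℕ.*_) (sym (e-coprime n t f)) ⟩
   4 ℕ.* (12 ℕ.* e (suc n) ℕ.+ 1) ≡⟨ lem₃ (e (suc n)) ⟩
   12 ℕ.* (4 ℕ.* e (suc n)) ℕ.+ 4 ∎))
   where
   open ≡-Reasoning
   lem₁ : ∀ e → 12 ℕ.* e ℕ.+ 4 ≡ 3 ℕ.* 1 ℕ.+ 2 ℕ.* (2 ℕ.* (2 ℕ.* 0)) ℕ.+ 2 ℕ.* (2 ℕ.* (3 ℕ.* e)) ℕ.+ 1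
   lem₁ = ℕ-solve
   lem₂ : ∀ n → (n ℕ.+ n) ℕ.* (n ℕ.+ n) ≡ 4 ℕ.* (n ℕ.* n)
   lem₂ = ℕ-solve
   lem₃ : ∀ e → 4 ℕ.* (12 ℕ.* e ℕ.+ 1) ≡ 12 ℕ.* (4 ℕ.* e) ℕ.+ 4
   lem₃ = ℕ-solve

 e-triple : ∀ n → τ (suc n) ≡ 0 → δ (suc n) ≡ 0 → τ (suc n ℕ.+ suc n ℕ.+ suc n) ≡ 0 → δ (suc n ℕ.+ suc n ℕ.+ suc n) ≡ 1 →
            e (suc n ℕ.+ suc n ℕ.+ suc n) ≡ 9 ℕ.* e (suc n)
 e-triple n t f t₃ f₃ = ℕₚ.*-cancelˡ-≡ E (9 ℕ.* e (suc n)) 12 (ℕₚ.+-cancelʳ-≡ 9 _ _ (begin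
   12 ℕ.* E ℕ.+ 9 ≡⟨ lem₁ E ⟩
   3 ℕ.* 0 ℕ.+ 2 ℕ.* (2 ℕ.* (2 ℕ.* 1)) ℕ.+ 2 ℕ.* (2 ℕ.* (3 ℕ.* E)) ℕ.+ 1
     ≡⟨ cong₂ (λ t f → 3 ℕ.* t ℕ.+ 2 ℕ.* (2 ℕ.* (2 ℕ.* f)) ℕ.+ 2 ℕ.* (2 ℕ.* (3 ℕ.* E)) ℕ.+ 1) (sym t₃) (sym f₃) ⟩
   _ ≡⟨ e-square (n ℕ.+ suc n ℕ.+ suc n) ⟩
   (suc n ℕ.+ suc n ℕ.+ suc n) ℕ.* (suc n ℕ.+ suc n ℕ.+ suc n) ≡⟨ lem₂ (suc n) ⟩
   9 ℕ.* (suc n ℕ.* suc n) ≡⟨ cong (9 ℕ.*_) (sym (e-coprime n t f)) ⟩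
   9 ℕ.* (12 ℕ.* e (suc n) ℕ.+ 1) ≡⟨ lem₃ (e (suc n)) ⟩
   12 ℕ.* (9 ℕ.* e (suc n)) ℕ.+ 9 ∎))
   where
   open ≡-Reasoning
   E = e (suc n ℕ.+ suc n ℕ.+ suc n)
   lem₁ : ∀ e → 12 ℕ.* e ℕ.+ 9 ≡ 3 ℕ.* 0 ℕ.+ 2 ℕ.* (2 ℕ.* (2 ℕ.* 1)) ℕ.+ 2 ℕ.* (2 ℕ.* (3 ℕ.* e)) ℕ.+ 1
   lem₁ = ℕ-solve
   lem₂ : ∀ n → (n ℕ.+ n ℕ.+ n) ℕ.* (n ℕ.+ n ℕ.+ n) ≡ 9 ℕ.* (n ℕ.* n)
   lem₂ = ℕ-solve
   lem₃ : ∀ e → 9 ℕ.* (12 ℕ.* e ℕ.+ 1) ≡ 12 ℕ.* (9 ℕ.* e) ℕ.+ 9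
   lem₃ = ℕ-solve

 -- When v is a unit at m and 2m, `W-double` squared gives 4 y(mP)² = σ(2m)² / σ(m)⁸, a pure
 -- monomial. Equal monomials give equal y², hence equal x³ and equal x.
 Y²-ratio : ∀ m n → ℤ.∣ v (suc m) ∣ ≡ 1 → ℤ.∣ v (suc m ℕ.+ suc m) ∣ ≡ 1 → ℤ.∣ v (suc n) ∣ ≡ 1 → ℤ.∣ v (suc n ℕ.+ suc n) ∣ ≡ 1 →
   σ (suc m ℕ.+ suc m) ²ℤ · σ (suc n) ²ℤ ²ℤ ²ℤ ≡ σ (suc n ℕ.+ suc n) ²ℤ · σ (suc m) ²ℤ ²ℤ ²ℤ → X (suc m) ≡ X (suc n)
 Y²-ratio m n um um₂ un un₂ e = equal-Y² m n (*-cancelʳ 4ℚ (λ ()) (*-cancelʳ (ι (σ (suc m) ²ℤ ²ℤ ²ℤ) * ι (σ (suc n) ²ℤ ²ℤ ²ℤ))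
     (*-≢0 (ι-≢0 (eighth≢0 m)) (ι-≢0 (eighth≢0 n))) (begin
   Y (suc m) * Y (suc m) * 4ℚ * (ι sm * ι sn) ≡⟨ lem₁ (Y (suc m)) (ι sm) (ι sn) ⟩
   4ℚ * (Y (suc m) * Y (suc m)) * ι sm * ι sn ≡⟨ cong (_* ι sn) (scaled² m um um₂) ⟩
   ι (σ (suc m ℕ.+ suc m) ²ℤ) * ι sn ≡⟨ trans (sym (ι-* (σ (suc m ℕ.+ suc m) ²ℤ) sn)) (trans (cong ι e) (ι-* (σ (suc n ℕ.+ suc n) ²ℤ) sm)) ⟩
   ι (σ (suc n ℕ.+ suc n) ²ℤ) * ι sm ≡⟨ cong (_* ι sm) (sym (scaled² n un un₂)) ⟩
   4ℚ * (Y (suc n) * Y (suc n)) * ι sn * ι sm ≡⟨ lem₂ (Y (suc n)) (ι sm) (ι sn) ⟩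
   Y (suc n) * Y (suc n) * 4ℚ * (ι sm * ι sn) ∎)))
   where
   open ≡-Reasoning
   sm = σ (suc m) ²ℤ ²ℤ ²ℤ
   sn = σ (suc n) ²ℤ ²ℤ ²ℤ
   eighth≢0 : ∀ m → σ (suc m) ²ℤ ²ℤ ²ℤ ≢ 0ℤ
   eighth≢0 m = ℤ-*-≢0 s⁴ s⁴
     where
     s² = ℤ-*-≢0 (σ≢0 (suc m)) (σ≢0 (suc m))
     s⁴ = ℤ-*-≢0 s² s²
   scaled² : ∀ m → ℤ.∣ v (suc m) ∣ ≡ 1 → ℤ.∣ v (suc m ℕ.+ suc m) ∣ ≡ 1 → 4ℚ * (Y (suc m) * Y (suc m)) * ι (σ (suc m) ²ℤ ²ℤ ²ℤ) ≡ ι (σ (suc m ℕ.+ suc m) ²ℤ)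
   scaled² m u u₂ = trans (cong (4ℚ * (Y (suc m) * Y (suc m)) *_) (trans (ι-sqs 2 (σ (suc m) ²ℤ)) (sym (cong (λ t → t * t * (t * t)) (w-unit (suc m) u)))))
     (trans (double-Y² m) (w-unit (suc m ℕ.+ suc m) u₂))
   lem₁ : ∀ Y s t → Y * Y * 4ℚ * (s * t) ≡ 4ℚ * (Y * Y) * s * t
   lem₁ = ℚ-solve 3 (λ Y s t → Y :* Y :* Κ 4ℚ :* (s :* t) , Κ 4ℚ :* (Y :* Y) :* s :* t) refl
   lem₂ : ∀ Y s t → 4ℚ * (Y * Y) * t * s ≡ Y * Y * 4ℚ * (s * t)
   lem₂ = ℚ-solve 3 (λ Y s t → Κ 4ℚ :* (Y :* Y) :* t :* s , Y :* Y :* Κ 4ℚ :* (s :* t)) refl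

 nine : ℤ → ℤ
 nine s = s · s ²ℤ ²ℤ ²ℤ

 -- By `W-triple`, ψ₃(mP) is W(3m)/W(m)⁹, which for a unit v(m) is v(3m) v(m) times the monomial
 -- σ(3m)/σ(m)⁹. No square is available here, so the sign has to be an assumption.
 Ψ-ratio : ∀ m n → ℤ.∣ v (suc m) ∣ ≡ 1 → ℤ.∣ v (suc n) ∣ ≡ 1 →
   v (suc m ℕ.+ suc m ℕ.+ suc m) · v (suc m) ≡ v (suc n ℕ.+ suc n ℕ.+ suc n) · v (suc n) →
   σ (suc m ℕ.+ suc m ℕ.+ suc m) · nine (σ (suc n)) ≡ σ (suc n ℕ.+ suc n ℕ.+ suc n) · nine (σ (suc m)) → X (suc m) ≡ X (suc n)
 Ψ-ratio m n um un ev e = Ψ-injective {X (suc m)} {Y (suc m)} {X (suc n)} {Y (suc n)} (curve m) (curve n) (Y≢0 m) (*-cancelʳ (ι (nine sm) * ι (nine sn)) (*-≢0 (ι-≢0 (nine≢0 m)) (ι-≢0 (nine≢0 n))) (begin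
   Ψ (X (suc m)) * (ι (nine sm) * ι (nine sn)) ≡⟨ sym (ℚₚ.*-assoc (Ψ (X (suc m))) (ι (nine sm)) (ι (nine sn))) ⟩
   Ψ (X (suc m)) * ι (nine sm) * ι (nine sn) ≡⟨ cong (_* ι (nine sn)) (scaled³ m um) ⟩
   ι (c₃ m · s₃ m) * ι (nine sn) ≡⟨ sym (ι-* (c₃ m · s₃ m) (nine sn)) ⟩
   ι (c₃ m · s₃ m · nine sn) ≡⟨ cong ι (trans (ℤₚ.*-assoc (c₃ m) (s₃ m) (nine sn)) (trans (cong₂ _·_ ev e) (sym (ℤₚ.*-assoc (c₃ n) (s₃ n) (nine sm))))) ⟩
   ι (c₃ n · s₃ n · nine sm) ≡⟨ ι-* (c₃ n · s₃ n) (nine sm) ⟩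
   ι (c₃ n · s₃ n) * ι (nine sm) ≡⟨ cong (_* ι (nine sm)) (sym (scaled³ n un)) ⟩
   Ψ (X (suc n)) * ι (nine sn) * ι (nine sm) ≡⟨ lem (Ψ (X (suc n))) (ι (nine sn)) (ι (nine sm)) ⟩
   Ψ (X (suc n)) * (ι (nine sm) * ι (nine sn)) ∎))
   where
   open ≡-Reasoning
   sm = σ (suc m)
   sn = σ (suc n)
   c₃ s₃ : ℕ → ℤ
   c₃ m = v (suc m ℕ.+ suc m ℕ.+ suc m) · v (suc m)
   s₃ m = σ (suc m ℕ.+ suc m ℕ.+ suc m)
   nine≢0 : ∀ m → nine (σ (suc m)) ≢ 0ℤ
   nine≢0 m = ℤ-*-≢0 (σ≢0 (suc m)) (ℤ-*-≢0 s⁴ s⁴)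
     where
     s² = ℤ-*-≢0 (σ≢0 (suc m)) (σ≢0 (suc m))
     s⁴ = ℤ-*-≢0 s² s²
   lem : ∀ p q r → p * q * r ≡ p * (r * q)
   lem = ℚ-solve 3 (λ p q r → p :* q :* r , p :* (r :* q)) refl
   scaled³ : ∀ m → ℤ.∣ v (suc m) ∣ ≡ 1 → Ψ (X (suc m)) * ι (nine (σ (suc m))) ≡ ι (c₃ m · s₃ m)
   scaled³ m u = sym (begin
     ι (c₃ m · s₃ m) ≡⟨ cong ι (lem₁ (v (suc m ℕ.+ suc m ℕ.+ suc m)) (v (suc m)) (s₃ m)) ⟩
     ι (W-int (suc m ℕ.+ suc m ℕ.+ suc m) · v (suc m)) ≡⟨ ι-* (W-int (suc m ℕ.+ suc m ℕ.+ suc m)) (v (suc m)) ⟩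
     ι (W-int (suc m ℕ.+ suc m ℕ.+ suc m)) * V ≡⟨ cong (_* V) (trans (sym (W≡W-int (suc m ℕ.+ suc m ℕ.+ suc m))) (W-triple m)) ⟩
     Ψ (X (suc m)) * (W (suc m) * w (suc m) ² ²) * V
       ≡⟨ cong (λ t → Ψ (X (suc m)) * (t * ((t * t) * (t * t) * ((t * t) * (t * t)))) * V) (trans (W≡W-int (suc m)) (ι-* (v (suc m)) (σ (suc m)))) ⟩
     Ψ (X (suc m)) * (V * S * ((V * S * (V * S)) * (V * S * (V * S)) * ((V * S * (V * S)) * (V * S * (V * S))))) * V ≡⟨ lem₂ (Ψ (X (suc m))) V S ⟩
     Ψ (X (suc m)) * (S * ((S * S) * (S * S) * ((S * S) * (S * S)))) * (V * V * (V * V) * (V * V) * (V * V) * (V * V))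
       ≡⟨ cong (λ t → Ψ (X (suc m)) * (S * ((S * S) * (S * S) * ((S * S) * (S * S)))) * (t * t * t * t * t)) (trans (sym (ι-* (v (suc m)) (v (suc m)))) (cong ι (unit-sq {v (suc m)} u))) ⟩
     Ψ (X (suc m)) * (S * ((S * S) * (S * S) * ((S * S) * (S * S)))) * 1ℚ ≡⟨ ℚₚ.*-identityʳ _ ⟩
     Ψ (X (suc m)) * (S * ((S * S) * (S * S) * ((S * S) * (S * S)))) ≡⟨ cong (Ψ (X (suc m)) *_) (sym (trans (ι-* (σ (suc m)) (σ (suc m) ²ℤ ²ℤ ²ℤ)) (cong (S *_) (ι-sqs 3 (σ (suc m)))))) ⟩
     Ψ (X (suc m)) * ι (nine (σ (suc m))) ∎)
     where
     V = ι (v (suc m))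
     S = ι (σ (suc m))
     lem₁ : ∀ p q r → p · q · r ≡ p · r · q
     lem₁ = ℤ-solve 3 (λ p q r → p :* q :* r , p :* r :* q) refl
     lem₂ : ∀ P V S → P * (V * S * ((V * S * (V * S)) * (V * S * (V * S)) * ((V * S * (V * S)) * (V * S * (V * S))))) * V ≡
       P * (S * ((S * S) * (S * S) * ((S * S) * (S * S)))) * (V * V * (V * V) * (V * V) * (V * V) * (V * V))
     lem₂ = ℚ-solve 3 (λ P V S → P :* (V :* S :* ((V :* S :* (V :* S)) :* (V :* S :* (V :* S)) :* ((V :* S :* (V :* S)) :* (V :* S :* (V :* S))))) :* V , P :* (S :* ((S :* S) :* (S :* S) :* ((S :* S) :* (S :* S)))) :* (V :* V :* (V :* V) :* (V :* V) :* (V :* V) :* (V :* V))) refl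

 double-τ : ∀ n → τ (n ℕ.+ n) ≡ 1
 double-τ n = trans (cong τ (sym (trans (dbl≡ n 0) (ℕₚ.+-identityʳ (n ℕ.+ n))))) (by n)
   where
   by : ∀ n → τ (dbl n 0) ≡ 1
   by zero = refl
   by (suc n) = by n

 double-δ : ∀ n → δ (n ℕ.+ n) ≡ δ n
 double-δ n = trans (cong δ (sym (trans (dbl≡ n 0) (ℕₚ.+-identityʳ (n ℕ.+ n))))) (by n)
   where
   by : ∀ n → δ (dbl n 0) ≡ δ n
   by = by-six _ refl refl refl refl refl refl λ k h → h

 trp≡ : ∀ n → trp n ≡ n ℕ.+ n ℕ.+ n
 trp≡ zero = refl
 trp≡ (suc n) = trans (cong (3 ℕ.+_) (trp≡ n)) (lem n)
   where
   lem : ∀ n → 3 ℕ.+ (n ℕ.+ n ℕ.+ n) ≡ suc n ℕ.+ suc n ℕ.+ suc n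
   lem = ℕ-solve

 triple-τ : ∀ n → τ (n ℕ.+ n ℕ.+ n) ≡ τ n
 triple-τ n = trans (cong τ (sym (trp≡ n))) (by n)
   where
   by : ∀ n → τ (trp n) ≡ τ n
   by = by-six _ refl refl refl refl refl refl λ k h → h

 triple-δ : ∀ n → δ (n ℕ.+ n ℕ.+ n) ≡ 1
 triple-δ n = trans (cong δ (sym (trp≡ n))) (by n)
   where
   by : ∀ n → δ (trp n) ≡ 1
   by zero = refl
   by (suc n) = by n

 unit-product : ∀ {i j} → ℤ.∣ i ∣ ≡ 1 → ℤ.∣ j ∣ ≡ 1 → i ≈ j → i · j ≡ 1ℤ
 unit-product {+ 1} {+ 1} refl refl h = refl
 unit-product {ℤ.-[1+ 0 ]} {ℤ.-[1+ 0 ]} refl refl h = refl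
 unit-product {+ 1} {ℤ.-[1+ 0 ]} refl refl h with ℕD.∣⇒≤ (∣⇒∣ᵤ h)
 ... | ℕ.s≤s (ℕ.s≤s ())
 unit-product {ℤ.-[1+ 0 ]} {+ 1} refl refl h with ℕD.∣⇒≤ (∣⇒∣ᵤ h)
 ... | ℕ.s≤s (ℕ.s≤s ())

 ∣unit : ∀ {p i} → ℤ.∣ i ∣ ≡ 1 → + (2 ℕ.+ p) ∣ i → ⊥
 ∣unit {p} u h with ℕD.∣1⇒≡1 (subst (2 ℕ.+ p ℕD.∣_) u (∣⇒∣ᵤ h))
 ... | ()

 G^4* : ∀ k → G ^ (4 ℕ.* k) ≡ G ^ k · G ^ k · (G ^ k · G ^ k)
 G^4* k = sym (trans (cong sq (sq^ k)) (trans (sq^ (2 ℕ.* k)) (cong (G ^_) (lem k))))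
   where
   lem : ∀ k → 2 ℕ.* (2 ℕ.* k) ≡ 4 ℕ.* k
   lem = ℕ-solve

 G^9* : ∀ k → G ^ (9 ℕ.* k) ≡ cube (cube (G ^ k))
 G^9* k = sym (trans (cong cube (cube^ k)) (trans (cube^ (3 ℕ.* k)) (cong (G ^_) (lem k))))
   where
   lem : ∀ k → 3 ℕ.* (3 ℕ.* k) ≡ 9 ℕ.* k
   lem = ℕ-solve

 -- e(2q) = 4 e(q) turns σ(2q)²/σ(q)⁸ into a², its value at q = 1. The resulting x(qP) = x
 -- contradicts q > 1.
 non-integral-2q : ∀ n → τ (2 ℕ.+ n) ≡ 0 → δ (2 ℕ.+ n) ≡ 0 → ¬ IntegralMultiple (2 ℕ.+ n ℕ.+ (2 ℕ.+ n))
 non-integral-2q n t f h = X≢x n (trans (Y²-ratio (suc n) 0 (v-unit (integral-half (suc n) h)) (v-unit h) (cong ℤ.∣_∣ v₁) (cong ℤ.∣_∣ v₂) eq) X₁)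
   where
   q = 2 ℕ.+ n
   E = G ^ e q
   f₂ = trans (double-δ q) f
   lem : ∀ a E → let s = a · 1ℤ · 1ℤ · (E · E · (E · E)) ; r = 1ℤ · 1ℤ · E ; r² = r · r ; r⁴ = r² · r² ; u = a · 1ℤ · 1ℤ · 1ℤ in
     s · s · 1ℤ ≡ u · u · (r⁴ · r⁴)
   lem = ℤ-solve 2 (λ a E →
                 let s = a :* Κ 1ℤ :* Κ 1ℤ :* (E :* E :* (E :* E)) ; r = Κ 1ℤ :* Κ 1ℤ :* E ; r² = r :* r ; r⁴ = r² :* r² ; u = a :* Κ 1ℤ :* Κ 1ℤ :* Κ 1ℤ in
     s :* s :* Κ 1ℤ , u :* u :* (r⁴ :* r⁴)) refl
   eq : σ (q ℕ.+ q) ²ℤ · σ 1 ²ℤ ²ℤ ²ℤ ≡ σ 2 ²ℤ · σ q ²ℤ ²ℤ ²ℤ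
   eq = trans (cong (λ s → s ²ℤ · 1ℤ) (trans (σ-form (q ℕ.+ q) (double-τ q) f₂ (e-double (suc n) t f (double-τ q) f₂)) (cong (a · 1ℤ · 1ℤ ·_) (G^4* (e q)))))
     (trans (lem a E) (cong (λ s → σ 2 ²ℤ · s ²ℤ ²ℤ ²ℤ) (sym (σ-form q t f refl))))

 -- The doublings 8 = 2 · 4 and 4 = 2 · 2 have the same monomial, because e 8 = 5 and e 4 = 1; so
 -- x(4P) would equal x(2P).
 non-integral-8 : ¬ IntegralMultiple 8
 non-integral-8 h = X-distinct {1} {1} {3} refl (sym (Y²-ratio 3 1 (v-unit h₄) (v-unit h) (cong ℤ.∣_∣ v₂) (v-unit h₄) (lem a G)))
   where
   h₄ = integral-half 3 h
   lem : ∀ a G → let s = a · 1ℤ · 1ℤ · (G · (G · (G · (G · (G · 1ℤ))))) ; r = a · 1ℤ · 1ℤ · 1ℤ ; r² = r · r ; r⁴ = r² · r²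
                     u = a · 1ℤ · 1ℤ · (G · 1ℤ) ; u² = u · u ; u⁴ = u² · u² in
     s · s · (r⁴ · r⁴) ≡ u · u · (u⁴ · u⁴)
   lem = ℤ-solve 2 (λ a G →
                 let s = a :* Κ 1ℤ :* Κ 1ℤ :* (G :* (G :* (G :* (G :* (G :* Κ 1ℤ))))) ; r = a :* Κ 1ℤ :* Κ 1ℤ :* Κ 1ℤ ; r² = r :* r ; r⁴ = r² :* r²
                     u = a :* Κ 1ℤ :* Κ 1ℤ :* (G :* Κ 1ℤ) ; u² = u :* u ; u⁴ = u² :* u² in
     s :* s :* (r⁴ :* r⁴) , u :* u :* (u⁴ :* u⁴)) refl

 -- Integrality descends to q, so v(3q) and v(q) are both ± 1, and their congruence modulo 3 makes
 -- them equal. With e(3q) = 9 e(q) the comparison is with q = 1.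
 non-integral-3q : ∀ n → τ (2 ℕ.+ n) ≡ 0 → δ (2 ℕ.+ n) ≡ 0 → ¬ IntegralMultiple (2 ℕ.+ n ℕ.+ (2 ℕ.+ n) ℕ.+ (2 ℕ.+ n))
 non-integral-3q n t f h = X≢x n (trans (Ψ-ratio (suc n) 0 uq (cong ℤ.∣_∣ v₁)
     (trans (unit-product {v (q ℕ.+ q ℕ.+ q)} {v q} (v-unit h) uq (subst (λ k → v k ≈ v q) (trp≡ q) (v-triple≈ (suc n) t f))) (sym (cong₂ _·_ v₃ v₁))) eq) X₁)
   where
   q = 2 ℕ.+ n
   uq = v-unit (integral-third (suc n) h)
   E = G ^ e q
   t₃ = trans (triple-τ q) t
   lem : ∀ d E → let E³ = E · E · E ; s = 1ℤ · (d · 1ℤ) · (E³ · E³ · E³) ; r = 1ℤ · 1ℤ · E ; r² = r · r ; r⁴ = r² · r² in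
     s · 1ℤ ≡ 1ℤ · (d · 1ℤ) · 1ℤ · (r · (r⁴ · r⁴))
   lem = ℤ-solve 2 (λ d E →
                 let E³ = E :* E :* E ; s = Κ 1ℤ :* (d :* Κ 1ℤ) :* (E³ :* E³ :* E³) ; r = Κ 1ℤ :* Κ 1ℤ :* E ; r² = r :* r ; r⁴ = r² :* r² in
     s :* Κ 1ℤ , Κ 1ℤ :* (d :* Κ 1ℤ) :* Κ 1ℤ :* (r :* (r⁴ :* r⁴))) refl
   eq : σ (q ℕ.+ q ℕ.+ q) · nine (σ 1) ≡ σ 3 · nine (σ q)
   eq = trans (cong (_· 1ℤ) (trans (σ-form (q ℕ.+ q ℕ.+ q) t₃ (triple-δ q) (e-triple (suc n) t f t₃ (triple-δ q))) (cong (1ℤ · (d · 1ℤ) ·_) (G^9* (e q)))))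
     (trans (lem d E) (cong (λ s → σ 3 · nine s) (sym (σ-form q t f refl))))

 -- The triplings of 9 and of 3 are compared, which needs v 27 = 1. Modulo 3, either this sign holds
 -- or 3 divides v 9, which is a unit since 9P would be integral too.
 non-integral-27 : ¬ IntegralMultiple 27
 non-integral-27 h = by v-ninth≈
   where
   u₉ = v-unit (integral-third 8 h)
   lem : ∀ d P → let s = 1ℤ · (d · 1ℤ) ; r = s · 1ℤ ; r² = r · r ; r⁴ = r² · r² ; z = s · P ; z² = z · z ; z⁴ = z² · z² in
     s · (P · (P · P · (P · P) · (P · P · (P · P))) · P) · (r · (r⁴ · r⁴)) ≡ z · (z · (z⁴ · z⁴))
   lem = ℤ-solve 2 (λ d P →
                 let s = Κ 1ℤ :* (d :* Κ 1ℤ) ; r = s :* Κ 1ℤ ; r² = r :* r ; r⁴ = r² :* r² ; z = s :* P ; z² = z :* z ; z⁴ = z² :* z² in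
     s :* (P :* (P :* P :* (P :* P) :* (P :* P :* (P :* P))) :* P) :* (r :* (r⁴ :* r⁴)) , z :* (z :* (z⁴ :* z⁴))) refl
   G⁶⁰ : ∀ k → G ^ (9 ℕ.* k ℕ.+ k) ≡ let P = G ^ k in P · (P · P · (P · P) · (P · P · (P · P))) · P
   G⁶⁰ k = trans (ℤₚ.^-distribˡ-+-* G (9 ℕ.* k) k) (cong (_· G ^ k) (trans (G^9* k) (lem₁ (G ^ k))))
     where
     lem₁ : ∀ P → let c = P · P · P in c · c · c ≡ P · (P · P · (P · P) · (P · P · (P · P)))
     lem₁ = ℤ-solve 1 (λ P → let c = P :* P :* P in c :* c :* c , P :* (P :* P :* (P :* P) :* (P :* P :* (P :* P)))) refl
   eq : σ 27 · nine (σ 3) ≡ σ 9 · nine (σ 9)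
   eq = trans (cong (_· nine (σ 3)) (trans (σ-form 27 {0} {1} {9 ℕ.* 6 ℕ.+ 6} refl refl refl) (cong (1ℤ · (d · 1ℤ) ·_) (G⁶⁰ 6)))) (lem d (G ^ 6))
   by : + 3 ∣ v 9 ⊎ v 27 ≈ 1ℤ → ⊥
   by (inj₁ h₉) = ∣unit {1} {v 9} u₉ h₉
   by (inj₂ h₂₇) = X-distinct {2} {5} {8} refl (sym (Ψ-ratio 8 2 u₉ (cong ℤ.∣_∣ v₃) (trans (cong (_· v 9) v₂₇) (trans (ℤₚ.*-comm 1ℤ (v 9)) (cong (v 9 ·_) (sym v₃)))) eq))
     where
     v₂₇ : v 27 ≡ 1ℤ
     v₂₇ = trans (sym (ℤₚ.*-identityʳ (v 27))) (unit-product {v 27} {1ℤ} (v-unit h) refl h₂₇)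

 -- Both 6P and 4P would be integral, but v 6 is even in one 2-adic case and v 4 = c in the other.
 non-integral-12 : ¬ IntegralMultiple 12
 non-integral-12 h with case
 ... | inj₁ C = ∣unit {0} {v 6} (v-unit (integral-half 5 h)) (Six.v₆-even C)
 ... | inj₂ C = ∣unit {0} {v 4} (v-unit (integral-third 3 h)) (subst (+ 2 ∣_) (sym v₄) (Four.c∣ C))

 -- The numbers 2^i 3^j greater than 1 that are not multiples of 8, 12 or 27. A proper factor prime
 -- to 6 is excluded by the lemmas for 2q and 3q.
 data Small : ℕ → Set where
   s₂  : Small 2
   s₃  : Small 3
   s₄  : Small 4
   s₆  : Small 6
   s₉  : Small 9
   s₁₈ : Small 18

 half⊎odd : ∀ n → (Σ ℕ λ k → n ≡ k ℕ.+ k) ⊎ τ n ≡ 0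
 half⊎odd 0 = inj₁ (0 , refl)
 half⊎odd 1 = inj₂ refl
 half⊎odd (suc (suc n)) with half⊎odd n
 ... | inj₁ (k , refl) = inj₁ (suc k , cong suc (sym (ℕₚ.+-suc k k)))
 ... | inj₂ h = inj₂ h

 third⊎∤ : ∀ n → (Σ ℕ λ k → n ≡ k ℕ.+ k ℕ.+ k) ⊎ δ n ≡ 0
 third⊎∤ 0 = inj₁ (0 , refl)
 third⊎∤ 1 = inj₂ refl
 third⊎∤ 2 = inj₂ refl
 third⊎∤ (suc (suc (suc n))) with third⊎∤ n
 ... | inj₁ (k , refl) = inj₁ (suc k , lem k)
   where
   lem : ∀ k → 3 ℕ.+ (k ℕ.+ k ℕ.+ k) ≡ suc k ℕ.+ suc k ℕ.+ suc k
   lem = ℕ-solve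
 ... | inj₂ h = inj₂ h

 Classified : ℕ → Set
 Classified n = (τ n ≡ 0 × δ n ≡ 0) ⊎ Small n

 doubled : ∀ k → IntegralMultiple (suc k ℕ.+ suc k) → Classified (suc k) → Classified (suc k ℕ.+ suc k)
 doubled zero    h _ = inj₂ s₂
 doubled (suc k) h (inj₁ (t , f)) = ⊥-elim (non-integral-2q k t f h)
 doubled (suc k) h (inj₂ s₂)  = inj₂ s₄
 doubled (suc k) h (inj₂ s₃)  = inj₂ s₆
 doubled (suc k) h (inj₂ s₄)  = ⊥-elim (non-integral-8 h)
 doubled (suc k) h (inj₂ s₆)  = ⊥-elim (non-integral-12 h)
 doubled (suc k) h (inj₂ s₉)  = inj₂ s₁₈
 doubled (suc k) h (inj₂ s₁₈) = ⊥-elim (non-integral-12 (integral-third 11 h))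

 tripled : ∀ k → IntegralMultiple (suc k ℕ.+ suc k ℕ.+ suc k) → Classified (suc k) → Classified (suc k ℕ.+ suc k ℕ.+ suc k)
 tripled zero    h _ = inj₂ s₃
 tripled (suc k) h (inj₁ (t , f)) = ⊥-elim (non-integral-3q k t f h)
 tripled (suc k) h (inj₂ s₂)  = inj₂ s₆
 tripled (suc k) h (inj₂ s₃)  = inj₂ s₉
 tripled (suc k) h (inj₂ s₄)  = ⊥-elim (non-integral-12 h)
 tripled (suc k) h (inj₂ s₆)  = inj₂ s₁₈
 tripled (suc k) h (inj₂ s₉)  = ⊥-elim (non-integral-27 h)
 tripled (suc k) h (inj₂ s₁₈) = ⊥-elim (non-integral-27 (integral-half 26 h))

 classify : ∀ n → IntegralMultiple (suc n) → Classified (suc n)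
 classify = <-rec _ step
   where
   step : ∀ n → (∀ {m} → m ℕ.< n → IntegralMultiple (suc m) → Classified (suc m)) → IntegralMultiple (suc n) → Classified (suc n)
   step n rec h with half⊎odd (suc n) | third⊎∤ (suc n)
   ... | inj₂ t | inj₂ f = inj₁ (t , f)
   ... | inj₁ (zero , ()) | _
   ... | inj₁ (suc k , refl) | _ = doubled k h (rec (ℕₚ.m<m+n k (ℕ.s≤s ℕ.z≤n)) (integral-half k h))
   ... | inj₂ _ | inj₁ (zero , ())
   ... | inj₂ _ | inj₁ (suc k , refl) = tripled k h (rec (ℕₚ.<-≤-trans (ℕₚ.m<m+n k (ℕ.s≤s ℕ.z≤n)) (ℕₚ.m≤m+n (k ℕ.+ suc k) (suc k))) (integral-third k h))

 at-most-one : ∀ {m n} → 29 ℕ.≤ suc m → 29 ℕ.≤ suc n → IntegralMultiple (suc m) → IntegralMultiple (suc n) → suc m ≡ suc n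
 at-most-one {m} {n} 29≤m 29≤n hm hn with suc m ℕ.≟ suc n
 ... | yes e = e
 ... | no m≢n = ⊥-elim (by (large 29≤m (classify m hm)) (large 29≤n (classify n hn)))
   where
   large : ∀ {n} → 29 ℕ.≤ n → Classified n → τ n ≡ 0 × δ n ≡ 0
   large h (inj₁ c) = c
   large h (inj₂ s) = ⊥-elim (ℕₚ.<⇒≱ (ℕₚ.<-≤-trans (ℕₚ.m≤m+n 19 10) h) (bound s))
     where
     bound : ∀ {n} → Small n → n ℕ.≤ 18
     bound s₂  = ℕₚ.m≤m+n 2 16
     bound s₃  = ℕₚ.m≤m+n 3 15
     bound s₄  = ℕₚ.m≤m+n 4 14
     bound s₆  = ℕₚ.m≤m+n 6 12
     bound s₉  = ℕₚ.m≤m+n 9 9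
     bound s₁₈ = ℕₚ.≤-refl
   ≢1 : ∀ {n} → 29 ℕ.≤ n → n ≢ 1
   ≢1 (ℕ.s≤s ()) refl
   by : τ (suc m) ≡ 0 × δ (suc m) ≡ 0 → τ (suc n) ≡ 0 × δ (suc n) ≡ 0 → ⊥
   by (tm , fm) (tn , fn) = one-unit {suc m} {suc n} tm fm tn fn (v-unit hm) (v-unit hn) (≢1 29≤m) (≢1 29≤n) m≢n

-- From an integral point to the normalised setting

open import Data.Integer using (+_)
open import Data.Rational using (_+_; _-_; _*_; -_)

ι-³ : ∀ i → ι (i ³ℤ) ≡ ι i * ι i * ι i
ι-³ i = trans (ι-* (i · i) i) (cong (_* ι i) (ι-* i i))

curve-coefficient : ∀ {B x y} → OnCurve B (pt (ι x) (ι y)) → B ≡ y ²ℤ ℤ.- x ³ℤ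
curve-coefficient {B} {x} {y} e = trans (lem (x ³ℤ) B) (cong (ℤ._- x ³ℤ) (sym (ι-injective {y ²ℤ} {x ³ℤ ∔ B}
    (trans (ι-* y y) (trans e (trans (cong (_+ ι B) (sym (ι-³ x))) (sym (ι-+ (x ³ℤ) B))))))))
  where
  lem : ∀ c B → B ≡ c ∔ B ℤ.- c
  lem = ℤ-solve 2 (λ c B → B , c :+ B :- c) refl

-- `W-triple` at the point P itself identifies W 3 with ψ₃ x y, and W 3 is nonzero by construction.
ψ₃≢0 : ∀ {B x y} → B ≡ y ²ℤ ℤ.- x ³ℤ → Multiples (ι B) (ι x) (ι y) → ψ₃ x y ≢ 0ℤ
ψ₃≢0 {B} {x} {y} B≡ M e = W≢0 2 (trans (W-triple 0) (trans (cong (_* (1ℚ * (1ℚ * 1ℚ) ² ²)) (trans (cong (λ X → 3ℚ * X * (X * X * X + 4ℚ * ι B)) X₁) ψ≡0)) (ℚₚ.*-zeroˡ (1ℚ * (1ℚ * 1ℚ) ² ²))))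
  where
  open EllipticDivisibility M
  lem : ∀ x y → + 3 · x · (x · x · x ∔ + 4 · (y · y ℤ.- x · x · x)) ≡ + 3 · x · (+ 4 · (y · y) ℤ.- + 3 · (x · x · x))
  lem = ℤ-solve 2 (λ x y → Κ (+ 3) :* x :* (x :* x :* x :+ Κ (+ 4) :* (y :* y :- x :* x :* x)) , Κ (+ 3) :* x :* (Κ (+ 4) :* (y :* y) :- Κ (+ 3) :* (x :* x :* x))) refl
  ψ≡0 : 3ℚ * ι x * (ι x * ι x * ι x + 4ℚ * ι B) ≡ 0ℚ
  ψ≡0 = trans (cong₂ _*_ (sym (ι-* (+ 3) x)) (trans (cong₂ _+_ (sym (ι-³ x)) (sym (ι-* (+ 4) B))) (sym (ι-+ (x ³ℤ) (+ 4 · B)))))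
    (trans (sym (ι-* (+ 3 · x) (x ³ℤ ∔ + 4 · B))) (cong ι (trans (cong (λ B → + 3 · x · (x ³ℤ ∔ + 4 · B)) B≡) (trans (lem x y) e))))

pt-injectiveˡ : ∀ {x y x′ y′} → pt x y ≡ pt x′ y′ → x ≡ x′
pt-injectiveˡ refl = refl

theorem1p2 : (B : ℤ) → B ≢ 0ℤ → SixthPowerFree B →
    (P : Point) → OnCurve B P → Integral P → NonTorsion P →
    (m n : ℕ) → 29 ≤ m → 29 ≤ n →
    Integral ([ m ] P) → Integral ([ n ] P) → m ≡ n
theorem1p2 B _ free .(pt (ι x) (ι y)) on (x , y , refl) nontorsion (suc m) (suc n) 29≤m 29≤n hm hn =
  Classification.at-most-one B≡ M params localParams (subst (Reduction.TwoAdic params) (sym B≡) twoAdic) residues 29≤m 29≤n (integral m hm) (integral n hn)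
  where
  B≡ = curve-coefficient {B} {x} {y} on
  M : Multiples (ι B) (ι x) (ι y)
  M = proj₁ (multiples {B} on nontorsion)
  d≢0 : ψ₃ x y ≢ 0ℤ
  d≢0 = ψ₃≢0 {B} {x} {y} B≡ M
  y≢0 : y ≢ 0ℤ
  y≢0 e = Multiples.y≢0 M (cong ι e)
  -- x = 0 is a root of ψ₃, that is, P would be a point of order 3.
  x≢0 : x ≢ 0ℤ
  x≢0 refl = d≢0 refl
  open Reduction.Build {x} {y} (Reduction.reduced x y y≢0) (subst SixthPowerFree B≡ free) x≢0 y≢0 d≢0
  integral : ∀ n → Integral ([ suc n ] (pt (ι x) (ι y))) → Σ ℤ λ z → Multiples.X M (suc n) ≡ ι z
  integral n (z , _ , e) = z , pt-injectiveˡ (trans (sym (proj₂ (multiples {B} on nontorsion) n)) e)
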